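{- Let $m \in \{62, 67, 71\}$ and let $K_m = \mathbb{Q}(\sqrt{m})$. Then there is no elliptic curve $E$ defined over $K_m$ such that $E$ has everywhere good reduction over $K_m$ and the discriminant $\Delta(E)$ is a cube in $K_m$.
   Context: For a squarefree positive integer $m$, $K_m$ denotes the real quadratic field $\mathbb{Q}(\sqrt{m})$. An elliptic curve over $K_m$ has everywhere good reduction if it has good reduction at every finite prime of $K_m$. $\Delta(E)$ denotes the discriminant of a (global minimal) Weierstrass equation of $E$ over $K_m$. Changing the Weierstrass equation multiplies the discriminant by a 12th power in $K_m^\times$, so whether $\Delta(E)$ is a cube in $K_m$ does not depend on the equation chosen. "Cubic discriminant" means that $\Delta(E)$ is a cube in $K_m$. -}

module Defs where

open import Algebra.Bundles using (CommutativeRing; Semiring)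
open import Algebra.Structures using (IsCommutativeRing)
open import Data.Integer.Base as ℤ using (ℤ; +_; -[1+_])
open import Data.List.Base using (List; []; _∷_)
open import Data.Nat.Base as ℕ using (ℕ; suc)
open import Data.Product.Base using (∃-syntax; _×_; _,_)
open import Data.Rational.Base as ℚ using (ℚ; 0ℚ; 1ℚ)
import Data.Rational.Properties as ℚ
open import Data.Rational.Solver using (module +-*-Solver)
open import Data.Sum.Base using (_⊎_)
open import Level using (0ℓ) renaming (suc to lsuc)
open import Relation.Binary.Definitions using (_Respects_)
open import Relation.Binary.PropositionalEquality
  using (_≡_; refl; cong₂; isEquivalence)
open import Relation.Nullary.Negation using (¬_)
open import Relation.Unary using (Pred)

-- a + b √m is the pair of its coordinates in the ℚ-basis 1, √m. This is the
-- field ℚ(√m) exactly when m is not a perfect square.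

record ℚ[√_] (m : ℕ) : Set where
  constructor _+_√
  field
    rational   : ℚ
    irrational : ℚ

module _ (m : ℕ) where
  private
    d : ℚ
    d = + m ℚ./ 1

    _⊕_ _⊗_ : ℚ[√ m ] → ℚ[√ m ] → ℚ[√ m ]
    (a + b √) ⊕ (a′ + b′ √) = (a ℚ.+ a′) + (b ℚ.+ b′) √
    (a + b √) ⊗ (a′ + b′ √) =
      (a ℚ.* a′ ℚ.+ d ℚ.* (b ℚ.* b′)) + (a ℚ.* b′ ℚ.+ b ℚ.* a′) √

    ⊖_ : ℚ[√ m ] → ℚ[√ m ]
    ⊖ (a + b √) = (ℚ.- a) + (ℚ.- b) √

    𝟘 𝟙 : ℚ[√ m ]
    𝟘 = 0ℚ + 0ℚ √
    𝟙 = 1ℚ + 0ℚ √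

    ext : ∀ {a a′ b b′} → a ≡ a′ → b ≡ b′ → _≡_ {A = ℚ[√ m ]} (a + b √) (a′ + b′ √)
    ext = cong₂ _+_√

    ⊗-comm : ∀ x y → x ⊗ y ≡ y ⊗ x
    ⊗-comm (a + b √) (a′ + b′ √) = ext
      (solve 5 (λ k a b a′ b′ → a :* a′ :+ k :* (b :* b′) := a′ :* a :+ k :* (b′ :* b)) refl d a b a′ b′)
      (solve 4 (λ a b a′ b′ → a :* b′ :+ b :* a′ := a′ :* b :+ b′ :* a) refl a b a′ b′)
      where open +-*-Solver

    ⊗-assoc : ∀ x y z → (x ⊗ y) ⊗ z ≡ x ⊗ (y ⊗ z)
    ⊗-assoc (a + b √) (a′ + b′ √) (a″ + b″ √) = ext
      (solve 7 (λ k a b a′ b′ a″ b″ →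
           (a :* a′ :+ k :* (b :* b′)) :* a″ :+ k :* ((a :* b′ :+ b :* a′) :* b″)
        := a :* (a′ :* a″ :+ k :* (b′ :* b″)) :+ k :* (b :* (a′ :* b″ :+ b′ :* a″)))
        refl d a b a′ b′ a″ b″)
      (solve 7 (λ k a b a′ b′ a″ b″ →
           (a :* a′ :+ k :* (b :* b′)) :* b″ :+ (a :* b′ :+ b :* a′) :* a″
        := a :* (a′ :* b″ :+ b′ :* a″) :+ b :* (a′ :* a″ :+ k :* (b′ :* b″)))
        refl d a b a′ b′ a″ b″)
      where open +-*-Solver

    ⊗-identityˡ : ∀ x → 𝟙 ⊗ x ≡ x
    ⊗-identityˡ (a + b √) = ext
      (solve 3 (λ k a b → con 1ℚ :* a :+ k :* (con 0ℚ :* b) := a) refl d a b)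
      (solve 2 (λ a b → con 1ℚ :* b :+ con 0ℚ :* a := b) refl a b)
      where open +-*-Solver

    ⊗-identityʳ : ∀ x → x ⊗ 𝟙 ≡ x
    ⊗-identityʳ (a + b √) = ext
      (solve 3 (λ k a b → a :* con 1ℚ :+ k :* (b :* con 0ℚ) := a) refl d a b)
      (solve 2 (λ a b → a :* con 0ℚ :+ b :* con 1ℚ := b) refl a b)
      where open +-*-Solver

    distribˡ : ∀ x y z → x ⊗ (y ⊕ z) ≡ (x ⊗ y) ⊕ (x ⊗ z)
    distribˡ (a + b √) (a′ + b′ √) (a″ + b″ √) = ext
      (solve 7 (λ k a b a′ b′ a″ b″ →
           a :* (a′ :+ a″) :+ k :* (b :* (b′ :+ b″))
        := (a :* a′ :+ k :* (b :* b′)) :+ (a :* a″ :+ k :* (b :* b″)))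
        refl d a b a′ b′ a″ b″)
      (solve 6 (λ a b a′ b′ a″ b″ →
           a :* (b′ :+ b″) :+ b :* (a′ :+ a″)
        := (a :* b′ :+ b :* a′) :+ (a :* b″ :+ b :* a″))
        refl a b a′ b′ a″ b″)
      where open +-*-Solver

    distribʳ : ∀ x y z → (y ⊕ z) ⊗ x ≡ (y ⊗ x) ⊕ (z ⊗ x)
    distribʳ (a + b √) (a′ + b′ √) (a″ + b″ √) = ext
      (solve 7 (λ k a b a′ b′ a″ b″ →
           (a′ :+ a″) :* a :+ k :* ((b′ :+ b″) :* b)
        := (a′ :* a :+ k :* (b′ :* b)) :+ (a″ :* a :+ k :* (b″ :* b)))
        refl d a b a′ b′ a″ b″)
      (solve 6 (λ a b a′ b′ a″ b″ →
           (a′ :+ a″) :* b :+ (b′ :+ b″) :* a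
        := (a′ :* b :+ b′ :* a) :+ (a″ :* b :+ b″ :* a))
        refl a b a′ b′ a″ b″)
      where open +-*-Solver

    isCommutativeRing : IsCommutativeRing _≡_ _⊕_ _⊗_ ⊖_ 𝟘 𝟙
    isCommutativeRing = record
      { isRing = record
        { +-isAbelianGroup = record
          { isGroup = record
            { isMonoid = record
              { isSemigroup = record
                { isMagma = record { isEquivalence = isEquivalence ; ∙-cong = cong₂ _⊕_ }
                ; assoc = λ { (a + b √) (a′ + b′ √) (a″ + b″ √) →
                    ext (ℚ.+-assoc a a′ a″) (ℚ.+-assoc b b′ b″) }
                }
              ; identity = (λ { (a + b √) → ext (ℚ.+-identityˡ a) (ℚ.+-identityˡ b) })
                         , (λ { (a + b √) → ext (ℚ.+-identityʳ a) (ℚ.+-identityʳ b) })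
              }
            ; inverse = (λ { (a + b √) → ext (ℚ.+-inverseˡ a) (ℚ.+-inverseˡ b) })
                      , (λ { (a + b √) → ext (ℚ.+-inverseʳ a) (ℚ.+-inverseʳ b) })
            ; ⁻¹-cong = λ { refl → refl }
            }
          ; comm = λ { (a + b √) (a′ + b′ √) → ext (ℚ.+-comm a a′) (ℚ.+-comm b b′) }
          }
        ; *-cong = cong₂ _⊗_
        ; *-assoc = ⊗-assoc
        ; *-identity = ⊗-identityˡ , ⊗-identityʳ
        ; distrib = distribˡ , distribʳ
        }
      ; *-comm = ⊗-comm
      }

  ℚ√ : CommutativeRing 0ℓ 0ℓ
  ℚ√ = record { isCommutativeRing = isCommutativeRing }

-- Elliptic curves over K. The definitions only use the ring operations, but K
-- is meant to be a number field (which the standard library does not have).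

module EllipticCurves (K : CommutativeRing 0ℓ 0ℓ) where
  open CommutativeRing K
  open import Algebra.Definitions.RawSemiring (Semiring.rawSemiring semiring)
    using (_^_) renaming (_×_ to _·_)

  fromℤ : ℤ → Carrier
  fromℤ (+ n)    = n · 1#
  fromℤ -[1+ n ] = - (suc n · 1#)

  -- monic (c₀ ∷ … ∷ cₙ₋₁ ∷ []) x = c₀ + c₁ x + … + cₙ₋₁ xⁿ⁻¹ + xⁿ
  monic : List ℤ → Carrier → Carrier
  monic []       x = 1#
  monic (c ∷ cs) x = fromℤ c + x * monic cs x

  -- The ring of integers of K, as a subset of K.
  𝒪 : Pred Carrier 0ℓ
  𝒪 x = ∃[ cs ] monic cs x ≈ 0#

  -- Finite primes of K: the nonzero prime ideals of 𝒪.
  record FinitePrime : Set (lsuc 0ℓ) where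
    field
      𝔭          : Pred Carrier 0ℓ
      resp       : 𝔭 Respects _≈_
      integral   : ∀ {x} → 𝔭 x → 𝒪 x
      0∈𝔭        : 𝔭 0#
      +-closed   : ∀ {x y} → 𝔭 x → 𝔭 y → 𝔭 (x + y)
      *-absorb   : ∀ {x y} → 𝒪 x → 𝔭 y → 𝔭 (x * y)
      proper     : ¬ 𝔭 1#
      prime      : ∀ {x y} → 𝒪 x → 𝒪 y → 𝔭 (x * y) → 𝔭 x ⊎ 𝔭 y
      nonzero    : ∃[ x ] 𝔭 x × ¬ x ≈ 0#

    -- The localization of 𝒪 at 𝔭, i.e. the valuation ring { x ∣ v_𝔭(x) ≥ 0 }.
    Local : Pred Carrier 0ℓ
    Local x = ∃[ a ] ∃[ b ] 𝒪 a × 𝒪 b × ¬ 𝔭 b × x * b ≈ a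

    -- v_𝔭(x) = 0
    LocalUnit : Pred Carrier 0ℓ
    LocalUnit x = Local x × (∃[ y ] Local y × x * y ≈ 1#)

  -- y² + a₁xy + a₃y = x³ + a₂x² + a₄x + a₆
  record Weierstrass : Set where
    field
      a₁ a₂ a₃ a₄ a₆ : Carrier

    b₂ b₄ b₆ b₈ Δ : Carrier
    b₂ = a₁ ^ 2 + 4 · a₂
    b₄ = 2 · a₄ + a₁ * a₃
    b₆ = a₃ ^ 2 + 4 · a₆
    b₈ = a₁ ^ 2 * a₆ + 4 · (a₂ * a₆) - a₁ * a₃ * a₄ + a₂ * a₃ ^ 2 - a₄ ^ 2
    Δ  = - (b₂ ^ 2 * b₈) - 8 · (b₄ ^ 3) - 27 · (b₆ ^ 2) + 9 · (b₂ * b₄ * b₆)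

  open Weierstrass using (Δ)

  -- W′ is obtained from W by the substitution
  --   x = u²x′ + r,  y = u³y′ + u²sx′ + t   with u ≠ 0.
  record _≅_ (W W′ : Weierstrass) : Set where
    open Weierstrass W using (a₁; a₂; a₃; a₄; a₆)
    open Weierstrass W′ using ()
      renaming (a₁ to a₁′; a₂ to a₂′; a₃ to a₃′; a₄ to a₄′; a₆ to a₆′)
    field
      u r s t : Carrier
      u≉0 : ¬ u ≈ 0#
      eq₁ : u * a₁′     ≈ a₁ + 2 · s
      eq₂ : u ^ 2 * a₂′ ≈ a₂ - s * a₁ + 3 · r - s ^ 2
      eq₃ : u ^ 3 * a₃′ ≈ a₃ + r * a₁ + 2 · t
      eq₄ : u ^ 4 * a₄′ ≈ a₄ - s * a₃ + 2 · (r * a₂) - (t + r * s) * a₁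
                            + 3 · (r ^ 2) - 2 · (s * t)
      eq₆ : u ^ 6 * a₆′ ≈ a₆ + r * a₄ + r ^ 2 * a₂ + r ^ 3 - t * a₃ - t ^ 2 - r * t * a₁

  record EllipticCurve : Set where
    field
      equation    : Weierstrass
      nonsingular : ¬ Δ equation ≈ 0#

    discriminant : Carrier
    discriminant = Δ equation

  module _ (v : FinitePrime) where
    open FinitePrime v

    IntegralAt : Pred Weierstrass 0ℓ
    IntegralAt W = Local a₁ × Local a₂ × Local a₃ × Local a₄ × Local a₆
      where open Weierstrass W

    -- Integral, with v(Δ) least among the integral equations of the same curve;
    -- v(Δ W) ≤ v(Δ W′) is expressed as Δ W′ ∈ Δ W · 𝒪_𝔭.
    MinimalAt : Pred Weierstrass 0ℓ
    MinimalAt W = IntegralAt W ×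
      (∀ W′ → W ≅ W′ → IntegralAt W′ → ∃[ c ] Local c × Δ W′ ≈ c * Δ W)

    -- A minimal equation has discriminant of valuation 0, i.e. its reduction
    -- modulo 𝔭 is nonsingular.
    GoodReductionAt : Pred EllipticCurve 0ℓ
    GoodReductionAt E = ∃[ W ] EllipticCurve.equation E ≅ W × MinimalAt W × LocalUnit (Δ W)

  EverywhereGoodReduction : Pred EllipticCurve (lsuc 0ℓ)
  EverywhereGoodReduction E = ∀ v → GoodReductionAt v E

  IsCube : Pred Carrier 0ℓ
  IsCube x = ∃[ y ] y ^ 3 ≈ x

{-# OPTIONS --safe #-}
-- Take a model with good reduction at the prime above 2, and write x³ for the j-invariant: since Δ is a
-- cube and the reduction is good everywhere, x lies in 𝕆 = ℤ[√m]. With t = x − 12 and B = t² + 36t + 432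
-- one has t B Δ = c₆². Away from 6 the factors t and B are coprime and Δ has even valuation, so B has
-- even valuation there. Hence N B (after removing powers of 2) is a square, and by Hilbert 90 some ρB
-- with ρ ∈ {1, 2, 3, 6} is a square; neither class numbers nor fundamental units enter, because m is a
-- prime or twice a prime and (√m)² = m disposes of the ramified primes.
-- Congruences modulo 8 exclude every ρ when m = 67. For m = 71 the class ρ = 3 survives; it gives
-- (v + 2)(v − 2) = 3z² with N (v + 2) ≡ 5 (mod 8), which is impossible. For m = 62 the class ρ = 6 gives
-- the Pell equation A² − 93 E² = 4 with 3 ∤ E, and the class ρ = 1 a factorisation of 27 into a unit and its
-- cofactor, which forces t = 8; then 2Δ is a square G² with N G ≡ 6 (mod 16), again impossible.
module Submission where

open import Defs
open import Data.List.Base using ([]; _∷_)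
open import Data.List.Membership.Propositional using (_∈_)
open import Data.Nat.Base using (ℕ)
open import Data.Product.Base using (Σ-syntax; _×_)
open import Relation.Nullary.Negation using (¬_)

open import Algebra.Bundles using (CommutativeMonoid; CommutativeRing; Semiring)
import Algebra.Properties.AbelianGroup as AbelianGroupProperties
import Algebra.Properties.Monoid.Mult as Mult
import Algebra.Properties.Ring as RingProperties
import Algebra.Solver.Ring as RingSolver
open import Algebra.Solver.Ring.AlmostCommutativeRing using (_-Raw-AlmostCommutative⟶_; fromCommutativeRing)
open import Algebra.Structures using (IsCommutativeRing)
import Data.Integer.Base as ℤᵇ
import Data.Integer.DivMod as ℤᵈ
import Data.Integer.Divisibility as ℤᵘ
import Data.Integer.Divisibility.Signed as ℤˢ
import Data.Integer.Properties as ℤᵖ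
open import Data.Maybe.Base using (Maybe; just; nothing)
open import Data.Nat.Base as ℕ using (zero; suc)
import Data.Nat.Properties as ℕ
open import Data.Product.Base using (∃-syntax; _,_; proj₁; proj₂)
open import Data.Sum.Base using (_⊎_)
open import Level using (0ℓ)
open import Relation.Binary.PropositionalEquality as ≡ using (_≡_)
import Relation.Binary.Reasoning.Setoid as SetoidReasoning
open import Relation.Nullary.Decidable.Core using (Dec; yes; no; map′)

-- A global minimal model would presuppose information on the class group, so a single integral
-- model is fixed by its behaviour at the prime v₂ above 2. At any other place it may fail to be
-- minimal, but its discriminant then differs from a local unit by a twelfth power, which keeps
-- every valuation argument away from 2 intact. Over a real quadratic field two ambiguities of sign
-- remain. B = (t + 18)² + 108 has positive rational part, which makes ρ positive; norms of elements
-- prime to 2 are never 7 modulo 8, which excludes norm -1. What happens at 2 depends on a₁. If a₁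
-- is prime to v₂, then so is t, and the congruences for ρ apply. If 2 divides a₁, then Δ ≡ -27 a₃⁴
-- (mod 8), which the square class of Δ forbids. If a₁ generates v₂ modulo 2, then Δ ≡ r + 2√m (mod
-- 4) with r odd, and N Δ ≡ 1 - 4m (mod 8) must be a square: impossible for odd m, but not for m =
-- 62, the only field where this case needs an analysis of its own. The prime 3 is inert for m = 62
-- and m = 71, and comparing valuations in t B Δ = c₆² there leaves only 3 ∤ t or 27 ∣ t.

-- Integer multiplication is made opaque: its unfolding duplicates both
-- arguments, which makes conversion checking of nested products exponential.
module ℤ where

  open ≡ using (refl; sym; trans; cong; subst)

  open ℤᵇ public
    using (ℤ; +_; -[1+_]; ∣_∣; _+_; -_; _-_; -1ℤ; NonZero; ≢-nonZero)
  open ℤᵖ public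
    using (_≟_; +-comm; +-assoc; +-identityˡ; +-identityʳ; +-inverseˡ; +-inverseʳ;
           neg-involutive; +-injective; ∣i∣≡0⇒i≡0; i-j≡0⇒i≡j)

  infixl 7 _*_
  opaque
    _*_ : ℤ → ℤ → ℤ
    _*_ = ℤᵇ._*_

    *-def : ∀ a b → a * b ≡ a ℤᵇ.* b
    *-def a b = refl

    +-*-isCommutativeRing : IsCommutativeRing _≡_ _+_ _*_ -_ (+ 0) (+ 1)
    +-*-isCommutativeRing = ℤᵖ.+-*-isCommutativeRing

    *-cancelˡ-≡ : ∀ i j k .{{_ : NonZero i}} → i * j ≡ i * k → j ≡ k
    *-cancelˡ-≡ = ℤᵖ.*-cancelˡ-≡

    i*j≡0⇒i≡0∨j≡0 : ∀ i {j} → i * j ≡ + 0 → i ≡ + 0 ⊎ j ≡ + 0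
    i*j≡0⇒i≡0∨j≡0 = ℤᵖ.i*j≡0⇒i≡0∨j≡0

    pos-* : ∀ a b → + (a ℕ.* b) ≡ + a * + b
    pos-* = ℤᵖ.pos-*

    abs-* : ∀ a b → ∣ a * b ∣ ≡ ∣ a ∣ ℕ.* ∣ b ∣
    abs-* = ℤᵖ.abs-*

    -1*i≡-i : ∀ i → -1ℤ * i ≡ - i
    -1*i≡-i = ℤᵖ.-1*i≡-i

    neg-distribˡ-* : ∀ i j → - (i * j) ≡ - i * j
    neg-distribˡ-* = ℤᵖ.neg-distribˡ-*

  +-*-commutativeRing : CommutativeRing 0ℓ 0ℓ
  +-*-commutativeRing = record { isCommutativeRing = +-*-isCommutativeRing }

  open CommutativeRing +-*-commutativeRing public
    using (*-comm; *-assoc; *-identityˡ; *-identityʳ)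
    renaming (distribʳ to *-distribʳ-+; zeroʳ to *-zeroʳ; zeroˡ to *-zeroˡ)

  open ℤᵇ public using (+-*-rawRing)

  id-morphism : +-*-rawRing -Raw-AlmostCommutative⟶ fromCommutativeRing +-*-commutativeRing
  id-morphism = record
    { ⟦_⟧    = λ n → n
    ; +-homo = λ _ _ → refl
    ; *-homo = λ a b → sym (*-def a b)
    ; -‿homo = λ _ → refl
    ; 0-homo = refl
    ; 1-homo = refl
    }

  ≡? : ∀ a b → Maybe (a ≡ b)
  ≡? a b with a ≟ b
  ... | yes eq = just eq
  ... | no  _  = nothing

  module +-*-Solver = RingSolver +-*-rawRing (fromCommutativeRing +-*-commutativeRing) id-morphism ≡?

  infix 4 _∣_ _∣?_
  record _∣_ (k z : ℤ) : Set where
    constructor divides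
    field
      quotient : ℤ
      equality : z ≡ quotient * k
  open _∣_ public

  ∣-refl : ∀ {k} → k ∣ k
  ∣-refl = divides (+ 1) (sym (*-identityˡ _))

  ∣0 : ∀ {k} → k ∣ + 0
  ∣0 {k} = divides (+ 0) (sym (*-zeroˡ k))

  ∣ᵤ⇒∣ : ∀ {k z} → k ℤᵘ.∣ z → k ∣ z
  ∣ᵤ⇒∣ h with ℤˢ.∣ᵤ⇒∣ h
  ... | ℤˢ.divides r eq = divides r (trans eq (sym (*-def r _)))

  ∣⇒∣ᵤ : ∀ {k z} → k ∣ z → k ℤᵘ.∣ z
  ∣⇒∣ᵤ (divides r eq) = ℤˢ.∣⇒∣ᵤ (ℤˢ.divides r (trans eq (*-def r _)))

  _∣?_ : ∀ k z → Dec (k ∣ z)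
  k ∣? z = map′ (λ h → ∣ᵤ⇒∣ (ℤˢ.∣⇒∣ᵤ h)) (λ h → ℤˢ.∣ᵤ⇒∣ (∣⇒∣ᵤ h)) (k ℤˢ.∣? z)

  open ℤᵈ public using (_%ℕ_; _/ℕ_; n%ℕd<d)

  a≡a%ℕn+[a/ℕn]*n : ∀ a n .{{_ : ℕ.NonZero n}} → a ≡ + (a %ℕ n) + (a /ℕ n) * + n
  a≡a%ℕn+[a/ℕn]*n a n = trans (ℤᵈ.a≡a%ℕn+[a/ℕn]*n a n) (cong (λ z → + (a %ℕ n) + z) (sym (*-def (a /ℕ n) (+ n))))

open ℤ using (ℤ; +_; -[1+_]; _∣_; divides; _∣?_; _%ℕ_; _/ℕ_; a≡a%ℕn+[a/ℕn]*n; n%ℕd<d)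

-- Covariants of Weierstrass equations and their transformation laws

module WeierstrassInvariants (R : CommutativeRing 0ℓ 0ℓ) where
  open CommutativeRing R
  open EllipticCurves R
  open import Algebra.Definitions.RawSemiring (Semiring.rawSemiring semiring)
    using (_^_) renaming (_×_ to _·_)
  open Weierstrass

  private
    open Mult +-monoid using (×-homo-+)
    open RingProperties ring using (-0#≈0#; -‿+-comm; -‿distribˡ-*)
    open AbelianGroupProperties +-abelianGroup using (⁻¹-involutive)
    open SetoidReasoning setoid

    fromℤ-neg : ∀ a → fromℤ (ℤᵇ.- a) ≈ - fromℤ a
    fromℤ-neg (+ zero)    = sym -0#≈0#
    fromℤ-neg (+ suc n)   = refl
    fromℤ-neg -[1+ n ]    = sym (⁻¹-involutive _)

    fromℤ-⊖ : ∀ k l → fromℤ (k ℤᵇ.⊖ l) ≈ k · 1# - l · 1#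
    fromℤ-⊖ zero    zero    = sym (-‿inverseʳ 0#)
    fromℤ-⊖ zero    (suc l) = sym (+-identityˡ _)
    fromℤ-⊖ (suc k) zero    = sym (trans (+-congˡ -0#≈0#) (+-identityʳ _))
    fromℤ-⊖ (suc k) (suc l) = begin
      fromℤ (suc k ℤᵇ.⊖ suc l)                 ≡⟨ ≡.cong fromℤ (ℤᵖ.[1+m]⊖[1+n]≡m⊖n k l) ⟩
      fromℤ (k ℤᵇ.⊖ l)                         ≈⟨ fromℤ-⊖ k l ⟩
      k · 1# - l · 1#                          ≈⟨ +-congʳ (+-identityˡ _) ⟨
      (0# + k · 1#) - l · 1#                   ≈⟨ +-congʳ (+-congʳ (-‿inverseʳ 1#)) ⟨
      ((1# - 1#) + k · 1#) - l · 1#            ≈⟨ +-congʳ (+-assoc 1# (- 1#) _) ⟩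
      (1# + (- 1# + k · 1#)) - l · 1#          ≈⟨ +-congʳ (+-congˡ (+-comm _ _)) ⟩
      (1# + (k · 1# - 1#)) - l · 1#            ≈⟨ +-congʳ (+-assoc 1# _ _) ⟨
      ((1# + k · 1#) - 1#) - l · 1#            ≈⟨ +-assoc _ _ _ ⟩
      (1# + k · 1#) + (- 1# - l · 1#)          ≈⟨ +-congˡ (-‿+-comm 1# _) ⟩
      suc k · 1# - suc l · 1#                  ∎

    fromℤ-+ : ∀ a b → fromℤ (a ℤᵇ.+ b) ≈ fromℤ a + fromℤ b
    fromℤ-+ (+ k)    (+ l)    = ×-homo-+ 1# k l
    fromℤ-+ (+ k)    -[1+ l ] = fromℤ-⊖ k (suc l)
    fromℤ-+ -[1+ k ] (+ l)    = trans (fromℤ-⊖ l (suc k)) (+-comm _ _)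
    fromℤ-+ -[1+ k ] -[1+ l ] = begin
      - (suc (suc (k ℕ.+ l)) · 1#)       ≡⟨ ≡.cong (λ z → - (suc z · 1#)) (ℕ.+-suc k l) ⟨
      - ((suc k ℕ.+ suc l) · 1#)         ≈⟨ -‿cong (×-homo-+ 1# (suc k) (suc l)) ⟩
      - (suc k · 1# + suc l · 1#)        ≈⟨ -‿+-comm _ _ ⟨
      - (suc k · 1#) + - (suc l · 1#)    ∎

    fromℤ-*⁺ : ∀ k b → fromℤ (+ k ℤᵇ.* b) ≈ k · 1# * fromℤ b
    fromℤ-*⁺ zero    b = trans (reflexive (≡.cong fromℤ (ℤᵖ.*-zeroˡ b))) (sym (zeroˡ _))
    fromℤ-*⁺ (suc k) b = begin
      fromℤ (+ suc k ℤᵇ.* b)             ≡⟨ ≡.cong fromℤ (ℤᵖ.suc-* (+ k) b) ⟩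
      fromℤ (b ℤᵇ.+ + k ℤᵇ.* b)          ≈⟨ fromℤ-+ b _ ⟩
      fromℤ b + fromℤ (+ k ℤᵇ.* b)       ≈⟨ +-cong (sym (*-identityˡ _)) (fromℤ-*⁺ k b) ⟩
      1# * fromℤ b + k · 1# * fromℤ b    ≈⟨ distribʳ _ _ _ ⟨
      suc k · 1# * fromℤ b               ∎

    fromℤ-* : ∀ a b → fromℤ (a ℤᵇ.* b) ≈ fromℤ a * fromℤ b
    fromℤ-* (+ k)    b = fromℤ-*⁺ k b
    fromℤ-* -[1+ k ] b = begin
      fromℤ (-[1+ k ] ℤᵇ.* b)            ≡⟨ ≡.cong fromℤ (ℤᵖ.neg-distribˡ-* (+ suc k) b) ⟨
      fromℤ (ℤᵇ.- (+ suc k ℤᵇ.* b))      ≈⟨ fromℤ-neg (+ suc k ℤᵇ.* b) ⟩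
      - fromℤ (+ suc k ℤᵇ.* b)           ≈⟨ -‿cong (fromℤ-*⁺ (suc k) b) ⟩
      - (suc k · 1# * fromℤ b)           ≈⟨ -‿distribˡ-* _ _ ⟩
      - (suc k · 1#) * fromℤ b           ∎

    morphism : ℤᵇ.+-*-rawRing -Raw-AlmostCommutative⟶ fromCommutativeRing R
    morphism = record
      { ⟦_⟧ = fromℤ ; +-homo = fromℤ-+ ; *-homo = fromℤ-* ; -‿homo = fromℤ-neg
      ; 0-homo = refl ; 1-homo = +-identityʳ 1# }

    coefficient≟ : ∀ a b → Maybe (fromℤ a ≈ fromℤ b)
    coefficient≟ a b with a ℤᵖ.≟ b
    ... | yes eq = just (reflexive (≡.cong fromℤ eq))
    ... | no  _  = nothing

  module Solver = RingSolver ℤᵇ.+-*-rawRing (fromCommutativeRing R) morphism coefficient≟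
  open Solver using (solve; _:=_; _:+_; _:*_; _:-_; :-_; _:^_; _:×_; Polynomial)

  c₄ c₆ : Weierstrass → Carrier
  c₄ W = b₂ W ^ 2 - fromℤ (+ 24) * b₄ W
  c₆ W = - (b₂ W ^ 3) + fromℤ (+ 36) * (b₂ W * b₄ W) - fromℤ (+ 216) * b₆ W

  4b₈ : ∀ W → 4 · b₈ W ≈ b₂ W * b₆ W - b₄ W ^ 2
  4b₈ W = solve 5 (λ a₁ a₂ a₃ a₄ a₆ →
      4 :× (a₁ :^ 2 :* a₆ :+ 4 :× (a₂ :* a₆) :- a₁ :* a₃ :* a₄ :+ a₂ :* a₃ :^ 2 :- a₄ :^ 2)
    := (a₁ :^ 2 :+ 4 :× a₂) :* (a₃ :^ 2 :+ 4 :× a₆) :- (2 :× a₄ :+ a₁ :* a₃) :^ 2)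
    refl (a₁ W) (a₂ W) (a₃ W) (a₄ W) (a₆ W)

  -- Checked with `b₂`, `b₄`, `b₆`, `b₈` as independent variables, where it holds only up to a
  -- multiple of the relation `4b₈`; since b₈ enters 1728 Δ as -432 b₂² · 4b₈, the multiplier is 432
  -- b₂².
  1728Δ : ∀ W → fromℤ (+ 1728) * Δ W ≈ c₄ W ^ 3 - c₆ W ^ 2
  1728Δ W = begin
    fromℤ (+ 1728) * Δ W
      ≈⟨ lemma (b₂ W) (b₄ W) (b₆ W) (b₈ W) ⟩
    c₄ W ^ 3 - c₆ W ^ 2 - fromℤ (+ 432) * (b₂ W ^ 2 * (4 · b₈ W - (b₂ W * b₆ W - b₄ W ^ 2)))
      ≈⟨ +-congˡ (-‿cong (vanish (b₂ W ^ 2) (4b₈ W))) ⟩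
    c₄ W ^ 3 - c₆ W ^ 2 - 0#
      ≈⟨ trans (+-congˡ -0#≈0#) (+-identityʳ _) ⟩
    c₄ W ^ 3 - c₆ W ^ 2 ∎
    where
    lemma : ∀ b₂ b₄ b₆ b₈ →
      fromℤ (+ 1728) * (- (b₂ ^ 2 * b₈) - 8 · (b₄ ^ 3) - 27 · (b₆ ^ 2) + 9 · (b₂ * b₄ * b₆)) ≈
      (b₂ ^ 2 - fromℤ (+ 24) * b₄) ^ 3 - (- (b₂ ^ 3) + fromℤ (+ 36) * (b₂ * b₄) - fromℤ (+ 216) * b₆) ^ 2
        - fromℤ (+ 432) * (b₂ ^ 2 * (4 · b₈ - (b₂ * b₆ - b₄ ^ 2)))
    lemma = solve 4 (λ b₂ b₄ b₆ b₈ →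
      k 1728 :* (:- (b₂ :^ 2 :* b₈) :- 8 :× (b₄ :^ 3) :- 27 :× (b₆ :^ 2) :+ 9 :× (b₂ :* b₄ :* b₆)) :=
      (b₂ :^ 2 :- k 24 :* b₄) :^ 3 :- (:- (b₂ :^ 3) :+ k 36 :* (b₂ :* b₄) :- k 216 :* b₆) :^ 2
        :- k 432 :* (b₂ :^ 2 :* (4 :× b₈ :- (b₂ :* b₆ :- b₄ :^ 2)))) refl
      where
      k : ∀ {n} → ℕ → Polynomial n
      k n = Polynomial.con (+ n)
    vanish : ∀ {x y} z → x ≈ y → fromℤ (+ 432) * (z * (x - y)) ≈ 0#
    vanish {x} {y} z x≈y = trans (*-congˡ (trans (*-congˡ (trans (+-congʳ x≈y) (-‿inverseʳ y))) (zeroʳ z))) (zeroʳ _)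

  module Transformation {W W′ : Weierstrass} (W≅W′ : W ≅ W′) where
    open _≅_ W≅W′
    open Weierstrass W using ()
      renaming (a₁ to A₁; a₂ to A₂; a₃ to A₃; a₄ to A₄; a₆ to A₆; b₂ to B₂; b₄ to B₄; b₆ to B₆)
    open Weierstrass W′ using ()
      renaming (a₁ to A₁′; a₂ to A₂′; a₃ to A₃′; a₄ to A₄′; a₆ to A₆′; b₂ to B₂′; b₄ to B₄′; b₆ to B₆′)

    private
      ·-cong : ∀ n {x y} → x ≈ y → n · x ≈ n · y
      ·-cong n = Mult.×-congʳ +-monoid n
      ^-cong : ∀ n {x y} → x ≈ y → x ^ n ≈ y ^ n
      ^-cong n = Mult.×-congʳ *-monoid n

    b₂-scale : u ^ 2 * B₂′ ≈ B₂ + 12 · r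
    b₂-scale = begin
      u ^ 2 * B₂′
        ≈⟨ solve 3 (λ u a₁ a₂ → u :^ 2 :* (a₁ :^ 2 :+ 4 :× a₂) := (u :* a₁) :^ 2 :+ 4 :× (u :^ 2 :* a₂)) refl u A₁′ A₂′ ⟩
      (u * A₁′) ^ 2 + 4 · (u ^ 2 * A₂′)
        ≈⟨ +-cong (^-cong 2 eq₁) (·-cong 4 eq₂) ⟩
      (A₁ + 2 · s) ^ 2 + 4 · (A₂ - s * A₁ + 3 · r - s ^ 2)
        ≈⟨ solve 4 (λ a₁ a₂ r s → (a₁ :+ 2 :× s) :^ 2 :+ 4 :× (a₂ :- s :* a₁ :+ 3 :× r :- s :^ 2)
             := (a₁ :^ 2 :+ 4 :× a₂) :+ 12 :× r) refl A₁ A₂ r s ⟩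
      B₂ + 12 · r ∎

    b₄-scale : u ^ 4 * B₄′ ≈ B₄ + r * B₂ + 6 · (r ^ 2)
    b₄-scale = begin
      u ^ 4 * B₄′
        ≈⟨ solve 4 (λ u a₁ a₃ a₄ → u :^ 4 :* (2 :× a₄ :+ a₁ :* a₃) := 2 :× (u :^ 4 :* a₄) :+ (u :* a₁) :* (u :^ 3 :* a₃)) refl u A₁′ A₃′ A₄′ ⟩
      2 · (u ^ 4 * A₄′) + (u * A₁′) * (u ^ 3 * A₃′)
        ≈⟨ +-cong (·-cong 2 eq₄) (*-cong eq₁ eq₃) ⟩
      2 · (A₄ - s * A₃ + 2 · (r * A₂) - (t + r * s) * A₁ + 3 · (r ^ 2) - 2 · (s * t)) + (A₁ + 2 · s) * (A₃ + r * A₁ + 2 · t)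
        ≈⟨ solve 7 (λ a₁ a₂ a₃ a₄ r s t →
             2 :× (a₄ :- s :* a₃ :+ 2 :× (r :* a₂) :- (t :+ r :* s) :* a₁ :+ 3 :× (r :^ 2) :- 2 :× (s :* t)) :+ (a₁ :+ 2 :× s) :* (a₃ :+ r :* a₁ :+ 2 :× t)
             := (2 :× a₄ :+ a₁ :* a₃) :+ r :* (a₁ :^ 2 :+ 4 :× a₂) :+ 6 :× (r :^ 2)) refl A₁ A₂ A₃ A₄ r s t ⟩
      B₄ + r * B₂ + 6 · (r ^ 2) ∎

    b₆-scale : u ^ 6 * B₆′ ≈ B₆ + 2 · (r * B₄) + r ^ 2 * B₂ + 4 · (r ^ 3)
    b₆-scale = begin
      u ^ 6 * B₆′
        ≈⟨ solve 3 (λ u a₃ a₆ → u :^ 6 :* (a₃ :^ 2 :+ 4 :× a₆) := (u :^ 3 :* a₃) :^ 2 :+ 4 :× (u :^ 6 :* a₆)) refl u A₃′ A₆′ ⟩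
      (u ^ 3 * A₃′) ^ 2 + 4 · (u ^ 6 * A₆′)
        ≈⟨ +-cong (^-cong 2 eq₃) (·-cong 4 eq₆) ⟩
      (A₃ + r * A₁ + 2 · t) ^ 2 + 4 · (A₆ + r * A₄ + r ^ 2 * A₂ + r ^ 3 - t * A₃ - t ^ 2 - r * t * A₁)
        ≈⟨ solve 7 (λ a₁ a₂ a₃ a₄ a₆ r t →
             (a₃ :+ r :* a₁ :+ 2 :× t) :^ 2 :+ 4 :× (a₆ :+ r :* a₄ :+ r :^ 2 :* a₂ :+ r :^ 3 :- t :* a₃ :- t :^ 2 :- r :* t :* a₁)
             := (a₃ :^ 2 :+ 4 :× a₆) :+ 2 :× (r :* (2 :× a₄ :+ a₁ :* a₃)) :+ r :^ 2 :* (a₁ :^ 2 :+ 4 :× a₂) :+ 4 :× (r :^ 3)) refl A₁ A₂ A₃ A₄ A₆ r t ⟩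
      B₆ + 2 · (r * B₄) + r ^ 2 * B₂ + 4 · (r ^ 3) ∎

    private
      k : ∀ {n} → ℕ → Polynomial n
      k n = Polynomial.con (+ n)

    c₄-scale : u ^ 4 * c₄ W′ ≈ c₄ W
    c₄-scale = begin
      u ^ 4 * c₄ W′
        ≈⟨ solve 3 (λ u b₂ b₄ → u :^ 4 :* (b₂ :^ 2 :- k 24 :* b₄) := (u :^ 2 :* b₂) :^ 2 :- k 24 :* (u :^ 4 :* b₄)) refl u B₂′ B₄′ ⟩
      (u ^ 2 * B₂′) ^ 2 - fromℤ (+ 24) * (u ^ 4 * B₄′)
        ≈⟨ +-cong (^-cong 2 b₂-scale) (-‿cong (*-congˡ b₄-scale)) ⟩
      (B₂ + 12 · r) ^ 2 - fromℤ (+ 24) * (B₄ + r * B₂ + 6 · (r ^ 2))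
        ≈⟨ solve 3 (λ b₂ b₄ r → (b₂ :+ 12 :× r) :^ 2 :- k 24 :* (b₄ :+ r :* b₂ :+ 6 :× (r :^ 2)) := b₂ :^ 2 :- k 24 :* b₄) refl B₂ B₄ r ⟩
      c₄ W ∎

    c₆-scale : u ^ 6 * c₆ W′ ≈ c₆ W
    c₆-scale = begin
      u ^ 6 * c₆ W′
        ≈⟨ solve 4 (λ u b₂ b₄ b₆ → u :^ 6 :* (:- (b₂ :^ 3) :+ k 36 :* (b₂ :* b₄) :- k 216 :* b₆)
             := :- ((u :^ 2 :* b₂) :^ 3) :+ k 36 :* ((u :^ 2 :* b₂) :* (u :^ 4 :* b₄)) :- k 216 :* (u :^ 6 :* b₆)) refl u B₂′ B₄′ B₆′ ⟩
      - ((u ^ 2 * B₂′) ^ 3) + fromℤ (+ 36) * ((u ^ 2 * B₂′) * (u ^ 4 * B₄′)) - fromℤ (+ 216) * (u ^ 6 * B₆′)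
        ≈⟨ +-cong (+-cong (-‿cong (^-cong 3 b₂-scale)) (*-congˡ (*-cong b₂-scale b₄-scale))) (-‿cong (*-congˡ b₆-scale)) ⟩
      - ((B₂ + 12 · r) ^ 3) + fromℤ (+ 36) * ((B₂ + 12 · r) * (B₄ + r * B₂ + 6 · (r ^ 2)))
        - fromℤ (+ 216) * (B₆ + 2 · (r * B₄) + r ^ 2 * B₂ + 4 · (r ^ 3))
        ≈⟨ solve 4 (λ b₂ b₄ b₆ r → :- ((b₂ :+ 12 :× r) :^ 3) :+ k 36 :* ((b₂ :+ 12 :× r) :* (b₄ :+ r :* b₂ :+ 6 :× (r :^ 2)))
             :- k 216 :* (b₆ :+ 2 :× (r :* b₄) :+ r :^ 2 :* b₂ :+ 4 :× (r :^ 3))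
             := :- (b₂ :^ 3) :+ k 36 :* (b₂ :* b₄) :- k 216 :* b₆) refl B₂ B₄ B₆ r ⟩
      c₆ W ∎

    -- Obtained from the weights 4 and 6 of `c₄` and `c₆`, so the factor 1728 stays until it is
    -- cancelled in ℚ(√m).
    1728Δ-scale : fromℤ (+ 1728) * (u ^ 12 * Δ W′) ≈ fromℤ (+ 1728) * Δ W
    1728Δ-scale = begin
      fromℤ (+ 1728) * (u ^ 12 * Δ W′)
        ≈⟨ solve 3 (λ n u d → n :* (u :^ 12 :* d) := u :^ 12 :* (n :* d)) refl (fromℤ (+ 1728)) u (Δ W′) ⟩
      u ^ 12 * (fromℤ (+ 1728) * Δ W′)
        ≈⟨ *-congˡ (1728Δ W′) ⟩
      u ^ 12 * (c₄ W′ ^ 3 - c₆ W′ ^ 2)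
        ≈⟨ solve 3 (λ u x y → u :^ 12 :* (x :^ 3 :- y :^ 2) := (u :^ 4 :* x) :^ 3 :- (u :^ 6 :* y) :^ 2) refl u (c₄ W′) (c₆ W′) ⟩
      (u ^ 4 * c₄ W′) ^ 3 - (u ^ 6 * c₆ W′) ^ 2
        ≈⟨ +-cong (^-cong 3 c₄-scale) (-‿cong (^-cong 2 c₆-scale)) ⟩
      c₄ W ^ 3 - c₆ W ^ 2
        ≈⟨ 1728Δ W ⟨
      fromℤ (+ 1728) * Δ W ∎

  scaled : ∀ (W W′ : Weierstrass) u → ¬ u ≈ 0# → a₁ W ≈ u * a₁ W′ → a₂ W ≈ u ^ 2 * a₂ W′ → a₃ W ≈ u ^ 3 * a₃ W′ →
           a₄ W ≈ u ^ 4 * a₄ W′ → a₆ W ≈ u ^ 6 * a₆ W′ → W ≅ W′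
  scaled W W′ u u≉0 e₁ e₂ e₃ e₄ e₆ = record
    { u = u ; r = 0# ; s = 0# ; t = 0# ; u≉0 = u≉0
    ; eq₁ = trans (sym e₁) (solve 1 (λ a → a := a :+ 2 :× o) refl (a₁ W))
    ; eq₂ = trans (sym e₂) (solve 2 (λ a b → b := b :- o :* a :+ 3 :× o :- o :^ 2) refl (a₁ W) (a₂ W))
    ; eq₃ = trans (sym e₃) (solve 2 (λ a c → c := c :+ o :* a :+ 2 :× o) refl (a₁ W) (a₃ W))
    ; eq₄ = trans (sym e₄) (solve 4 (λ a b c d → d := d :- o :* c :+ 2 :× (o :* b) :- (o :+ o :* o) :* a
              :+ 3 :× (o :^ 2) :- 2 :× (o :* o)) refl (a₁ W) (a₂ W) (a₃ W) (a₄ W))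
    ; eq₆ = trans (sym e₆) (solve 5 (λ a b c d e → e := e :+ o :* d :+ o :^ 2 :* b :+ o :^ 3 :- o :* c :- o :^ 2 :- o :* o :* a)
              refl (a₁ W) (a₂ W) (a₃ W) (a₄ W) (a₆ W)) }
    where
    o : ∀ {n} → Polynomial n
    o = Polynomial.con (+ 0)

-- Weierstrass models along a ring homomorphism

module InvariantsHomomorphism (R S : CommutativeRing 0ℓ 0ℓ)
  (φ : CommutativeRing.Carrier R → CommutativeRing.Carrier S)
  (φ-+ : ∀ x y → CommutativeRing._≈_ S (φ (CommutativeRing._+_ R x y)) (CommutativeRing._+_ S (φ x) (φ y)))
  (φ-* : ∀ x y → CommutativeRing._≈_ S (φ (CommutativeRing._*_ R x y)) (CommutativeRing._*_ S (φ x) (φ y)))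
  (φ-neg : ∀ x → CommutativeRing._≈_ S (φ (CommutativeRing.-_ R x)) (CommutativeRing.-_ S (φ x)))
  (φ-0 : CommutativeRing._≈_ S (φ (CommutativeRing.0# R)) (CommutativeRing.0# S))
  (φ-1 : CommutativeRing._≈_ S (φ (CommutativeRing.1# R)) (CommutativeRing.1# S))
  where
  private
    module R = CommutativeRing R
    module ER = EllipticCurves R
    module IR = WeierstrassInvariants R
    module ES = EllipticCurves S
    module IS = WeierstrassInvariants S
    open CommutativeRing S
    open import Algebra.Definitions.RawSemiring (Semiring.rawSemiring semiring)
      using (_^_) renaming (_×_ to _·_)
    module ROps where
      open import Algebra.Definitions.RawSemiring (Semiring.rawSemiring R.semiring) public
        using (_^_) renaming (_×_ to _·_)

  image : ER.Weierstrass → ES.Weierstrass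
  image W = record { a₁ = φ a₁ ; a₂ = φ a₂ ; a₃ = φ a₃ ; a₄ = φ a₄ ; a₆ = φ a₆ }
    where open ER.Weierstrass W

  φ-^ : ∀ x n → φ (x ROps.^ n) ≈ φ x ^ n
  φ-^ x zero    = φ-1
  φ-^ x (suc n) = trans (φ-* x _) (*-congˡ (φ-^ x n))

  φ-· : ∀ n x → φ (n ROps.· x) ≈ n · φ x
  φ-· zero    x = φ-0
  φ-· (suc n) x = trans (φ-+ x _) (+-congˡ (φ-· n x))

  φ-fromℤ : ∀ a → φ (ER.fromℤ a) ≈ ES.fromℤ a
  φ-fromℤ (+ n)    = trans (φ-· n R.1#) (Mult.×-congʳ +-monoid n φ-1)
  φ-fromℤ -[1+ n ] = trans (φ-neg _) (-‿cong (φ-fromℤ (+ suc n)))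

  private
    infixl 6 _⟨+⟩_ _⟨-⟩_
    infixl 7 _⟨*⟩_
    _⟨+⟩_ : ∀ {x y x′ y′} → φ x ≈ x′ → φ y ≈ y′ → φ (x R.+ y) ≈ x′ + y′
    p ⟨+⟩ q = trans (φ-+ _ _) (+-cong p q)
    _⟨*⟩_ : ∀ {x y x′ y′} → φ x ≈ x′ → φ y ≈ y′ → φ (x R.* y) ≈ x′ * y′
    p ⟨*⟩ q = trans (φ-* _ _) (*-cong p q)
    ⟨neg⟩ : ∀ {x x′} → φ x ≈ x′ → φ (R.- x) ≈ - x′
    ⟨neg⟩ p = trans (φ-neg _) (-‿cong p)
    _⟨-⟩_ : ∀ {x y x′ y′} → φ x ≈ x′ → φ y ≈ y′ → φ (x R.- y) ≈ x′ - y′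
    p ⟨-⟩ q = p ⟨+⟩ ⟨neg⟩ q
    _⟨^⟩_ : ∀ {x x′} → φ x ≈ x′ → ∀ n → φ (x ROps.^ n) ≈ x′ ^ n
    p ⟨^⟩ n = trans (φ-^ _ n) (Mult.×-congʳ *-monoid n p)
    _⟨·⟩_ : ∀ {x x′} n → φ x ≈ x′ → φ (n ROps.· x) ≈ n · x′
    n ⟨·⟩ p = trans (φ-· n _) (Mult.×-congʳ +-monoid n p)

  module _ (W : ER.Weierstrass) where
    private
      module W = ER.Weierstrass W
      module W′ = ES.Weierstrass (image W)
      a₁ : φ W.a₁ ≈ W′.a₁
      a₁ = refl
      a₂ : φ W.a₂ ≈ W′.a₂
      a₂ = refl
      a₃ : φ W.a₃ ≈ W′.a₃
      a₃ = refl
      a₄ : φ W.a₄ ≈ W′.a₄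
      a₄ = refl
      a₆ : φ W.a₆ ≈ W′.a₆
      a₆ = refl
      b₂ : φ W.b₂ ≈ W′.b₂
      b₂ = (a₁ ⟨^⟩ 2) ⟨+⟩ (4 ⟨·⟩ a₂)
      b₄ : φ W.b₄ ≈ W′.b₄
      b₄ = (2 ⟨·⟩ a₄) ⟨+⟩ a₁ ⟨*⟩ a₃
      b₆ : φ W.b₆ ≈ W′.b₆
      b₆ = (a₃ ⟨^⟩ 2) ⟨+⟩ (4 ⟨·⟩ a₆)
      b₈ : φ W.b₈ ≈ W′.b₈
      b₈ = (a₁ ⟨^⟩ 2) ⟨*⟩ a₆ ⟨+⟩ (4 ⟨·⟩ (a₂ ⟨*⟩ a₆)) ⟨-⟩ a₁ ⟨*⟩ a₃ ⟨*⟩ a₄ ⟨+⟩ a₂ ⟨*⟩ (a₃ ⟨^⟩ 2) ⟨-⟩ (a₄ ⟨^⟩ 2)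

    φ-c₄ : φ (IR.c₄ W) ≈ IS.c₄ (image W)
    φ-c₄ = (b₂ ⟨^⟩ 2) ⟨-⟩ φ-fromℤ (+ 24) ⟨*⟩ b₄

    φ-Δ : φ W.Δ ≈ W′.Δ
    φ-Δ = ⟨neg⟩ ((b₂ ⟨^⟩ 2) ⟨*⟩ b₈) ⟨-⟩ (8 ⟨·⟩ (b₄ ⟨^⟩ 3)) ⟨-⟩ (27 ⟨·⟩ (b₆ ⟨^⟩ 2)) ⟨+⟩ (9 ⟨·⟩ (b₂ ⟨*⟩ b₄ ⟨*⟩ b₆))

  module _ where
    open IS.Solver using (solve; _:=_; _:*_; _:^_)

    common-denominator : ∀ {x₁ x₂ x₃ x₄ x₅} {b₁ b₂ b₃ b₄ b₅ c₁ c₂ c₃ c₄ c₅ : R.Carrier} →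
      x₁ * φ b₁ ≈ φ c₁ → x₂ * φ b₂ ≈ φ c₂ → x₃ * φ b₃ ≈ φ c₃ → x₄ * φ b₄ ≈ φ c₄ → x₅ * φ b₅ ≈ φ c₅ →
      let β = b₁ R.* (b₂ R.* (b₃ R.* (b₄ R.* b₅))) in
      ∃[ d₁ ] ∃[ d₂ ] ∃[ d₃ ] ∃[ d₄ ] ∃[ d₅ ]
        x₁ * φ β ≈ φ d₁ × x₂ * φ β ≈ φ d₂ × x₃ * φ β ≈ φ d₃ × x₄ * φ β ≈ φ d₄ × x₅ * φ β ≈ φ d₅
    common-denominator {x₁} {x₂} {x₃} {x₄} {x₅} {b₁} {b₂} {b₃} {b₄} {b₅} {c₁} {c₂} {c₃} {c₄} {c₅} e₁ e₂ e₃ e₄ e₅ =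
      c₁ R.* (b₂ R.* b₃ R.* b₄ R.* b₅) , c₂ R.* (b₁ R.* b₃ R.* b₄ R.* b₅) , c₃ R.* (b₁ R.* b₂ R.* b₄ R.* b₅) ,
      c₄ R.* (b₁ R.* b₂ R.* b₃ R.* b₅) , c₅ R.* (b₁ R.* b₂ R.* b₃ R.* b₄) ,
      extend e₁ (solve 5 (λ a b c d e → a :* (b :* (c :* (d :* e))) := a :* (b :* c :* d :* e)) refl (φ b₁) (φ b₂) (φ b₃) (φ b₄) (φ b₅)) ,
      extend e₂ (solve 5 (λ a b c d e → a :* (b :* (c :* (d :* e))) := b :* (a :* c :* d :* e)) refl (φ b₁) (φ b₂) (φ b₃) (φ b₄) (φ b₅)) ,
      extend e₃ (solve 5 (λ a b c d e → a :* (b :* (c :* (d :* e))) := c :* (a :* b :* d :* e)) refl (φ b₁) (φ b₂) (φ b₃) (φ b₄) (φ b₅)) ,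
      extend e₄ (solve 5 (λ a b c d e → a :* (b :* (c :* (d :* e))) := d :* (a :* b :* c :* e)) refl (φ b₁) (φ b₂) (φ b₃) (φ b₄) (φ b₅)) ,
      extend e₅ (solve 5 (λ a b c d e → a :* (b :* (c :* (d :* e))) := e :* (a :* b :* c :* d)) refl (φ b₁) (φ b₂) (φ b₃) (φ b₄) (φ b₅))
      where
      φ-β : φ (b₁ R.* (b₂ R.* (b₃ R.* (b₄ R.* b₅)))) ≈ φ b₁ * (φ b₂ * (φ b₃ * (φ b₄ * φ b₅)))
      φ-β = refl ⟨*⟩ (refl ⟨*⟩ (refl ⟨*⟩ (refl ⟨*⟩ refl)))
      extend : ∀ {x b c p q r s} → x * φ b ≈ φ c →
        φ b₁ * (φ b₂ * (φ b₃ * (φ b₄ * φ b₅))) ≈ φ b * (φ p * φ q * φ r * φ s) →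
        x * φ (b₁ R.* (b₂ R.* (b₃ R.* (b₄ R.* b₅)))) ≈ φ (c R.* (p R.* q R.* r R.* s))
      extend {x} {b} {c} {p} {q} {r} {s} e split = trans (*-congˡ (trans φ-β split))
        (trans (sym (*-assoc x (φ b) _)) (trans (*-congʳ e) (sym (refl ⟨*⟩ (refl ⟨*⟩ refl ⟨*⟩ refl ⟨*⟩ refl)))))

    -- The scaling u = β multiplies aᵢ by βⁱ. One factor β turns aᵢ into φ αᵢ, which leaves βⁱ⁻¹ in
    -- the coefficients of W′, for i = 1, 2, 3, 4, 6.
    clear-denominators : ∀ (W : ES.Weierstrass) {β α₁ α₂ α₃ α₄ α₆} → let open ES.Weierstrass W in ¬ φ β ≈ 0# →
      a₁ * φ β ≈ φ α₁ → a₂ * φ β ≈ φ α₂ → a₃ * φ β ≈ φ α₃ → a₄ * φ β ≈ φ α₄ → a₆ * φ β ≈ φ α₆ →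
      ∃[ W′ ] image W′ ES.≅ W
    clear-denominators W {β} {α₁} {α₂} {α₃} {α₄} {α₆} φβ≉0 e₁ e₂ e₃ e₄ e₆ =
      W′ , IS.scaled (image W′) W (φ β) φβ≉0
        (trans (sym e₁) (*-comm _ _))
        (scale 1 e₂) (scale 2 e₃) (scale 3 e₄) (scale 5 e₆)
      where
      W′ : ER.Weierstrass
      W′ = record { a₁ = α₁ ; a₂ = α₂ R.* β ROps.^ 1 ; a₃ = α₃ R.* β ROps.^ 2 ; a₄ = α₄ R.* β ROps.^ 3 ; a₆ = α₆ R.* β ROps.^ 5 }
      scale : ∀ n {a α} → a * φ β ≈ φ α → φ (α R.* β ROps.^ n) ≈ φ β ^ suc n * a
      scale n {a} {α} e = trans (sym e ⟨*⟩ (refl ⟨^⟩ n)) (trans (*-assoc a (φ β) _) (*-comm a _))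

    -- Both E and the integral model W′ are compared with W. The scalings are u = υ/n and β, so
    -- invariants of weight k of E and W′ differ by the factor (υ/(β n))ᵏ; the equations are kept
    -- free of division.
    module CompareModels
      (1728-cancel : ∀ {x y} → ES.fromℤ (+ 1728) * x ≈ ES.fromℤ (+ 1728) * y → x ≈ y)
      {E W : ES.Weierstrass} {W′ : ER.Weierstrass} (E≅W : E ES.≅ W) (W′≅W : image W′ ES.≅ W)
      {β n υ} (u≈ : ES._≅_.u W′≅W ≈ φ β) (υ≈ : ES._≅_.u E≅W * φ n ≈ φ υ)
      where
      private
        module E≅W = IS.Transformation E≅W
        module W′≅W = IS.Transformation W′≅W
        u = ES._≅_.u E≅W

        compare : ∀ k {e w w′} → u ^ k * w ≈ e → ES._≅_.u W′≅W ^ k * w ≈ w′ →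
                  φ ((β R.* n) ROps.^ k) * e ≈ φ (υ ROps.^ k) * w′
        compare k {e} {w} {w′} eq eq′ = trans (*-congʳ (trans (φ-^ _ k) (trans (Mult.×-congʳ *-monoid k (φ-* β n)) (^-distrib-* (φ β) (φ n) k))))
          (trans (*-congˡ (sym eq)) (trans (rearrange (φ β ^ k) (φ n ^ k) (u ^ k) w)
          (trans (*-congʳ (sym (^-distrib-* u (φ n) k)))
          (*-cong (sym (trans (φ-^ υ k) (Mult.×-congʳ *-monoid k (sym υ≈))))
            (trans (*-congʳ (Mult.×-congʳ *-monoid k (sym u≈))) eq′)))))
          where
          open import Algebra.Properties.CommutativeSemiring.Exp commutativeSemiring using (^-distrib-*)
          rearrange : ∀ b n u w → b * n * (u * w) ≈ u * n * (b * w)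
          rearrange = solve 4 (λ b n u w → b :* n :* (u :* w) := u :* n :* (b :* w)) refl

      compare-c₄ : φ ((β R.* n) ROps.^ 4) * IS.c₄ E ≈ φ (υ ROps.^ 4) * φ (IR.c₄ W′)
      compare-c₄ = trans (compare 4 E≅W.c₄-scale W′≅W.c₄-scale) (*-congˡ (sym (φ-c₄ W′)))

      compare-Δ : φ ((β R.* n) ROps.^ 12) * ES.Weierstrass.Δ E ≈ φ (υ ROps.^ 12) * φ (ER.Weierstrass.Δ W′)
      compare-Δ = trans (compare 12 (1728-cancel E≅W.1728Δ-scale) (1728-cancel W′≅W.1728Δ-scale)) (*-congˡ (sym (φ-Δ W′)))

      Δ-scale : φ β ^ 12 * ES.Weierstrass.Δ W ≈ φ (ER.Weierstrass.Δ W′)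
      Δ-scale = trans (*-congʳ (Mult.×-congʳ *-monoid 12 (sym u≈)))
        (trans (1728-cancel W′≅W.1728Δ-scale) (sym (φ-Δ W′)))

import Algebra.Properties.CommutativeSemiring.Exp as CExp
import Algebra.Properties.Semiring.Exp as Exp
import Algebra.Solver.CommutativeMonoid as CMSolver
open import Data.Bool.Base using (Bool; true; false; _∧_)
open import Data.Empty using (⊥; ⊥-elim)
open import Data.Fin.Base using (Fin; zero; suc)
open import Data.Fin.Patterns using (0F; 1F; 2F; 3F; 4F; 5F)
open import Data.List.Relation.Unary.All using ([]; _∷_)
open import Data.List.Relation.Unary.Any using (here; there)
open import Data.Nat.Coprimality using (Coprime; coprime-Bézout)
open import Data.Nat.Base using (NonZero)
import Data.Nat.DivMod as ℕ
import Data.Nat.Divisibility as ℕ∣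
open import Data.Nat.GCD using (module Bézout)
open import Data.Nat.Induction using (<-wellFounded)
open import Data.Nat.Primality using (Prime; euclidsLemma; prime?; prime⇒irreducible; prime⇒nonTrivial; prime⇒nonZero)
open import Data.Nat.Primality.Factorisation using (factorise)
import Data.Nat.Solver
open import Data.Rational.Base as ℚ using (ℚ; mkℚ; ↥_; ↧_; toℚᵘ)
import Data.Rational.Properties as ℚ
open import Data.Rational.Unnormalised.Base as ℚᵘ using (mkℚᵘ; *≡*)
import Data.Rational.Unnormalised.Properties as ℚᵘ
open import Data.Sum.Base using (inj₁; inj₂; [_,_]′; reduce)
open import Data.Vec.Base using (Vec; []; _∷_; lookup)
open import Function.Base using (case_of_)
open import Induction.WellFounded using (Acc; acc)
open import Relation.Binary.Definitions using (_Respects_)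
open import Relation.Binary.PropositionalEquality
  using (_≢_; refl; sym; trans; cong; cong₂; subst; isEquivalence; module ≡-Reasoning)
open import Relation.Nullary.Decidable using (_→-dec_; ¬?)
open import Relation.Nullary.Decidable.Core using (from-yes; _×-dec_)
open import Relation.Nullary.Negation using (contradiction)
open import Relation.Nullary.Reflects using (Reflects; ofʸ; ofⁿ; invert; _×-reflects_; _⊎-reflects_; _→-reflects_)
open import Relation.Unary using (Pred; Decidable)

-- Congruences decided by evaluation at residues

-- Formulas about divisibility of integer polynomials by a fixed n are decided
-- by evaluating them at all residues.
module Residues where

  infixl 7 _⊗_
  infixl 6 _⊕_ _⊖_

  data Poly (v : ℕ) : Set where
    con     : ℤ → Poly v
    var     : Fin v → Poly v
    _⊕_ _⊗_ : Poly v → Poly v → Poly v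
    ⊝_      : Poly v → Poly v

  _⊖_ : ∀ {v} → Poly v → Poly v → Poly v
  p ⊖ q = p ⊕ ⊝ q

  value : ∀ {v} → Poly v → Vec ℤ v → ℤ
  value (con c) xs = c
  value (var i) xs = lookup xs i
  value (p ⊕ q) xs = value p xs ℤ.+ value q xs
  value (p ⊗ q) xs = value p xs ℤ.* value q xs
  value (⊝ p)   xs = ℤ.- value p xs

  infix  5 n∣_
  infixr 4 _∧̇_
  infixr 3 _∨̇_
  infixr 2 _⇒̇_

  -- The modulus is the same in all atoms. Divisibility by a proper divisor k of n is therefore
  -- expressed as divisibility of (n/k) p by n; `∣-double` and `∣-halve` translate between the two.
  data Formula (v : ℕ) : Set where
    n∣_            : Poly v → Formula v
    ⊥̇              : Formula v
    _∧̇_ _∨̇_ _⇒̇_    : Formula v → Formula v → Formula v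

  module _ (n : ℕ) .{{_ : NonZero n}} where

    Holds : ∀ {v} → Formula v → Vec ℤ v → Set
    Holds (n∣ p)    xs = + n ∣ value p xs
    Holds ⊥̇        xs = ⊥
    Holds (φ ∧̇ ψ)  xs = Holds φ xs × Holds ψ xs
    Holds (φ ∨̇ ψ)  xs = Holds φ xs ⊎ Holds ψ xs
    Holds (φ ⇒̇ ψ)  xs = Holds φ xs → Holds ψ xs

    residue : ∀ {v} → Poly v → Vec ℕ v → ℕ
    residue (con c) rs = c %ℕ n
    residue (var i) rs = lookup rs i
    residue (p ⊕ q) rs = (residue p rs ℕ.+ residue q rs) ℕ.% n
    residue (p ⊗ q) rs = (residue p rs ℕ.* residue q rs) ℕ.% n
    -- On natural residues the factor n ∸ 1 represents -1.
    residue (⊝ p)   rs = (residue p rs ℕ.* (n ℕ.∸ 1)) ℕ.% n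

    check : ∀ {v} → Formula v → Vec ℕ v → Bool
    check (n∣ p)    rs = residue p rs ℕ.% n ℕ.≡ᵇ 0
    check ⊥̇        rs = false
    check (φ ∧̇ ψ)  rs = check φ rs ∧ check ψ rs
    check (φ ∨̇ ψ)  rs = check φ rs Data.Bool.Base.∨ check ψ rs
    check (φ ⇒̇ ψ)  rs = Data.Bool.Base.not (check φ rs) Data.Bool.Base.∨ check ψ rs

    allBelow : ℕ → (ℕ → Bool) → Bool
    allBelow zero    f = true
    allBelow (suc k) f = f k ∧ allBelow k f

    allResidues : ∀ v → (Vec ℕ v → Bool) → Bool
    allResidues zero    f = f []
    allResidues (suc v) f = allBelow n (λ r → allResidues v (λ rs → f (r ∷ rs)))

    private
      infix 4 _≋_
      record _≋_ (x y : ℤ) : Set where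
        constructor _by_
        field
          quotient : ℤ
          equality : x ≡ y ℤ.+ quotient ℤ.* + n

      open ℤ.+-*-Solver

      +-≋ : ∀ {x x′ y y′} → x ≋ x′ → y ≋ y′ → x ℤ.+ y ≋ x′ ℤ.+ y′
      +-≋ {x′ = x′} {y′ = y′} (k by refl) (l by refl) = (k ℤ.+ l) by
        solve 5 (λ x y k l n → (x :+ k :* n) :+ (y :+ l :* n) := (x :+ y) :+ (k :+ l) :* n)
          refl x′ y′ k l (+ n)

      *-≋ : ∀ {x x′ y y′} → x ≋ x′ → y ≋ y′ → x ℤ.* y ≋ x′ ℤ.* y′
      *-≋ {x′ = x′} {y′ = y′} (k by refl) (l by refl) = (x′ ℤ.* l ℤ.+ k ℤ.* y′ ℤ.+ k ℤ.* l ℤ.* + n) by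
        solve 5 (λ x y k l n → (x :+ k :* n) :* (y :+ l :* n)
                   := (x :* y) :+ (x :* l :+ k :* y :+ k :* l :* n) :* n)
          refl x′ y′ k l (+ n)

      neg-≋ : ∀ {x x′} → x ≋ x′ → ℤ.- x ≋ x′ ℤ.* + (n ℕ.∸ 1)
      neg-≋ {x′ = x′} (k by refl) = (ℤ.- k ℤ.- x′) by (begin
        ℤ.- (x′ ℤ.+ k ℤ.* + n)
          ≡⟨ cong (λ z → ℤ.- (x′ ℤ.+ k ℤ.* z)) n≡ ⟩
        ℤ.- (x′ ℤ.+ k ℤ.* (+ 1 ℤ.+ p))
          ≡⟨ solve 3 (λ x k p → :- (x :+ k :* (con (+ 1) :+ p))
               := x :* p :+ (:- k :- x) :* (con (+ 1) :+ p)) refl x′ k p ⟩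
        x′ ℤ.* p ℤ.+ (ℤ.- k ℤ.- x′) ℤ.* (+ 1 ℤ.+ p)
          ≡⟨ cong (λ z → x′ ℤ.* p ℤ.+ (ℤ.- k ℤ.- x′) ℤ.* z) (sym n≡) ⟩
        x′ ℤ.* p ℤ.+ (ℤ.- k ℤ.- x′) ℤ.* + n ∎)
        where
        open ≡-Reasoning
        p = + (n ℕ.∸ 1)
        n≡ : + n ≡ + 1 ℤ.+ p
        n≡ = cong +_ (sym (ℕ.m+[n∸m]≡n (ℕ.>-nonZero⁻¹ n)))

      %-≋ : ∀ {x} a → x ≋ + a → x ≋ + (a ℕ.% n)
      %-≋ a (k by refl) = (+ (a ℕ./ n) ℤ.+ k) by (begin
        + a ℤ.+ k ℤ.* + n
          ≡⟨ cong (λ z → z ℤ.+ k ℤ.* + n) a≡ ⟩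
        (+ (a ℕ.% n) ℤ.+ + (a ℕ./ n) ℤ.* + n) ℤ.+ k ℤ.* + n
          ≡⟨ solve 4 (λ r q k n → (r :+ q :* n) :+ k :* n := r :+ (q :+ k) :* n) refl
               (+ (a ℕ.% n)) (+ (a ℕ./ n)) k (+ n) ⟩
        + (a ℕ.% n) ℤ.+ (+ (a ℕ./ n) ℤ.+ k) ℤ.* + n ∎)
        where
        open ≡-Reasoning
        a≡ : + a ≡ + (a ℕ.% n) ℤ.+ + (a ℕ./ n) ℤ.* + n
        a≡ = trans (cong +_ (ℕ.m≡m%n+[m/n]*n a n))
               (cong (λ z → + (a ℕ.% n) ℤ.+ z) (ℤ.pos-* (a ℕ./ n) n))

      residue-≋ : ∀ {v} (p : Poly v) {xs rs} → (∀ i → lookup xs i ≋ + lookup rs i) →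
                  value p xs ≋ + residue p rs
      residue-≋ (con c) h = (c /ℕ n) by a≡a%ℕn+[a/ℕn]*n c n
      residue-≋ (var i) h = h i
      residue-≋ (p ⊕ q) h = %-≋ _ (+-≋ (residue-≋ p h) (residue-≋ q h))
      residue-≋ (p ⊗ q) {xs} {rs} h = %-≋ (residue p rs ℕ.* residue q rs) (subst (value (p ⊗ q) xs ≋_)
        (sym (ℤ.pos-* (residue p rs) (residue q rs))) (*-≋ (residue-≋ p h) (residue-≋ q h)))
      residue-≋ (⊝ p) {xs} {rs} h = %-≋ (residue p rs ℕ.* (n ℕ.∸ 1)) (subst (value (⊝ p) xs ≋_)
        (sym (ℤ.pos-* (residue p rs) (n ℕ.∸ 1))) (neg-≋ (residue-≋ p h)))

      zero-reflects : ∀ {x} a → x ≋ + a → Reflects (+ n ∣ x) (a ℕ.% n ℕ.≡ᵇ 0)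
      zero-reflects {x} a x≋a with a ℕ.% n in eq | %-≋ a x≋a
      ... | zero  | (k by e) = ofʸ (divides k (trans e (ℤ.+-identityˡ _)))
      ... | suc r | (k by e) = ofⁿ λ n∣x → ℕ.<⇒≱ r<n (ℕ∣⇒≤ (n∣r n∣x))
        where
        import Data.Nat.Divisibility as ℕ∣
        r<n : suc r ℕ.< n
        r<n = subst (ℕ._< n) eq (ℕ.m%n<n a n)
        ℕ∣⇒≤ : n ℕ∣.∣ suc r → n ℕ.≤ suc r
        ℕ∣⇒≤ = ℕ∣.∣⇒≤
        n∣r : + n ∣ x → n ℕ∣.∣ suc r
        n∣r (divides q refl) = ℤ.∣⇒∣ᵤ (divides (q ℤ.- k) (begin
          + suc r
            ≡⟨ solve 2 (λ r b → r := (r :+ b) :- b) refl (+ suc r) (k ℤ.* + n) ⟩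
          (+ suc r ℤ.+ k ℤ.* + n) ℤ.- k ℤ.* + n
            ≡⟨ cong (λ z → z ℤ.- k ℤ.* + n) (sym e) ⟩
          q ℤ.* + n ℤ.- k ℤ.* + n
            ≡⟨ solve 3 (λ q k n → q :* n :- k :* n := (q :- k) :* n) refl q k (+ n) ⟩
          (q ℤ.- k) ℤ.* + n ∎))
          where open ≡-Reasoning

      -- Both directions are carried through the induction, because the premise of an implication
      -- needs completeness of `check` where its conclusion needs soundness.
      check-reflects : ∀ {v} (φ : Formula v) {xs rs} → (∀ i → lookup xs i ≋ + lookup rs i) →
                       Reflects (Holds φ xs) (check φ rs)
      check-reflects (n∣ p)   {rs = rs} h = zero-reflects (residue p rs) (residue-≋ p h)
      check-reflects ⊥̇       h = ofⁿ λ ()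
      check-reflects (φ ∧̇ ψ) h = check-reflects φ h ×-reflects check-reflects ψ h
      check-reflects (φ ∨̇ ψ) h = check-reflects φ h ⊎-reflects check-reflects ψ h
      check-reflects (φ ⇒̇ ψ) h = check-reflects φ h →-reflects check-reflects ψ h

      ∧-true : ∀ {a b} → a ∧ b ≡ true → a ≡ true × b ≡ true
      ∧-true {true} eq = refl , eq

      allBelow-sound : ∀ k f → allBelow k f ≡ true → ∀ {i} → i ℕ.< k → f i ≡ true
      allBelow-sound (suc k) f eq i<k with ℕ.m≤n⇒m<n∨m≡n (ℕ.s≤s⁻¹ i<k)
      ... | inj₁ i<k′ = allBelow-sound k f (proj₂ (∧-true eq)) i<k′
      ... | inj₂ refl = proj₁ (∧-true {f k} eq)

      residues : ∀ {v} → Vec ℤ v → Vec ℕ v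
      residues []       = []
      residues (x ∷ xs) = x %ℕ n ∷ residues xs

      residues-≋ : ∀ {v} (xs : Vec ℤ v) i → lookup xs i ≋ + lookup (residues xs) i
      residues-≋ (x ∷ xs) zero    = (x /ℕ n) by a≡a%ℕn+[a/ℕn]*n x n
      residues-≋ (x ∷ xs) (suc i) = residues-≋ xs i

      allResidues-sound : ∀ v f → allResidues v f ≡ true → ∀ (xs : Vec ℤ v) → f (residues xs) ≡ true
      allResidues-sound zero    f eq []       = eq
      allResidues-sound (suc v) f eq (x ∷ xs) =
        allResidues-sound v _ (allBelow-sound n _ eq (n%ℕd<d x n)) xs

    Valid : ∀ {v} → Formula v → Set
    Valid {v} φ = allResidues v (check φ) ≡ true

    valid : ∀ {v} (φ : Formula v) → Valid φ → ∀ xs → Holds φ xs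
    valid {v} φ eq xs = invert (subst (Reflects _)
      (allResidues-sound v (check φ) eq xs) (check-reflects φ (residues-≋ xs)))

    -- Wraps Valid so that it does not unfold when φ is not closed.
    record Tautology {v} (φ : Formula v) : Set where
      constructor tautology
      field decided : Valid φ

    tautological : ∀ {v} (φ : Formula v) → Tautology φ → ∀ xs → Holds φ xs
    tautological φ (tautology eq) = valid φ eq

-- Prime ideals and valuations in a commutative ring

record PrimeIdeal (R : CommutativeRing 0ℓ 0ℓ) : Set₁ where
  open CommutativeRing R
  field
    𝔓        : Pred Carrier 0ℓ
    𝔓?       : Decidable 𝔓
    resp     : 𝔓 Respects _≈_
    +-closed : ∀ {x y} → 𝔓 x → 𝔓 y → 𝔓 (x + y)
    *-absorb : ∀ x {y} → 𝔓 y → 𝔓 (x * y)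
    proper   : ¬ 𝔓 1#
    prime    : ∀ x y → 𝔓 (x * y) → 𝔓 x ⊎ 𝔓 y

  absorbʳ : ∀ {x} y → 𝔓 x → 𝔓 (x * y)
  absorbʳ y x∈ = resp (*-comm y _) (*-absorb y x∈)

  ∉-* : ∀ {x y} → ¬ 𝔓 x → ¬ 𝔓 y → ¬ 𝔓 (x * y)
  ∉-* x∉ y∉ xy∈ with prime _ _ xy∈
  ... | inj₁ x∈ = x∉ x∈
  ... | inj₂ y∈ = y∉ y∈

  open Exp semiring public using (_^_)

  ^-∈ : ∀ k {x} → 𝔓 (x ^ k) → 𝔓 x
  ^-∈ zero    1∈ = ⊥-elim (proper 1∈)
  ^-∈ (suc k) {x} x^k∈ with prime x (x ^ k) x^k∈
  ... | inj₁ x∈ = x∈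
  ... | inj₂ h  = ^-∈ k h

-- x has valuation k in the localisation at 𝔓, where ϖ is a uniformiser.
record HasValuation (R : CommutativeRing 0ℓ 0ℓ) (𝔓 : Pred (CommutativeRing.Carrier R) 0ℓ)
  (ϖ x : CommutativeRing.Carrier R) (k : ℕ) : Set where
  constructor val
  open CommutativeRing R using (Carrier; _≈_; _*_; semiring)
  open Exp semiring using (_^_)
  field
    {c d} : Carrier
    c∉    : ¬ 𝔓 c
    d∉    : ¬ 𝔓 d
    eq    : c * x ≈ ϖ ^ k * d

module Valuation (R : CommutativeRing 0ℓ 0ℓ) (I : PrimeIdeal R)
  (ϖ : CommutativeRing.Carrier R) (ϖ∈𝔓 : PrimeIdeal.𝔓 I ϖ)
  (ϖ-cancel : ∀ {x y} → CommutativeRing._≈_ R (CommutativeRing._*_ R ϖ x) (CommutativeRing._*_ R ϖ y) →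
     CommutativeRing._≈_ R x y)
  where
  open CommutativeRing R renaming (refl to ≈-refl; sym to ≈-sym; trans to ≈-trans)
  open PrimeIdeal I hiding (_^_)
  open Exp semiring
  open CMSolver *-commutativeMonoid using (_⊜_) renaming (solve to rearrange; _⊕_ to _⊙_)

  Val : Carrier → ℕ → Set
  Val = HasValuation R 𝔓 ϖ

  Val-resp : ∀ {x y k} → x ≈ y → Val x k → Val y k
  Val-resp x≈y (val c∉ d∉ eq) = val c∉ d∉ (≈-trans (*-congˡ (≈-sym x≈y)) eq)

  Val-unit : ∀ {x} → ¬ 𝔓 x → Val x 0
  Val-unit x∉ = val proper x∉ ≈-refl

  Val-ϖ : Val ϖ 1
  Val-ϖ = val proper proper (≈-trans (*-identityˡ ϖ)
    (≈-sym (≈-trans (*-identityʳ _) (*-identityʳ ϖ))))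

  Val-* : ∀ {x y k l} → Val x k → Val y l → Val (x * y) (k ℕ.+ l)
  Val-* {x} {y} {k} {l} (val {c} {d} c∉ d∉ eq) (val {c′} {d′} c′∉ d′∉ eq′) =
    val (∉-* c∉ c′∉) (∉-* d∉ d′∉)
      (≈-trans (rearrange 4 (λ c c′ x y → ((c ⊙ c′) ⊙ (x ⊙ y)) ⊜ ((c ⊙ x) ⊙ (c′ ⊙ y))) ≈-refl c c′ x y)
      (≈-trans (*-cong eq eq′)
      (≈-trans (rearrange 4 (λ a b d d′ → ((a ⊙ d) ⊙ (b ⊙ d′)) ⊜ ((a ⊙ b) ⊙ (d ⊙ d′))) ≈-refl (ϖ ^ k) (ϖ ^ l) d d′)
               (*-congʳ (≈-sym (^-homo-* ϖ k l))))))

  Val-^ : ∀ {x k} n → Val x k → Val (x ^ n) (n ℕ.* k)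
  Val-^ zero    v = Val-unit proper
  Val-^ (suc n) v = Val-* v (Val-^ n v)

  private
    unique : ∀ k l {a b} → ¬ 𝔓 a → ¬ 𝔓 b → ϖ ^ k * a ≈ ϖ ^ l * b → k ≡ l
    unique zero    zero    a∉ b∉ eq = refl
    unique zero    (suc l) a∉ b∉ eq = ⊥-elim (a∉ (resp
      (≈-trans (≈-sym eq) (*-identityˡ _)) (absorbʳ _ (absorbʳ _ ϖ∈𝔓))))
    unique (suc k) zero    a∉ b∉ eq = ⊥-elim (b∉ (resp
      (≈-trans eq (*-identityˡ _)) (absorbʳ _ (absorbʳ _ ϖ∈𝔓))))
    unique (suc k) (suc l) a∉ b∉ eq = cong suc (unique k l a∉ b∉
      (ϖ-cancel (≈-trans (≈-sym (*-assoc ϖ _ _)) (≈-trans eq (*-assoc ϖ _ _)))))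

  Val-unique : ∀ {x k l} → Val x k → Val x l → k ≡ l
  Val-unique {x} {k} {l} (val {c} {d} c∉ d∉ eq) (val {c′} {d′} c′∉ d′∉ eq′) =
    unique k l (∉-* c′∉ d∉) (∉-* c∉ d′∉)
      (≈-trans (rearrange 3 (λ p c′ d → (p ⊙ (c′ ⊙ d)) ⊜ (c′ ⊙ (p ⊙ d))) ≈-refl (ϖ ^ k) c′ d)
      (≈-trans (*-congˡ (≈-sym eq))
      (≈-trans (rearrange 3 (λ c c′ x → (c′ ⊙ (c ⊙ x)) ⊜ (c ⊙ (c′ ⊙ x))) ≈-refl c c′ x)
      (≈-trans (*-congˡ eq′)
               (rearrange 3 (λ p c d′ → (c ⊙ (p ⊙ d′)) ⊜ (p ⊙ (c ⊙ d′))) ≈-refl (ϖ ^ l) c d′)))))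

-- Valuations and squarefree parts of integers

prime-∣-* : ∀ {p} → Prime p → ∀ a b → + p ∣ a ℤ.* b → + p ∣ a ⊎ + p ∣ b
prime-∣-* {p} pp a b p∣ab with euclidsLemma ℤ.∣ a ∣ ℤ.∣ b ∣ pp
                              (subst (p ℕ∣.∣_) (ℤ.abs-* a b) (ℤ.∣⇒∣ᵤ p∣ab))
... | inj₁ h = inj₁ (ℤ.∣ᵤ⇒∣ h)
... | inj₂ h = inj₂ (ℤ.∣ᵤ⇒∣ h)

∣-*ˡ : ∀ {k} a {b} → k ∣ b → k ∣ a ℤ.* b
∣-*ˡ a (divides q refl) = divides (a ℤ.* q) (sym (ℤ.*-assoc a q _))

∣-+ : ∀ {k a b} → k ∣ a → k ∣ b → k ∣ a ℤ.+ b
∣-+ {k} (divides q refl) (divides r refl) = divides (q ℤ.+ r) (sym (ℤ.*-distribʳ-+ k q r))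

¬p∣1 : ∀ {p} → Prime p → ¬ (+ p ∣ + 1)
¬p∣1 {p} pp h = contradiction (ℕ∣.∣1⇒≡1 (ℤ.∣⇒∣ᵤ h)) λ { refl → ℕ.nonTrivial⇒≢1 {{prime⇒nonTrivial pp}} refl }

primeIdealℤ : ∀ {p} → Prime p → PrimeIdeal ℤ.+-*-commutativeRing
primeIdealℤ {p} pp = record
  { 𝔓        = + p ∣_
  ; 𝔓?       = + p ∣?_
  ; resp     = λ { refl h → h }
  ; +-closed = ∣-+
  ; *-absorb = ∣-*ˡ
  ; proper   = ¬p∣1 pp
  ; prime    = prime-∣-* pp
  }

prime≢0 : ∀ {p} → Prime p → + p ≢ + 0
prime≢0 pp eq = ℕ.≢-nonZero⁻¹ _ {{prime⇒nonZero pp}} (ℤ.+-injective eq)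

cancelℤ : ∀ k {x y} → k ≢ + 0 → k ℤ.* x ≡ k ℤ.* y → x ≡ y
cancelℤ k {x} {y} k≢0 eq = ℤ.*-cancelˡ-≡ k x y {{ℤ.≢-nonZero k≢0}} eq

module Valℤ {p} (pp : Prime p) where
  open Valuation ℤ.+-*-commutativeRing (primeIdealℤ pp) (+ p) (ℤ.∣-refl)
    (λ {x} {y} → cancelℤ (+ p) {x} {y} (prime≢0 pp)) public

  private
    instance _ = prime⇒nonTrivial pp

    step : ∀ n → Acc ℕ._<_ ℤ.∣ n ∣ → n ≢ + 0 → ∃[ k ] Val n k
    step n (acc rs) n≢0 with + p ∣? n
    ... | no  p∤n = 0 , Val-unit p∤n
    ... | yes (divides q refl) with step q (rs q<n) q≢0
      where
      q≢0 : q ≢ + 0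
      q≢0 refl = n≢0 (ℤ.*-zeroˡ (+ p))
      q<n : ℤ.∣ q ∣ ℕ.< ℤ.∣ q ℤ.* + p ∣
      q<n = subst (ℤ.∣ q ∣ ℕ.<_) (sym (ℤ.abs-* q (+ p)))
        (ℕ.m<m*n ℤ.∣ q ∣ p {{ℤ.≢-nonZero q≢0}} (ℕ.nonTrivial⇒n>1 p))
    ... | k , v = suc k , Val-resp (ℤ.*-comm (+ p) q) (Val-* Val-ϖ v)

  total : ∀ n → n ≢ + 0 → ∃[ k ] Val n k
  total n = step n (<-wellFounded _)

SquareFree : ℕ → Set
SquareFree f = ∀ d → 1 ℕ.< d → ¬ (d ℕ.* d ℕ∣.∣ f)

square-part : ∀ n → n ≢ + 0 → ∃[ f ] ∃[ k ] n ≡ f ℤ.* (k ℤ.* k) × k ≢ + 0 × f ≢ + 0 × SquareFree ℤ.∣ f ∣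
square-part n = go n (<-wellFounded _)
  where
  go : ∀ n → Acc ℕ._<_ ℤ.∣ n ∣ → n ≢ + 0 →
       ∃[ f ] ∃[ k ] n ≡ f ℤ.* (k ℤ.* k) × k ≢ + 0 × f ≢ + 0 × SquareFree ℤ.∣ f ∣
  -- A d with d² ∣ n is at most |n|, so the search below suc |n| is exhaustive.
  go n (acc rs) n≢0 with ℕ.anyUpTo? (λ d → (1 ℕ.<? d) ×-dec (d ℕ.* d ℕ∣.∣? ℤ.∣ n ∣)) (suc ℤ.∣ n ∣)
  ... | no none = n , + 1 , sym (trans (cong (n ℤ.*_) (ℤ.*-identityˡ (+ 1))) (ℤ.*-identityʳ n)) , (λ ()) , n≢0 , λ d 1<d d²∣n → none
          (d , ℕ.s≤s (ℕ.≤-trans (ℕ.m≤m*n d d {{ℕ.>-nonZero (ℕ.<-trans (ℕ.s≤s ℕ.z≤n) 1<d)}})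
                       (ℕ∣.∣⇒≤ {{ℕ.≢-nonZero (λ e → n≢0 (ℤ.∣i∣≡0⇒i≡0 e))}} d²∣n)) , 1<d , d²∣n)
  ... | yes (d , _ , 1<d , d²∣n) with ℤ.∣ᵤ⇒∣ {+ (d ℕ.* d)} {n} d²∣n
  ...   | divides q eq with go q (rs q<n) q≢0
    where
    q≢0 : q ≢ + 0
    q≢0 refl = n≢0 (trans eq (ℤ.*-zeroˡ _))
    q<n : ℤ.∣ q ∣ ℕ.< ℤ.∣ n ∣
    q<n = subst (ℤ.∣ q ∣ ℕ.<_) (sym (trans (cong ℤ.∣_∣ eq) (ℤ.abs-* q (+ (d ℕ.* d)))))
      (ℕ.m<m*n ℤ.∣ q ∣ (d ℕ.* d) {{ℤ.≢-nonZero q≢0}} (ℕ.*-mono-< 1<d 1<d))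
  ...     | f , k , eq′ , k≢0 , f≢0 , sf = f , k ℤ.* + d , eq″ , kd≢0 , f≢0 , sf
    where
    open ℤ.+-*-Solver
    eq″ : n ≡ f ℤ.* (k ℤ.* + d ℤ.* (k ℤ.* + d))
    eq″ = trans eq (trans (cong₂ ℤ._*_ eq′ (ℤ.pos-* d d))
      (solve 3 (λ f k d → f :* (k :* k) :* (d :* d) := f :* (k :* d :* (k :* d))) refl f k (+ d)))
    kd≢0 : k ℤ.* + d ≢ + 0
    kd≢0 e with ℤ.i*j≡0⇒i≡0∨j≡0 k e
    ... | inj₁ k≡0 = k≢0 k≡0
    ... | inj₂ refl = contradiction 1<d λ ()

-- The ring ℤ[√m], its conjugation and its norm

module ℤ√ (m : ℕ) where

  infix 5 _+√_
  record 𝕆 : Set where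
    no-eta-equality
    pattern
    constructor _+√_
    field
      re im : ℤ
  open 𝕆 public

  D : ℤ
  D = + m

  infixl 6 _⊞_ _⊟_
  infixl 7 _⊠_
  infix  8 ⊖_

  _⊞_ _⊠_ _⊟_ : 𝕆 → 𝕆 → 𝕆
  (a +√ b) ⊞ (c +√ d) = (a ℤ.+ c) +√ (b ℤ.+ d)
  (a +√ b) ⊠ (c +√ d) = (a ℤ.* c ℤ.+ D ℤ.* (b ℤ.* d)) +√ (a ℤ.* d ℤ.+ b ℤ.* c)

  ⊖_ : 𝕆 → 𝕆
  ⊖ (a +√ b) = (ℤ.- a) +√ (ℤ.- b)

  x ⊟ y = x ⊞ ⊖ y

  ι : ℤ → 𝕆
  ι n = n +√ (+ 0)

  ω : 𝕆
  ω = (+ 0) +√ (+ 1)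

  σ : 𝕆 → 𝕆
  σ (a +√ b) = a +√ (ℤ.- b)

  N : 𝕆 → ℤ
  N (a +√ b) = a ℤ.* a ℤ.- D ℤ.* (b ℤ.* b)

  _≟_ : (x y : 𝕆) → Dec (x ≡ y)
  (a +√ b) ≟ (c +√ d) = map′ (λ { (refl , refl) → refl }) (λ { refl → refl , refl })
    ((a ℤ.≟ c) ×-dec (b ℤ.≟ d))

  private
    ext : ∀ {a b c d} → a ≡ c → b ≡ d → _≡_ {A = 𝕆} (a +√ b) (c +√ d)
    ext = cong₂ _+√_

    open ℤ.+-*-Solver

  𝕆-isCommutativeRing : IsCommutativeRing _≡_ _⊞_ _⊠_ ⊖_ (ι (+ 0)) (ι (+ 1))
  𝕆-isCommutativeRing = record
    { isRing = record
      { +-isAbelianGroup = record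
        { isGroup = record
          { isMonoid = record
            { isSemigroup = record
              { isMagma = record { isEquivalence = isEquivalence ; ∙-cong = cong₂ _⊞_ }
              ; assoc = λ { (a +√ b) (c +√ d) (e +√ f) → ext (ℤ.+-assoc a c e) (ℤ.+-assoc b d f) }
              }
            ; identity = (λ { (a +√ b) → ext (ℤ.+-identityˡ a) (ℤ.+-identityˡ b) })
                       , (λ { (a +√ b) → ext (ℤ.+-identityʳ a) (ℤ.+-identityʳ b) })
            }
          ; inverse = (λ { (a +√ b) → ext (ℤ.+-inverseˡ a) (ℤ.+-inverseˡ b) })
                    , (λ { (a +√ b) → ext (ℤ.+-inverseʳ a) (ℤ.+-inverseʳ b) })
          ; ⁻¹-cong = cong ⊖_
          }
        ; comm = λ { (a +√ b) (c +√ d) → ext (ℤ.+-comm a c) (ℤ.+-comm b d) }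
        }
      ; *-cong = cong₂ _⊠_
      ; *-assoc = λ { (a +√ b) (c +√ d) (e +√ f) → ext
          (solve 7 (λ k a b c d e f → (a :* c :+ k :* (b :* d)) :* e :+ k :* ((a :* d :+ b :* c) :* f)
             := a :* (c :* e :+ k :* (d :* f)) :+ k :* (b :* (c :* f :+ d :* e))) refl D a b c d e f)
          (solve 7 (λ k a b c d e f → (a :* c :+ k :* (b :* d)) :* f :+ (a :* d :+ b :* c) :* e
             := a :* (c :* f :+ d :* e) :+ b :* (c :* e :+ k :* (d :* f))) refl D a b c d e f) }
      ; *-identity = (λ { (a +√ b) → ext
          (solve 3 (λ k a b → con (+ 1) :* a :+ k :* (con (+ 0) :* b) := a) refl D a b)
          (solve 2 (λ a b → con (+ 1) :* b :+ con (+ 0) :* a := b) refl a b) })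
        , (λ { (a +√ b) → ext
          (solve 3 (λ k a b → a :* con (+ 1) :+ k :* (b :* con (+ 0)) := a) refl D a b)
          (solve 2 (λ a b → a :* con (+ 0) :+ b :* con (+ 1) := b) refl a b) })
      ; distrib = (λ { (a +√ b) (c +√ d) (e +√ f) → ext
          (solve 7 (λ k a b c d e f → a :* (c :+ e) :+ k :* (b :* (d :+ f))
             := (a :* c :+ k :* (b :* d)) :+ (a :* e :+ k :* (b :* f))) refl D a b c d e f)
          (solve 6 (λ a b c d e f → a :* (d :+ f) :+ b :* (c :+ e)
             := (a :* d :+ b :* c) :+ (a :* f :+ b :* e)) refl a b c d e f) })
        , (λ { (a +√ b) (c +√ d) (e +√ f) → ext
          (solve 7 (λ k a b c d e f → (c :+ e) :* a :+ k :* ((d :+ f) :* b)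
             := (c :* a :+ k :* (d :* b)) :+ (e :* a :+ k :* (f :* b))) refl D a b c d e f)
          (solve 6 (λ a b c d e f → (c :+ e) :* b :+ (d :+ f) :* a
             := (c :* b :+ d :* a) :+ (e :* b :+ f :* a)) refl a b c d e f) })
      }
    ; *-comm = λ { (a +√ b) (c +√ d) → ext
        (solve 5 (λ k a b c d → a :* c :+ k :* (b :* d) := c :* a :+ k :* (d :* b)) refl D a b c d)
        (solve 4 (λ a b c d → a :* d :+ b :* c := c :* b :+ d :* a) refl a b c d) }
    }

  𝕆-ring : CommutativeRing 0ℓ 0ℓ
  𝕆-ring = record { isCommutativeRing = 𝕆-isCommutativeRing }

  ι-* : ∀ a b → ι (a ℤ.* b) ≡ ι a ⊠ ι b
  ι-* a b = ext
    (solve 3 (λ k a b → a :* b := a :* b :+ k :* (con (+ 0) :* con (+ 0))) refl D a b)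
    (solve 2 (λ a b → con (+ 0) := a :* con (+ 0) :+ con (+ 0) :* b) refl a b)

  private
    ι-morphism : ℤ.+-*-rawRing -Raw-AlmostCommutative⟶ fromCommutativeRing 𝕆-ring
    ι-morphism = record
      { ⟦_⟧    = ι
      ; +-homo = λ _ _ → refl
      ; *-homo = λ a b → trans (cong ι (sym (ℤ.*-def a b))) (ι-* a b)
      ; -‿homo = λ _ → refl
      ; 0-homo = refl
      ; 1-homo = refl
      }

    ι-≟ : ∀ a b → Maybe (ι a ≡ ι b)
    ι-≟ a b with a ℤ.≟ b
    ... | yes refl = just refl
    ... | no  _    = nothing

  module 𝕆-Solver = RingSolver ℤ.+-*-rawRing (fromCommutativeRing 𝕆-ring) ι-morphism ι-≟

  open CommutativeRing 𝕆-ring public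
    using () renaming (*-comm to ⊠-comm; *-assoc to ⊠-assoc; zeroʳ to ⊠-zeroʳ; *-identityˡ to ⊠-identityˡ)
  open Exp (CommutativeRing.semiring 𝕆-ring) public using (_^_)

  σ-⊠ : ∀ x y → σ (x ⊠ y) ≡ σ x ⊠ σ y
  σ-⊠ (a +√ b) (c +√ d) = ext
    (solve 5 (λ k a b c d → a :* c :+ k :* (b :* d) := a :* c :+ k :* (:- b :* :- d)) refl D a b c d)
    (solve 4 (λ a b c d → :- (a :* d :+ b :* c) := a :* :- d :+ :- b :* c) refl a b c d)

  σ-σ : ∀ x → σ (σ x) ≡ x
  σ-σ (a +√ b) = ext refl (ℤ.neg-involutive b)

  x⊠σx : ∀ x → x ⊠ σ x ≡ ι (N x)
  x⊠σx (a +√ b) = ext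
    (solve 3 (λ k a b → a :* a :+ k :* (b :* :- b) := a :* a :- k :* (b :* b)) refl D a b)
    (solve 2 (λ a b → a :* :- b :+ b :* a := con (+ 0)) refl a b)

  N-⊠ : ∀ x y → N (x ⊠ y) ≡ N x ℤ.* N y
  N-⊠ (a +√ b) (c +√ d) = solve 5 (λ k a b c d →
      (a :* c :+ k :* (b :* d)) :* (a :* c :+ k :* (b :* d)) :- k :* ((a :* d :+ b :* c) :* (a :* d :+ b :* c))
    := (a :* a :- k :* (b :* b)) :* (c :* c :- k :* (d :* d))) refl D a b c d

  N-ι : ∀ n → N (ι n) ≡ n ℤ.* n
  N-ι n = solve 2 (λ k n → n :* n :- k :* (con (+ 0) :* con (+ 0)) := n :* n) refl D n

  ι-⊠ : ∀ n x → ι n ⊠ x ≡ (n ℤ.* re x) +√ (n ℤ.* im x)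
  ι-⊠ n (a +√ b) = ext
    (solve 4 (λ k n a b → n :* a :+ k :* (con (+ 0) :* b) := n :* a) refl D n a b)
    (solve 3 (λ n a b → n :* b :+ con (+ 0) :* a := n :* b) refl n a b)

  infix 4 _∣ᴼ_
  _∣ᴼ_ : 𝕆 → 𝕆 → Set
  x ∣ᴼ y = ∃[ z ] y ≡ x ⊠ z

  coords⇒∣ᴼ : ∀ {n x} → n ∣ re x → n ∣ im x → ι n ∣ᴼ x
  coords⇒∣ᴼ {n} {a +√ b} (divides q refl) (divides r refl) = q +√ r ,
    trans (ext (ℤ.*-comm q n) (ℤ.*-comm r n)) (sym (ι-⊠ n (q +√ r)))

open Residues

-- Elementary arithmetic of integers, with the equations behind m = 62

squarefree? : ∀ n .{{_ : NonZero n}} → Dec (SquareFree n)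
squarefree? n = map′ (λ h d 1<d d²∣n → h (ℕ.s≤s (ℕ.≤-trans (ℕ.m≤m*n d d {{ℕ.>-nonZero (ℕ.<-trans (ℕ.s≤s ℕ.z≤n) 1<d)}}) (ℕ∣.∣⇒≤ d²∣n))) 1<d d²∣n)
  (λ sf {d} _ → sf d)
  (ℕ.allUpTo? (λ d → (1 ℕ.<? d) →-dec ¬? (d ℕ.* d ℕ∣.∣? n)) (suc n))

prime-divisor : ∀ {n} → 1 ℕ.< n → ∃[ p ] Prime p × p ℕ∣.∣ n
prime-divisor {n} 1<n with factorise n {{ℕ.>-nonZero (ℕ.<-trans (ℕ.s≤s ℕ.z≤n) 1<n)}}
... | record { factors = [] ; isFactorisation = refl } = contradiction 1<n λ { (ℕ.s≤s ()) }
... | record { factors = p ∷ ps ; isFactorisation = refl ; factorsPrime = pp ∷ _ } = p , pp , ℕ∣.m∣m*n _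

∣-combine : ∀ {k x a b} u v → k ∣ a → k ∣ b → x ≡ u ℤ.* a ℤ.+ v ℤ.* b → k ∣ x
∣-combine u v k∣a k∣b refl = ∣-+ (∣-*ˡ u k∣a) (∣-*ˡ v k∣b)

∣-multiple : ∀ {k x a} u → k ∣ a → x ≡ u ℤ.* a → k ∣ x
∣-multiple u k∣a refl = ∣-*ˡ u k∣a

inverse-mod : ∀ {p} → Prime p → ∀ b → ¬ (+ p ∣ b) → ∃[ c ] + p ∣ b ℤ.* c ℤ.- + 1
inverse-mod {p} pp b p∤b with absolute b
  where
  absolute : ∀ b → ∃[ s ] + ℤ.∣ b ∣ ≡ b ℤ.* s
  absolute (+ n)      = + 1 , sym (ℤ.*-identityʳ (+ n))
  absolute -[1+ n ]   = ℤ.-1ℤ , sym (trans (ℤ.*-comm -[1+ n ] ℤ.-1ℤ) (ℤ.-1*i≡-i -[1+ n ]))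
... | s , s≡ with coprime-Bézout {p} {ℤ.∣ b ∣} coprime
  where
  coprime : Coprime p ℤ.∣ b ∣
  coprime (d∣p , d∣b) with prime⇒irreducible pp d∣p
  ... | inj₁ d≡1  = d≡1
  ... | inj₂ refl = contradiction (ℤ.∣ᵤ⇒∣ d∣b) p∤b
... | Bézout.+- x y eq = s ℤ.* ℤ.- + y , divides (ℤ.- + x) (begin
    b ℤ.* (s ℤ.* ℤ.- + y) ℤ.- + 1
      ≡⟨ solve 3 (λ b s y → b :* (s :* :- y) :- con (+ 1) := :- (con (+ 1) :+ y :* (b :* s))) refl b s (+ y) ⟩
    ℤ.- (+ 1 ℤ.+ + y ℤ.* (b ℤ.* s))
      ≡⟨ cong (λ z → ℤ.- (+ 1 ℤ.+ + y ℤ.* z)) (sym s≡) ⟩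
    ℤ.- (+ 1 ℤ.+ + y ℤ.* + ℤ.∣ b ∣)
      ≡⟨ cong (λ z → ℤ.- (+ 1 ℤ.+ z)) (sym (ℤ.pos-* y ℤ.∣ b ∣)) ⟩
    ℤ.- (+ (1 ℕ.+ y ℕ.* ℤ.∣ b ∣))
      ≡⟨ cong (λ z → ℤ.- + z) eq ⟩
    ℤ.- (+ (x ℕ.* p))
      ≡⟨ cong ℤ.-_ (ℤ.pos-* x p) ⟩
    ℤ.- (+ x ℤ.* + p)
      ≡⟨ ℤ.neg-distribˡ-* (+ x) (+ p) ⟩
    ℤ.- + x ℤ.* + p ∎)
  where
  open ≡-Reasoning
  open ℤ.+-*-Solver
... | Bézout.-+ x y eq = s ℤ.* + y , divides (+ x) (begin
    b ℤ.* (s ℤ.* + y) ℤ.- + 1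
      ≡⟨ solve 3 (λ b s y → b :* (s :* y) :- con (+ 1) := y :* (b :* s) :- con (+ 1)) refl b s (+ y) ⟩
    + y ℤ.* (b ℤ.* s) ℤ.- + 1
      ≡⟨ cong (λ z → + y ℤ.* z ℤ.- + 1) (sym s≡) ⟩
    + y ℤ.* + ℤ.∣ b ∣ ℤ.- + 1
      ≡⟨ cong (λ z → z ℤ.- + 1) (sym (ℤ.pos-* y ℤ.∣ b ∣)) ⟩
    + (y ℕ.* ℤ.∣ b ∣) ℤ.- + 1
      ≡⟨ cong (λ z → + z ℤ.- + 1) (sym eq) ⟩
    + (1 ℕ.+ x ℕ.* p) ℤ.- + 1
      ≡⟨ solve 1 (λ z → (con (+ 1) :+ z) :- con (+ 1) := z) refl (+ (x ℕ.* p)) ⟩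
    + (x ℕ.* p)
      ≡⟨ ℤ.pos-* x p ⟩
    + x ℤ.* + p ∎)
  where
  open ≡-Reasoning
  open ℤ.+-*-Solver

private module ℕ-Solve = Data.Nat.Solver.+-*-Solver

∣i∣²≡i² : ∀ i → + (ℤ.∣ i ∣ ℕ.* ℤ.∣ i ∣) ≡ i ℤ.* i
∣i∣²≡i² (+ n)    = ℤ.pos-* n n
∣i∣²≡i² -[1+ n ] = trans (ℤ.pos-* (suc n) (suc n)) (solve 1 (λ a → a :* a := :- a :* :- a) refl (+ suc n))
  where open ℤ.+-*-Solver

∣-of-≡ : ∀ n {a b} → a ≡ b → n ∣ a ℤ.- b
∣-of-≡ n {a} refl = divides (+ 0) (trans (ℤ.+-inverseʳ a) (sym (ℤ.*-zeroˡ n)))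

square-class-≢ : ∀ n .{{_ : NonZero n}} f r → Valid n {2} ((n∣ var 0F ⊖ con f ⊗ (var 1F ⊗ var 1F)) ⇒̇ (n∣ var 0F ⊖ con r) ⇒̇ ⊥̇) →
  ∀ x k → x ≡ f ℤ.* (k ℤ.* k) → ¬ (+ n ∣ x ℤ.- r)
square-class-≢ n f r chk x k eq = valid n ((n∣ var 0F ⊖ con f ⊗ (var 1F ⊗ var 1F)) ⇒̇ (n∣ var 0F ⊖ con r) ⇒̇ ⊥̇) chk (x ∷ k ∷ []) (∣-of-≡ (+ n) eq)

∣-minus-trans : ∀ n {x y z} → n ∣ x ℤ.- y → n ∣ y ℤ.- z → n ∣ x ℤ.- z
∣-minus-trans n {x} {y} {z} h h′ = ∣-combine (+ 1) (+ 1) h h′ (solve 3 (λ x y z → x :- z := con (+ 1) :* (x :- y) :+ con (+ 1) :* (y :- z)) refl x y z)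
  where open ℤ.+-*-Solver

-- Descent by the unit (29 + 3√93)/2.
pell-93 : ∀ {n} → Acc ℕ._<_ n → ∀ a → a ℕ.* a ≡ 93 ℕ.* (n ℕ.* n) ℕ.+ 4 → + 3 ∣ + n
pell-93 {n} (acc rec) a eq with + 3 ∣? + n
... | yes 3∣n = 3∣n
... | no  3∤n = ⊥-elim (step d-b)
  where
  eqℤ : + a ℤ.* + a ≡ + 93 ℤ.* (+ n ℤ.* + n) ℤ.+ + 4
  eqℤ = trans (sym (ℤ.pos-* a a)) (trans (cong +_ eq) (cong (ℤ._+ + 4) (trans (ℤ.pos-* 93 (n ℕ.* n)) (cong (+ 93 ℤ.*_) (ℤ.pos-* n n)))))
  instance
    n≢0 : NonZero n
    n≢0 = ℕ.≢-nonZero λ { refl → 3∤n ℤ.∣0 }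
  -- The descent needs |29n - 3a| < 2n, that is 27n < 3a < 31n: on the left from 81 < 93, on the
  -- right from 9a² = 837n² + 36 < 961n² for n ≥ 1.
  9n<a : 9 ℕ.* n ℕ.< a
  9n<a = ℕ.≰⇒> λ a≤9n → ℕ.<⇒≱ (ℕ.≤-<-trans (ℕ.≤-reflexive (solve 1 (λ n → con 9 :* n :* (con 9 :* n) := con 81 :* (n :* n)) refl n))
      (ℕ.≤-<-trans (ℕ.*-monoˡ-≤ (n ℕ.* n) {81} {93} (ℕ.m≤m+n 81 12)) (ℕ.m<m+n (93 ℕ.* (n ℕ.* n)) (ℕ.s≤s ℕ.z≤n))))
    (ℕ.≤-trans (ℕ.≤-reflexive (sym eq)) (ℕ.*-mono-≤ a≤9n a≤9n))
    where open ℕ-Solve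
  3a<31n : 3 ℕ.* a ℕ.< 31 ℕ.* n
  3a<31n = ℕ.≰⇒> λ h → ℕ.<⇒≱ bound (ℕ.≤-trans (ℕ.*-mono-≤ h h)
      (ℕ.≤-reflexive (trans (solve 1 (λ a → con 3 :* a :* (con 3 :* a) := con 9 :* (a :* a)) refl a) (trans (cong (9 ℕ.*_) eq)
        (solve 1 (λ n → con 9 :* (con 93 :* n :+ con 4) := con 837 :* n :+ con 36) refl (n ℕ.* n))))))
    where
    open ℕ-Solve
    bound : 837 ℕ.* (n ℕ.* n) ℕ.+ 36 ℕ.< 31 ℕ.* n ℕ.* (31 ℕ.* n)
    bound = ℕ.<-≤-trans (ℕ.+-monoʳ-< (837 ℕ.* (n ℕ.* n)) (ℕ.<-≤-trans (ℕ.m<m+n 36 {88} (ℕ.s≤s ℕ.z≤n)) (ℕ.m≤m*n 124 (n ℕ.* n) {{ℕ.m*n≢0 n n}})))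
      (ℕ.≤-reflexive (solve 1 (λ n → con 837 :* (n :* n) :+ con 124 :* (n :* n) := con 31 :* n :* (con 31 :* n)) refl n))
  -- The halves exist because a and n have the same parity; with them, (b + d√93)/2 is the product
  -- of (a + n√93)/2 and (29 - 3√93)/2.
  d-b : + 2 ∣ + 29 ℤ.* + n ℤ.- + 3 ℤ.* + a × + 2 ∣ + 29 ℤ.* + a ℤ.- + 279 ℤ.* + n
  d-b = valid 2 ((n∣ var 0F ⊗ var 0F ⊖ (con (+ 93) ⊗ (var 1F ⊗ var 1F) ⊕ con (+ 4))) ⇒̇
      (n∣ con (+ 29) ⊗ var 1F ⊖ con (+ 3) ⊗ var 0F) ∧̇ (n∣ con (+ 29) ⊗ var 0F ⊖ con (+ 279) ⊗ var 1F)) refl (+ a ∷ + n ∷ [])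
    (∣-of-≡ (+ 2) eqℤ)
  ∣d∣<n : ∀ d → + 29 ℤ.* + n ℤ.- + 3 ℤ.* + a ≡ d ℤ.* + 2 → ℤ.∣ d ∣ ℕ.< n
  ∣d∣<n (+ k) e = ℕ.*-cancelˡ-< 2 k n (ℕ.+-cancelˡ-< (27 ℕ.* n) (2 ℕ.* k) (2 ℕ.* n) (begin-strict
      27 ℕ.* n ℕ.+ 2 ℕ.* k       ≡⟨ ℕ-Solve.solve 2 (λ n k → ℕ-Solve.con 27 ℕ-Solve.:* n ℕ-Solve.:+ k ℕ-Solve.:= ℕ-Solve.con 3 ℕ-Solve.:* (ℕ-Solve.con 9 ℕ-Solve.:* n) ℕ-Solve.:+ k) refl n (2 ℕ.* k) ⟩
      3 ℕ.* (9 ℕ.* n) ℕ.+ 2 ℕ.* k <⟨ ℕ.+-monoˡ-< (2 ℕ.* k) (ℕ.*-monoʳ-< 3 9n<a) ⟩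
      3 ℕ.* a ℕ.+ 2 ℕ.* k        ≡⟨ ℤ.+-injective eqℕ ⟨
      29 ℕ.* n                   ≡⟨ ℕ.*-distribʳ-+ n 27 2 ⟩
      27 ℕ.* n ℕ.+ 2 ℕ.* n       ∎))
    where
    open ℕ.≤-Reasoning
    eqℕ : + (29 ℕ.* n) ≡ + (3 ℕ.* a) ℤ.+ + (2 ℕ.* k)
    eqℕ = trans (ℤ.pos-* 29 n) (trans (trans (solve 2 (λ x y → x := y :+ (x :- y)) refl (+ 29 ℤ.* + n) (+ 3 ℤ.* + a)) (cong (λ z → + 3 ℤ.* + a ℤ.+ z) (trans e (ℤ.*-comm (+ k) (+ 2)))))
      (sym (cong₂ ℤ._+_ (ℤ.pos-* 3 a) (ℤ.pos-* 2 k))))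
      where open ℤ.+-*-Solver
  ∣d∣<n -[1+ k ] e = ℕ.*-cancelˡ-< 2 (suc k) n (ℕ.+-cancelˡ-< (29 ℕ.* n) (2 ℕ.* suc k) (2 ℕ.* n) (begin-strict
      29 ℕ.* n ℕ.+ 2 ℕ.* suc k   ≡⟨ ℤ.+-injective eqℕ ⟩
      3 ℕ.* a                    <⟨ 3a<31n ⟩
      31 ℕ.* n                   ≡⟨ ℕ.*-distribʳ-+ n 29 2 ⟩
      29 ℕ.* n ℕ.+ 2 ℕ.* n       ∎))
    where
    open ℕ.≤-Reasoning
    eqℕ : + (29 ℕ.* n) ℤ.+ + (2 ℕ.* suc k) ≡ + (3 ℕ.* a)
    eqℕ = trans (cong₂ ℤ._+_ (ℤ.pos-* 29 n) (ℤ.pos-* 2 (suc k))) (trans (trans (solve 3 (λ x y k → x :+ con (+ 2) :* k := (x :- y) :+ y :+ k :* con (+ 2)) refl (+ 29 ℤ.* + n) (+ 3 ℤ.* + a) (+ suc k))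
      (trans (cong (λ z → z ℤ.+ + 3 ℤ.* + a ℤ.+ + suc k ℤ.* + 2) e) (solve 2 (λ k y → :- k :* con (+ 2) :+ y :+ k :* con (+ 2) := y) refl (+ suc k) (+ 3 ℤ.* + a)))) (sym (ℤ.pos-* 3 a)))
      where open ℤ.+-*-Solver
  step : + 2 ∣ + 29 ℤ.* + n ℤ.- + 3 ℤ.* + a × + 2 ∣ + 29 ℤ.* + a ℤ.- + 279 ℤ.* + n → ⊥
  -- Modulo 3 the equation 29n - 3a = 2d reads n ≡ d.
  step (divides d d≡ , divides b b≡) = 3∤n (valid 3 ((n∣ con (+ 29) ⊗ var 0F ⊖ con (+ 3) ⊗ var 1F ⊖ var 2F ⊗ con (+ 2)) ⇒̇ (n∣ var 2F) ⇒̇ (n∣ var 0F)) refl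
      (+ n ∷ + a ∷ d ∷ []) (∣-of-≡ (+ 3) d≡)
      (ℤ.∣ᵤ⇒∣ (ℤ.∣⇒∣ᵤ (pell-93 (rec (∣d∣<n d d≡)) ℤ.∣ b ∣ (ℤ.+-injective eq′)))))
    where
    open ℤ.+-*-Solver
    4eq : + 4 ℤ.* (b ℤ.* b) ≡ + 4 ℤ.* (+ 93 ℤ.* (d ℤ.* d) ℤ.+ + 4)
    4eq = begin
      + 4 ℤ.* (b ℤ.* b)                                      ≡⟨ solve 1 (λ b → con (+ 4) :* (b :* b) := (b :* con (+ 2)) :* (b :* con (+ 2))) refl b ⟩
      b ℤ.* + 2 ℤ.* (b ℤ.* + 2)                              ≡⟨ cong (λ z → z ℤ.* z) b≡ ⟨
      _                                                      ≡⟨ solve 2 (λ a n → (con (+ 29) :* a :- con (+ 279) :* n) :* (con (+ 29) :* a :- con (+ 279) :* n)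
                                                                  := con (+ 93) :* ((con (+ 29) :* n :- con (+ 3) :* a) :* (con (+ 29) :* n :- con (+ 3) :* a)) :+ con (+ 4) :* (a :* a :- con (+ 93) :* (n :* n))) refl (+ a) (+ n) ⟩
      _                                                      ≡⟨ cong₂ (λ y z → + 93 ℤ.* (y ℤ.* y) ℤ.+ + 4 ℤ.* (z ℤ.- + 93 ℤ.* (+ n ℤ.* + n))) d≡ eqℤ ⟩
      _                                                      ≡⟨ solve 2 (λ d n → con (+ 93) :* (d :* con (+ 2) :* (d :* con (+ 2))) :+ con (+ 4) :* (con (+ 93) :* n :+ con (+ 4) :- con (+ 93) :* n)
                                                                  := con (+ 4) :* (con (+ 93) :* (d :* d) :+ con (+ 4))) refl d (+ n ℤ.* + n) ⟩
      + 4 ℤ.* (+ 93 ℤ.* (d ℤ.* d) ℤ.+ + 4)                   ∎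
      where open ≡-Reasoning
    eq′ : + (ℤ.∣ b ∣ ℕ.* ℤ.∣ b ∣) ≡ + (93 ℕ.* (ℤ.∣ d ∣ ℕ.* ℤ.∣ d ∣) ℕ.+ 4)
    eq′ = trans (∣i∣²≡i² b) (trans (ℤ.*-cancelˡ-≡ (+ 4) (b ℤ.* b) (+ 93 ℤ.* (d ℤ.* d) ℤ.+ + 4) 4eq)
      (cong (ℤ._+ + 4) (sym (trans (ℤ.pos-* 93 _) (cong (+ 93 ℤ.*_) (∣i∣²≡i² d))))))

factor-of-3^ : ∀ k n {l} → n ℤ.* l ≡ + (3 ℕ.^ k) → ¬ (+ 3 ∣ n) → n ≡ + 1 ⊎ n ≡ ℤ.-1ℤ
factor-of-3^ zero n {l} eq 3∤n = unit n (ℕ.m*n≡1⇒m≡1 ℤ.∣ n ∣ ℤ.∣ l ∣ (trans (sym (ℤ.abs-* n l)) (cong ℤ.∣_∣ eq)))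
  where
  unit : ∀ n → ℤ.∣ n ∣ ≡ 1 → n ≡ + 1 ⊎ n ≡ ℤ.-1ℤ
  unit (+ .1)    refl = inj₁ refl
  unit -[1+ .0 ] refl = inj₂ refl
factor-of-3^ (suc k) n {l} eq 3∤n = [ (λ h → contradiction h 3∤n) , divide ]′
    (prime-∣-* (from-yes (prime? 3)) n l (divides (+ (3 ℕ.^ k)) (trans eq (trans (ℤ.pos-* 3 (3 ℕ.^ k)) (ℤ.*-comm (+ 3) (+ (3 ℕ.^ k)))))))
  where
  divide : + 3 ∣ l → n ≡ + 1 ⊎ n ≡ ℤ.-1ℤ
  divide (divides c refl) = factor-of-3^ k n (ℤ.*-cancelˡ-≡ (+ 3) (n ℤ.* c) (+ (3 ℕ.^ k))
    (trans (solve 2 (λ n c → con (+ 3) :* (n :* c) := n :* (c :* con (+ 3))) refl n c) (trans eq (ℤ.pos-* 3 (3 ℕ.^ k))))) 3∤n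
    where open ℤ.+-*-Solver

-- The second left-hand side is the norm of η - 27 ση - 18 for η = a + b√62. With 62b² = a² - 1 it
-- becomes -108a² + 936a + 1108, which is -332 at a = 10 and -1196 at a = -2, so -1 ≤ a ≤ 9.
-- Divisibility of a² - 1 by 31 then leaves a = ±1.
bounded-unit : ∀ a b n → a ℤ.* a ℤ.- + 62 ℤ.* (b ℤ.* b) ≡ + 1 →
  (+ 26 ℤ.* a ℤ.+ + 18) ℤ.* (+ 26 ℤ.* a ℤ.+ + 18) ℤ.- + 62 ℤ.* (+ 28 ℤ.* b ℤ.* (+ 28 ℤ.* b)) ≡ + n → a ≡ + 1 ⊎ a ≡ ℤ.-1ℤ
bounded-unit a b n norm norm-t = by-sign a a²≡ norm
  where
  open ℤ.+-*-Solver
  a²≡ : + 108 ℤ.* (a ℤ.* a) ℤ.+ + n ≡ + 936 ℤ.* a ℤ.+ + 1108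
  a²≡ = trans (cong (λ z → + 108 ℤ.* (a ℤ.* a) ℤ.+ z) (sym norm-t)) (trans (solve 2 (λ a b →
      con (+ 108) :* (a :* a) :+ ((con (+ 26) :* a :+ con (+ 18)) :* (con (+ 26) :* a :+ con (+ 18)) :- con (+ 62) :* (con (+ 28) :* b :* (con (+ 28) :* b)))
      := con (+ 784) :* (a :* a :- con (+ 62) :* (b :* b)) :+ (con (+ 936) :* a :+ con (+ 324))) refl a b)
    (trans (cong (λ z → + 784 ℤ.* z ℤ.+ (+ 936 ℤ.* a ℤ.+ + 324)) norm) (solve 1 (λ a → con (+ 784) :* con (+ 1) :+ (con (+ 936) :* a :+ con (+ 324)) := con (+ 936) :* a :+ con (+ 1108)) refl a)))
  small : ∀ {k} → k ℕ.< 10 → + 31 ∣ + (k ℕ.* k) ℤ.- + 1 → k ≡ 1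
  small = from-yes (ℕ.allUpTo? (λ k → (+ 31 ∣? + (k ℕ.* k) ℤ.- + 1) →-dec (k ℕ.≟ 1)) 10)
  by-sign : ∀ a → + 108 ℤ.* (a ℤ.* a) ℤ.+ + n ≡ + 936 ℤ.* a ℤ.+ + 1108 → a ℤ.* a ℤ.- + 62 ℤ.* (b ℤ.* b) ≡ + 1 → a ≡ + 1 ⊎ a ≡ ℤ.-1ℤ
  by-sign (+ k) e norm = inj₁ (cong +_ (small k<10 (divides (+ 2 ℤ.* (b ℤ.* b)) (trans (cong (ℤ._- + 1) (ℤ.pos-* k k))
      (trans (cong (λ z → + k ℤ.* + k ℤ.- z) (sym norm)) (solve 2 (λ a b → a :- (a :- con (+ 62) :* b) := con (+ 2) :* b :* con (+ 31)) refl (+ k ℤ.* + k) (b ℤ.* b)))))))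
    where
    eℕ : 108 ℕ.* (k ℕ.* k) ℕ.+ n ≡ 936 ℕ.* k ℕ.+ 1108
    eℕ = ℤ.+-injective (trans (cong (ℤ._+ + n) (trans (ℤ.pos-* 108 (k ℕ.* k)) (cong (+ 108 ℤ.*_) (ℤ.pos-* k k)))) (trans e (cong (ℤ._+ + 1108) (sym (ℤ.pos-* 936 k)))))
    k<10 : k ℕ.< 10
    k<10 = ℕ.≰⇒> λ h → large (ℕ.m≤n⇒∃[o]m+o≡n h)
      where
      large : ∃[ j ] 10 ℕ.+ j ≡ k → ⊥
      large (j , refl) = ℕ.m+1+n≢m (936 ℕ.* (10 ℕ.+ j) ℕ.+ 1108) {331 ℕ.+ (1224 ℕ.* j ℕ.+ 108 ℕ.* (j ℕ.* j) ℕ.+ n)}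
        (trans (ℕ-Solve.solve 2 (λ j n → ℕ-Solve.con 936 ℕ-Solve.:* (ℕ-Solve.con 10 ℕ-Solve.:+ j) ℕ-Solve.:+ ℕ-Solve.con 1108 ℕ-Solve.:+ (ℕ-Solve.con 332 ℕ-Solve.:+ (ℕ-Solve.con 1224 ℕ-Solve.:* j ℕ-Solve.:+ ℕ-Solve.con 108 ℕ-Solve.:* (j ℕ-Solve.:* j) ℕ-Solve.:+ n))
          ℕ-Solve.:= ℕ-Solve.con 108 ℕ-Solve.:* ((ℕ-Solve.con 10 ℕ-Solve.:+ j) ℕ-Solve.:* (ℕ-Solve.con 10 ℕ-Solve.:+ j)) ℕ-Solve.:+ n) refl j n) eℕ)
  by-sign -[1+ 0 ]     e norm = inj₂ refl
  by-sign -[1+ suc j ] e norm = ⊥-elim (ℕ.m+1+n≢m 1108 {1195 ℕ.+ (1368 ℕ.* j ℕ.+ 108 ℕ.* (j ℕ.* j) ℕ.+ n)} (ℤ.+-injective eℤ))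
    where
    J = + j
    eℤ : + 1108 ℤ.+ + (1196 ℕ.+ (1368 ℕ.* j ℕ.+ 108 ℕ.* (j ℕ.* j) ℕ.+ n)) ≡ + 1108
    eℤ = trans (cong (λ z → + 1108 ℤ.+ (+ 1196 ℤ.+ (z ℤ.+ + n))) (cong₂ ℤ._+_ (ℤ.pos-* 1368 j) (trans (ℤ.pos-* 108 (j ℕ.* j)) (cong (+ 108 ℤ.*_) (ℤ.pos-* j j)))))
      (trans (solve 2 (λ j n → con (+ 1108) :+ (con (+ 1196) :+ (con (+ 1368) :* j :+ con (+ 108) :* (j :* j) :+ n))
          := con (+ 108) :* (:- (con (+ 2) :+ j) :* :- (con (+ 2) :+ j)) :+ n :- (con (+ 936) :* :- (con (+ 2) :+ j) :+ con (+ 1108)) :+ con (+ 1108)) refl J (+ n))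
        (trans (cong (λ z → z ℤ.- (+ 936 ℤ.* ℤ.- (+ 2 ℤ.+ J) ℤ.+ + 1108) ℤ.+ + 1108) e)
          (solve 1 (λ x → x :- x :+ con (+ 1108) := con (+ 1108)) refl (+ 936 ℤ.* ℤ.- (+ 2 ℤ.+ J) ℤ.+ + 1108))))

square-quotient-≥0 : ∀ n l {k} → l ≢ + 0 → n ℤ.* (l ℤ.* l) ≡ k ℤ.* k → ∃[ s ] n ≡ + s
square-quotient-≥0 (+ s)    l     l≢0 eq = s , refl
square-quotient-≥0 -[1+ s ] l {k} l≢0 eq = ⊥-elim (negative (ℤ.∣ l ∣ ℕ.* ℤ.∣ l ∣) {{ℕ.m*n≢0 ℤ.∣ l ∣ ℤ.∣ l ∣ {{abs≢0}} {{abs≢0}}}}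
    (trans (cong (-[1+ s ] ℤ.*_) (∣i∣²≡i² l)) (trans eq (sym (∣i∣²≡i² k)))))
  where
  abs≢0 : NonZero ℤ.∣ l ∣
  abs≢0 = ℕ.≢-nonZero λ e → l≢0 (ℤ.∣i∣≡0⇒i≡0 e)
  negative : ∀ a .{{_ : NonZero a}} {b} → -[1+ s ] ℤ.* + a ≢ + b
  negative (suc a) e = contradiction (trans (sym (ℤ.*-def -[1+ s ] (+ suc a))) e) λ ()

-- Elements of ℤ[√D] with polynomial coordinates, mirroring the ring operations.
module QuadraticPoly (D : ℤ) where
  infixl 6 _+ₚ_ _-ₚ_
  infixl 7 _*ₚ_
  Quad : ℕ → Set
  Quad v = Poly v × Poly v

  _+ₚ_ _*ₚ_ _-ₚ_ : ∀ {v} → Quad v → Quad v → Quad v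
  (a , b) +ₚ (c , d) = a ⊕ c , b ⊕ d
  (a , b) *ₚ (c , d) = a ⊗ c ⊕ con D ⊗ (b ⊗ d) , a ⊗ d ⊕ b ⊗ c
  (a , b) -ₚ (c , d) = a ⊕ ⊝ c , b ⊕ ⊝ d

  ιₚ : ∀ {v} → ℤ → Quad v
  ιₚ n = con n , con (+ 0)

  _^ₚ_ : ∀ {v} → Quad v → ℕ → Quad v
  p ^ₚ zero  = ιₚ (+ 1)
  p ^ₚ suc n = p *ₚ (p ^ₚ n)

  Nₚ : ∀ {v} → Quad v → Poly v
  Nₚ (a , b) = a ⊗ a ⊖ con D ⊗ (b ⊗ b)

  evₚ : ∀ {v} → Quad v → Poly v
  evₚ (a , b) = a ⊕ con D ⊗ b

  Bₚ : ∀ {v} → Quad v → Quad v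
  Bₚ t = t *ₚ t +ₚ ιₚ (+ 36) *ₚ t +ₚ ιₚ (+ 432)

  infix 1 _≈ₚ_
  _≈ₚ_ : ∀ {v} → Quad v → Quad v → Formula v
  (a , b) ≈ₚ (c , d) = (n∣ a ⊖ c) ∧̇ (n∣ b ⊖ d)

-- ℤ[√m] as a domain, for m a prime or twice a prime

module Arithmetic (m : ℕ) (sqfree : SquareFree m) (4∣m-2⊎4∣m-3 : (+ 4 ∣ + m ℤ.- + 2) ⊎ (+ 4 ∣ + m ℤ.- + 3))
  (q : ℕ) (q-prime : Prime q) (q∣m : + q ∣ + m) (e : ℕ) (e≡1⊎2 : e ≡ 1 ⊎ e ≡ 2) (m≡eq : m ≡ e ℕ.* q) where

  private
    module ℤ-Solve = ℤ.+-*-Solver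
    module Exp-ℤ = Exp (CommutativeRing.semiring ℤ.+-*-commutativeRing)

  open ℤ√ m public

  p²∤D : ∀ {p} → Prime p → ¬ (+ p ℤ.* + p ∣ D)
  p²∤D {p} pp h = sqfree p (ℕ.nonTrivial⇒n>1 p {{prime⇒nonTrivial pp}})
    (ℤ.∣⇒∣ᵤ (subst (_∣ D) (sym (ℤ.pos-* p p)) h))

  -- The prime q divides D exactly once, so a nonzero solution would have even q-adic valuation on
  -- the left and odd valuation on the right.
  nonsquare : ∀ a b → a ℤ.* a ≡ D ℤ.* (b ℤ.* b) → b ≡ + 0
  nonsquare a b eq with b ℤ.≟ + 0
  ... | yes b≡0 = b≡0
  ... | no  b≢0 with a ℤ.≟ + 0
  ...   | yes refl = contradiction (ℤ.i*j≡0⇒i≡0∨j≡0 D (trans (sym eq) (ℤ.*-zeroˡ (+ 0)))) λ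
            { (inj₁ D≡0) → p²∤D q-prime (subst (+ q ℤ.* + q ∣_) (sym D≡0) (ℤ.∣0))
            ; (inj₂ bb≡0) → b≢0 (Data.Sum.Base.[ (λ z → z) , (λ z → z) ] (ℤ.i*j≡0⇒i≡0∨j≡0 b bb≡0)) }
  ...   | no  a≢0 with total a a≢0 | total b b≢0
    where open Valℤ q-prime
  ...     | k , va | l , vb = contradiction
            (Val-unique (Val-* va va) (Val-resp (sym eq′) (Val-* (Val-* (Val-unit q∤m₁) Val-ϖ) (Val-* vb vb))))
            (even≢odd k l)
    where
    open Valℤ q-prime
    m₁ = ℤ.quotient q∣m
    m≡ = ℤ._∣_.equality q∣m
    eq′ : a ℤ.* a ≡ m₁ ℤ.* + q ℤ.* (b ℤ.* b)
    eq′ = trans eq (cong (ℤ._* (b ℤ.* b)) m≡)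
    q∤m₁ : ¬ (+ q ∣ m₁)
    q∤m₁ (divides r m₁≡) = p²∤D q-prime
      (divides r (trans m≡ (trans (cong (ℤ._* + q) m₁≡) (ℤ.*-assoc r _ _))))
    even≢odd : ∀ k l → k ℕ.+ k ≢ 0 ℕ.+ 1 ℕ.+ (l ℕ.+ l)
    even≢odd k l e = ℕ.even≢odd k l (trans (cong (k ℕ.+_) (ℕ.+-identityʳ k))
      (trans e (cong (λ z → suc (l ℕ.+ z)) (sym (ℕ.+-identityʳ l)))))

  𝟎 : 𝕆
  𝟎 = ι (+ 0)

  N≡0⇒≡0 : ∀ x → N x ≡ + 0 → x ≡ 𝟎
  N≡0⇒≡0 (a +√ b) eq with nonsquare a b a²≡
    where
    a²≡ : a ℤ.* a ≡ D ℤ.* (b ℤ.* b)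
    a²≡ = ℤ.i-j≡0⇒i≡j _ _ eq
  ... | refl with ℤ.i*j≡0⇒i≡0∨j≡0 a (trans (solve 2 (λ k a → a :* a := a :* a :- k :* (con (+ 0) :* con (+ 0))) refl D a) eq)
    where open ℤ-Solve
  ...   | inj₁ refl = refl
  ...   | inj₂ refl = refl

  ι-cancel : ∀ n {x y} → n ≢ + 0 → ι n ⊠ x ≡ ι n ⊠ y → x ≡ y
  ι-cancel n {x@(a +√ b)} {y@(c +√ d)} n≢0 eq = cong₂ _+√_ (cancelℤ n n≢0 (cong re eq′)) (cancelℤ n n≢0 (cong im eq′))
    where
    eq′ : (n ℤ.* a) +√ (n ℤ.* b) ≡ (n ℤ.* c) +√ (n ℤ.* d)
    eq′ = trans (sym (ι-⊠ n x)) (trans eq (ι-⊠ n y))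

  N≢0 : ∀ {x} → x ≢ 𝟎 → N x ≢ + 0
  N≢0 x≢0 eq = x≢0 (N≡0⇒≡0 _ eq)

  cancel : ∀ {w x y} → w ≢ 𝟎 → w ⊠ x ≡ w ⊠ y → x ≡ y
  cancel {w} {x} {y} w≢0 eq = ι-cancel (N w) (N≢0 w≢0) (begin
    ι (N w) ⊠ x   ≡⟨ cong (_⊠ x) (x⊠σx w) ⟨
    w ⊠ σ w ⊠ x   ≡⟨ swap w (σ w) x ⟩
    σ w ⊠ (w ⊠ x) ≡⟨ cong (σ w ⊠_) eq ⟩
    σ w ⊠ (w ⊠ y) ≡⟨ swap w (σ w) y ⟨
    w ⊠ σ w ⊠ y   ≡⟨ cong (_⊠ y) (x⊠σx w) ⟩
    ι (N w) ⊠ y   ∎)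
    where
    open ≡-Reasoning
    open 𝕆-Solver
    swap : ∀ a b c → a ⊠ b ⊠ c ≡ b ⊠ (a ⊠ c)
    swap = solve 3 (λ a b c → a :* b :* c := b :* (a :* c)) refl

  ⊠-≢0 : ∀ {x y} → x ≢ 𝟎 → y ≢ 𝟎 → x ⊠ y ≢ 𝟎
  ⊠-≢0 {x} x≢0 y≢0 eq = y≢0 (cancel x≢0 (trans eq (sym (⊠-zeroʳ x))))

  ^-≢0 : ∀ k {x} → x ≢ 𝟎 → x ^ k ≢ 𝟎
  ^-≢0 zero    x≢0 = λ ()
  ^-≢0 (suc k) x≢0 = ⊠-≢0 x≢0 (^-≢0 k x≢0)

  ι-≢0 : ∀ {n} → n ≢ + 0 → ι n ≢ 𝟎
  ι-≢0 n≢0 refl = n≢0 refl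

  -- Prime ideals above a rational prime

  -- Reduction modulo the prime ideal (p, √m − r).
  rootIdeal : ∀ {p} → Prime p → ∀ r → + p ∣ r ℤ.* r ℤ.- D → PrimeIdeal 𝕆-ring
  rootIdeal {p} pp r p∣r²-D = record
    { 𝔓        = λ x → + p ∣ ev x
    ; 𝔓?       = λ x → + p ∣? ev x
    ; resp     = λ { refl h → h }
    ; +-closed = λ { {a +√ b} {c +√ d} h h′ → ∣-combine (+ 1) (+ 1) h h′
        (solve 5 (λ a b c d r → (a :+ c) :+ r :* (b :+ d)
           := con (+ 1) :* (a :+ r :* b) :+ con (+ 1) :* (c :+ r :* d)) refl a b c d r) }
    ; *-absorb = λ { x {y} h → ∣-combine (ev x) (ℤ.- (im x ℤ.* im y)) h p∣r²-D (trans (split x y) (cong (λ z → ev x ℤ.* ev y ℤ.+ z) (ℤ.*-comm (r ℤ.* r ℤ.- D) _))) }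
    ; proper   = λ h → ¬p∣1 pp (∣-multiple (+ 1) h
        (solve 1 (λ r → con (+ 1) := con (+ 1) :* (con (+ 1) :+ r :* con (+ 0))) refl r))
    ; prime    = λ x y h → prime-∣-* pp (ev x) (ev y) (∣-combine (+ 1) (im x ℤ.* im y) h p∣r²-D
        (trans (solve 3 (λ u w v → u := con (+ 1) :* (u :+ v) :+ :- v) refl (ev x ℤ.* ev y) (+ 0) ((r ℤ.* r ℤ.- D) ℤ.* ℤ.- (im x ℤ.* im y)))
        (trans (cong (λ z → + 1 ℤ.* z ℤ.+ ℤ.- ((r ℤ.* r ℤ.- D) ℤ.* ℤ.- (im x ℤ.* im y))) (sym (split x y)))
          (cong (λ z → + 1 ℤ.* ev (x ⊠ y) ℤ.+ z) (solve 2 (λ v w → :- (v :* :- w) := w :* v) refl (r ℤ.* r ℤ.- D) (im x ℤ.* im y))))))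
    }
    where
    open ℤ-Solve
    ev : 𝕆 → ℤ
    ev x = re x ℤ.+ r ℤ.* im x
    split : ∀ x y → ev (x ⊠ y) ≡ ev x ℤ.* ev y ℤ.+ (r ℤ.* r ℤ.- D) ℤ.* ℤ.- (im x ℤ.* im y)
    split (a +√ b) (c +√ d) = solve 6 (λ k r a b c d →
      (a :* c :+ k :* (b :* d)) :+ r :* (a :* d :+ b :* c)
        := (a :+ r :* b) :* (c :+ r :* d) :+ (r :* r :- k) :* :- (b :* d)) refl D r a b c d

  -- The norm form is anisotropic modulo p; multiplicativity of the norm then makes (p) a prime
  -- ideal.
  Inert : ℕ → Set
  Inert p = ∀ x → + p ∣ N x → + p ∣ re x × + p ∣ im x

  inertIdeal : ∀ {p} → Prime p → Inert p → PrimeIdeal 𝕆-ring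
  inertIdeal {p} pp inert = record
    { 𝔓        = λ x → + p ∣ re x × + p ∣ im x
    ; 𝔓?       = λ x → (+ p ∣? re x) ×-dec (+ p ∣? im x)
    ; resp     = λ { refl h → h }
    ; +-closed = λ { {a +√ b} {c +√ d} (h , h′) (k , k′) → ∣-+ h k , ∣-+ h′ k′ }
    ; *-absorb = λ { (a +√ b) {c +√ d} (h , h′) →
          ∣-combine a (D ℤ.* b) h h′ (cong (λ z → a ℤ.* c ℤ.+ z) (sym (ℤ.*-assoc D b d)))
        , ∣-combine a b h′ h refl }
    ; proper   = λ (h , _) → ¬p∣1 pp h
    ; prime    = λ x y (h , h′) → Data.Sum.Base.map (inert x) (inert y) (prime-∣-* pp (N x) (N y)
        (subst (+ p ∣_) (N-⊠ x y) (∣-combine (re (x ⊠ y)) (ℤ.- (D ℤ.* im (x ⊠ y))) h h′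
          (norm (x ⊠ y)))))
    }
    where
    open ℤ-Solve
    norm : ∀ z → N z ≡ re z ℤ.* re z ℤ.+ ℤ.- (D ℤ.* im z) ℤ.* im z
    norm (a +√ b) = solve 3 (λ k a b → a :* a :- k :* (b :* b) := a :* a :+ :- (k :* b) :* b) refl D a b

  -- If p ∣ a² - D b² and p ∤ b, then a times an inverse of b is a square root of D modulo p. It
  -- suffices to search for a root below p.
  root-or-inert : ∀ {p} → Prime p → (∃[ r ] + p ∣ r ℤ.* r ℤ.- D) ⊎ Inert p
  root-or-inert {p} pp with ℕ.anyUpTo? (λ r → + p ∣? (+ r ℤ.* + r ℤ.- D)) p
  ... | yes (r , _ , h) = inj₁ (+ r , h)
  ... | no  none = inj₂ λ { (a +√ b) h → inert a b h }
    where
    open ℤ-Solve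
    instance _ = prime⇒nonZero pp
    noroot : ∀ r → ¬ (+ p ∣ r ℤ.* r ℤ.- D)
    noroot r h = none (r%p , n%ℕd<d r p , ∣-combine (+ 1) (ℤ.- (r ℤ.+ + r%p)) h
        (divides (r /ℕ p) (trans (cong (ℤ._- + r%p) (a≡a%ℕn+[a/ℕn]*n r p)) (solve 2 (λ u v → (u :+ v) :- u := v) refl (+ r%p) (r /ℕ p ℤ.* + p))))
        (solve 3 (λ k r s → s :* s :- k := con (+ 1) :* (r :* r :- k) :+ :- (r :+ s) :* (r :- s)) refl D r (+ r%p)))
      where
      r%p = r %ℕ p
    inert : ∀ a b → + p ∣ N (a +√ b) → + p ∣ a × + p ∣ b
    inert a b h with + p ∣? b
    ... | yes p∣b = p∣a , p∣b
      where
      p∣a : + p ∣ a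
      p∣a = Data.Sum.Base.[ (λ z → z) , (λ z → z) ] (prime-∣-* pp a a (∣-combine (+ 1) (D ℤ.* b) h p∣b
        (solve 3 (λ k a b → a :* a := con (+ 1) :* (a :* a :- k :* (b :* b)) :+ (k :* b) :* b) refl D a b)))
    ... | no  p∤b with inverse-mod pp b p∤b
    ...   | c , p∣bc-1 = ⊥-elim (noroot (a ℤ.* c) (∣-combine (c ℤ.* c) (D ℤ.* (b ℤ.* c ℤ.+ + 1)) h p∣bc-1
        (solve 4 (λ k a b c → a :* c :* (a :* c) :- k := (c :* c) :* (a :* a :- k :* (b :* b)) :+ k :* (b :* c :+ con (+ 1)) :* (b :* c :- con (+ 1))) refl D a b c)))

  -- Places of ℚ(√m)

  -- `root` serves split and ramified primes alike: the roots r and -r give the two places above a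
  -- split p, and they give the same ideal when p ∣ 2r.
  data Place : Set where
    root  : ∀ {p} → Prime p → ∀ r → + p ∣ r ℤ.* r ℤ.- D → Place
    inert : ∀ {p} → Prime p → Inert p → Place

  ideal : Place → PrimeIdeal 𝕆-ring
  ideal (root pp r h) = rootIdeal pp r h
  ideal (inert pp i)  = inertIdeal pp i

  infix 4 _∈ᴾ_ _∉ᴾ_
  _∈ᴾ_ _∉ᴾ_ : 𝕆 → Place → Set
  x ∈ᴾ v = PrimeIdeal.𝔓 (ideal v) x
  x ∉ᴾ v = ¬ x ∈ᴾ v

  char : Place → ℕ
  char (root {p} _ _ _) = p
  char (inert {p} _ _)  = p

  char-prime : ∀ v → Prime (char v)
  char-prime (root pp _ _) = pp
  char-prime (inert pp _)  = pp

  char∣⇒∈ : ∀ v {n} → + char v ∣ n → ι n ∈ᴾ v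
  char∣⇒∈ (root pp r h) {n} p∣n = ∣-multiple (+ 1) p∣n
    (solve 2 (λ n r → n :+ r :* con (+ 0) := con (+ 1) :* n) refl n r)
    where open ℤ-Solve
  char∣⇒∈ (inert pp i) p∣n = p∣n , ℤ.∣0

  ∈⇒char∣ : ∀ v {n} → ι n ∈ᴾ v → + char v ∣ n
  ∈⇒char∣ (root pp r h) {n} ιn∈ = ∣-multiple (+ 1) ιn∈
    (solve 2 (λ n r → n := con (+ 1) :* (n :+ r :* con (+ 0))) refl n r)
    where open ℤ-Solve
  ∈⇒char∣ (inert pp i) (p∣n , _) = p∣n

  ∈⇒char∣N : ∀ v {x} → x ∈ᴾ v → + char v ∣ N x
  ∈⇒char∣N v {x} x∈ = ∈⇒char∣ v (resp (x⊠σx x) (absorbʳ (σ x) x∈))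
    where open PrimeIdeal (ideal v)

  𝟎∈ : ∀ v → 𝟎 ∈ᴾ v
  𝟎∈ v = char∣⇒∈ v (ℤ.∣0)

  ∉⇒≢0 : ∀ v {x} → x ∉ᴾ v → x ≢ 𝟎
  ∉⇒≢0 v x∉ refl = x∉ (𝟎∈ v)

  ∉-⊠ : ∀ v x y → x ∉ᴾ v → y ∉ᴾ v → x ⊠ y ∉ᴾ v
  ∉-⊠ v x y = PrimeIdeal.∉-* (ideal v) {x} {y}

  -- Integrality of fractions, place by place

  -- x/w is integral at v, without mentioning fractions.
  IntegralAt : Place → 𝕆 → 𝕆 → Set
  IntegralAt v x w = ∀ η ε → x ⊠ η ≡ w ⊠ ε → η ∈ᴾ v → ε ∈ᴾ v

  infix 4 _∣̂_
  _∣̂_ : ℕ → 𝕆 → Set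
  p ∣̂ x = + p ∣ re x × + p ∣ im x

  _∣̂?_ : ∀ p x → Dec (p ∣̂ x)
  p ∣̂? x = (+ p ∣? re x) ×-dec (+ p ∣? im x)

  private
    conjugateRoot : ∀ {p} r → + p ∣ r ℤ.* r ℤ.- D → + p ∣ ℤ.- r ℤ.* ℤ.- r ℤ.- D
    conjugateRoot r h = ∣-multiple (+ 1) h
      (solve 2 (λ k r → :- r :* :- r :- k := con (+ 1) :* (r :* r :- k)) refl D r)
      where open ℤ-Solve

  conjugate : Place → Place
  conjugate (root pp r h) = root pp (ℤ.- r) (conjugateRoot r h)
  conjugate (inert pp i)  = inert pp i

  σ-∈ : ∀ v {x} → σ x ∈ᴾ conjugate v → x ∈ᴾ v
  σ-∈ (root pp r h) {a +√ b} h′ = ∣-multiple (+ 1) h′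
    (solve 3 (λ a b r → a :+ r :* b := con (+ 1) :* (a :+ :- r :* :- b)) refl a b r)
    where open ℤ-Solve
  σ-∈ (inert pp i) {a +√ b} (h , h′) = h , ∣-multiple ℤ.-1ℤ h′
    (trans (sym (ℤ.neg-involutive b)) (sym (ℤ.-1*i≡-i (ℤ.- b))))

  σ-∉ : ∀ v {x} → x ∉ᴾ v → σ x ∉ᴾ conjugate v
  σ-∉ v x∉ σx∈ = x∉ (σ-∈ v σx∈)

  -- For an unramified p the two conjugate ideals above p meet in (p).
  split-∩ : ∀ {p} (pp : Prime p) r h → ¬ (+ p ∣ + 2 ℤ.* r) → ∀ {x} →
            x ∈ᴾ root pp r h → x ∈ᴾ conjugate (root pp r h) → p ∣̂ x
  split-∩ {p} pp r h p∤2r {a +√ b} h₁ h₂ = p∣a , p∣b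
    where
    open ℤ-Solve
    p∣b : + p ∣ b
    p∣b = [ (λ p∣2r → contradiction p∣2r p∤2r) , (λ p∣b → p∣b) ]′
      (prime-∣-* pp (+ 2 ℤ.* r) b (∣-combine (+ 1) ℤ.-1ℤ h₁ h₂
          (solve 3 (λ a b r → con (+ 2) :* r :* b
             := con (+ 1) :* (a :+ r :* b) :+ con ℤ.-1ℤ :* (a :+ :- r :* b)) refl a b r)))
    p∣a : + p ∣ a
    p∣a = ∣-combine (+ 1) (ℤ.- r) h₁ p∣b
      (solve 3 (λ a b r → a := con (+ 1) :* (a :+ r :* b) :+ :- r :* b) refl a b r)

  extract : ∀ {p x} → p ∣̂ x → ∃[ y ] x ≡ ι (+ p) ⊠ y
  extract (h , h′) = coords⇒∣ᴼ h h′

  -- In the ramified case the square of a generator of 𝔓 modulo p is p times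
  -- a unit at 𝔓.
  ramified-square : ∀ {p} (pp : Prime p) r h → + p ∣ + 2 ℤ.* r → ∀ {x} → x ∈ᴾ root pp r h →
    ¬ p ∣̂ x → ∃[ ε ] x ⊠ x ≡ ι (+ p) ⊠ ε × ε ∉ᴾ root pp r h
  ramified-square {p} pp r h p∣2r {a +√ b} x∈ p∤x with + p ∣? r
  ... | yes (divides r₁ r≡) = ε , square , ε∉
    where
    open ℤ-Solve
    p∣r = divides r₁ r≡
    p∣a : + p ∣ a
    p∣a = ∣-combine (+ 1) (ℤ.- b) x∈ p∣r
      (solve 3 (λ a b r → a := con (+ 1) :* (a :+ r :* b) :+ :- b :* r) refl a b r)
    a₁ = ℤ.quotient p∣a
    a≡ : a ≡ a₁ ℤ.* + p
    a≡ = ℤ.equality p∣a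
    p∣D : + p ∣ D
    p∣D = ∣-combine ℤ.-1ℤ r h p∣r
      (solve 2 (λ k r → k := con ℤ.-1ℤ :* (r :* r :- k) :+ r :* r) refl D r)
    D₁ = ℤ.quotient p∣D
    D≡ : D ≡ D₁ ℤ.* + p
    D≡ = ℤ.equality p∣D
    ε : 𝕆
    ε = (a₁ ℤ.* a₁ ℤ.* + p ℤ.+ D₁ ℤ.* (b ℤ.* b)) +√ (+ 2 ℤ.* a₁ ℤ.* b)
    square : (a +√ b) ⊠ (a +√ b) ≡ ι (+ p) ⊠ ε
    square = trans (cong₂ _+√_
      (trans (cong₂ (λ y z → y ℤ.* y ℤ.+ z ℤ.* (b ℤ.* b)) a≡ D≡)
        (solve 4 (λ a b k p → a :* p :* (a :* p) :+ k :* p :* (b :* b) := p :* (a :* a :* p :+ k :* (b :* b))) refl a₁ b D₁ (+ p)))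
      (trans (cong (λ y → y ℤ.* b ℤ.+ b ℤ.* y) a≡)
        (solve 3 (λ a b p → a :* p :* b :+ b :* (a :* p) := p :* (con (+ 2) :* a :* b)) refl a₁ b (+ p))))
      (sym (ι-⊠ (+ p) ε))
    p∣D₁b² : ε ∈ᴾ root pp r h → + p ∣ D₁ ℤ.* (b ℤ.* b)
    p∣D₁b² ε∈ = ∣-combine (+ 1) (ℤ.- (a₁ ℤ.* a₁)) (∣-combine (+ 1) (ℤ.- (+ 2 ℤ.* a₁ ℤ.* b)) ε∈ p∣r
        (solve 4 (λ x a b r → x := con (+ 1) :* (x :+ r :* (con (+ 2) :* a :* b)) :+ :- (con (+ 2) :* a :* b) :* r)
          refl (re ε) a₁ b r)) ℤ.∣-refl
      (solve 4 (λ a b k p → k :* (b :* b) := con (+ 1) :* (a :* a :* p :+ k :* (b :* b)) :+ :- (a :* a) :* p)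
        refl a₁ b D₁ (+ p))
    p∤D₁ : ¬ (+ p ∣ D₁)
    p∤D₁ (divides d D₁≡) = p²∤D pp (divides d (trans D≡ (trans (cong (ℤ._* + p) D₁≡) (ℤ.*-assoc d _ _))))
    ε∉ : ε ∉ᴾ root pp r h
    ε∉ ε∈ = [ p∤D₁ , (λ p∣b² → p∤x (p∣a , reduce (prime-∣-* pp b b p∣b²))) ]′
      (prime-∣-* pp D₁ (b ℤ.* b) (p∣D₁b² ε∈))
  ... | no p∤r with prime-∣-* pp (+ 2) r p∣2r
  ...   | inj₂ p∣r = contradiction p∣r p∤r
  ...   | inj₁ p∣2 with ℕ.≤-antisym (ℕ∣.∣⇒≤ (ℤ.∣⇒∣ᵤ p∣2)) (ℕ.nonTrivial⇒n>1 p {{prime⇒nonTrivial pp}})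
  ...     | refl = ε , square , ε∉
    where
    open ℤ-Solve
    parity : ∀ x → + 2 ∣ x → + 4 ∣ + 2 ℤ.* x
    parity _ (divides c refl) = divides c (solve 1 (λ c → con (+ 2) :* (c :* con (+ 2)) := c :* con (+ 4)) refl c)
    parity⁻¹ : ∀ x → + 4 ∣ + 2 ℤ.* x → + 2 ∣ x
    parity⁻¹ x (divides c e) = divides c (cancelℤ (+ 2) (λ ())
      (trans e (solve 1 (λ c → c :* con (+ 4) := con (+ 2) :* (c :* con (+ 2))) refl c)))
    A B R K : Poly 4
    A = var 0F
    B = var 1F
    R = var 2F
    K = var 3F
    -- Here r is odd, so m ≡ 3 (mod 4) and a, b are both odd: a² + m b² is divisible by 4, and in ε
    -- = x²/2 only the √m-coordinate ab is odd.
    facts : + 4 ∣ a ℤ.* a ℤ.+ D ℤ.* (b ℤ.* b) × ¬ (+ 4 ∣ + 2 ℤ.* (r ℤ.* (a ℤ.* b)))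
    facts = valid 4
      ((n∣ K ⊖ con (+ 2)) ∨̇ (n∣ K ⊖ con (+ 3)) ⇒̇ (n∣ con (+ 2) ⊗ (R ⊗ R ⊖ K)) ⇒̇
       ((n∣ con (+ 2) ⊗ R) ⇒̇ ⊥̇) ⇒̇ (n∣ con (+ 2) ⊗ (A ⊕ R ⊗ B)) ⇒̇
       ((n∣ con (+ 2) ⊗ A) ∧̇ (n∣ con (+ 2) ⊗ B) ⇒̇ ⊥̇) ⇒̇
       (n∣ A ⊗ A ⊕ K ⊗ (B ⊗ B)) ∧̇ ((n∣ con (+ 2) ⊗ (R ⊗ (A ⊗ B))) ⇒̇ ⊥̇))
      refl (a ∷ b ∷ r ∷ D ∷ []) 4∣m-2⊎4∣m-3 (parity _ h) (λ k → p∤r (parity⁻¹ r k)) (parity _ x∈)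
      (λ (k , l) → p∤x (parity⁻¹ a k , parity⁻¹ b l))
    e₁ = ℤ.quotient (proj₁ facts)
    ε : 𝕆
    ε = (e₁ ℤ.* + 2) +√ (a ℤ.* b)
    square : (a +√ b) ⊠ (a +√ b) ≡ ι (+ 2) ⊠ ε
    square = trans (cong₂ _+√_
      (trans (ℤ.equality (proj₁ facts)) (solve 1 (λ e → e :* con (+ 4) := con (+ 2) :* (e :* con (+ 2))) refl e₁))
      (solve 2 (λ a b → a :* b :+ b :* a := con (+ 2) :* (a :* b)) refl a b))
      (sym (ι-⊠ (+ 2) ε))
    ε∉ : ε ∉ᴾ root pp r h
    ε∉ ε∈ = proj₂ facts (parity _ (∣-combine (+ 1) (ℤ.- e₁) ε∈ ℤ.∣-refl
      (solve 4 (λ a b r e → r :* (a :* b) := con (+ 1) :* (e :* con (+ 2) :+ r :* (a :* b)) :+ :- e :* con (+ 2)) refl a b r e₁)))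

  private
    ι-product : ∀ {n p n₁} → n ≡ n₁ ℕ.* p → ι (+ n) ≡ ι (+ p) ⊠ ι (+ n₁)
    ι-product {n} {p} {n₁} n≡ = trans
      (cong ι (trans (cong +_ (trans n≡ (ℕ.*-comm n₁ p))) (ℤ.pos-* p n₁))) (ι-* (+ p) (+ n₁))

    -- Integrality is tested on η = n, which puts γ into every place above p. This suffices unless p
    -- is ramified. There, if p ∤ γ, then γ² = p ε with ε a unit at 𝔓, and the test η = n₁ γ, for
    -- which γ η = n ε, would put ε into 𝔓.
    char-divides : ∀ {p γ} → Prime p → ∀ n₁ n → n ≡ n₁ ℕ.* p → (∀ v → IntegralAt v γ (ι (+ n))) → p ∣̂ γ
    char-divides {p} {γ} pp n₁ n n≡ h with root-or-inert pp
    ... | inj₂ i = h (inert pp i) (ι (+ n)) γ (⊠-comm γ _) (char∣⇒∈ (inert pp i) (ℤ.∣ᵤ⇒∣ (ℕ∣.divides n₁ n≡)))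
    ... | inj₁ (r , k) = divides-root
      where
      v = root pp r k
      γ∈ : ∀ v → char v ≡ p → γ ∈ᴾ v
      γ∈ v refl = h v (ι (+ n)) γ (⊠-comm γ _) (char∣⇒∈ v (ℤ.∣ᵤ⇒∣ (ℕ∣.divides n₁ n≡)))
      divides-root : p ∣̂ γ
      divides-root with + p ∣? + 2 ℤ.* r
      ... | no  p∤2r = split-∩ pp r k p∤2r {γ} (γ∈ v refl) (γ∈ (conjugate v) refl)
      ... | yes p∣2r with p ∣̂? γ
      ...   | yes p∣γ = p∣γ
      ...   | no  p∤γ = contradiction
                (h v (ι (+ n₁) ⊠ γ) ε eq (*-absorb (ι (+ n₁)) {γ} (γ∈ v refl))) (proj₂ (proj₂ square))
        where
        open PrimeIdeal (ideal v)
        open 𝕆-Solver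
        square = ramified-square pp r k p∣2r {γ} (γ∈ v refl) p∤γ
        ε = proj₁ square
        eq : γ ⊠ (ι (+ n₁) ⊠ γ) ≡ ι (+ n) ⊠ ε
        eq = trans (solve 2 (λ γ n → γ :* (n :* γ) := n :* (γ :* γ)) refl γ (ι (+ n₁)))
          (trans (cong (ι (+ n₁) ⊠_) (proj₁ (proj₂ square)))
          (trans (solve 3 (λ n p ε → n :* (p :* ε) := p :* n :* ε) refl (ι (+ n₁)) (ι (+ p)) ε)
                 (cong (_⊠ ε) (sym (ι-product n≡)))))

  integral-ℤ : ∀ γ n → Acc ℕ._<_ n → n ≢ 0 → (∀ v → IntegralAt v γ (ι (+ n))) → ι (+ n) ∣ᴼ γ
  integral-ℤ γ n (acc rs) n≢0 h with n ℕ.≟ 1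
  ... | yes refl = γ , sym (⊠-identityˡ γ)
  ... | no  n≢1 with prime-divisor {n} (ℕ.≤∧≢⇒< (ℕ.n≢0⇒n>0 n≢0) (λ e → n≢1 (sym e)))
  ...   | p , pp , ℕ∣.divides n₁ n≡ = proj₁ smaller , trans γ≡ (trans (cong (ι (+ p) ⊠_) (proj₂ smaller))
      (trans (sym (⊠-assoc (ι (+ p)) (ι (+ n₁)) (proj₁ smaller))) (cong (_⊠ proj₁ smaller) (sym (ι-product n≡)))))
    where
    p∣γ = extract {p} {γ} (char-divides pp n₁ n n≡ h)
    γ₁ = proj₁ p∣γ
    γ≡ : γ ≡ ι (+ p) ⊠ γ₁
    γ≡ = proj₂ p∣γ
    n₁≢0 : n₁ ≢ 0
    n₁≢0 refl = n≢0 n≡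
    n₁<n : n₁ ℕ.< n
    n₁<n = subst (n₁ ℕ.<_) (sym n≡) (ℕ.m<m*n n₁ p {{ℕ.≢-nonZero n₁≢0}} (ℕ.nonTrivial⇒n>1 p {{prime⇒nonTrivial pp}}))
    h₁ : ∀ v → IntegralAt v γ₁ (ι (+ n₁))
    h₁ v η ε eq = h v η ε (trans (cong (_⊠ η) γ≡) (trans (⊠-assoc (ι (+ p)) γ₁ η) (trans (cong (ι (+ p) ⊠_) eq)
      (trans (sym (⊠-assoc (ι (+ p)) (ι (+ n₁)) ε)) (cong (_⊠ ε) (sym (ι-product n≡)))))))
    smaller : ι (+ n₁) ∣ᴼ γ₁
    smaller = integral-ℤ γ₁ n₁ (rs n₁<n) n₁≢0 h₁

  σ-≢0 : ∀ {x} → x ≢ 𝟎 → σ x ≢ 𝟎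
  σ-≢0 {x} x≢0 σx≡0 = x≢0 (trans (sym (σ-σ x)) (cong σ σx≡0))

  -- An element of the field that is integral at every place lies in 𝕆.
  integral : ∀ {γ w} → w ≢ 𝟎 → (∀ v → IntegralAt v γ w) → w ∣ᴼ γ
  integral {γ} {w} w≢0 h = δ , cancel c≢0 (trans (⊠-comm c γ)
    (trans γc≡ (trans (cong (_⊠ δ) n≡) (solve 3 (λ c w δ → w :* c :* δ := c :* (w :* δ)) refl c w δ))))
    where
    open 𝕆-Solver
    absolute : ∀ n → ∃[ s ] s ≢ + 0 × + ℤ.∣ n ∣ ≡ n ℤ.* s
    absolute (+ k)    = + 1 , (λ ()) , sym (ℤ.*-identityʳ (+ k))
    absolute -[1+ k ] = ℤ.-1ℤ , (λ ()) , sym (trans (ℤ.*-comm -[1+ k ] ℤ.-1ℤ) (ℤ.-1*i≡-i -[1+ k ]))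
    s = proj₁ (absolute (N w))
    n = ℤ.∣ N w ∣
    -- w c = |N w|, so multiplying by c makes the denominator a positive integer.
    c = σ w ⊠ ι s
    c≢0 : c ≢ 𝟎
    c≢0 = ⊠-≢0 (σ-≢0 w≢0) (ι-≢0 (proj₁ (proj₂ (absolute (N w)))))
    n≡ : ι (+ n) ≡ w ⊠ c
    n≡ = trans (cong ι (proj₂ (proj₂ (absolute (N w))))) (trans (ι-* (N w) s)
      (trans (cong (_⊠ ι s) (sym (x⊠σx w))) (⊠-assoc w (σ w) (ι s))))
    h′ : ∀ v → IntegralAt v (γ ⊠ c) (ι (+ n))
    h′ v η ε eq = h v η ε (cancel c≢0
      (trans (solve 3 (λ c γ η → c :* (γ :* η) := γ :* c :* η) refl c γ η)
      (trans eq (trans (cong (_⊠ ε) n≡) (solve 3 (λ c w ε → w :* c :* ε := c :* (w :* ε)) refl c w ε)))))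
    result = integral-ℤ (γ ⊠ c) n (<-wellFounded n) (λ e → N≢0 w≢0 (ℤ.∣i∣≡0⇒i≡0 e)) h′
    δ = proj₁ result
    γc≡ = proj₂ result

  -- If (x/w)ᵏ is integral then so is x/w; here zᵏ is allowed a factor that is a unit at v.
  root-integralAt : ∀ v k {x w y c} → c ∉ᴾ v → x ^ suc k ⊠ c ≡ w ^ suc k ⊠ y → w ≢ 𝟎 → IntegralAt v x w
  root-integralAt v k {x} {w} {y} {c} c∉ eq w≢0 η ε xη≡wε η∈ =
    [ ^-∈ K , (λ c∈ → contradiction c∈ c∉) ]′ (prime (ε ^ K) c εc∈)
    where
    open PrimeIdeal (ideal v) hiding (_^_)
    open CExp (CommutativeRing.commutativeSemiring 𝕆-ring) using (^-distrib-*)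
    open 𝕆-Solver
    K = suc k
    εc≡ : ε ^ K ⊠ c ≡ η ^ K ⊠ y
    εc≡ = cancel (^-≢0 K w≢0) (trans (sym (⊠-assoc (w ^ K) (ε ^ K) c))
      (trans (cong (_⊠ c) (trans (sym (^-distrib-* w ε K)) (trans (cong (_^ K) (sym xη≡wε)) (^-distrib-* x η K))))
      (trans (solve 3 (λ a b c → a :* b :* c := b :* (a :* c)) refl (x ^ K) (η ^ K) c)
      (trans (cong (η ^ K ⊠_) eq) (solve 3 (λ a b c → a :* (b :* c) := b :* (a :* c)) refl (η ^ K) (w ^ K) y)))))
    εc∈ : ε ^ K ⊠ c ∈ᴾ v
    εc∈ = resp (sym εc≡) (absorbʳ y (absorbʳ (η ^ k) η∈))

  root-integral : ∀ k {x w y} → w ≢ 𝟎 → x ^ suc k ≡ w ^ suc k ⊠ y → w ∣ᴼ x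
  root-integral k {x} w≢0 eq = integral w≢0 (λ v →
    root-integralAt v k (PrimeIdeal.proper (ideal v)) (trans (CommutativeRing.*-identityʳ 𝕆-ring _) eq) w≢0)

  σ-∈⁻¹ : ∀ v {x} → σ x ∈ᴾ v → x ∈ᴾ conjugate v
  σ-∈⁻¹ (root pp r h) {a +√ b} h′ = ∣-multiple (+ 1) h′
    (solve 3 (λ a b r → a :+ :- r :* b := con (+ 1) :* (a :+ r :* :- b)) refl a b r)
    where open ℤ-Solve
  σ-∈⁻¹ (inert pp i) {a +√ b} (h , h′) = h , ∣-multiple ℤ.-1ℤ h′
    (trans (sym (ℤ.neg-involutive b)) (sym (ℤ.-1*i≡-i (ℤ.- b))))

  -- Valuations at the places away from 2

  root∣D : ∀ {p} → Prime p → ∀ r → + p ∣ r ℤ.* r ℤ.- D → + p ∣ D → + p ∣ r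
  root∣D pp r h p∣D = reduce (prime-∣-* pp r r (∣-combine (+ 1) (+ 1) h p∣D
    (solve 2 (λ k r → r :* r := con (+ 1) :* (r :* r :- k) :+ con (+ 1) :* k) refl D r)))
    where open ℤ-Solve

  D∣root : ∀ {p} r → + p ∣ r ℤ.* r ℤ.- D → + p ∣ r → + p ∣ D
  D∣root r h p∣r = ∣-combine ℤ.-1ℤ r h p∣r
    (solve 2 (λ k r → k := con ℤ.-1ℤ :* (r :* r :- k) :+ r :* r) refl D r)
    where open ℤ-Solve

  inert∤D : ∀ {p} → Prime p → Inert p → ¬ (+ p ∣ D)
  inert∤D pp i p∣D = ¬p∣1 pp (proj₂ (i ω (∣-multiple ℤ.-1ℤ p∣D
    (solve 1 (λ k → con (+ 0) :* con (+ 0) :- k :* (con (+ 1) :* con (+ 1)) := con ℤ.-1ℤ :* k) refl D))))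
    where open ℤ-Solve

  ω≢0 : ω ≢ 𝟎
  ω≢0 ()

  ω∈ : ∀ v → + char v ∣ D → ω ∈ᴾ v
  ω∈ (root pp r h) p∣D = ∣-multiple (+ 1) (root∣D pp r h p∣D)
    (solve 1 (λ r → con (+ 0) :+ r :* con (+ 1) := con (+ 1) :* r) refl r)
    where open ℤ-Solve
  ω∈ (inert pp i)  p∣D = contradiction p∣D (inert∤D pp i)

  -- For odd p the place is ramified exactly when p ∣ m, and √m is then a uniformiser because m is
  -- squarefree. When m is odd, 2 is ramified without dividing m, and neither choice works; hence
  -- the condition `char v ≢ 2` in `total`.
  uniformiser : ∀ v → Dec (+ char v ∣ D) → 𝕆
  uniformiser v (yes _) = ω
  uniformiser v (no  _) = ι (+ char v)

  uniformiser∈ : ∀ v d → uniformiser v d ∈ᴾ v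
  uniformiser∈ v (yes p∣D) = ω∈ v p∣D
  uniformiser∈ v (no  _)   = char∣⇒∈ v ℤ.∣-refl

  uniformiser≢0 : ∀ v d → uniformiser v d ≢ 𝟎
  uniformiser≢0 v (yes _) = ω≢0
  uniformiser≢0 v (no  _) = ι-≢0 (prime≢0 (char-prime v))

  module Valᴾ (v : Place) (d : Dec (+ char v ∣ D)) where
    open Valuation 𝕆-ring (ideal v) (uniformiser v d) (uniformiser∈ v d)
      (λ {x} {y} → cancel {uniformiser v d} {x} {y} (uniformiser≢0 v d)) public

  primitive-part : ∀ {p} → Prime p → ∀ x → x ≢ 𝟎 → ∃[ j ] ∃[ y ] x ≡ ι (+ p) ^ j ⊠ y × ¬ p ∣̂ y
  primitive-part {p} pp x = go x (<-wellFounded _)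
    where
    go : ∀ x → Acc ℕ._<_ ℤ.∣ N x ∣ → x ≢ 𝟎 → ∃[ j ] ∃[ y ] x ≡ ι (+ p) ^ j ⊠ y × ¬ p ∣̂ y
    go x (acc rs) x≢0 with p ∣̂? x
    ... | no  p∤x = 0 , x , sym (⊠-identityˡ x) , p∤x
    ... | yes p∣x = suc (proj₁ rest) , proj₁ (proj₂ rest) ,
          trans x≡ (trans (cong (ι (+ p) ⊠_) (proj₁ (proj₂ (proj₂ rest)))) (sym (⊠-assoc (ι (+ p)) (ι (+ p) ^ proj₁ rest) _))) ,
          proj₂ (proj₂ (proj₂ rest))
      where
      x₁ = proj₁ (extract {p} {x} p∣x)
      x≡ : x ≡ ι (+ p) ⊠ x₁
      x≡ = proj₂ (extract {p} {x} p∣x)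
      x₁≢0 : x₁ ≢ 𝟎
      x₁≢0 e = x≢0 (trans x≡ (trans (cong (ι (+ p) ⊠_) e) (⊠-zeroʳ _)))
      ∣N∣ : ℤ.∣ N x ∣ ≡ ℤ.∣ N x₁ ∣ ℕ.* (p ℕ.* p)
      ∣N∣ = trans (cong ℤ.∣_∣ (trans (cong N x≡) (trans (N-⊠ (ι (+ p)) x₁) (trans (cong (ℤ._* N x₁) (N-ι (+ p))) (ℤ.*-comm _ (N x₁))))))
        (trans (ℤ.abs-* (N x₁) _) (cong (ℤ.∣ N x₁ ∣ ℕ.*_) (ℤ.abs-* (+ p) (+ p))))
      1<p : 1 ℕ.< p
      1<p = ℕ.nonTrivial⇒n>1 p {{prime⇒nonTrivial pp}}
      N< : ℤ.∣ N x₁ ∣ ℕ.< ℤ.∣ N x ∣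
      N< = subst (ℤ.∣ N x₁ ∣ ℕ.<_) (sym ∣N∣) (ℕ.m<m*n ℤ.∣ N x₁ ∣ (p ℕ.* p)
        {{ℕ.≢-nonZero (λ e → N≢0 x₁≢0 (ℤ.∣i∣≡0⇒i≡0 e))}} (ℕ.*-mono-< 1<p 1<p))
      rest = go x₁ (rs N<) x₁≢0

  private
    -- The prime above p ∣ m is (√m): m₁ (p a₁ + b √m) = √m (m₁ b + a₁ √m) with m = p m₁.
    module Ramified {p} (pp : Prime p) r (h : + p ∣ r ℤ.* r ℤ.- D) (p∣D : + p ∣ D) where
      open ℤ-Solve
      v = root pp r h
      module V = Valℤ pp
      module W = Valᴾ v (yes p∣D)
      m₁ = ℤ.quotient p∣D

      D≡ : D ≡ m₁ ℤ.* + p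
      D≡ = ℤ.equality p∣D

      p∤m₁ : ¬ (+ p ∣ m₁)
      p∤m₁ (divides d m₁≡) = p²∤D pp (divides d (trans D≡ (trans (cong (ℤ._* + p) m₁≡) (ℤ.*-assoc d _ _))))

      p∣re : ∀ x → x ∈ᴾ v → + p ∣ re x
      p∣re x x∈ = ∣-combine (+ 1) (ℤ.- im x) x∈ (root∣D pp r h p∣D)
        (solve 3 (λ a b r → a := con (+ 1) :* (a :+ r :* b) :+ :- b :* r) refl (re x) (im x) r)

      step : ∀ x → x ∈ᴾ v → ∃[ x₁ ] ι m₁ ⊠ x ≡ ω ⊠ x₁ × m₁ ℤ.* N x ≡ ℤ.-1ℤ ℤ.* (+ p ℤ.* N x₁)
      step x@(a +√ b) x∈ = x₁ , m₁x≡ , Nx≡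
        where
        a₁ = ℤ.quotient (p∣re x x∈)
        a≡ : a ≡ a₁ ℤ.* + p
        a≡ = ℤ.equality (p∣re x x∈)
        x₁ : 𝕆
        x₁ = (m₁ ℤ.* b) +√ a₁
        m₁x≡ : ι m₁ ⊠ x ≡ ω ⊠ x₁
        m₁x≡ = trans (ι-⊠ m₁ x) (cong₂ _+√_
          (trans (cong (m₁ ℤ.*_) a≡)
            (trans (solve 4 (λ m a b p → m :* (a :* p) := con (+ 0) :* (m :* b) :+ m :* p :* (con (+ 1) :* a)) refl m₁ a₁ b (+ p))
              (cong (λ z → + 0 ℤ.* (m₁ ℤ.* b) ℤ.+ z ℤ.* (+ 1 ℤ.* a₁)) (sym D≡))))
          (solve 3 (λ m a b → m :* b := con (+ 0) :* a :+ con (+ 1) :* (m :* b)) refl m₁ a₁ b))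
        Nx≡ : m₁ ℤ.* N x ≡ ℤ.-1ℤ ℤ.* (+ p ℤ.* N x₁)
        Nx≡ = trans (cong₂ (λ y z → m₁ ℤ.* (y ℤ.* y ℤ.- z ℤ.* (b ℤ.* b))) a≡ D≡)
          (trans (solve 4 (λ m a b p → m :* (a :* p :* (a :* p) :- m :* p :* (b :* b))
                   := con ℤ.-1ℤ :* (p :* (m :* b :* (m :* b) :- m :* p :* (a :* a)))) refl m₁ a₁ b (+ p))
            (cong (λ z → ℤ.-1ℤ ℤ.* (+ p ℤ.* (m₁ ℤ.* b ℤ.* (m₁ ℤ.* b) ℤ.- z ℤ.* (a₁ ℤ.* a₁)))) (sym D≡)))

      lower : ∀ {n n₁ k} → m₁ ℤ.* n ≡ ℤ.-1ℤ ℤ.* (+ p ℤ.* n₁) → V.Val n (suc k) → V.Val n₁ k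
      lower {n} {n₁} {k} eq vn = cancel-p (V.Val-resp eq (V.Val-* (V.Val-unit p∤m₁) vn))
        where
        p∤-1 : ¬ (+ p ∣ ℤ.-1ℤ)
        p∤-1 h′ = ¬p∣1 pp (∣-multiple ℤ.-1ℤ h′ (sym (ℤ.-1*i≡-i ℤ.-1ℤ)))
        cancel-p : V.Val (ℤ.-1ℤ ℤ.* (+ p ℤ.* n₁)) (suc k) → V.Val n₁ k
        cancel-p (val {c} {d} p∤c p∤d eq) = val {c = c ℤ.* ℤ.-1ℤ} {d = d}
          (PrimeIdeal.∉-* (primeIdealℤ pp) p∤c p∤-1) p∤d
          (cancelℤ (+ p) (prime≢0 pp) (trans
            (solve 3 (λ c p n → p :* (c :* con ℤ.-1ℤ :* n) := c :* (con ℤ.-1ℤ :* (p :* n))) refl c (+ p) n₁)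
            (trans eq (ℤ.*-assoc (+ p) _ d))))

      raise : ∀ {x x₁ l} → ι m₁ ⊠ x ≡ ω ⊠ x₁ → W.Val x₁ l → W.Val x (suc l)
      raise {x} {x₁} {l} m₁x≡ (val {c} {d} c∉ d∉ eq) = val {c = c ⊠ ι m₁} {d = d}
        (∉-⊠ v c (ι m₁) c∉ (λ m₁∈ → p∤m₁ (∈⇒char∣ v m₁∈))) d∉
        (trans (⊠-assoc c (ι m₁) x) (trans (cong (c ⊠_) m₁x≡)
          (trans (swap c ω x₁)
          (trans (cong (ω ⊠_) eq) (sym (⊠-assoc ω (ω ^ l) d))))))
        where
        swap : ∀ c w x → c ⊠ (w ⊠ x) ≡ w ⊠ (c ⊠ x)
        swap = 𝕆-Solver.solve 3 (λ c w x → c 𝕆-Solver.:* (w 𝕆-Solver.:* x) 𝕆-Solver.:= w 𝕆-Solver.:* (c 𝕆-Solver.:* x)) refl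

      -- Each division by √m lowers the p-adic valuation of the norm by one, which bounds the
      -- recursion.
      total-from-norm : ∀ k x → V.Val (N x) k → Dec (x ∈ᴾ v) → ∃[ l ] W.Val x l
      total-from-norm k       x vN (no x∉)  = 0 , W.Val-unit x∉
      total-from-norm zero    x (val {c} {d} p∤c p∤d eq) (yes x∈) =
        contradiction (∣-multiple c (∈⇒char∣N v {x} x∈) (trans (sym (ℤ.*-identityˡ d)) (sym eq))) p∤d
      total-from-norm (suc k) x vN (yes x∈) = suc (proj₁ rest) , raise (proj₁ (proj₂ next)) (proj₂ rest)
        where
        next = step x x∈
        x₁ = proj₁ next
        rest = total-from-norm k x₁ (lower (proj₂ (proj₂ next)) vN) (PrimeIdeal.𝔓? (ideal v) x₁)

  ι-^ : ∀ n k → ι (n Exp-ℤ.^ k) ≡ ι n ^ k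
  ι-^ n zero    = refl
  ι-^ n (suc k) = trans (ι-* n _) (cong (ι n ⊠_) (ι-^ n k))

  private
    inert-total : ∀ {p} (pp : Prime p) i (p∤D : ¬ (+ p ∣ D)) x → x ≢ 𝟎 →
                  ∃[ k ] Valᴾ.Val (inert pp i) (no p∤D) x k
    inert-total pp i p∤D x x≢0 = case primitive-part pp x x≢0 of λ (j , y , x≡ , p∤y) →
      j , val {c = ι (+ 1)} {d = y} (PrimeIdeal.proper (ideal (inert pp i))) p∤y
        (trans (⊠-identityˡ x) x≡)

    module Split {p} (pp : Prime p) r (h : + p ∣ r ℤ.* r ℤ.- D) (p∤D : ¬ (+ p ∣ D)) (p≢2 : p ≢ 2) where
      v = root pp r h
      open Valᴾ v (no p∤D)

      p∤2r : ¬ (+ p ∣ + 2 ℤ.* r)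
      p∤2r h′ = [ (λ p∣2 → p≢2 (ℕ.≤-antisym (ℕ∣.∣⇒≤ (ℤ.∣⇒∣ᵤ p∣2)) (ℕ.nonTrivial⇒n>1 p {{prime⇒nonTrivial pp}})))
                , (λ p∣r → p∤D (D∣root r h p∣r)) ]′ (prime-∣-* pp (+ 2) r h′)

      σ∉ : ∀ y → ¬ p ∣̂ y → y ∈ᴾ v → σ y ∉ᴾ v
      σ∉ y p∤y y∈ σy∈ = p∤y (split-∩ pp r h p∤2r {y} y∈ (σ-∈⁻¹ v {y} σy∈))

      -- As σ y is a unit at v, the elements y and N y = y σ y have the same valuation there; p
      -- itself is a uniformiser because it is unramified.
      from-norm : ∀ y k → σ y ∉ᴾ v → Valℤ.Val pp (N y) k → Val y k
      from-norm y k σy∉ (val {c} {n} p∤c p∤n eq) = val {c = ι c ⊠ σ y} {d = ι n}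
        (∉-⊠ v (ι c) (σ y) (λ c∈ → p∤c (∈⇒char∣ v c∈)) σy∉) (λ n∈ → p∤n (∈⇒char∣ v n∈))
        (trans (⊠-assoc (ι c) (σ y) y) (trans (cong (ι c ⊠_) (trans (⊠-comm (σ y) y) (x⊠σx y)))
        (trans (sym (ι-* c (N y))) (trans (cong ι eq) (trans (ι-* _ n) (cong (_⊠ ι n) (ι-^ (+ p) k)))))))

      ϖʲ : ∀ j → Val (ι (+ p) ^ j) j
      ϖʲ j = val {c = ι (+ 1)} {d = ι (+ 1)} (PrimeIdeal.proper (ideal v)) (PrimeIdeal.proper (ideal v))
        (⊠-comm (ι (+ 1)) (ι (+ p) ^ j))

      primitive-total : ∀ y → y ≢ 𝟎 → ¬ p ∣̂ y → Dec (y ∈ᴾ v) → ∃[ k ] Val y k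
      primitive-total y y≢0 p∤y (no y∉)  = 0 , Val-unit y∉
      primitive-total y y≢0 p∤y (yes y∈) = case Valℤ.total pp (N y) (N≢0 y≢0) of λ (k , vN) →
        k , from-norm y k (σ∉ y p∤y y∈) vN

      split-total : ∀ x → x ≢ 𝟎 → ∃[ k ] Val x k
      split-total x x≢0 = case primitive-part pp x x≢0 of λ (j , y , x≡ , p∤y) →
        case primitive-total y (λ e → p∤y (subst (p ∣̂_) (sym e) (ℤ.∣0 , ℤ.∣0))) p∤y (PrimeIdeal.𝔓? (ideal v) y) of λ
          (k , vy) → j ℕ.+ k , Val-resp (sym x≡) (Val-* (ϖʲ j) vy)

  total : ∀ v → char v ≢ 2 → ∀ d x → x ≢ 𝟎 → ∃[ k ] Valᴾ.Val v d x k
  total (root pp r h) p≢2 (no p∤D)  x x≢0 = Split.split-total pp r h p∤D p≢2 x x≢0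
  total (inert pp i)  p≢2 (no p∤D)  x x≢0 = inert-total pp i p∤D x x≢0
  total (inert pp i)  p≢2 (yes p∣D) x x≢0 = contradiction p∣D (inert∤D pp i)
  total (root pp r h) p≢2 (yes p∣D) x x≢0 = case Valℤ.total pp (N x) (N≢0 x≢0) of λ (k , vN) →
    Ramified.total-from-norm pp r h p∣D k x vN (PrimeIdeal.𝔓? (ideal (root pp r h)) x)

  -- The uniformiser, and with it `Val`, depends on the decision d; quantifying over d lets a caller
  -- supply whichever proof it has.
  EvenAt : Place → 𝕆 → Set
  EvenAt v x = ∀ d → ∃[ k ] Valᴾ.Val v d x (k ℕ.+ k)

  odd≢even : ∀ j k → suc (j ℕ.+ j) ≢ k ℕ.+ k
  odd≢even j k e = ℕ.even≢odd k j (trans (cong (k ℕ.+_) (ℕ.+-identityʳ k))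
    (trans (sym e) (cong (λ z → suc (j ℕ.+ z)) (sym (ℕ.+-identityʳ j)))))

  even-sum : ∀ j k → (j ℕ.+ j) ℕ.+ (k ℕ.+ k) ≡ (j ℕ.+ k) ℕ.+ (j ℕ.+ k)
  even-sum j k = trans (ℕ.+-assoc j j _) (trans (cong (j ℕ.+_) (trans (sym (ℕ.+-assoc j k k))
    (trans (cong (ℕ._+ k) (ℕ.+-comm j k)) (ℕ.+-assoc k j k)))) (sym (ℕ.+-assoc j k _)))

  even-cancel : ∀ i j k → (i ℕ.+ i) ℕ.+ j ≡ k ℕ.+ k → ∃[ l ] j ≡ l ℕ.+ l
  even-cancel zero    j k       e = k , e
  even-cancel (suc i) j (suc k) e = even-cancel i j k (ℕ.suc-injective (ℕ.suc-injective
    (trans (cong (λ z → suc (z ℕ.+ j)) (sym (ℕ.+-suc i i))) (trans e (cong suc (ℕ.+-suc k k))))))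

  -- Squarefree parts of norms of elements with even valuations

  cofactor : ∀ {p f} → Prime p → SquareFree ℤ.∣ f ∣ → (h : + p ∣ f) → ¬ (+ p ∣ ℤ.quotient h)
  cofactor {p} {f} pp sf (divides f₁ f≡) (divides e f₁≡) =
    sf p (ℕ.nonTrivial⇒n>1 p {{prime⇒nonTrivial pp}}) (ℤ.∣⇒∣ᵤ {+ (p ℕ.* p)} {f} (divides e
      (trans f≡ (trans (cong (ℤ._* + p) f₁≡) (trans (ℤ.*-assoc e _ _) (cong (e ℤ.*_) (sym (ℤ.pos-* p p))))))))

  factor≢0 : ∀ {n} f k → n ≢ + 0 → n ≡ f ℤ.* (k ℤ.* k) → k ≢ + 0
  factor≢0 f k n≢0 n≡ refl = n≢0 (trans n≡ (trans (cong (f ℤ.*_) (ℤ.*-zeroˡ (+ 0))) (ℤ.*-zeroʳ f)))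

  val-squarefree : ∀ v (p∤D : ¬ (+ char v ∣ D)) {f} → SquareFree ℤ.∣ f ∣ → + char v ∣ f →
                   Valᴾ.Val v (no p∤D) (ι f) 1
  val-squarefree v p∤D {f} sf p∣f@(divides f₁ f≡) = Val-resp (sym (trans (cong ι f≡) (ι-* f₁ _)))
    (Val-* (Val-unit (λ f₁∈ → cofactor {f = f} (char-prime v) sf p∣f (∈⇒char∣ v f₁∈))) Val-ϖ)
    where open Valᴾ v (no p∤D)

  squarefree-factor : ∀ v → char v ≢ 2 → (p∤D : ¬ (+ char v ∣ D)) → ∀ {n f k e} → n ≢ + 0 →
    Valᴾ.Val v (no p∤D) (ι n) (e ℕ.+ e) → n ≡ f ℤ.* (k ℤ.* k) → SquareFree ℤ.∣ f ∣ → ¬ (+ char v ∣ f)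
  squarefree-factor v p≢2 p∤D {n} {f} {k} {e} n≢0 vn n≡ sf p∣f =
    case total v p≢2 (no p∤D) (ι k) (ι-≢0 (factor≢0 f k n≢0 n≡)) of λ (j , vk) →
      odd≢even j e (Val-unique (Val-resp (sym (trans (cong ι n≡) (trans (ι-* f _) (cong (ι f ⊠_) (ι-* k k)))))
        (Val-* (val-squarefree v p∤D {f} sf p∣f) (Val-* vk vk))) vn)
    where open Valᴾ v (no p∤D)

  private
    val-conjugate : ∀ {p} (pp : Prime p) r h (p∤D : ¬ (+ p ∣ D)) {x k} →
      Valᴾ.Val (conjugate (root pp r h)) (no p∤D) x k → Valᴾ.Val (root pp r h) (no p∤D) (σ x) k
    val-conjugate {p} pp r h p∤D {x} {k} (val {c} {d} c∉ d∉ eq) = val {c = σ c} {d = σ d}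
      (λ c∈ → c∉ (σ-∈⁻¹ (root pp r h) {c} c∈)) (λ d∈ → d∉ (σ-∈⁻¹ (root pp r h) {d} d∈)) (σ-eq {c} {x} {d} k eq)
      where
      σ-eq : ∀ {c x d} k → c ⊠ x ≡ ι (+ p) ^ k ⊠ d → σ c ⊠ σ x ≡ ι (+ p) ^ k ⊠ σ d
      σ-eq {c} {x} {d} k eq = trans (sym (σ-⊠ c x)) (trans (cong σ eq) (trans (σ-⊠ (ι (+ p) ^ k) d)
        (cong (_⊠ σ d) (trans (cong σ (sym (ι-^ (+ p) k))) (ι-^ (+ p) k)))))

    val-conjugate-inert : ∀ {p} (pp : Prime p) i (p∤D : ¬ (+ p ∣ D)) {x k} →
      Valᴾ.Val (inert pp i) (no p∤D) x k → Valᴾ.Val (inert pp i) (no p∤D) (σ x) k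
    val-conjugate-inert {p} pp i p∤D {x} {k} (val {c} {d} c∉ d∉ eq) = val {c = σ c} {d = σ d}
      (σ-∉ (inert pp i) {c} c∉) (σ-∉ (inert pp i) {d} d∉) (trans (sym (σ-⊠ c x)) (trans (cong σ eq)
        (trans (σ-⊠ (ι (+ p) ^ k) d) (cong (_⊠ σ d) (trans (cong σ (sym (ι-^ (+ p) k))) (ι-^ (+ p) k))))))

    N-^ : ∀ x k → N (x ^ k) ≡ N x Exp-ℤ.^ k
    N-^ x zero    = trans (N-ι (+ 1)) (ℤ.*-identityˡ (+ 1))
    N-^ x (suc k) = trans (N-⊠ x (x ^ k)) (cong (N x ℤ.*_) (N-^ x k))

    -- At a ramified place the valuation of x is that of its norm at p.
    ramified-norm : ∀ {p} (pp : Prime p) r h (p∣D : + p ∣ D) {x k} →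
      Valᴾ.Val (root pp r h) (yes p∣D) x k → Valℤ.Val pp (N x) (k ℕ.* 1)
    ramified-norm {p} pp r h p∣D {x} {k} (val {c} {d} c∉ d∉ eq) = strip (V.Val-resp (sym norms) (V.Val-* (V.Val-^ k vω) (V.Val-unit (p∤N d d∉))))
      where
      module V = Valℤ pp
      v = root pp r h
      p∤N : ∀ x → x ∉ᴾ v → ¬ (+ p ∣ N x)
      p∤N (a +√ b) x∉ p∣N = x∉ (∣-combine (+ 1) b (reduce (prime-∣-* pp a a (∣-combine (+ 1) (b ℤ.* b) p∣N p∣D
          (solve 3 (λ k a b → a :* a := con (+ 1) :* (a :* a :- k :* (b :* b)) :+ b :* b :* k) refl D a b))))
        (root∣D pp r h p∣D) (solve 3 (λ a b r → a :+ r :* b := con (+ 1) :* a :+ b :* r) refl a b r))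
        where open ℤ-Solve
      norms : N c ℤ.* N x ≡ N ω Exp-ℤ.^ k ℤ.* N d
      norms = trans (sym (N-⊠ c x)) (trans (cong N eq) (trans (N-⊠ (ω ^ k) d) (cong (ℤ._* N d) (N-^ ω k))))
      vω : V.Val (N ω) 1
      vω = V.Val-resp (trans (cong (ℤ.- m₁ ℤ.*_) refl) (sym Nω)) (V.Val-* (V.Val-unit p∤m₁) V.Val-ϖ)
        where
        open ℤ-Solve
        m₁ = ℤ.quotient p∣D
        Nω : N ω ≡ ℤ.- m₁ ℤ.* + p
        Nω = trans (cong (λ z → + 0 ℤ.* + 0 ℤ.- z ℤ.* (+ 1 ℤ.* + 1)) (ℤ.equality p∣D))
          (solve 2 (λ m p → con (+ 0) :* con (+ 0) :- m :* p :* (con (+ 1) :* con (+ 1)) := :- m :* p) refl m₁ (+ p))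
        p∤m₁ : ¬ (+ p ∣ ℤ.- m₁)
        p∤m₁ (divides e eq) = p²∤D pp (divides (ℤ.- e) (trans (ℤ.equality p∣D)
          (trans (solve 2 (λ m p → m :* p := :- (:- m :* p)) refl m₁ (+ p)) (trans (cong (λ z → ℤ.- (z ℤ.* + p)) eq)
            (solve 2 (λ e p → :- (e :* p :* p) := :- e :* (p :* p)) refl e (+ p))))))
      strip : V.Val (N c ℤ.* N x) (k ℕ.* 1 ℕ.+ 0) → V.Val (N x) (k ℕ.* 1)
      strip vcx = subst (V.Val (N x)) (ℕ.+-identityʳ (k ℕ.* 1)) (drop-unit vcx)
        where
        drop-unit : ∀ {l} → V.Val (N c ℤ.* N x) l → V.Val (N x) l
        drop-unit (val {c′} {d′} c′∉ d′∉ eq′) = val {c = c′ ℤ.* N c} {d = d′}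
          (PrimeIdeal.∉-* (primeIdealℤ pp) c′∉ (p∤N c c∉)) d′∉ (trans (ℤ.*-assoc c′ (N c) (N x)) eq′)

  -- x and σ x have the same valuation at an inert place, so the norm of every nonzero x has even
  -- valuation at p.
  inert-norm-squarefree-part : ∀ {p} → Prime p → p ≢ 2 → Inert p → ∀ {x f k} → x ≢ 𝟎 →
    N x ≡ f ℤ.* (k ℤ.* k) → SquareFree ℤ.∣ f ∣ → ¬ (+ p ∣ f)
  inert-norm-squarefree-part {p} pp p≢2 i {x} {f} {k} x≢0 N≡ sf p∣f =
    case total v p≢2 (no p∤D) x x≢0 of λ (e , vx) →
      squarefree-factor v p≢2 p∤D {f = f} {k} {e} (N≢0 x≢0)
        (Val-resp (x⊠σx x) (Val-* vx (val-conjugate-inert pp i p∤D {x} vx))) N≡ sf p∣f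
    where
    v = inert pp i
    p∤D = inert∤D pp i
    open Valᴾ v (no p∤D)

  -- The valuation of N x at p is the sum of the valuations of x at the two places when p splits,
  -- and the single valuation of x when p ramifies. A factor p of the squarefree part f would make
  -- it odd.
  norm-squarefree-part : ∀ {p} → Prime p → p ≢ 2 → ∀ {x f k} → x ≢ 𝟎 → (∀ v → char v ≡ p → EvenAt v x) →
    N x ≡ f ℤ.* (k ℤ.* k) → SquareFree ℤ.∣ f ∣ → ¬ (+ p ∣ f)
  norm-squarefree-part {p} pp p≢2 {x} {f} {k} x≢0 even N≡ sf p∣f = case root-or-inert pp of λ
    { (inj₂ i)       → inert-norm-squarefree-part pp p≢2 i {x} {f} {k} x≢0 N≡ sf p∣f
    ; (inj₁ (r , h)) → case + p ∣? D of λ { (no p∤D) → split-case r h p∤D ; (yes p∣D) → ramified-case r h p∣D } }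
    where
    split-case : ∀ r (h : + p ∣ r ℤ.* r ℤ.- D) → ¬ (+ p ∣ D) → ⊥
    split-case r h p∤D = case even v refl (no p∤D) of λ (e , vx) → case even (conjugate v) refl (no p∤D) of λ (e′ , vx′) →
      squarefree-factor v p≢2 p∤D {f = f} {k} {e ℕ.+ e′} (N≢0 x≢0)
        (Val-resp (x⊠σx x) (subst (Val (x ⊠ σ x)) (even-sum e e′) (Val-* vx (val-conjugate pp r h p∤D {x} vx′)))) N≡ sf p∣f
      where
      v = root pp r h
      open Valᴾ v (no p∤D)
    ramified-case : ∀ r (h : + p ∣ r ℤ.* r ℤ.- D) → + p ∣ D → ⊥
    ramified-case r h p∣D = case even (root pp r h) refl (yes p∣D) of λ (e , vx) →
      case Valℤ.total pp k (factor≢0 f k (N≢0 x≢0) N≡) of λ (j , vk) →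
        odd≢even j e (trans (V.Val-unique (V.Val-resp (sym N≡) (V.Val-* vf (V.Val-* vk vk))) (ramified-norm pp r h p∣D {x} vx))
          (ℕ.*-identityʳ (e ℕ.+ e)))
      where
      module V = Valℤ pp
      vf : V.Val f 1
      vf = V.Val-resp (sym (ℤ.equality p∣f)) (V.Val-* (V.Val-unit (cofactor {f = f} pp sf p∣f)) V.Val-ϖ)

  -- Since p is unramified, p ∣ f would give f valuation 1 and f x an odd valuation, against f x =
  -- y².
  square-class-factor : ∀ v → char v ≢ 2 → ¬ (+ char v ∣ D) → ∀ {x f y} → y ≢ 𝟎 → EvenAt v x →
    ι f ⊠ x ≡ y ⊠ y → SquareFree ℤ.∣ f ∣ → ¬ (+ char v ∣ f)
  square-class-factor v p≢2 p∤D {x} {f} {y} y≢0 even eq sf p∣f =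
    case total v p≢2 (no p∤D) y y≢0 of λ (j , vy) → case even (no p∤D) of λ (k , vx) →
      odd≢even k j (Val-unique (Val-resp eq (Val-* (val-squarefree v p∤D {f} sf p∣f) vx)) (Val-* vy vy))
    where open Valᴾ v (no p∤D)

  place-above : ∀ {p} → Prime p → ∃[ v ] char v ≡ p
  place-above pp = case root-or-inert pp of λ { (inj₁ (r , h)) → root pp r h , refl ; (inj₂ i) → inert pp i , refl }

  -- Hilbert 90 and square classes

  hilbert : ∀ x n → N x ≡ n ℤ.* n → (x ⊞ ι n) ⊠ (x ⊞ ι n) ≡ ι (+ 2 ℤ.* re x ℤ.+ + 2 ℤ.* n) ⊠ x
  hilbert (a +√ b) n Nx≡ = trans (cong₂ _+√_
      (trans (solve 4 (λ k a b n → (a :+ n) :* (a :+ n) :+ k :* ((b :+ con (+ 0)) :* (b :+ con (+ 0)))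
               := (con (+ 2) :* a :+ con (+ 2) :* n) :* a :+ (n :* n :- (a :* a :- k :* (b :* b)))) refl D a b n)
        (trans (cong (λ z → c ℤ.* a ℤ.+ (n ℤ.* n ℤ.- z)) Nx≡)
          (solve 2 (λ u v → u :+ (v :- v) := u) refl (c ℤ.* a) (n ℤ.* n))))
      (solve 3 (λ a b n → (a :+ n) :* (b :+ con (+ 0)) :+ (b :+ con (+ 0)) :* (a :+ n)
               := (con (+ 2) :* a :+ con (+ 2) :* n) :* b) refl a b n))
    (sym (ι-⊠ c (a +√ b)))
    where
    open ℤ-Solve
    c = + 2 ℤ.* a ℤ.+ + 2 ℤ.* n

  ^2≡ : ∀ x → x ^ 2 ≡ x ⊠ x
  ^2≡ x = cong (x ⊠_) (CommutativeRing.*-identityʳ 𝕆-ring x)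

  square-root : ∀ {x w y} → w ≢ 𝟎 → x ⊠ x ≡ w ⊠ w ⊠ y → w ∣ᴼ x
  square-root {x} {w} {y} w≢0 eq = root-integral 1 {x} {w} {y} w≢0
    (trans (^2≡ x) (trans eq (cong (_⊠ y) (sym (^2≡ w)))))

  -- Hilbert 90 in the form (x + n)² = x (Tr x + 2n) for N x = n²: up to squares x is an integer.
  square-class : ∀ x n → N x ≡ n ℤ.* n → x ≢ 𝟎 → + 2 ℤ.* re x ℤ.+ + 2 ℤ.* n ≢ + 0 →
    ∃[ f ] ∃[ y ] ι f ⊠ x ≡ y ⊠ y × y ≢ 𝟎 × SquareFree ℤ.∣ f ∣ ×
    ∃[ k ] + 2 ℤ.* re x ℤ.+ + 2 ℤ.* n ≡ f ℤ.* (k ℤ.* k)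
  square-class x n Nx≡ x≢0 c≢0 = decompose (square-part c c≢0)
    where
    c = + 2 ℤ.* re x ℤ.+ + 2 ℤ.* n
    z = x ⊞ ι n
    open 𝕆-Solver
    eq : ∀ f k → c ≡ f ℤ.* (k ℤ.* k) → z ⊠ z ≡ ι k ⊠ ι k ⊠ (ι f ⊠ x)
    eq f k c≡ = trans (hilbert x n Nx≡) (trans (cong (_⊠ x) (trans (cong ι c≡) (trans (ι-* f _) (cong (ι f ⊠_) (ι-* k k)))))
      (solve 3 (λ f k x → f :* (k :* k) :* x := k :* k :* (f :* x)) refl (ι f) (ι k) x))
    fx≡ : ∀ f k y → k ≢ + 0 → c ≡ f ℤ.* (k ℤ.* k) → z ≡ ι k ⊠ y → ι f ⊠ x ≡ y ⊠ y
    fx≡ f k y k≢0 c≡ z≡ = cancel (⊠-≢0 (ι-≢0 k≢0) (ι-≢0 k≢0)) (trans (sym (eq f k c≡)) (trans (cong₂ _⊠_ z≡ z≡)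
      (solve 2 (λ k y → k :* y :* (k :* y) := k :* k :* (y :* y)) refl (ι k) y)))
    y≢0 : ∀ f k y → f ≢ + 0 → k ≢ + 0 → c ≡ f ℤ.* (k ℤ.* k) → z ≡ ι k ⊠ y → y ≢ 𝟎
    y≢0 f k y f≢0 k≢0 c≡ z≡ y≡0 = ⊠-≢0 (ι-≢0 f≢0) x≢0 (trans (fx≡ f k y k≢0 c≡ z≡)
      (trans (cong (y ⊠_) y≡0) (⊠-zeroʳ y)))
    extract-root : ∀ f k → c ≡ f ℤ.* (k ℤ.* k) → k ≢ + 0 → f ≢ + 0 → SquareFree ℤ.∣ f ∣ → ι k ∣ᴼ z →
      ∃[ f ] ∃[ y ] ι f ⊠ x ≡ y ⊠ y × y ≢ 𝟎 × SquareFree ℤ.∣ f ∣ × ∃[ k ] c ≡ f ℤ.* (k ℤ.* k)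
    extract-root f k c≡ k≢0 f≢0 sf (y , z≡) =
      f , y , fx≡ f k y k≢0 c≡ z≡ , y≢0 f k y f≢0 k≢0 c≡ z≡ , sf , k , c≡
    decompose : ∃[ f ] ∃[ k ] c ≡ f ℤ.* (k ℤ.* k) × k ≢ + 0 × f ≢ + 0 × SquareFree ℤ.∣ f ∣ →
      ∃[ f ] ∃[ y ] ι f ⊠ x ≡ y ⊠ y × y ≢ 𝟎 × SquareFree ℤ.∣ f ∣ × ∃[ k ] c ≡ f ℤ.* (k ℤ.* k)
    -- Here (x + n)² = k² · f x, and integrality of square roots allows k to be divided out of x + n
    -- without unique factorisation.
    decompose (f , k , c≡ , k≢0 , f≢0 , sf) = extract-root f k c≡ k≢0 f≢0 sf
      (square-root {z} {ι k} {ι f ⊠ x} (ι-≢0 k≢0) (eq f k c≡))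

  -- Elliptic curves with everywhere good reduction

  module K = CommutativeRing (ℚ√ m)
  module EK = EllipticCurves (ℚ√ m)
  module E𝕆 = EllipticCurves 𝕆-ring

  -- ℤ[√m] inside ℚ(√m) as its ring of integers

  private
    ⟦_⟧ : ℤ → ℚ
    ⟦ a ⟧ = a ℚ./ 1

    ⟦⟧≃ : ∀ a → toℚᵘ ⟦ a ⟧ ℚᵘ.≃ mkℚᵘ a 0
    ⟦⟧≃ a = ℚ.toℚᵘ-fromℚᵘ (mkℚᵘ a 0)

    ⟦⟧-+ : ∀ a b → ⟦ a ℤ.+ b ⟧ ≡ ⟦ a ⟧ ℚ.+ ⟦ b ⟧
    ⟦⟧-+ a b = ℚ.toℚᵘ-injective (ℚᵘ.≃-trans (⟦⟧≃ (a ℤ.+ b)) (ℚᵘ.≃-sym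
      (ℚᵘ.≃-trans (ℚ.toℚᵘ-homo-+ ⟦ a ⟧ ⟦ b ⟧) (ℚᵘ.≃-trans (ℚᵘ.+-cong (⟦⟧≃ a) (⟦⟧≃ b))
        (*≡* (cong (ℤᵇ._* + 1) (cong₂ ℤ._+_ (ℤᵖ.*-identityʳ a) (ℤᵖ.*-identityʳ b))))))))

    ⟦⟧-* : ∀ a b → ⟦ a ℤ.* b ⟧ ≡ ⟦ a ⟧ ℚ.* ⟦ b ⟧
    ⟦⟧-* a b = ℚ.toℚᵘ-injective (ℚᵘ.≃-trans (⟦⟧≃ (a ℤ.* b)) (ℚᵘ.≃-sym
      (ℚᵘ.≃-trans (ℚ.toℚᵘ-homo-* ⟦ a ⟧ ⟦ b ⟧) (ℚᵘ.≃-trans (ℚᵘ.*-cong (⟦⟧≃ a) (⟦⟧≃ b))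
        (*≡* (cong (ℤᵇ._* + 1) (sym (ℤ.*-def a b))))))))

    ⟦⟧-neg : ∀ a → ⟦ ℤ.- a ⟧ ≡ ℚ.- ⟦ a ⟧
    ⟦⟧-neg a = ℚ.toℚᵘ-injective (ℚᵘ.≃-trans (⟦⟧≃ (ℤ.- a)) (ℚᵘ.≃-sym
      (ℚᵘ.≃-trans (ℚ.toℚᵘ-homo‿- ⟦ a ⟧) (ℚᵘ.-‿cong (⟦⟧≃ a)))))

    ⟦⟧-injective : ∀ {a b} → ⟦ a ⟧ ≡ ⟦ b ⟧ → a ≡ b
    ⟦⟧-injective {a} {b} eq with ℚᵘ.≃-trans (ℚᵘ.≃-sym (⟦⟧≃ a)) (ℚᵘ.≃-trans (ℚᵘ.≃-reflexive (cong toℚᵘ eq)) (⟦⟧≃ b))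
    ... | *≡* e = trans (sym (ℤᵖ.*-identityʳ a)) (trans e (ℤᵖ.*-identityʳ b))

    ↧-clears : ∀ p → p ℚ.* ⟦ ↧ p ⟧ ≡ ⟦ ↥ p ⟧
    ↧-clears p@(mkℚ n d _) = ℚ.toℚᵘ-injective (ℚᵘ.≃-trans (ℚ.toℚᵘ-homo-* p ⟦ ↧ p ⟧)
      (ℚᵘ.≃-trans (ℚᵘ.*-cong {mkℚᵘ n d} ℚᵘ.≃-refl (⟦⟧≃ (+ suc d))) (ℚᵘ.≃-trans
        (*≡* (trans (ℤᵖ.*-identityʳ (n ℤᵇ.* + suc d)) (cong (λ z → n ℤᵇ.* + suc z) (sym (ℕ.*-identityʳ d)))))
        (ℚᵘ.≃-sym (⟦⟧≃ n)))))

    ⟦⟧-cancel : ∀ {n p q} → n ≢ + 0 → p ℚ.* ⟦ n ⟧ ≡ q ℚ.* ⟦ n ⟧ → p ≡ q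
    ⟦⟧-cancel {n} {p} {q} n≢0 eq = trans (undo p) (trans (cong (ℚ._* ℚ.1/ ⟦ n ⟧) eq) (sym (undo q)))
      where
      instance
        nz : ℚ.NonZero ⟦ n ⟧
        nz = ℚ.≢-nonZero (λ e → n≢0 (⟦⟧-injective e))
      undo : ∀ p → p ≡ p ℚ.* ⟦ n ⟧ ℚ.* ℚ.1/ ⟦ n ⟧
      undo p = sym (trans (ℚ.*-assoc p ⟦ n ⟧ _) (trans (cong (p ℚ.*_) (ℚ.*-inverseʳ ⟦ n ⟧)) (ℚ.*-identityʳ p)))

  private
    pair : ∀ {a b c d} → a ≡ c → b ≡ d → _≡_ {A = ℚ[√ m ]} (a + b √) (c + d √)
    pair = cong₂ _+_√

  embed : 𝕆 → ℚ[√ m ]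
  embed (a +√ b) = ⟦ a ⟧ + ⟦ b ⟧ √

  embed-+ : ∀ x y → embed (x ⊞ y) ≡ embed x K.+ embed y
  embed-+ (a +√ b) (c +√ d) = pair (⟦⟧-+ a c) (⟦⟧-+ b d)

  embed-* : ∀ x y → embed (x ⊠ y) ≡ embed x K.* embed y
  embed-* (a +√ b) (c +√ d) = pair
    (trans (⟦⟧-+ (a ℤ.* c) _) (cong₂ ℚ._+_ (⟦⟧-* a c) (trans (⟦⟧-* D _) (cong (⟦ D ⟧ ℚ.*_) (⟦⟧-* b d)))))
    (trans (⟦⟧-+ (a ℤ.* d) _) (cong₂ ℚ._+_ (⟦⟧-* a d) (⟦⟧-* b c)))

  embed-neg : ∀ x → embed (⊖ x) ≡ K.- embed x
  embed-neg (a +√ b) = pair (⟦⟧-neg a) (⟦⟧-neg b)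

  embed-injective : ∀ {x y} → embed x ≡ embed y → x ≡ y
  embed-injective {a +√ b} {c +√ d} eq = cong₂ _+√_ (⟦⟧-injective (cong ℚ[√_].rational eq)) (⟦⟧-injective (cong ℚ[√_].irrational eq))

  private
    *-ι : ∀ p r n → (p + r √) K.* embed (ι n) ≡ (p ℚ.* ⟦ n ⟧) + (r ℚ.* ⟦ n ⟧) √
    *-ι p r n = pair
      (trans (cong (p ℚ.* ⟦ n ⟧ ℚ.+_) (trans (cong (⟦ D ⟧ ℚ.*_) (ℚ.*-zeroʳ r)) (ℚ.*-zeroʳ ⟦ D ⟧))) (ℚ.+-identityʳ _))
      (trans (cong (ℚ._+ r ℚ.* ⟦ n ⟧) (ℚ.*-zeroʳ p)) (ℚ.+-identityˡ _))

  fraction : ∀ x → ∃[ n ] ∃[ γ ] n ≢ + 0 × x K.* embed (ι n) ≡ embed γ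
  fraction (p + r √) = n , γ , n≢0 , trans (*-ι p r n) (pair
      (trans (cong (p ℚ.*_) (⟦⟧-* (↧ p) (↧ r))) (trans (sym (ℚ.*-assoc p _ _)) (trans (cong (ℚ._* ⟦ ↧ r ⟧) (↧-clears p)) (sym (⟦⟧-* (↥ p) (↧ r))))))
      (trans (cong (r ℚ.*_) (trans (cong ⟦_⟧ (ℤ.*-comm (↧ p) (↧ r))) (⟦⟧-* (↧ r) (↧ p)))) (trans (sym (ℚ.*-assoc r _ _)) (trans (cong (ℚ._* ⟦ ↧ p ⟧) (↧-clears r)) (sym (⟦⟧-* (↥ r) (↧ p)))))))
    where
    n = ↧ p ℤ.* ↧ r
    γ : 𝕆
    γ = (↥ p ℤ.* ↧ r) +√ (↥ r ℤ.* ↧ p)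
    n≢0 : n ≢ + 0
    n≢0 e = [ (λ ()) , (λ ()) ]′ (ℤ.i*j≡0⇒i≡0∨j≡0 (↧ p) e)

  K-cancel : ∀ {n x y} → n ≢ + 0 → x K.* embed (ι n) ≡ y K.* embed (ι n) → x ≡ y
  K-cancel {n} {p + r √} {p′ + r′ √} n≢0 eq = pair (⟦⟧-cancel n≢0 (cong ℚ[√_].rational eq′)) (⟦⟧-cancel n≢0 (cong ℚ[√_].irrational eq′))
    where
    eq′ : (p ℚ.* ⟦ n ⟧) + (r ℚ.* ⟦ n ⟧) √ ≡ (p′ ℚ.* ⟦ n ⟧) + (r′ ℚ.* ⟦ n ⟧) √
    eq′ = trans (sym (*-ι p r n)) (trans eq (*-ι p′ r′ n))

  module Hom = InvariantsHomomorphism 𝕆-ring (ℚ√ m) embed embed-+ embed-* embed-neg refl refl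

  fromℤ-ι : ∀ n → E𝕆.fromℤ n ≡ ι n
  fromℤ-ι (+ n)        = natural n
    where
    natural : ∀ n → E𝕆.fromℤ (+ n) ≡ ι (+ n)
    natural zero    = refl
    natural (suc n) = cong (ι (+ 1) ⊞_) (natural n)
  fromℤ-ι -[1+ n ]     = cong ⊖_ (fromℤ-ι (+ suc n))

  embed-fromℤ : ∀ n → embed (ι n) ≡ EK.fromℤ n
  embed-fromℤ n = trans (cong embed (sym (fromℤ-ι n))) (Hom.φ-fromℤ n)

  1728-cancel : ∀ {x y} → EK.fromℤ (+ 1728) K.* x ≡ EK.fromℤ (+ 1728) K.* y → x ≡ y
  1728-cancel {x} {y} eq = K-cancel {+ 1728} (λ ()) (trans (commute x) (trans eq (sym (commute y))))
    where
    commute : ∀ x → x K.* embed (ι (+ 1728)) ≡ EK.fromℤ (+ 1728) K.* x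
    commute x = trans (K.*-comm x (embed (ι (+ 1728)))) (cong (K._* x) (embed-fromℤ (+ 1728)))

  embed-𝒪 : ∀ x → EK.𝒪 (embed x)
  embed-𝒪 x = N x ∷ trace ∷ [] , trans (cong₂ K._+_ (sym (embed-fromℤ (N x)))
      (trans (cong (λ z → embed x K.* (z K.+ embed x K.* K.1#)) (sym (embed-fromℤ trace)))
      (trans (cong (λ z → embed x K.* (embed (ι trace) K.+ z)) (K.*-identityʳ (embed x)))
      (trans (cong (embed x K.*_) (sym (embed-+ (ι trace) x))) (sym (embed-* x _))))))
      (trans (sym (embed-+ (ι (N x)) _)) (cong embed (quadratic x)))
    where
    trace = ℤ.- (+ 2 ℤ.* re x)
    quadratic : ∀ x → ι (N x) ⊞ x ⊠ (ι (ℤ.- (+ 2 ℤ.* re x)) ⊞ x) ≡ 𝟎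
    quadratic (a +√ b) = cong₂ _+√_
      (solve 3 (λ k a b → (a :* a :- k :* (b :* b)) :+ (a :* (:- (con (+ 2) :* a) :+ a) :+ k :* (b :* (con (+ 0) :+ b))) := con (+ 0)) refl D a b)
      (solve 2 (λ a b → con (+ 0) :+ (a :* (con (+ 0) :+ b) :+ b :* (:- (con (+ 2) :* a) :+ a)) := con (+ 0)) refl a b)
      where open ℤ-Solve

  private
    -- Multiplying a monic polynomial at x = ε/η by a power of η leaves a power of ε modulo η.
    monic-numerator : ∀ cs x η ε → x K.* embed η ≡ embed ε →
      ∃[ k ] ∃[ ζ ] embed (η ^ k) K.* EK.monic cs x ≡ embed (ε ^ k ⊞ η ⊠ ζ)
    monic-numerator []       x η ε eq = 0 , 𝟎 , trans (K.*-identityʳ (embed (ι (+ 1)))) (cong embed (sym one))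
      where
      open 𝕆-Solver
      one : ι (+ 1) ⊞ η ⊠ 𝟎 ≡ ι (+ 1)
      one = solve 1 (λ η → con (+ 1) :+ η :* con (+ 0) := con (+ 1)) refl η
    monic-numerator (c ∷ cs) x η ε eq = step (monic-numerator cs x η ε eq)
      where
      step : ∃[ k ] ∃[ ζ ] embed (η ^ k) K.* EK.monic cs x ≡ embed (ε ^ k ⊞ η ⊠ ζ) →
             ∃[ k ] ∃[ ζ ] embed (η ^ k) K.* (EK.fromℤ c K.+ x K.* EK.monic cs x) ≡ embed (ε ^ k ⊞ η ⊠ ζ)
      step (k , ζ , e) = suc k , η ^ k ⊠ ι c ⊞ ε ⊠ ζ ,
        trans (cong₂ (λ y z → y K.* (z K.+ x K.* EK.monic cs x)) (embed-* η (η ^ k)) (sym (embed-fromℤ c)))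
        (trans (expand (embed η) (embed (η ^ k)) (embed (ι c)) x (EK.monic cs x))
        (trans (cong₂ (λ y z → embed η K.* embed (η ^ k) K.* embed (ι c) K.+ y K.* z) eq e)
        (trans (cong₂ K._+_ (trans (cong (K._* embed (ι c)) (sym (embed-* η (η ^ k)))) (sym (embed-* (η ⊠ η ^ k) (ι c))))
                            (sym (embed-* ε (ε ^ k ⊞ η ⊠ ζ))))
        (trans (sym (embed-+ (η ⊠ η ^ k ⊠ ι c) _)) (cong embed
          (𝕆-identity η (η ^ k) (ι c) ε (ε ^ k) ζ))))))
        where
        expand : ∀ η p c x f → η K.* p K.* (c K.+ x K.* f) ≡ η K.* p K.* c K.+ (x K.* η) K.* (p K.* f)
        expand η p c x f = trans (K.distribˡ (η K.* p) c (x K.* f)) (cong (η K.* p K.* c K.+_)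
          (trans (K.*-assoc η p _) (trans (cong (η K.*_) (trans (sym (K.*-assoc p x f)) (trans (cong (K._* f) (K.*-comm p x)) (K.*-assoc x p f))))
            (trans (sym (K.*-assoc η x _)) (cong (K._* (p K.* f)) (K.*-comm η x))))))
        𝕆-identity : ∀ η p c ε e ζ → η ⊠ p ⊠ c ⊞ ε ⊠ (e ⊞ η ⊠ ζ) ≡ ε ⊠ e ⊞ η ⊠ (p ⊠ c ⊞ ε ⊠ ζ)
        𝕆-identity = solve 6 (λ η p c ε e ζ → η :* p :* c :+ ε :* (e :+ η :* ζ) := ε :* e :+ η :* (p :* c :+ ε :* ζ)) refl
          where open 𝕆-Solver

  -- If x η = ε, multiplying the monic equation by a power of η puts a power of ε into the ideal
  -- (η). So ε lies in every place that contains η, which is integrality in the form of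
  -- `IntegralAt`.
  integral-closure : ∀ {x} → EK.𝒪 x → ∃[ α ] x ≡ embed α
  integral-closure {x} (cs , monic≡0) = finish (fraction x)
    where
    finish : ∃[ n ] ∃[ γ ] n ≢ + 0 × x K.* embed (ι n) ≡ embed γ → ∃[ α ] x ≡ embed α
    finish (n , γ , n≢0 , xn≡γ) = proj₁ n∣γ , K-cancel n≢0 (trans xn≡γ (trans (cong embed (proj₂ n∣γ))
        (trans (embed-* (ι n) (proj₁ n∣γ)) (K.*-comm (embed (ι n)) _))))
      where
      xη≡ε : ∀ η ε → γ ⊠ η ≡ ι n ⊠ ε → x K.* embed η ≡ embed ε
      xη≡ε η ε eq = K-cancel n≢0 (trans (K.*-assoc x _ _) (trans (cong (x K.*_) (K.*-comm (embed η) (embed (ι n))))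
        (trans (sym (K.*-assoc x _ _)) (trans (cong (K._* embed η) xn≡γ) (trans (sym (embed-* γ η))
        (trans (cong embed eq) (trans (embed-* (ι n) ε) (K.*-comm (embed (ι n)) (embed ε)))))))))
      integral-at : ∀ v → IntegralAt v γ (ι n)
      integral-at v η ε eq η∈ = at (monic-numerator cs x η ε (xη≡ε η ε eq))
        where
        open PrimeIdeal (ideal v) using (resp; absorbʳ; ^-∈)
        at : ∃[ k ] ∃[ ζ ] embed (η ^ k) K.* EK.monic cs x ≡ embed (ε ^ k ⊞ η ⊠ ζ) → ε ∈ᴾ v
        at (k , ζ , e) = ^-∈ k (resp (sym ε^k≡) (absorbʳ {η} (⊖ ζ) η∈))
          where
          open 𝕆-Solver
          vanishes : ε ^ k ⊞ η ⊠ ζ ≡ 𝟎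
          vanishes = embed-injective (trans (sym e) (trans (cong (embed (η ^ k) K.*_) monic≡0) (K.zeroʳ (embed (η ^ k)))))
          ε^k≡ : ε ^ k ≡ η ⊠ ⊖ ζ
          ε^k≡ = trans (solve 3 (λ e η ζ → e := (e :+ η :* ζ) :+ η :* :- ζ) refl (ε ^ k) η ζ)
            (trans (cong (_⊞ η ⊠ ⊖ ζ) vanishes) (solve 2 (λ η ζ → con (+ 0) :+ η :* :- ζ := η :* :- ζ) refl η ζ))
      n∣γ = integral (ι-≢0 n≢0) integral-at

  finitePrime : Place → EK.FinitePrime
  finitePrime v = record
    { 𝔭        = λ x → ∃[ α ] α ∈ᴾ v × x ≡ embed α
    ; resp     = λ { refl h → h }
    ; integral = λ { (α , _ , refl) → embed-𝒪 α }
    ; 0∈𝔭      = 𝟎 , 𝟎∈ v , refl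
    ; +-closed = λ { (α , α∈ , refl) (β , β∈ , refl) → α ⊞ β , +-closed {α} {β} α∈ β∈ , sym (embed-+ α β) }
    ; *-absorb = λ { x∈𝒪 (β , β∈ , refl) → absorb (integral-closure x∈𝒪) β β∈ }
    ; proper   = λ { (α , α∈ , eq) → proper (resp (sym (embed-injective {ι (+ 1)} {α} eq)) α∈) }
    ; prime    = λ x∈𝒪 y∈𝒪 h → split (integral-closure x∈𝒪) (integral-closure y∈𝒪) h
    ; nonzero  = embed (ι (+ char v)) , (ι (+ char v) , char∣⇒∈ v ℤ.∣-refl , refl) ,
                 λ eq → ι-≢0 (prime≢0 (char-prime v)) (embed-injective {ι (+ char v)} {𝟎} eq)
    }
    where
    open PrimeIdeal (ideal v)
    absorb : ∀ {x} → ∃[ α ] x ≡ embed α → ∀ β → β ∈ᴾ v → ∃[ γ ] γ ∈ᴾ v × x K.* embed β ≡ embed γ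
    absorb (α , refl) β β∈ = α ⊠ β , *-absorb α {β} β∈ , sym (embed-* α β)
    split : ∀ {x y} → ∃[ α ] x ≡ embed α → ∃[ β ] y ≡ embed β → ∃[ γ ] γ ∈ᴾ v × x K.* y ≡ embed γ →
            (∃[ α ] α ∈ᴾ v × x ≡ embed α) ⊎ (∃[ β ] β ∈ᴾ v × y ≡ embed β)
    split (α , refl) (β , refl) (γ , γ∈ , eq) = Data.Sum.Base.map (λ h → α , h , refl) (λ h → β , h , refl)
      (prime α β (resp (sym (embed-injective {α ⊠ β} {γ} (trans (embed-* α β) eq))) γ∈))

  local-fraction : ∀ v {x} → EK.FinitePrime.Local (finitePrime v) x →
    ∃[ b ] ∃[ c ] b ∉ᴾ v × x K.* embed b ≡ embed c
  local-fraction v {x} (a , b , a∈𝒪 , b∈𝒪 , b∉ , eq) = go (integral-closure a∈𝒪) (integral-closure b∈𝒪)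
    where
    go : ∃[ α ] a ≡ embed α → ∃[ β ] b ≡ embed β → ∃[ b ] ∃[ c ] b ∉ᴾ v × x K.* embed b ≡ embed c
    go (α , refl) (β , refl) = β , α , (λ β∈ → b∉ (β , β∈ , refl)) , eq

  -- Local models and their comparison

  module I𝕆 = WeierstrassInvariants 𝕆-ring
  module IK = WeierstrassInvariants (ℚ√ m)

  ^-∉ : ∀ v x k → x ∉ᴾ v → x ^ k ∉ᴾ v
  ^-∉ v x k x∉ x^k∈ = x∉ (PrimeIdeal.^-∈ (ideal v) k x^k∈)

  -- A model over 𝕆 with good reduction at v of a curve with invariants c₄ and Δ;
  -- μ/ν is the scaling factor.
  record LocalModel (v : Place) (c₄ Δ : K.Carrier) : Set where
    field
      model   : E𝕆.Weierstrass
      {μ ν}   : 𝕆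
      μ≢0     : μ ≢ 𝟎
      ν≢0     : ν ≢ 𝟎
      Δ∉      : E𝕆.Weierstrass.Δ model ∉ᴾ v
      c₄-eq   : embed (ν ^ 4) K.* c₄ ≡ embed (μ ^ 4) K.* embed (I𝕆.c₄ model)
      Δ-eq    : embed (ν ^ 12) K.* Δ ≡ embed (μ ^ 12) K.* embed (E𝕆.Weierstrass.Δ model)

  -- The coefficients of the minimal model have denominators outside 𝔓. Clearing them with their
  -- product β multiplies Δ by β¹², a unit at v, so the integral model keeps good reduction.
  local-model : ∀ v E → EK.GoodReductionAt (finitePrime v) E → LocalModel v (IK.c₄ (EK.EllipticCurve.equation E)) (EK.EllipticCurve.discriminant E)
  local-model v E (W , E≅W , ((l₁ , l₂ , l₃ , l₄ , l₆) , _) , (_ , y , y-local , Δy≡1)) =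
    from-coefficients (local-fraction v {a₁} l₁) (local-fraction v {a₂} l₂) (local-fraction v {a₃} l₃)
      (local-fraction v {a₄} l₄) (local-fraction v {a₆} l₆)
    where
    E₀ = EK.EllipticCurve.equation E
    Frac : K.Carrier → Set
    Frac x = ∃[ b ] ∃[ c ] b ∉ᴾ v × x K.* embed b ≡ embed c
    open EK.Weierstrass W
    u = EK._≅_.u E≅W

    build : ∀ β (β∉ : β ∉ᴾ v) → (W′ : E𝕆.Weierstrass) (W′≅W : Hom.image W′ EK.≅ W) → EK._≅_.u W′≅W ≡ embed β →
            ∃[ n ] ∃[ υ ] n ≢ + 0 × u K.* embed (ι n) ≡ embed υ → Frac y → LocalModel v (IK.c₄ E₀) (EK.Weierstrass.Δ E₀)
    build β β∉ W′ W′≅W u≡ (n , υ , n≢0 , un≡υ) (b , c , b∉ , yb≡c) = record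
      { model = W′ ; μ = υ ; ν = β ⊠ ι n ; μ≢0 = υ≢0 ; ν≢0 = ⊠-≢0 (∉⇒≢0 v β∉) (ι-≢0 n≢0)
      ; Δ∉ = Δ∉ ; c₄-eq = CM.compare-c₄ ; Δ-eq = CM.compare-Δ }
      where
      module CM = Hom.CompareModels 1728-cancel {E₀} {W} {W′} E≅W W′≅W {β} {ι n} {υ} u≡ un≡υ
      υ≢0 : υ ≢ 𝟎
      υ≢0 υ≡0 = EK._≅_.u≉0 E≅W (K-cancel n≢0 (trans un≡υ (trans (cong embed υ≡0) (sym (K.zeroˡ (embed (ι n)))))))
      Δ′ = E𝕆.Weierstrass.Δ W′
      unit : Δ′ ⊠ c ≡ β ^ 12 ⊠ b
      unit = embed-injective (trans (embed-* Δ′ c) (trans (cong₂ K._*_ (sym CM.Δ-scale) (sym yb≡c))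
        (trans (rearrange (Hom-^ β 12) Δ y (embed b)) (trans (cong (K._* embed b) (cong₂ K._*_ (sym (Hom.φ-^ β 12)) Δy≡1))
          (trans (cong (K._* embed b) (K.*-identityʳ (embed (β ^ 12)))) (sym (embed-* (β ^ 12) b)))))))
        where
        Hom-^ : 𝕆 → ℕ → K.Carrier
        Hom-^ β k = Exp._^_ K.semiring (embed β) k
        rearrange : ∀ p d y b → p K.* d K.* (y K.* b) ≡ p K.* (d K.* y) K.* b
        rearrange p d y b = trans (sym (K.*-assoc (p K.* d) y b)) (cong (K._* b) (K.*-assoc p d y))
      Δ∉ : Δ′ ∉ᴾ v
      Δ∉ Δ∈ = ∉-⊠ v (β ^ 12) b (^-∉ v β 12 β∉) b∉ (PrimeIdeal.resp (ideal v) unit (PrimeIdeal.absorbʳ (ideal v) {Δ′} c Δ∈))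

    from-coefficients : Frac a₁ → Frac a₂ → Frac a₃ → Frac a₄ → Frac a₆ → LocalModel v (IK.c₄ E₀) (EK.Weierstrass.Δ E₀)
    from-coefficients (b₁ , d₁ , n₁ , e₁) (b₂ , d₂ , n₂ , e₂) (b₃ , d₃ , n₃ , e₃) (b₄ , d₄ , n₄ , e₄) (b₆ , d₆ , n₆ , e₆) =
      common (Hom.common-denominator {a₁} {a₂} {a₃} {a₄} {a₆} {b₁} {b₂} {b₃} {b₄} {b₆} {d₁} {d₂} {d₃} {d₄} {d₆} e₁ e₂ e₃ e₄ e₆)
      where
      β = b₁ ⊠ (b₂ ⊠ (b₃ ⊠ (b₄ ⊠ b₆)))
      β∉ : β ∉ᴾ v
      β∉ = ∉-⊠ v b₁ _ n₁ (∉-⊠ v b₂ _ n₂ (∉-⊠ v b₃ _ n₃ (∉-⊠ v b₄ b₆ n₄ n₆)))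
      common : ∃[ d₁ ] ∃[ d₂ ] ∃[ d₃ ] ∃[ d₄ ] ∃[ d₅ ]
        a₁ K.* embed β ≡ embed d₁ × a₂ K.* embed β ≡ embed d₂ × a₃ K.* embed β ≡ embed d₃ ×
        a₄ K.* embed β ≡ embed d₄ × a₆ K.* embed β ≡ embed d₅ → LocalModel v (IK.c₄ E₀) (EK.Weierstrass.Δ E₀)
      common (d₁ , d₂ , d₃ , d₄ , d₆ , f₁ , f₂ , f₃ , f₄ , f₆) =
        build β β∉ (proj₁ cleared) (proj₂ cleared) refl (fraction u) (local-fraction v {y} y-local)
        where
        cleared = Hom.clear-denominators W {β} {d₁} {d₂} {d₃} {d₄} {d₆}
          (λ e → ∉⇒≢0 v β∉ (embed-injective {β} {𝟎} e)) f₁ f₂ f₃ f₄ f₆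

  prime-2 : Prime 2
  prime-2 = Data.Nat.Primality.prime[2]

  prime-3 : Prime 3
  prime-3 = from-yes (prime? 3)

  2∣D²-D : + 2 ∣ D ℤ.* D ℤ.- D
  2∣D²-D = valid 2 (n∣ var 0F ⊗ var 0F ⊖ var 0F) refl (D ∷ [])

  v₂ : Place
  v₂ = root prime-2 D 2∣D²-D

  record Comparison (v : Place) (c₄ Δ : 𝕆) : Set where
    field
      W′    : E𝕆.Weierstrass
      {μ ν} : 𝕆
      μ≢0   : μ ≢ 𝟎
      ν≢0   : ν ≢ 𝟎
      Δ′∉   : E𝕆.Weierstrass.Δ W′ ∉ᴾ v
      c₄-eq : ν ^ 4 ⊠ c₄ ≡ μ ^ 4 ⊠ I𝕆.c₄ W′
      Δ-eq  : ν ^ 12 ⊠ Δ ≡ μ ^ 12 ⊠ E𝕆.Weierstrass.Δ W′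

  -- Good reduction of `W` itself is guaranteed only at v₂; `at` records for each place the factor
  -- μ/ν that separates it from a model with good reduction there.
  record GoodCurve : Set where
    field
      W     : E𝕆.Weierstrass
      δ     : 𝕆
      Δ∉v₂  : E𝕆.Weierstrass.Δ W ∉ᴾ v₂
      δ³≡Δ  : δ ^ 3 ≡ E𝕆.Weierstrass.Δ W
      at    : ∀ v → Comparison v (I𝕆.c₄ W) (E𝕆.Weierstrass.Δ W)

  open CExp (CommutativeRing.commutativeSemiring 𝕆-ring) public using (^-distrib-*; ^-assocʳ)

  private
    compare-values : ∀ k {c μ ν μ′ ν′ y y′} → embed (ν ^ k) K.* c ≡ embed (μ ^ k) K.* embed y →
      embed (ν′ ^ k) K.* c ≡ embed (μ′ ^ k) K.* embed y′ → (ν′ ⊠ μ) ^ k ⊠ y ≡ (ν ⊠ μ′) ^ k ⊠ y′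
    compare-values k {c} {μ} {ν} {μ′} {ν′} {y} {y′} eq eq′ =
      trans (cong (_⊠ y) (^-distrib-* ν′ μ k)) (trans (embed-injective (trans (embed-* (ν′ ^ k ⊠ μ ^ k) y)
        (trans (cong (K._* embed y) (embed-* (ν′ ^ k) (μ ^ k))) (trans (K.*-assoc (embed (ν′ ^ k)) (embed (μ ^ k)) (embed y)) (trans (cong (embed (ν′ ^ k) K.*_) (sym eq))
        (trans (swap (embed (ν′ ^ k)) (embed (ν ^ k)) c) (trans (cong (embed (ν ^ k) K.*_) eq′)
        (trans (sym (K.*-assoc (embed (ν ^ k)) (embed (μ′ ^ k)) (embed y′))) (trans (cong (K._* embed y′) (sym (embed-* (ν ^ k) (μ′ ^ k)))) (sym (embed-* (ν ^ k ⊠ μ′ ^ k) y′)))))))))))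
        (cong (_⊠ y′) (sym (^-distrib-* ν μ′ k))))
      where
      swap : ∀ a b c → a K.* (b K.* c) ≡ b K.* (a K.* c)
      swap a b c = trans (sym (K.*-assoc a b c)) (trans (cong (K._* c) (K.*-comm a b)) (K.*-assoc b a c))

    compare-models : ∀ {v w c Δ} (L : LocalModel v c Δ) (L′ : LocalModel w c Δ) →
      Comparison w (I𝕆.c₄ (LocalModel.model L)) (E𝕆.Weierstrass.Δ (LocalModel.model L))
    compare-models {c = c} {Δ} L L′ = record
      { W′ = L′.model ; μ = L.ν ⊠ L′.μ ; ν = L′.ν ⊠ L.μ
      ; μ≢0 = ⊠-≢0 L.ν≢0 L′.μ≢0 ; ν≢0 = ⊠-≢0 L′.ν≢0 L.μ≢0 ; Δ′∉ = L′.Δ∉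
      ; c₄-eq = compare-values 4 {c} {L.μ} {L.ν} {L′.μ} {L′.ν} L.c₄-eq L′.c₄-eq
      ; Δ-eq = compare-values 12 {Δ} {L.μ} {L.ν} {L′.μ} {L′.ν} L.Δ-eq L′.Δ-eq }
      where
      module L = LocalModel L
      module L′ = LocalModel L′

    -- Δ₁ = (ν/μ)¹² Δ is the cube of (ν/μ)⁴ y because 3 ∣ 12, and a cube root in the field of an
    -- element of 𝕆 lies in 𝕆.
    cube-root : ∀ {Δ y n γ μ ν Δ₁} → μ ≢ 𝟎 → n ≢ + 0 → Exp._^_ K.semiring y 3 ≡ Δ → y K.* embed (ι n) ≡ embed γ →
      embed (ν ^ 12) K.* Δ ≡ embed (μ ^ 12) K.* embed Δ₁ → ∃[ δ ] δ ^ 3 ≡ Δ₁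
    cube-root {Δ} {y} {n} {γ} {μ} {ν} {Δ₁} μ≢0 n≢0 y³≡ yn≡ eq = extract-cube (root-integral 2 {ν ^ 4 ⊠ γ} {w} {Δ₁} w≢0 cubes)
      where
      w = μ ^ 4 ⊠ ι n
      w≢0 : w ≢ 𝟎
      w≢0 = ⊠-≢0 (^-≢0 4 μ≢0) (ι-≢0 n≢0)
      cubes : (ν ^ 4 ⊠ γ) ^ 3 ≡ w ^ 3 ⊠ Δ₁
      cubes = embed-injective (trans (embed-cube (ν ^ 4) γ ν (^-assocʳ ν 4 3))
        (trans (cong (embed (ν ^ 12) K.*_) (trans (Hom.φ-^ γ 3) (trans (cong (λ z → Exp._^_ K.semiring z 3) (sym yn≡))
          (trans (distrib y (embed (ι n))) (cong₂ K._*_ y³≡ (sym (Hom.φ-^ (ι n) 3)))))))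
        (trans (sym (K.*-assoc (embed (ν ^ 12)) Δ _)) (trans (cong (K._* embed (ι n ^ 3)) eq)
        (trans (rotate (embed (μ ^ 12)) (embed Δ₁) (embed (ι n ^ 3)))
        (trans (cong (K._* embed Δ₁) (sym (embed-cube (μ ^ 4) (ι n) μ (^-assocʳ μ 4 3)))) (sym (embed-* (w ^ 3) Δ₁))))))))
        where
        embed-cube : ∀ a b c → a ^ 3 ≡ c ^ 12 → embed ((a ⊠ b) ^ 3) ≡ embed (c ^ 12) K.* embed (b ^ 3)
        embed-cube a b c e = trans (cong embed (trans (^-distrib-* a b 3) (cong (_⊠ b ^ 3) e))) (embed-* (c ^ 12) (b ^ 3))
        distrib : ∀ a b → Exp._^_ K.semiring (a K.* b) 3 ≡ Exp._^_ K.semiring a 3 K.* Exp._^_ K.semiring b 3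
        distrib a b = CExp.^-distrib-* K.commutativeSemiring a b 3
        rotate : ∀ a b c → a K.* b K.* c ≡ a K.* c K.* b
        rotate a b c = trans (K.*-assoc a b c) (trans (cong (a K.*_) (K.*-comm b c)) (sym (K.*-assoc a c b)))
      extract-cube : w ∣ᴼ ν ^ 4 ⊠ γ → ∃[ δ ] δ ^ 3 ≡ Δ₁
      extract-cube (δ , e) = δ , cancel (^-≢0 3 w≢0) (trans (sym (^-distrib-* w δ 3)) (trans (cong (_^ 3) (sym e)) cubes))

    assemble : ∀ {c Δ y} → (∀ v → LocalModel v c Δ) → Exp._^_ K.semiring y 3 ≡ Δ →
      ∃[ n ] ∃[ γ ] n ≢ + 0 × y K.* embed (ι n) ≡ embed γ → GoodCurve
    assemble {c} {Δ} {y} L y³≡ (n , γ , n≢0 , yn≡) = record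
      { W = L₂.model ; δ = proj₁ root₃ ; Δ∉v₂ = L₂.Δ∉ ; δ³≡Δ = proj₂ root₃ ; at = λ v → compare-models (L v₂) (L v) }
      where
      module L₂ = LocalModel (L v₂)
      root₃ : ∃[ δ ] δ ^ 3 ≡ E𝕆.Weierstrass.Δ L₂.model
      root₃ = cube-root {Δ} {y} {n} {γ} {L₂.μ} {L₂.ν} {E𝕆.Weierstrass.Δ L₂.model} L₂.μ≢0 n≢0 y³≡ yn≡ L₂.Δ-eq

  good-curve : (E : EK.EllipticCurve) → EK.EverywhereGoodReduction E → EK.IsCube (EK.EllipticCurve.discriminant E) → GoodCurve
  good-curve E good (y , y³≡) = assemble {IK.c₄ (EK.EllipticCurve.equation E)} {EK.EllipticCurve.discriminant E} {y}
    (λ v → local-model v E (good (finitePrime v))) y³≡ (fraction y)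

  NoCurve : Set₁
  NoCurve = ¬ (Σ[ E ∈ EK.EllipticCurve ] EK.EverywhereGoodReduction E × EK.IsCube (EK.EllipticCurve.discriminant E))

  no-curve : ¬ GoodCurve → NoCurve
  no-curve none (E , good , cube) = none (good-curve E good cube)

  -- Square classes supported at few primes

  AtMost : ℕ → ℤ → Set
  AtMost s f = (f ≡ + 1 ⊎ f ≡ ℤ.-1ℤ) ⊎ (f ≡ + s ⊎ f ≡ ℤ.- + s)

  private
    prime-∣ℤ : ∀ {p} n → p ℕ∣.∣ ℤ.∣ n ∣ → + p ∣ n
    prime-∣ℤ n = ℤ.∣ᵤ⇒∣

    sqfree-∣ : ∀ {f g} → g ∣ f → SquareFree ℤ.∣ f ∣ → SquareFree ℤ.∣ g ∣
    sqfree-∣ g∣f sf d 1<d d²∣g = sf d 1<d (ℕ∣.∣-trans d²∣g (ℤ.∣⇒∣ᵤ g∣f))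

    no-primes : ∀ f → f ≢ + 0 → (∀ {p} → Prime p → ¬ (+ p ∣ f)) → f ≡ + 1 ⊎ f ≡ ℤ.-1ℤ
    no-primes f f≢0 none = signs f (ℕ.≤-antisym (ℕ.≮⇒≥ (λ 1<f → case prime-divisor 1<f of λ (p , pp , p∣f) → none pp (prime-∣ℤ f p∣f)))
        (ℕ.n≢0⇒n>0 (λ h → f≢0 (ℤ.∣i∣≡0⇒i≡0 h))))
      where
      signs : ∀ f → ℤ.∣ f ∣ ≡ 1 → f ≡ + 1 ⊎ f ≡ ℤ.-1ℤ
      signs (+ 1)     refl = inj₁ refl
      signs -[1+ 0 ]  refl = inj₂ refl

  -- Applied in turn to q, to 2 and to the last admissible prime; `Q` describes the prime factors
  -- that remain after each stage.
  strip : ∀ {Q : ℕ → Set} {s} → Prime s → ∀ f → f ≢ + 0 → SquareFree ℤ.∣ f ∣ →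
    (∀ {p} → Prime p → + p ∣ f → p ≡ s ⊎ Q p) →
    ∃[ g ] (f ≡ + 1 ℤ.* g ⊎ f ≡ + s ℤ.* g) × g ≢ + 0 × SquareFree ℤ.∣ g ∣ × (∀ {p} → Prime p → + p ∣ g → Q p × p ≢ s)
  strip {Q} {s} ps f f≢0 sf primes with + s ∣? f
  ... | no s∤f = f , inj₁ (sym (ℤ.*-identityˡ f)) , f≢0 , sf , λ pp p∣f →
          [ (λ { refl → contradiction p∣f s∤f }) , (λ h → h , λ { refl → s∤f p∣f }) ]′ (primes pp p∣f)
  ... | yes s∣f = g , inj₂ f≡ , (λ g≡0 → f≢0 (trans f≡ (trans (cong (+ s ℤ.*_) g≡0) (ℤ.*-zeroʳ (+ s))))) , sqfree-∣ g∣f sf , λ pp p∣g →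
          [ (λ { refl → contradiction p∣g (cofactor {f = f} ps sf s∣f) }) , (λ h → h , λ { refl → cofactor {f = f} ps sf s∣f p∣g }) ]′
            (primes pp (∣-multiple (+ s) p∣g f≡))
    where
    g = ℤ.quotient s∣f
    f≡ : f ≡ + s ℤ.* g
    f≡ = trans (ℤ.equality s∣f) (ℤ.*-comm g (+ s))
    g∣f : g ∣ f
    g∣f = divides (+ s) f≡

  at-most : ∀ {s} → Prime s → ∀ f → f ≢ + 0 → SquareFree ℤ.∣ f ∣ → (∀ {p} → Prime p → + p ∣ f → p ≡ s) → AtMost s f
  at-most {s} ps f f≢0 sf primes = go (strip {λ _ → ⊥} ps f f≢0 sf (λ pp h → inj₁ (primes pp h)))
    where
    go : ∃[ g ] (f ≡ + 1 ℤ.* g ⊎ f ≡ + s ℤ.* g) × g ≢ + 0 × SquareFree ℤ.∣ g ∣ × (∀ {p} → Prime p → + p ∣ g → ⊥ × p ≢ s) → AtMost s f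
    go (g , inj₁ refl , g≢0 , _ , none) = inj₁ (Data.Sum.Base.map (λ { refl → ℤ.*-identityˡ _ }) (λ { refl → ℤ.*-identityˡ _ }) (no-primes g g≢0 (λ pp h → proj₁ (none pp h))))
    go (g , inj₂ refl , g≢0 , _ , none) = inj₂ (Data.Sum.Base.map (λ { refl → ℤ.*-identityʳ _ })
      (λ { refl → trans (ℤ.*-comm (+ s) ℤ.-1ℤ) (ℤ.-1*i≡-i (+ s)) }) (no-primes g g≢0 (λ pp h → proj₁ (none pp h))))

  norm-class : ∀ {s} → Prime s → ∀ x → x ≢ 𝟎 → s ≡ 2 ⊎ ¬ (+ 2 ∣ N x) → (∀ v → char v ≢ 2 → char v ≢ s → EvenAt v x) →
    ∃[ f ] ∃[ k ] N x ≡ f ℤ.* (k ℤ.* k) × AtMost s f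
  norm-class {s} ps x x≢0 odd even = go (square-part (N x) (N≢0 x≢0))
    where
    go : ∃[ f ] ∃[ k ] N x ≡ f ℤ.* (k ℤ.* k) × k ≢ + 0 × f ≢ + 0 × SquareFree ℤ.∣ f ∣ →
         ∃[ f ] ∃[ k ] N x ≡ f ℤ.* (k ℤ.* k) × AtMost s f
    go (f , k , N≡ , k≢0 , f≢0 , sf) = f , k , N≡ , at-most ps f f≢0 sf primes
      where
      primes : ∀ {p} → Prime p → + p ∣ f → p ≡ s
      primes {p} pp p∣f with p ℕ.≟ s | p ℕ.≟ 2
      ... | yes p≡s | _        = p≡s
      ... | no  p≢s | yes refl = contradiction (∣-multiple (k ℤ.* k) p∣f (trans N≡ (ℤ.*-comm f _)))
              ([ (λ { refl → contradiction refl p≢s }) , (λ h → h) ]′ odd)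
      ... | no  p≢s | no  p≢2  = contradiction p∣f (norm-squarefree-part pp p≢2 {x} {f} {k} x≢0
              (λ { v refl → even v p≢2 p≢s }) N≡ sf)

  ι-square-root : ∀ {n x y} → n ≢ + 0 → ι n ⊠ ι n ⊠ x ≡ y ⊠ y → ∃[ z ] x ≡ z ⊠ z
  ι-square-root {n} {x} {y} n≢0 eq = go (square-root {y} {ι n} {x} (ι-≢0 n≢0) (sym eq))
    where
    open 𝕆-Solver
    go : ι n ∣ᴼ y → ∃[ z ] x ≡ z ⊠ z
    go (z , refl) = z , cancel (⊠-≢0 (ι-≢0 n≢0) (ι-≢0 n≢0))
      (trans eq (solve 2 (λ n z → n :* z :* (n :* z) := n :* n :* (z :* z)) refl (ι n) z))

  private
    ω-square-root : ∀ {x y} → ω ⊠ ω ⊠ x ≡ y ⊠ y → ∃[ z ] x ≡ z ⊠ z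
    ω-square-root {x} {y} eq = go (square-root {y} {ω} {x} ω≢0 (sym eq))
      where
      open 𝕆-Solver
      go : ω ∣ᴼ y → ∃[ z ] x ≡ z ⊠ z
      go (z , refl) = z , cancel (⊠-≢0 ω≢0 ω≢0)
        (trans eq (solve 2 (λ n z → n :* z :* (n :* z) := n :* n :* (z :* z)) refl ω z))

    ω²≡ : ω ⊠ ω ≡ ι (+ e) ⊠ ι (+ q)
    ω²≡ = trans (cong₂ _+√_
        (trans (solve 1 (λ k → con (+ 0) :* con (+ 0) :+ k :* (con (+ 1) :* con (+ 1)) := k) refl D) (trans (cong +_ m≡eq) (ℤ.pos-* e q)))
        (solve 0 (con (+ 0) :* con (+ 1) :+ con (+ 1) :* con (+ 0) := con (+ 0)) refl))
      (ι-* (+ e) (+ q))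
      where open ℤ-Solve

    ramified-prime : ∀ {p} → Prime p → p ≢ 2 → + p ∣ D → p ≡ q
    ramified-prime {p} pp p≢2 p∣D = [ (λ p∣e → [ (λ { refl → contradiction p∣e (¬p∣1 pp) }) , (λ { refl → contradiction p∣e p∤2 }) ]′ e≡1⊎2)
        , (λ p∣q → [ (λ { refl → ⊥-elim (¬p∣1 pp ℤ.∣-refl) }) , (λ p≡q → p≡q) ]′ (prime⇒irreducible q-prime (ℤ.∣⇒∣ᵤ p∣q))) ]′
        (prime-∣-* pp (+ e) (+ q) (subst (+ p ∣_) (trans (cong +_ m≡eq) (ℤ.pos-* e q)) p∣D))
      where
      p∤2 : ¬ (+ p ∣ + 2)
      p∤2 h = p≢2 (ℕ.≤-antisym (ℕ∣.∣⇒≤ (ℤ.∣⇒∣ᵤ h)) (ℕ.nonTrivial⇒n>1 p {{prime⇒nonTrivial pp}}))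

  -- The square class of x, with q removed by means of (√m)² = e q.
  record SquareClass (s : ℕ) (x : 𝕆) (c : ℤ) : Set where
    constructor squareClass
    field
      {ε f} : ℤ
      {y}   : 𝕆
      {k}   : ℤ
      a     : ℕ
      ε≡    : ε ≡ + 1 ⊎ ε ≡ + 2
      f≡    : AtMost s f
      odd   : ¬ (+ 2 ∣ f)
      sq    : ι ε ⊠ (ι f ⊠ x) ≡ y ⊠ y
      -- As a ≥ 0, a positive c forces f to be positive.
      c≡    : c ≡ + a ℤ.* (f ℤ.* (k ℤ.* k))

  square-class-reduced : ∀ {s} → Prime s → ∀ x n → N x ≡ n ℤ.* n → x ≢ 𝟎 →
    + 2 ℤ.* re x ℤ.+ + 2 ℤ.* n ≢ + 0 → (∀ v → char v ≢ 2 → char v ≢ s → EvenAt v x) →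
    SquareClass s x (+ 2 ℤ.* re x ℤ.+ + 2 ℤ.* n)
  square-class-reduced {s} ps x n Nx≡ x≢0 c≢0 even = go (square-class x n Nx≡ x≢0 c≢0)
    where
    c = + 2 ℤ.* re x ℤ.+ + 2 ℤ.* n
    go : ∃[ f ] ∃[ y ] ι f ⊠ x ≡ y ⊠ y × y ≢ 𝟎 × SquareFree ℤ.∣ f ∣ × ∃[ k ] c ≡ f ℤ.* (k ℤ.* k) → SquareClass s x c
    go (f , y , fx≡ , y≢0 , sf , k , c≡) = go₁ (strip {λ p → p ≡ 2 ⊎ p ≡ s} q-prime f f≢0 sf primes)
      where
      f≢0 : f ≢ + 0
      f≢0 refl = c≢0 (trans c≡ (ℤ.*-zeroˡ _))
      primes : ∀ {p} → Prime p → + p ∣ f → p ≡ q ⊎ (p ≡ 2 ⊎ p ≡ s)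
      primes {p} pp p∣f with p ℕ.≟ 2 | p ℕ.≟ s | + p ∣? D
      ... | yes p≡2 | _       | _       = inj₂ (inj₁ p≡2)
      ... | no  _   | yes p≡s | _       = inj₂ (inj₂ p≡s)
      ... | no  p≢2 | no  _   | yes p∣D = inj₁ (ramified-prime pp p≢2 p∣D)
      ... | no  p≢2 | no  p≢s | no  p∤D = case place-above pp of λ { (v , refl) →
              contradiction p∣f (square-class-factor v p≢2 p∤D {x} {f} {y} y≢0 (even v p≢2 p≢s) fx≡ sf) }
      go₂ : ∀ {h r} → (∃[ g ] (h ≡ + 1 ℤ.* g ⊎ h ≡ + 2 ℤ.* g) × g ≢ + 0 × SquareFree ℤ.∣ g ∣ × (∀ {p} → Prime p → + p ∣ g → p ≡ s × p ≢ 2)) →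
        (r ≡ 1 ⊎ r ≡ 2) → ∀ {y} → ι (+ r) ⊠ (ι h ⊠ x) ≡ y ⊠ y → ∀ a → c ≡ + a ℤ.* (h ℤ.* (k ℤ.* k)) → SquareClass s x c
      go₂ {h} {r} (g , h≡ , g≢0 , sfg , prs) r≡ {y} sq a c≡ with h≡ | r≡
      ... | inj₁ h≡g  | _ = squareClass a (Data.Sum.Base.map (cong +_) (cong +_) r≡) (at-most ps g g≢0 sfg (λ pp h → proj₁ (prs pp h))) (λ h → proj₂ (prs prime-2 h) refl)
              (trans (cong (λ z → ι (+ r) ⊠ (ι z ⊠ x)) (trans (sym (ℤ.*-identityˡ g)) (sym h≡g))) sq)
              (trans c≡ (cong (λ z → + a ℤ.* (z ℤ.* (k ℤ.* k))) (trans h≡g (ℤ.*-identityˡ g))))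
      ... | inj₂ h≡2g | inj₁ refl = squareClass {ε = + 2} (a ℕ.* 2) (inj₂ refl) (at-most ps g g≢0 sfg (λ pp h → proj₁ (prs pp h))) (λ h → proj₂ (prs prime-2 h) refl)
              (trans (reassoc g x) (trans (cong (λ z → ι (+ 1) ⊠ (ι z ⊠ x)) (sym h≡2g)) sq))
              (trans c≡ (c-reassoc a g (k ℤ.* k) h≡2g))
        where
        reassoc : ∀ g x → ι (+ 2) ⊠ (ι g ⊠ x) ≡ ι (+ 1) ⊠ (ι (+ 2 ℤ.* g) ⊠ x)
        reassoc g x = trans (solve 2 (λ g x → con (+ 2) :* (g :* x) := con (+ 1) :* (con (+ 2) :* g :* x)) refl (ι g) x)
          (cong (λ z → ι (+ 1) ⊠ (z ⊠ x)) (sym (ι-* (+ 2) g)))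
          where open 𝕆-Solver
        c-reassoc : ∀ a g k → h ≡ + 2 ℤ.* g → + a ℤ.* (h ℤ.* k) ≡ + (a ℕ.* 2) ℤ.* (g ℤ.* k)
        c-reassoc a g k refl = trans (solve 3 (λ a g k → a :* (con (+ 2) :* g :* k) := a :* con (+ 2) :* (g :* k)) refl (+ a) g k)
          (cong (ℤ._* (g ℤ.* k)) (sym (ℤ.pos-* a 2)))
          where open ℤ-Solve
      ... | inj₂ h≡2g | inj₂ refl = descend (ι-square-root {+ 2} (λ ()) (trans (reassoc g x) (trans (cong (λ z → ι (+ 2) ⊠ (ι z ⊠ x)) (sym h≡2g)) sq)))
        where
        reassoc : ∀ g x → ι (+ 2) ⊠ ι (+ 2) ⊠ (ι g ⊠ x) ≡ ι (+ 2) ⊠ (ι (+ 2 ℤ.* g) ⊠ x)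
        reassoc g x = trans (solve 2 (λ g x → con (+ 2) :* con (+ 2) :* (g :* x) := con (+ 2) :* (con (+ 2) :* g :* x)) refl (ι g) x)
          (cong (λ z → ι (+ 2) ⊠ (z ⊠ x)) (sym (ι-* (+ 2) g)))
          where open 𝕆-Solver
        c-reassoc : ∀ a g k → h ≡ + 2 ℤ.* g → + a ℤ.* (h ℤ.* k) ≡ + (a ℕ.* 2) ℤ.* (g ℤ.* k)
        c-reassoc a g k refl = trans (solve 3 (λ a g k → a :* (con (+ 2) :* g :* k) := a :* con (+ 2) :* (g :* k)) refl (+ a) g k)
          (cong (ℤ._* (g ℤ.* k)) (sym (ℤ.pos-* a 2)))
          where open ℤ-Solve
        descend : ∃[ z ] ι g ⊠ x ≡ z ⊠ z → SquareClass s x c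
        descend (z , eq) = squareClass {ε = + 1} (a ℕ.* 2) (inj₁ refl) (at-most ps g g≢0 sfg (λ pp h → proj₁ (prs pp h))) (λ h → proj₂ (prs prime-2 h) refl)
          (trans (⊠-identityˡ _) eq) (trans c≡ (c-reassoc a g (k ℤ.* k) h≡2g))
      go₁ : (∃[ g ] (f ≡ + 1 ℤ.* g ⊎ f ≡ + q ℤ.* g) × g ≢ + 0 × SquareFree ℤ.∣ g ∣ × (∀ {p} → Prime p → + p ∣ g → (p ≡ 2 ⊎ p ≡ s) × p ≢ q)) → SquareClass s x c
      go₁ (g , inj₁ f≡ , g≢0 , sfg , prs) = go₂ {g} {1} (strip prime-2 g g≢0 sfg (λ pp h → proj₁ (prs pp h))) (inj₁ refl) {y}
        (trans (⊠-identityˡ _) (trans (cong (λ z → ι z ⊠ x) (trans (sym (ℤ.*-identityˡ g)) (sym f≡))) fx≡)) 1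
        (trans c≡ (trans (cong (ℤ._* (k ℤ.* k)) (trans f≡ (ℤ.*-identityˡ g))) (sym (ℤ.*-identityˡ _))))
      -- (√m)² e g x = e² · q g x = (e y)², so dividing by √m replaces the factor q of f by e.
      go₁ (g , inj₂ f≡ , g≢0 , sfg , prs) = descend (ω-square-root (trans (cong (_⊠ (ι (+ e) ⊠ (ι g ⊠ x))) ω²≡)
          (trans (reassoc (ι (+ e)) (ι (+ q)) (ι g) x) (trans (cong (λ z → ι (+ e) ⊠ ι (+ e) ⊠ (z ⊠ x)) (sym (trans (cong ι f≡) (ι-* (+ q) g))))
          (trans (cong (ι (+ e) ⊠ ι (+ e) ⊠_) fx≡) (squares (ι (+ e)) y))))))
        where
        open 𝕆-Solver
        reassoc : ∀ e q g x → e ⊠ q ⊠ (e ⊠ (g ⊠ x)) ≡ e ⊠ e ⊠ (q ⊠ g ⊠ x)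
        reassoc = solve 4 (λ e q g x → e :* q :* (e :* (g :* x)) := e :* e :* (q :* g :* x)) refl
        squares : ∀ e y → e ⊠ e ⊠ (y ⊠ y) ≡ e ⊠ y ⊠ (e ⊠ y)
        squares = solve 2 (λ e y → e :* e :* (y :* y) := e :* y :* (e :* y)) refl
        descend : ∃[ z ] ι (+ e) ⊠ (ι g ⊠ x) ≡ z ⊠ z → SquareClass s x c
        descend (z , eq) = go₂ {g} {e} (strip prime-2 g g≢0 sfg (λ pp h → proj₁ (prs pp h))) e≡1⊎2 {z} eq q
          (trans c≡ (trans (cong (ℤ._* (k ℤ.* k)) f≡) (ℤ.*-assoc (+ q) g _)))

  -- The cube root of the j-invariant and the factors t and B

  B-of : 𝕆 → 𝕆
  B-of t = t ⊠ t ⊞ ι (+ 36) ⊠ t ⊞ ι (+ 432)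

  module Curve (G : GoodCurve) where
    open GoodCurve G public
    open E𝕆.Weierstrass W public using (a₁; a₂; a₃; a₄; a₆; b₂; b₄; b₆; b₈; Δ)

    c₄ c₆ : 𝕆
    c₄ = I𝕆.c₄ W
    c₆ = I𝕆.c₆ W

    Δ≢0 : Δ ≢ 𝟎
    Δ≢0 = ∉⇒≢0 v₂ Δ∉v₂

    δ≢0 : δ ≢ 𝟎
    δ≢0 δ≡0 = Δ≢0 (trans (sym δ³≡Δ) (trans (cong (_^ 3) δ≡0) (trans (⊠-comm 𝟎 _) (⊠-zeroʳ _))))

    module _ (v : Place) where
      module C = Comparison (at v)

      -- Equality of the two j-invariants, with δ³ in place of Δ. It exhibits (c₄/δ)³ as c₄′³/Δ′,
      -- which is integral at v.
      c₄³Δ′ : c₄ ^ 3 ⊠ E𝕆.Weierstrass.Δ C.W′ ≡ δ ^ 3 ⊠ I𝕆.c₄ C.W′ ^ 3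
      c₄³Δ′ = cancel (^-≢0 12 C.ν≢0) (begin
        C.ν ^ 12 ⊠ (c₄ ^ 3 ⊠ Δ′)                ≡⟨ ⊠-assoc (C.ν ^ 12) (c₄ ^ 3) Δ′ ⟨
        C.ν ^ 12 ⊠ c₄ ^ 3 ⊠ Δ′                  ≡⟨ cong (λ z → z ⊠ c₄ ^ 3 ⊠ Δ′) (^-assocʳ C.ν 4 3) ⟨
        (C.ν ^ 4) ^ 3 ⊠ c₄ ^ 3 ⊠ Δ′             ≡⟨ cong (_⊠ Δ′) (^-distrib-* (C.ν ^ 4) c₄ 3) ⟨
        (C.ν ^ 4 ⊠ c₄) ^ 3 ⊠ Δ′                 ≡⟨ cong (λ z → z ^ 3 ⊠ Δ′) C.c₄-eq ⟩
        (C.μ ^ 4 ⊠ c₄′) ^ 3 ⊠ Δ′                ≡⟨ cong (_⊠ Δ′) (^-distrib-* (C.μ ^ 4) c₄′ 3) ⟩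
        (C.μ ^ 4) ^ 3 ⊠ c₄′ ^ 3 ⊠ Δ′            ≡⟨ cong (λ z → z ⊠ c₄′ ^ 3 ⊠ Δ′) (^-assocʳ C.μ 4 3) ⟩
        C.μ ^ 12 ⊠ c₄′ ^ 3 ⊠ Δ′                 ≡⟨ swap (C.μ ^ 12) (c₄′ ^ 3) Δ′ ⟩
        C.μ ^ 12 ⊠ Δ′ ⊠ c₄′ ^ 3                 ≡⟨ cong (_⊠ c₄′ ^ 3) C.Δ-eq ⟨
        C.ν ^ 12 ⊠ Δ ⊠ c₄′ ^ 3                  ≡⟨ cong (λ z → C.ν ^ 12 ⊠ z ⊠ c₄′ ^ 3) δ³≡Δ ⟨
        C.ν ^ 12 ⊠ δ ^ 3 ⊠ c₄′ ^ 3              ≡⟨ ⊠-assoc (C.ν ^ 12) (δ ^ 3) (c₄′ ^ 3) ⟩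
        C.ν ^ 12 ⊠ (δ ^ 3 ⊠ c₄′ ^ 3)            ∎)
        where
        open ≡-Reasoning
        Δ′ = E𝕆.Weierstrass.Δ C.W′
        c₄′ = I𝕆.c₄ C.W′
        swap : ∀ a b c → a ⊠ b ⊠ c ≡ a ⊠ c ⊠ b
        swap = solve 3 (λ a b c → a :* b :* c := a :* c :* b) refl
          where open 𝕆-Solver

    δ∣c₄ : δ ∣ᴼ c₄
    δ∣c₄ = integral δ≢0 (λ v → root-integralAt v 2 {c₄} {δ} {I𝕆.c₄ (C.W′ v) ^ 3} {E𝕆.Weierstrass.Δ (C.W′ v)}
      (C.Δ′∉ v) (c₄³Δ′ v) δ≢0)

    -- x³ is the j-invariant.
    x t B : 𝕆
    x = proj₁ δ∣c₄
    t = x ⊟ ι (+ 12)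
    B = B-of t

    c₄≡δx : c₄ ≡ δ ⊠ x
    c₄≡δx = proj₂ δ∣c₄

    x³Δ : x ^ 3 ⊠ Δ ≡ c₄ ^ 3
    x³Δ = trans (⊠-comm (x ^ 3) Δ) (trans (cong (_⊠ x ^ 3) (sym δ³≡Δ)) (trans (sym (^-distrib-* δ x 3)) (cong (_^ 3) (sym c₄≡δx))))

    private
      1728-relation : ∀ (V : E𝕆.Weierstrass) → ι (+ 1728) ⊠ E𝕆.Weierstrass.Δ V ≡ I𝕆.c₄ V ^ 3 ⊟ I𝕆.c₆ V ^ 2
      1728-relation V = trans (cong (_⊠ E𝕆.Weierstrass.Δ V) (sym (fromℤ-ι (+ 1728)))) (I𝕆.1728Δ V)

      tB-formula : ∀ x d c → x ^ 3 ⊠ d ≡ c ^ 3 → ∀ g → ι (+ 1728) ⊠ d ≡ c ^ 3 ⊟ g ^ 2 →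
        (x ⊟ ι (+ 12)) ⊠ ((x ⊟ ι (+ 12)) ⊠ (x ⊟ ι (+ 12)) ⊞ ι (+ 36) ⊠ (x ⊟ ι (+ 12)) ⊞ ι (+ 432)) ⊠ d ≡ g ⊠ g
      tB-formula x d c x³d g 1728d = trans (solve 2 (λ x d → (x :- con (+ 12)) :* ((x :- con (+ 12)) :* (x :- con (+ 12)) :+ con (+ 36) :* (x :- con (+ 12)) :+ con (+ 432)) :* d
              := x :^ 3 :* d :- con (+ 1728) :* d) refl x d)
          (trans (cong₂ _⊟_ x³d 1728d) (solve 2 (λ c g → c :- (c :- g :^ 2) := g :* g) refl (c ^ 3) g))
        where open 𝕆-Solver

    tBΔ : t ⊠ B ⊠ Δ ≡ c₆ ⊠ c₆
    tBΔ = tB-formula x Δ c₄ x³Δ c₆ (1728-relation W)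

    module _ (v : Place) (p≢2 : char v ≢ 2) (d : Dec (+ char v ∣ D)) where
      open Valᴾ v d

      -- i and j are the valuations of ν and μ; that k is a multiple of 12 is stated without
      -- subtraction.
      val-Δ : ∃[ i ] ∃[ j ] ∀ {k} → Val Δ k → 12 ℕ.* i ℕ.+ k ≡ 12 ℕ.* j
      val-Δ = go (total v p≢2 d (C.ν v) (C.ν≢0 v)) (total v p≢2 d (C.μ v) (C.μ≢0 v))
        where
        go : ∃[ i ] Val (C.ν v) i → ∃[ j ] Val (C.μ v) j → ∃[ i ] ∃[ j ] ∀ {k} → Val Δ k → 12 ℕ.* i ℕ.+ k ≡ 12 ℕ.* j
        go (i , vν) (j , vμ) = i , j , λ vΔ → trans
          (Val-unique (Val-resp (C.Δ-eq v) (Val-* (Val-^ 12 vν) vΔ)) (Val-* (Val-^ 12 vμ) (Val-unit (C.Δ′∉ v))))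
          (ℕ.+-identityʳ _)

    private
      halve : ∀ n → 12 ℕ.* n ≡ 6 ℕ.* n ℕ.+ 6 ℕ.* n
      halve n = ℕ.*-distribʳ-+ n 6 6

      halve₆ : ∀ n → 6 ℕ.* n ≡ 3 ℕ.* n ℕ.+ 3 ℕ.* n
      halve₆ n = ℕ.*-distribʳ-+ n 3 3

    even-Δ : ∀ v → char v ≢ 2 → EvenAt v Δ
    even-Δ v p≢2 d = go (val-Δ v p≢2 d) (total v p≢2 d Δ Δ≢0)
      where
      open Valᴾ v d
      go : (∃[ i ] ∃[ j ] ∀ {k} → Val Δ k → 12 ℕ.* i ℕ.+ k ≡ 12 ℕ.* j) → ∃[ k ] Val Δ k → ∃[ k ] Val Δ (k ℕ.+ k)
      go (i , j , h) (k , vΔ) = finish (even-cancel (6 ℕ.* i) k (6 ℕ.* j)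
          (trans (cong (ℕ._+ k) (sym (halve i))) (trans (h vΔ) (halve j))))
        where
        finish : ∃[ l ] k ≡ l ℕ.+ l → ∃[ k ] Val Δ (k ℕ.+ k)
        finish (l , k≡) = l , subst (Val Δ) k≡ vΔ

    -- The valuation of Δ is divisible by 12, so that of y is divisible by 6.
    even-root : ∀ v → char v ≢ 2 → ∀ {c y} → c ∉ᴾ v → y ⊠ y ≡ c ⊠ Δ → y ≢ 𝟎 → EvenAt v y
    even-root v p≢2 {c} {y} c∉ y²≡ y≢0 d = go (val-Δ v p≢2 d) (total v p≢2 d Δ Δ≢0) (total v p≢2 d y y≢0)
      where
      open Valᴾ v d
      go : (∃[ i ] ∃[ j ] ∀ {k} → Val Δ k → 12 ℕ.* i ℕ.+ k ≡ 12 ℕ.* j) → ∃[ k ] Val Δ k → ∃[ l ] Val y l → ∃[ k ] Val y (k ℕ.+ k)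
      go (i , j , h) (k , vΔ) (l , vy) = finish (even-cancel (3 ℕ.* i) l (3 ℕ.* j)
          (trans (cong (ℕ._+ l) (sym (halve₆ i))) (trans (double-injective _ _ doubled) (halve₆ j))))
        where
        l+l≡k : l ℕ.+ l ≡ k
        l+l≡k = Val-unique (Val-resp y²≡ (Val-* vy vy)) (Val-* (Val-unit c∉) vΔ)
        doubled : (6 ℕ.* i ℕ.+ l) ℕ.+ (6 ℕ.* i ℕ.+ l) ≡ 6 ℕ.* j ℕ.+ 6 ℕ.* j
        doubled = trans (sym (even-sum (6 ℕ.* i) l)) (trans (cong₂ ℕ._+_ (sym (halve i)) l+l≡k) (trans (h vΔ) (halve j)))
        double-injective : ∀ a b → a ℕ.+ a ≡ b ℕ.+ b → a ≡ b
        double-injective a b e = ℕ.*-cancelˡ-≡ a b 2 (trans (cong (a ℕ.+_) (ℕ.+-identityʳ a)) (trans e (cong (b ℕ.+_) (sym (ℕ.+-identityʳ b)))))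
        finish : ∃[ k ] l ≡ k ℕ.+ k → ∃[ k ] Val y (k ℕ.+ k)
        finish (k , l≡) = k , subst (Val y) l≡ vy

    -- Away from 6 the factors t and B of c₆²/Δ are coprime.
    even-B : t ≢ 𝟎 → B ≢ 𝟎 → ∀ v → char v ≢ 2 → char v ≢ 3 → EvenAt v B
    even-B t≢0 B≢0 v p≢2 p≢3 d = by-cases (PrimeIdeal.𝔓? (ideal v) B)
      where
      open Valᴾ v d
      open PrimeIdeal (ideal v) using (resp; +-closed; *-absorb)
      pp = char-prime v
      -- 432 = 2⁴ · 3³ is the constant term of B, hence a combination of t and B.
      432∉ : ι (+ 432) ∉ᴾ v
      432∉ h = small (prime-∣-* pp (+ 16) (+ 27) (subst (+ char v ∣_) (ℤ.pos-* 16 27) (∈⇒char∣ v h)))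
        where
        prime-power : ∀ {p} → Prime p → char v ≢ p → ∀ k → ¬ (+ char v ∣ + (p ℕ.^ k))
        prime-power ps p≢ zero    h = ¬p∣1 pp h
        prime-power {p} ps p≢ (suc k) h = [ (λ h′ → [ (λ c≡1 → ¬p∣1 pp (ℤ.∣ᵤ⇒∣ (ℕ∣.∣-reflexive c≡1))) , p≢ ]′ (prime⇒irreducible ps (ℤ.∣⇒∣ᵤ h′)))
          , prime-power ps p≢ k ]′ (prime-∣-* pp (+ p) (+ (p ℕ.^ k)) (subst (+ char v ∣_) (ℤ.pos-* p (p ℕ.^ k)) h))
        small : + char v ∣ + 16 ⊎ + char v ∣ + 27 → ⊥
        small (inj₁ h) = prime-power prime-2 p≢2 4 h
        small (inj₂ h) = prime-power prime-3 p≢3 3 h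
      by-cases : Dec (B ∈ᴾ v) → ∃[ k ] Val B (k ℕ.+ k)
      by-cases (no B∉)  = 0 , Val-unit B∉
      by-cases (yes B∈) = go (total v p≢2 d B B≢0) (even-Δ v p≢2 d) (total v p≢2 d c₆ c₆≢0)
        where
        t∉ : t ∉ᴾ v
        t∉ t∈ = 432∉ (resp (solve 1 (λ t → (t :* t :+ con (+ 36) :* t :+ con (+ 432)) :+ (:- t :- con (+ 36)) :* t := con (+ 432)) refl t)
          (+-closed {B} B∈ (*-absorb (⊖ t ⊟ ι (+ 36)) {t} t∈)))
          where open 𝕆-Solver
        c₆≢0 : c₆ ≢ 𝟎
        c₆≢0 c₆≡0 = ⊠-≢0 (⊠-≢0 t≢0 B≢0) Δ≢0 (trans tBΔ (trans (cong (c₆ ⊠_) c₆≡0) (⊠-zeroʳ c₆)))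
        go : ∃[ k ] Val B k → ∃[ l ] Val Δ (l ℕ.+ l) → ∃[ j ] Val c₆ j → ∃[ k ] Val B (k ℕ.+ k)
        go (k , vB) (l , vΔ) (j , vc) = finish (even-cancel l k j (trans (ℕ.+-comm (l ℕ.+ l) k)
            (Val-unique (Val-resp tBΔ (Val-* (Val-* (Val-unit t∉) vB) vΔ)) (Val-* vc vc))))
          where
          finish : ∃[ l ] k ≡ l ℕ.+ l → ∃[ k ] Val B (k ℕ.+ k)
          finish (l , k≡) = l , subst (Val B) k≡ vB

  odd-norm : ∀ x → x ∉ᴾ v₂ → ¬ (+ 2 ∣ N x)
  odd-norm (a +√ b) x∉ 2∣N = x∉ (valid 2
    ((n∣ var 0F ⊗ var 0F ⊖ var 2F ⊗ (var 1F ⊗ var 1F)) ⇒̇ (n∣ var 0F ⊕ var 2F ⊗ var 1F))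
    refl (a ∷ b ∷ D ∷ []) 2∣N)

  -- The coefficients of the model at the prime above 2

  module ReductionAtTwo (G : GoodCurve) where
    open Curve G public

    private
      open 𝕆-Solver
      open import Algebra.Definitions.RawSemiring (Semiring.rawSemiring (CommutativeRing.semiring 𝕆-ring)) using () renaming (_×_ to _·_)
      module 𝔓₂ = PrimeIdeal (ideal v₂)

      2∈ : ι (+ 2) ∈ᴾ v₂
      2∈ = char∣⇒∈ v₂ ℤ.∣-refl

    -- Modulo 2 one has c₄ ≡ a₁⁴ and x ≡ t, and c₄³ = x³ Δ.
    ordinary : a₁ ∉ᴾ v₂ → t ∉ᴾ v₂
    ordinary a₁∉ t∈ = a₁∉ (𝔓₂.^-∈ 4 {a₁} (𝔓₂.resp a₁⁴ (𝔓₂.+-closed {c₄} {ι (+ 2) ⊠ Y} c₄∈ (𝔓₂.absorbʳ {ι (+ 2)} Y 2∈))))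
      where
      Y = ι (+ 12) ⊠ b₄ ⊟ ι (+ 4) ⊠ a₁ ^ 2 ⊠ a₂ ⊟ ι (+ 8) ⊠ a₂ ^ 2
      x∈ : x ∈ᴾ v₂
      x∈ = 𝔓₂.resp (solve 1 (λ x → (x :- con (+ 12)) :+ con (+ 2) :* con (+ 6) := x) refl x)
        (𝔓₂.+-closed {t} {ι (+ 2) ⊠ ι (+ 6)} t∈ (𝔓₂.absorbʳ {ι (+ 2)} (ι (+ 6)) 2∈))
      c₄∈ : c₄ ∈ᴾ v₂
      c₄∈ = 𝔓₂.^-∈ 3 {c₄} (𝔓₂.resp x³Δ (𝔓₂.absorbʳ {x ^ 3} Δ (𝔓₂.absorbʳ {x} (x ^ 2) x∈)))
      a₁⁴ : c₄ ⊞ ι (+ 2) ⊠ Y ≡ a₁ ^ 4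
      a₁⁴ = trans (cong (λ n → b₂ ^ 2 ⊟ n ⊠ b₄ ⊞ ι (+ 2) ⊠ Y) (fromℤ-ι (+ 24)))
        (solve 3 (λ a₁ a₂ b₄ → ((a₁ :^ 2 :+ 4 :× a₂) :^ 2 :- con (+ 24) :* b₄)
          :+ con (+ 2) :* (con (+ 12) :* b₄ :- con (+ 4) :* a₁ :^ 2 :* a₂ :- con (+ 8) :* a₂ :^ 2) := a₁ :^ 4) refl a₁ a₂ b₄)

    -- Now 4 ∣ b₂ and 2 ∣ b₄, so modulo 8 only -27 b₆² ≡ -27 a₃⁴ survives.
    Δ-2∣a₁ : ∀ a → a₁ ≡ ι (+ 2) ⊠ a → ∃[ Z ] Δ ≡ ι (ℤ.- + 27) ⊠ a₃ ^ 4 ⊞ ι (+ 8) ⊠ Z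
    Δ-2∣a₁ a a₁≡ = _ , trans (cong (λ z → ⊖ ((z ^ 2 ⊞ 4 · a₂) ^ 2 ⊠ b₈) ⊟ 8 · ((2 · a₄ ⊞ z ⊠ a₃) ^ 3) ⊟ 27 · (b₆ ^ 2) ⊞ 9 · ((z ^ 2 ⊞ 4 · a₂) ⊠ (2 · a₄ ⊞ z ⊠ a₃) ⊠ b₆)) a₁≡)
        (solve 6 (λ a a₂ a₃ a₄ a₆ b₈ → let a₁ = con (+ 2) :* a ; b₂ = a₁ :^ 2 :+ 4 :× a₂ ; b₄ = 2 :× a₄ :+ a₁ :* a₃ ; b₆ = a₃ :^ 2 :+ 4 :× a₆
                                           B₂ = a :^ 2 :+ a₂ ; B₄ = a₄ :+ a :* a₃ in
          :- (b₂ :^ 2 :* b₈) :- 8 :× (b₄ :^ 3) :- 27 :× (b₆ :^ 2) :+ 9 :× (b₂ :* b₄ :* b₆)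
          := con (ℤ.- + 27) :* a₃ :^ 4 :+ con (+ 8) :* (:- (con (+ 2) :* B₂ :^ 2 :* b₈) :- con (+ 8) :* B₄ :^ 3
               :- con (+ 27) :* a₃ :^ 2 :* a₆ :- con (+ 54) :* a₆ :^ 2 :+ con (+ 9) :* B₂ :* B₄ :* b₆)) refl a a₂ a₃ a₄ a₆ b₈)

    -- Here b₂ is only known to be even, and modulo 4 the product 9 b₂ b₄ b₆ contributes 18 e a₁
    -- a₃³.
    Δ-a₁²=2e : ∀ e → a₁ ^ 2 ≡ ι (+ 2) ⊠ e → ∃[ Z ] Δ ≡ ι (ℤ.- + 27) ⊠ a₃ ^ 4 ⊞ ι (+ 18) ⊠ (e ⊠ a₁ ⊠ a₃ ^ 3) ⊞ ι (+ 4) ⊠ Z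
    Δ-a₁²=2e e a₁²≡ = _ , trans (cong (λ z → ⊖ ((z ⊞ 4 · a₂) ^ 2 ⊠ b₈) ⊟ 8 · (b₄ ^ 3) ⊟ 27 · (b₆ ^ 2) ⊞ 9 · ((z ⊞ 4 · a₂) ⊠ b₄ ⊠ b₆)) a₁²≡)
        (solve 7 (λ e a₁ a₂ a₃ a₄ a₆ b₈ → let b₂ = con (+ 2) :* e :+ 4 :× a₂ ; b₄ = 2 :× a₄ :+ a₁ :* a₃ ; b₆ = a₃ :^ 2 :+ 4 :× a₆
                                              F = e :+ con (+ 2) :* a₂ in
          :- (b₂ :^ 2 :* b₈) :- 8 :× (b₄ :^ 3) :- 27 :× (b₆ :^ 2) :+ 9 :× (b₂ :* b₄ :* b₆)
          := con (ℤ.- + 27) :* a₃ :^ 4 :+ con (+ 18) :* (e :* a₁ :* a₃ :^ 3) :+ con (+ 4) :* (:- (F :^ 2 :* b₈) :- con (+ 2) :* b₄ :^ 3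
               :- con (+ 54) :* a₃ :^ 2 :* a₆ :- con (+ 108) :* a₆ :^ 2 :+ con (+ 18) :* e :* a₁ :* a₃ :* a₆
               :+ con (+ 9) :* e :* a₄ :* b₆ :+ con (+ 9) :* a₂ :* b₄ :* b₆)) refl e a₁ a₂ a₃ a₄ a₆ b₈)

    c₄-a₁²=2e : ∀ e → a₁ ^ 2 ≡ ι (+ 2) ⊠ e → ∃[ Z ] c₄ ≡ ι (+ 4) ⊠ (e ⊠ e ⊟ ι (+ 6) ⊠ (a₁ ⊠ a₃) ⊞ ι (+ 4) ⊠ Z)
    c₄-a₁²=2e e a₁²≡ = _ , trans (cong₂ (λ z n → (z ⊞ 4 · a₂) ^ 2 ⊟ n ⊠ b₄) a₁²≡ (fromℤ-ι (+ 24)))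
        (solve 5 (λ e a₁ a₂ a₃ a₄ → (con (+ 2) :* e :+ 4 :× a₂) :^ 2 :- con (+ 24) :* (2 :× a₄ :+ a₁ :* a₃)
          := con (+ 4) :* (e :* e :- con (+ 6) :* (a₁ :* a₃) :+ con (+ 4) :* (e :* a₂ :+ a₂ :^ 2 :- con (+ 3) :* a₄))) refl e a₁ a₂ a₃ a₄)

    a₃∉v₂ : ∀ {Y Z} → Δ ≡ ι (ℤ.- + 27) ⊠ a₃ ^ 4 ⊞ ι (+ 2) ⊠ Y ⊞ ι (+ 2) ⊠ Z → a₃ ∉ᴾ v₂
    a₃∉v₂ {Y} {Z} Δ≡ a₃∈ = Δ∉v₂ (𝔓₂.resp (sym Δ≡) (𝔓₂.+-closed {ι (ℤ.- + 27) ⊠ a₃ ^ 4 ⊞ ι (+ 2) ⊠ Y} {ι (+ 2) ⊠ Z}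
      (𝔓₂.+-closed {ι (ℤ.- + 27) ⊠ a₃ ^ 4} {ι (+ 2) ⊠ Y} (𝔓₂.*-absorb (ι (ℤ.- + 27)) {a₃ ^ 4} (𝔓₂.absorbʳ {a₃} (a₃ ^ 3) a₃∈))
        (𝔓₂.absorbʳ {ι (+ 2)} Y 2∈)) (𝔓₂.absorbʳ {ι (+ 2)} Z 2∈)))

    -- v₂ is ramified, so a₁² is twice a unit when a₁ generates v₂ modulo 2.
    a₁-cases : (a₁ ∉ᴾ v₂) ⊎ (∃[ a ] a₁ ≡ ι (+ 2) ⊠ a) ⊎ (a₁ ∈ᴾ v₂ × ¬ 2 ∣̂ a₁ × ∃[ e ] a₁ ⊠ a₁ ≡ ι (+ 2) ⊠ e × e ∉ᴾ v₂)
    a₁-cases with 𝔓₂.𝔓? a₁ | 2 ∣̂? a₁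
    ... | no a₁∉  | _       = inj₁ a₁∉
    ... | yes _   | yes 2∣a = inj₂ (inj₁ (extract {2} {a₁} 2∣a))
    ... | yes a₁∈ | no  2∤a = inj₂ (inj₂ (a₁∈ , 2∤a , ramified-square prime-2 D 2∣D²-D (divides D (ℤ.*-comm (+ 2) D)) {a₁} a₁∈ 2∤a))

  ∣-double : ∀ {j k n} → + k ∣ n → + (j ℕ.* k) ∣ + j ℤ.* n
  ∣-double {j} {k} (divides c refl) = divides c (trans (solve 3 (λ j c k → j :* (c :* k) := c :* (j :* k)) refl (+ j) c (+ k))
    (cong (c ℤ.*_) (sym (ℤ.pos-* j k))))
    where open ℤ-Solve

  ∣-halve : ∀ {j k n} → j ≢ 0 → + (j ℕ.* k) ∣ + j ℤ.* n → + k ∣ n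
  ∣-halve {j} {k} {n} j≢0 (divides c eq) = divides c (cancelℤ (+ j) (λ e → j≢0 (ℤ.+-injective e))
    (trans eq (trans (cong (c ℤ.*_) (ℤ.pos-* j k)) (solve 3 (λ j c k → c :* (j :* k) := j :* (c :* k)) refl (+ j) c (+ k)))))
    where open ℤ-Solve

  private
    positive-factor : ∀ r n {p} → + r ℤ.* n ≡ + suc p → ∃[ s ] n ≡ + suc s
    positive-factor r (+ zero)  eq = contradiction (trans (sym (ℤ.*-zeroʳ (+ r))) eq) λ ()
    positive-factor r (+ suc s) eq = s , refl
    positive-factor r -[1+ n ] {p} eq = contradiction (trans (ℤ.pos-* r (suc n)) (trans (solve 2 (λ r n → r :* n := :- (r :* :- n)) refl (+ r) (+ suc n)) (cong ℤ.-_ eq))) λ ()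
      where open ℤ-Solve

  -- Square classes of Δ and B

  module SquareClasses (norm≢7 : ∀ x → x ∉ᴾ v₂ → ¬ (+ 8 ∣ N x ℤ.- + 7)) (G : GoodCurve) where
    open ReductionAtTwo G public

    -- Among the classes ±1, ±2 the even ones contradict Δ ∉ v₂, and -k² with k odd would be 7
    -- modulo 8.
    NΔ-square : ∃[ k ] N Δ ≡ k ℤ.* k
    NΔ-square = go (norm-class prime-2 Δ Δ≢0 (inj₁ refl) (λ v p≢2 _ → even-Δ v p≢2))
      where
      odd : ¬ (+ 8 ∣ + 4 ℤ.* N Δ)
      odd h = odd-norm Δ Δ∉v₂ (∣-halve {4} {2} (λ ()) h)
      even-norm : ∀ r k → N Δ ≡ + 2 ℤ.* r ℤ.* k → ⊥
      even-norm r k N≡ = odd-norm Δ Δ∉v₂ (∣-multiple (r ℤ.* k) ℤ.∣-refl (trans N≡ (solve 2 (λ r k → con (+ 2) :* r :* k := r :* k :* con (+ 2)) refl r k)))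
        where open ℤ-Solve
      go : ∃[ f ] ∃[ k ] N Δ ≡ f ℤ.* (k ℤ.* k) × AtMost 2 f → ∃[ k ] N Δ ≡ k ℤ.* k
      go (f , k , N≡ , inj₁ (inj₁ refl)) = k , trans N≡ (ℤ.*-identityˡ _)
      go (f , k , N≡ , inj₁ (inj₂ refl)) = contradiction (valid 8
        ((n∣ var 0F ⊖ con ℤ.-1ℤ ⊗ (var 1F ⊗ var 1F)) ⇒̇ ((n∣ con (+ 4) ⊗ var 0F) ⇒̇ ⊥̇) ⇒̇ (n∣ var 0F ⊖ con (+ 7)))
        refl (N Δ ∷ k ∷ []) (∣-of-≡ (+ 8) N≡) odd) (norm≢7 Δ Δ∉v₂)
      go (f , k , N≡ , inj₂ (inj₁ refl)) = ⊥-elim (even-norm (+ 1) (k ℤ.* k) N≡′)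
        where
        N≡′ : N Δ ≡ + 2 ℤ.* + 1 ℤ.* (k ℤ.* k)
        N≡′ = trans N≡ (cong (ℤ._* (k ℤ.* k)) (sym (ℤ.*-identityʳ (+ 2))))
      go (f , k , N≡ , inj₂ (inj₂ refl)) = ⊥-elim (even-norm ℤ.-1ℤ (k ℤ.* k) N≡′)
        where
        N≡′ : N Δ ≡ + 2 ℤ.* ℤ.-1ℤ ℤ.* (k ℤ.* k)
        N≡′ = trans N≡ (cong (ℤ._* (k ℤ.* k)) (solve 0 (con (ℤ.- + 2) := con (+ 2) :* con ℤ.-1ℤ) refl))
          where open ℤ-Solve

    Small : ℤ → Set
    Small g = (g ≡ + 1 ⊎ g ≡ ℤ.-1ℤ) ⊎ (g ≡ + 2 ⊎ g ≡ ℤ.- + 2)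

    root-norm : ∀ {g y} → Small g → ι g ⊠ Δ ≡ y ⊠ y → ∃[ f ] ∃[ k ] N y ≡ f ℤ.* (k ℤ.* k) × AtMost 2 f
    root-norm {g} {y} small eq = norm-class prime-2 y y≢0 (inj₁ refl)
        (λ v p≢2 _ → even-root v p≢2 {ι g} {y} (g∉ v p≢2) (sym eq) y≢0)
      where
      g≢0 : Small g → g ≢ + 0
      g≢0 (inj₁ (inj₁ refl)) ()
      g≢0 (inj₁ (inj₂ refl)) ()
      g≢0 (inj₂ (inj₁ refl)) ()
      g≢0 (inj₂ (inj₂ refl)) ()
      y≢0 : y ≢ 𝟎
      y≢0 y≡0 = ⊠-≢0 (ι-≢0 (g≢0 small)) Δ≢0 (trans eq (trans (cong (y ⊠_) y≡0) (⊠-zeroʳ y)))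
      g∣2 : Small g → ℤ.∣ g ∣ ℕ∣.∣ 2
      g∣2 (inj₁ (inj₁ refl)) = ℕ∣.1∣ 2
      g∣2 (inj₁ (inj₂ refl)) = ℕ∣.1∣ 2
      g∣2 (inj₂ (inj₁ refl)) = ℕ∣.∣-refl
      g∣2 (inj₂ (inj₂ refl)) = ℕ∣.∣-refl
      g∉ : ∀ v → char v ≢ 2 → ι g ∉ᴾ v
      g∉ v p≢2 g∈ = p≢2 (ℕ.≤-antisym (ℕ∣.∣⇒≤ (ℕ∣.∣-trans (ℤ.∣⇒∣ᵤ (∈⇒char∣ v g∈)) (g∣2 small)))
        (ℕ.nonTrivial⇒n>1 (char v) {{prime⇒nonTrivial (char-prime v)}}))

    Δ-class : ∃[ g ] ∃[ y ] Small g × ι g ⊠ Δ ≡ y ⊠ y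
    Δ-class = go NΔ-square
      where
      from-class : ∀ {c} → SquareClass 2 Δ c → ∃[ g ] ∃[ y ] Small g × ι g ⊠ Δ ≡ y ⊠ y
      from-class (squareClass a ε≡ (inj₂ (inj₁ refl)) odd sq c≡) = contradiction ℤ.∣-refl odd
      from-class (squareClass a ε≡ (inj₂ (inj₂ refl)) odd sq c≡) = contradiction (divides ℤ.-1ℤ (sym (ℤ.-1*i≡-i (+ 2)))) odd
      from-class (squareClass {ε = ε} {f} {y} a ε≡ (inj₁ f≡) odd sq c≡) = ε ℤ.* f , y , small ε≡ f≡ ,
          trans (cong (_⊠ Δ) (ι-* ε f)) (trans (⊠-assoc (ι ε) (ι f) Δ) sq)
        where
        small : ∀ {ε f} → ε ≡ + 1 ⊎ ε ≡ + 2 → f ≡ + 1 ⊎ f ≡ ℤ.-1ℤ → Small (ε ℤ.* f)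
        small (inj₁ refl) (inj₁ refl) = inj₁ (inj₁ (ℤ.*-identityˡ (+ 1)))
        small (inj₁ refl) (inj₂ refl) = inj₁ (inj₂ (ℤ.*-identityˡ ℤ.-1ℤ))
        small (inj₂ refl) (inj₁ refl) = inj₂ (inj₁ (ℤ.*-identityʳ (+ 2)))
        small (inj₂ refl) (inj₂ refl) = inj₂ (inj₂ (trans (ℤ.*-comm (+ 2) ℤ.-1ℤ) (ℤ.-1*i≡-i (+ 2))))
      go : ∃[ k ] N Δ ≡ k ℤ.* k → ∃[ g ] ∃[ y ] Small g × ι g ⊠ Δ ≡ y ⊠ y
      go (k , N≡) with + 2 ℤ.* re Δ ℤ.+ + 2 ℤ.* k ℤ.≟ + 0
      ... | no  c≢0 = from-class (square-class-reduced prime-2 Δ k N≡ Δ≢0 c≢0 (λ v p≢2 _ → even-Δ v p≢2))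
      -- The multiplier 2 re Δ + 2k can vanish; -k then has a nonzero one, since both vanish only if
      -- k = 0.
      ... | yes c≡0 = from-class (square-class-reduced prime-2 Δ (ℤ.- k) (trans N≡ (solve 1 (λ k → k :* k := :- k :* :- k) refl k)) Δ≢0 c′≢0 (λ v p≢2 _ → even-Δ v p≢2))
        where
        open ℤ-Solve
        c′≢0 : + 2 ℤ.* re Δ ℤ.+ + 2 ℤ.* ℤ.- k ≢ + 0
        c′≢0 c′≡0 = N≢0 Δ≢0 (trans N≡ (trans (cong (λ z → z ℤ.* z) k≡0) (ℤ.*-zeroˡ (+ 0))))
          where
          k≡0 : k ≡ + 0
          k≡0 = cancelℤ (+ 4) (λ ()) (trans (solve 2 (λ r k → con (+ 4) :* k := (con (+ 2) :* r :+ con (+ 2) :* k) :- (con (+ 2) :* r :+ con (+ 2) :* :- k)) refl (re Δ) k)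
            (trans (cong₂ ℤ._-_ c≡0 c′≡0) (sym (ℤ.*-zeroʳ (+ 4)))))

    -- B = (t + 18)² + 108, and the rational part a² + m b² of a square is nonnegative.
    re-B : ∃[ n ] re B ≡ + suc n
    re-B = go t
      where
      go : ∀ t → ∃[ n ] re (B-of t) ≡ + suc n
      go (a +√ b) = A ℕ.* A ℕ.+ m ℕ.* (ℤ.∣ b ∣ ℕ.* ℤ.∣ b ∣) ℕ.+ 107 , trans
          (solve 3 (λ k a b → a :* a :+ k :* (b :* b) :+ (con (+ 36) :* a :+ k :* (con (+ 0) :* b)) :+ con (+ 432)
            := (a :+ con (+ 18)) :* (a :+ con (+ 18)) :+ k :* (b :* b) :+ con (+ 108)) refl D a b)
          (trans (cong₂ (λ y z → y ℤ.+ D ℤ.* z ℤ.+ + 108) (sym (∣i∣²≡i² (a ℤ.+ + 18))) (sym (∣i∣²≡i² b)))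
          (trans (cong (λ z → + (A ℕ.* A) ℤ.+ z ℤ.+ + 108) (sym (ℤ.pos-* m _))) (cong +_ (ℕ.+-suc _ 107))))
        where
        open ℤ-Solve
        A = ℤ.∣ a ℤ.+ + 18 ∣

    B≢0 : B ≢ 𝟎
    B≢0 B≡0 = contradiction (trans (sym (cong re B≡0)) (proj₂ re-B)) λ ()

    -- N B′ is odd, so modulo 8 the classes -1, 3, -3 are incompatible with N B′ ≡ 1. Hilbert 90 is
    -- applied with n = |k|: then 2 re B′ + 2n > 0, and ρ is positive.
    B-class : t ≢ 𝟎 → ∀ B′ j → B ≡ ι (+ (2 ℕ.^ j)) ⊠ B′ → + 8 ∣ N B′ ℤ.- + 1 →
      (∃[ k ] N B′ ≡ k ℤ.* k) × ∃[ ρ ] ∃[ y ] (ρ ≡ 1 ⊎ ρ ≡ 2 ⊎ ρ ≡ 3 ⊎ ρ ≡ 6) × ι (+ ρ) ⊠ B′ ≡ y ⊠ y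
    B-class t≢0 B′ j B≡ 8∣N-1 = go (norm-class prime-3 B′ B′≢0 (inj₂ 2∤N) even-B′)
      where
      B′≢0 : B′ ≢ 𝟎
      B′≢0 e = B≢0 (trans B≡ (trans (cong (ι (+ (2 ℕ.^ j)) ⊠_) e) (⊠-zeroʳ _)))
      2∤N : ¬ (+ 2 ∣ N B′)
      2∤N h = valid 8 ((n∣ con (+ 4) ⊗ var 0F) ⇒̇ (n∣ var 0F ⊖ con (+ 1)) ⇒̇ ⊥̇) refl (N B′ ∷ []) (∣-double {4} {2} h) 8∣N-1
      power∉ : ∀ v → char v ≢ 2 → ∀ j → ι (+ (2 ℕ.^ j)) ∉ᴾ v
      power∉ v p≢2 j h = go j (∈⇒char∣ v h)
        where
        pp = char-prime v
        go : ∀ j → ¬ (+ char v ∣ + (2 ℕ.^ j))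
        go zero    h = ¬p∣1 pp h
        go (suc j) h = [ (λ h′ → p≢2 (ℕ.≤-antisym (ℕ∣.∣⇒≤ (ℤ.∣⇒∣ᵤ h′)) (ℕ.nonTrivial⇒n>1 (char v) {{prime⇒nonTrivial pp}}))) , go j ]′
          (prime-∣-* pp (+ 2) (+ (2 ℕ.^ j)) (subst (+ char v ∣_) (ℤ.pos-* 2 (2 ℕ.^ j)) h))
      even-B′ : ∀ v → char v ≢ 2 → char v ≢ 3 → EvenAt v B′
      even-B′ v p≢2 p≢3 d = go (even-B t≢0 B≢0 v p≢2 p≢3 d) (total v p≢2 d B′ B′≢0)
        where
        open Valᴾ v d
        go : ∃[ k ] Val B (k ℕ.+ k) → ∃[ l ] Val B′ l → ∃[ k ] Val B′ (k ℕ.+ k)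
        go (k , vB) (l , vB′) = k , subst (Val B′) (Val-unique (Val-resp (sym B≡) (Val-* (Val-unit (power∉ v p≢2 j)) vB′)) vB) vB′
      reB′ : ∃[ s ] re B′ ≡ + suc s
      reB′ = positive-factor (2 ℕ.^ j) (re B′) {proj₁ re-B} (trans (sym (cong re (trans B≡ (ι-⊠ (+ (2 ℕ.^ j)) B′)))) (proj₂ re-B))
      only-1 : ∀ f k → AtMost 3 f → N B′ ≡ f ℤ.* (k ℤ.* k) → N B′ ≡ k ℤ.* k
      only-1 f k (inj₁ (inj₁ refl)) e = trans e (ℤ.*-identityˡ _)
      only-1 f k (inj₁ (inj₂ refl)) e = ⊥-elim (square-class-≢ 8 ℤ.-1ℤ (+ 1) refl (N B′) k e 8∣N-1)
      only-1 f k (inj₂ (inj₁ refl)) e = ⊥-elim (square-class-≢ 8 (+ 3) (+ 1) refl (N B′) k e 8∣N-1)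
      only-1 f k (inj₂ (inj₂ refl)) e = ⊥-elim (square-class-≢ 8 (ℤ.- + 3) (+ 1) refl (N B′) k e 8∣N-1)
      Result = ∃[ ρ ] ∃[ y ] (ρ ≡ 1 ⊎ ρ ≡ 2 ⊎ ρ ≡ 3 ⊎ ρ ≡ 6) × ι (+ ρ) ⊠ B′ ≡ y ⊠ y
      go : ∃[ f ] ∃[ k ] N B′ ≡ f ℤ.* (k ℤ.* k) × AtMost 3 f → (∃[ k ] N B′ ≡ k ℤ.* k) × Result
      go (f , k , N≡ , f≡) = (k , only-1 f k f≡ N≡) , from-class (square-class-reduced prime-3 B′ (+ ℤ.∣ k ∣)
          (trans (only-1 f k f≡ N≡) (trans (sym (∣i∣²≡i² k)) (ℤ.pos-* ℤ.∣ k ∣ ℤ.∣ k ∣))) B′≢0 (λ e → contradiction (trans (sym c≡) e) λ ()) even-B′)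
        where
        s = proj₁ reB′
        c : ℤ
        c = + 2 ℤ.* re B′ ℤ.+ + 2 ℤ.* + ℤ.∣ k ∣
        c≡ : c ≡ + suc (s ℕ.+ suc (s ℕ.+ 0) ℕ.+ 2 ℕ.* ℤ.∣ k ∣)
        c≡ = cong₂ ℤ._+_ (trans (cong (+ 2 ℤ.*_) (proj₂ reB′)) (sym (ℤ.pos-* 2 (suc s)))) (sym (ℤ.pos-* 2 ℤ.∣ k ∣))
        negative : ∀ a f k → c ≡ + a ℤ.* (ℤ.- + f ℤ.* (k ℤ.* k)) → ⊥
        negative a f k e = contradiction (trans (sym c≡) (trans e (trans (cong (λ z → + a ℤ.* (ℤ.- + f ℤ.* z)) (sym (∣i∣²≡i² k)))
          (trans (solve 3 (λ a f k → a :* (:- f :* k) := :- (a :* (f :* k))) refl (+ a) (+ f) (+ (ℤ.∣ k ∣ ℕ.* ℤ.∣ k ∣)))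
            (cong ℤ.-_ (trans (cong (+ a ℤ.*_) (sym (ℤ.pos-* f _))) (sym (ℤ.pos-* a _)))))))) (no-sign _ _)
          where
          open ℤ-Solve
          no-sign : ∀ p n → + suc p ≢ ℤ.- + n
          no-sign p zero    ()
          no-sign p (suc n) ()
        from-class : SquareClass 3 B′ c → Result
        from-class (squareClass {k = k′} a ε≡ (inj₁ (inj₂ refl)) odd sq c≡′) = ⊥-elim (negative a 1 k′ c≡′)
        from-class (squareClass {k = k′} a ε≡ (inj₂ (inj₂ refl)) odd sq c≡′) = ⊥-elim (negative a 3 k′ c≡′)
        from-class (squareClass {y = y} a (inj₁ refl) (inj₁ (inj₁ refl)) odd sq c≡′) = 1 , y , inj₁ refl ,
          trans (sym (⊠-identityˡ _)) sq
        from-class (squareClass {y = y} a (inj₂ refl) (inj₁ (inj₁ refl)) odd sq c≡′) = 2 , y , inj₂ (inj₁ refl) ,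
          trans (cong (ι (+ 2) ⊠_) (sym (⊠-identityˡ B′))) sq
        from-class (squareClass {y = y} a (inj₁ refl) (inj₂ (inj₁ refl)) odd sq c≡′) = 3 , y , inj₂ (inj₂ (inj₁ refl)) ,
          trans (sym (⊠-identityˡ _)) sq
        from-class (squareClass {y = y} a (inj₂ refl) (inj₂ (inj₁ refl)) odd sq c≡′) = 6 , y , inj₂ (inj₂ (inj₂ refl)) ,
          trans (cong (_⊠ B′) (trans (cong ι (ℤ.pos-* 2 3)) (ι-* (+ 2) (+ 3)))) (trans (⊠-assoc (ι (+ 2)) (ι (+ 3)) B′) sq)

    -- Taking norms in t B Δ = c₆², where N B and N Δ are squares, makes N t a rational square; this
    -- is used both for its residue modulo 8 and for its sign.
    Nt-square : ∀ {k} B′ j → B ≡ ι (+ (2 ℕ.^ j)) ⊠ B′ → N B′ ≡ k ℤ.* k → ∃[ l ] ∃[ n ] N t ℤ.* (l ℤ.* l) ≡ n ℤ.* n × l ≡ + (2 ℕ.^ j) ℤ.* k ℤ.* proj₁ NΔ-square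
    Nt-square {k} B′ j B≡ NB′ = l , N c₆ , trans (sym norms) (trans (cong N tBΔ) (N-⊠ c₆ c₆)) , refl
      where
      open ℤ-Solve
      p = + (2 ℕ.^ j)
      k′ = proj₁ NΔ-square
      l = p ℤ.* k ℤ.* k′
      norms : N (t ⊠ B ⊠ Δ) ≡ N t ℤ.* (l ℤ.* l)
      norms = trans (N-⊠ (t ⊠ B) Δ) (trans (cong₂ ℤ._*_ (trans (N-⊠ t B) (cong (N t ℤ.*_) (trans (cong N B≡) (trans (N-⊠ (ι p) B′) (cong₂ ℤ._*_ (N-ι p) NB′))))) (proj₂ NΔ-square))
        (solve 4 (λ n p k k′ → n :* (p :* p :* (k :* k)) :* (k′ :* k′) := n :* (p :* k :* k′ :* (p :* k :* k′))) refl (N t) p k k′))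

  -- Valuations at the inert prime 3

  module AtThree (inert-3 : Inert 3) (norm≢7 : ∀ x → x ∉ᴾ v₂ → ¬ (+ 8 ∣ N x ℤ.- + 7)) (G : GoodCurve) where
    open SquareClasses norm≢7 G public

    private
      v₃ = inert prime-3 inert-3
      3∤D : ¬ (+ 3 ∣ D)
      3∤D = inert∤D prime-3 inert-3
      open Valᴾ v₃ (no 3∤D)
      open PrimeIdeal (ideal v₃) using (resp; +-closed; *-absorb; absorbʳ; ∉-*)
      open 𝕆-Solver

      3∈ : ι (+ 3) ∈ᴾ v₃
      3∈ = char∣⇒∈ v₃ ℤ.∣-refl

      odd-valuation : t ≢ 𝟎 → ∀ {i j} → Val t i → Val B j → ∀ n → i ℕ.+ j ≡ suc (n ℕ.+ n) → ⊥
      odd-valuation t≢0 {i} {j} vt vB n i+j≡ = go (even-Δ v₃ (λ ()) (no 3∤D)) (total v₃ (λ ()) (no 3∤D) c₆ c₆≢0)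
        where
        c₆≢0 : c₆ ≢ 𝟎
        c₆≢0 e = ⊠-≢0 (⊠-≢0 t≢0 B≢0) Δ≢0 (trans tBΔ (trans (cong (c₆ ⊠_) e) (⊠-zeroʳ c₆)))
        go : ∃[ l ] Val Δ (l ℕ.+ l) → ∃[ k ] Val c₆ k → ⊥
        go (l , vΔ) (k , vc) = odd≢even (n ℕ.+ l) k (trans (cong suc (sym (even-sum n l))) (trans (cong (ℕ._+ (l ℕ.+ l)) (sym i+j≡))
          (Val-unique (Val-resp tBΔ (Val-* (Val-* vt vB) vΔ)) (Val-* vc vc))))

      val-3^ : ∀ k y → y ∉ᴾ v₃ → Val (ι (+ 3) ^ k ⊠ y) k
      val-3^ k y y∉ = val {c = ι (+ 1)} {d = y} (PrimeIdeal.proper (ideal v₃)) y∉ (⊠-identityˡ _)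

      factor∉ : ∀ y → ι (+ 27) ⊠ (y ⊠ y) ⊞ ι (+ 36) ⊠ y ⊞ ι (+ 16) ∉ᴾ v₃
      factor∉ y h = 16∉ (resp (solve 1 (λ y → (con (+ 27) :* (y :* y) :+ con (+ 36) :* y :+ con (+ 16)) :+ con (+ 3) :* (:- (con (+ 9) :* (y :* y)) :- con (+ 12) :* y) := con (+ 16)) refl y)
        (+-closed {ι (+ 27) ⊠ (y ⊠ y) ⊞ ι (+ 36) ⊠ y ⊞ ι (+ 16)} h (absorbʳ {ι (+ 3)} (⊖ (ι (+ 9) ⊠ (y ⊠ y)) ⊟ ι (+ 12) ⊠ y) 3∈)))
        where
        16∉ : ι (+ 16) ∉ᴾ v₃
        16∉ h = valid 3 ((n∣ con (+ 16)) ⇒̇ ⊥̇) refl [] (∈⇒char∣ v₃ h)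

    -- B(27 t₀) = 27 (27 t₀² + 36 t₀ + 16), where the second factor is a unit at 3.
    val-B : ∀ t₀ → t ≡ ι (+ 27) ⊠ t₀ → Val B 3
    val-B t₀ t≡ = Val-resp (sym (trans (cong B-of t≡) (solve 1 (λ t → con (+ 27) :* t :* (con (+ 27) :* t) :+ con (+ 36) :* (con (+ 27) :* t) :+ con (+ 432)
        := con (+ 3) :^ 3 :* (con (+ 27) :* (t :* t) :+ con (+ 36) :* t :+ con (+ 16))) refl t₀)))
      (val-3^ 3 _ (factor∉ t₀))

    -- Valuations 1 and 2 of t at 3 would make that of t B Δ odd.
    t-at-3 : t ≢ 𝟎 → ¬ 3 ∣̂ t ⊎ ∃[ t₀ ] t ≡ ι (+ 27) ⊠ t₀
    t-at-3 t≢0 = go (primitive-part prime-3 t t≢0)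
      where
      go : ∃[ j ] ∃[ y ] t ≡ ι (+ 3) ^ j ⊠ y × ¬ 3 ∣̂ y → ¬ 3 ∣̂ t ⊎ ∃[ t₀ ] t ≡ ι (+ 27) ⊠ t₀
      go (0 , y , t≡ , y∉) = inj₁ (λ h → y∉ (subst (3 ∣̂_) (trans t≡ (⊠-identityˡ y)) h))
      go (1 , y , t≡ , y∉) = ⊥-elim (odd-valuation t≢0 {1} {2} (Val-resp (sym t≡) (val-3^ 1 y y∉))
          (Val-resp (sym (trans (cong B-of t≡) (B≡ y))) (val-3^ 2 _ u∉)) 1 refl)
        where
        B≡ : ∀ y → B-of (ι (+ 3) ^ 1 ⊠ y) ≡ ι (+ 3) ^ 2 ⊠ (y ⊠ y ⊞ ι (+ 12) ⊠ y ⊞ ι (+ 48))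
        B≡ = solve 1 (λ y → (con (+ 3) :^ 1 :* y) :* (con (+ 3) :^ 1 :* y) :+ con (+ 36) :* (con (+ 3) :^ 1 :* y) :+ con (+ 432)
          := con (+ 3) :^ 2 :* (y :* y :+ con (+ 12) :* y :+ con (+ 48))) refl
        u∉ : y ⊠ y ⊞ ι (+ 12) ⊠ y ⊞ ι (+ 48) ∉ᴾ v₃
        u∉ h = ∉-* {y} {y} y∉ y∉ (resp (solve 1 (λ y → (y :* y :+ con (+ 12) :* y :+ con (+ 48)) :+ con (+ 3) :* (:- (con (+ 4) :* y) :- con (+ 16)) := y :* y) refl y)
          (+-closed {y ⊠ y ⊞ ι (+ 12) ⊠ y ⊞ ι (+ 48)} h (absorbʳ {ι (+ 3)} (⊖ (ι (+ 4) ⊠ y) ⊟ ι (+ 16)) 3∈)))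
      go (2 , y , t≡ , y∉) = ⊥-elim (odd-valuation t≢0 {2} {3} (Val-resp (sym t≡) (val-3^ 2 y y∉))
          (Val-resp (sym (trans (cong B-of t≡) (B≡ y))) (val-3^ 3 _ u∉)) 2 refl)
        where
        B≡ : ∀ y → B-of (ι (+ 3) ^ 2 ⊠ y) ≡ ι (+ 3) ^ 3 ⊠ (ι (+ 3) ⊠ (y ⊠ y) ⊞ ι (+ 12) ⊠ y ⊞ ι (+ 16))
        B≡ = solve 1 (λ y → (con (+ 3) :^ 2 :* y) :* (con (+ 3) :^ 2 :* y) :+ con (+ 36) :* (con (+ 3) :^ 2 :* y) :+ con (+ 432)
          := con (+ 3) :^ 3 :* (con (+ 3) :* (y :* y) :+ con (+ 12) :* y :+ con (+ 16))) refl
        u∉ : ι (+ 3) ⊠ (y ⊠ y) ⊞ ι (+ 12) ⊠ y ⊞ ι (+ 16) ∉ᴾ v₃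
        u∉ h = factor∉ y (resp (solve 1 (λ y → (con (+ 3) :* (y :* y) :+ con (+ 12) :* y :+ con (+ 16)) :+ con (+ 3) :* (con (+ 8) :* (y :* y) :+ con (+ 8) :* y)
            := con (+ 27) :* (y :* y) :+ con (+ 36) :* y :+ con (+ 16)) refl y)
          (+-closed {ι (+ 3) ⊠ (y ⊠ y) ⊞ ι (+ 12) ⊠ y ⊞ ι (+ 16)} h (absorbʳ {ι (+ 3)} (ι (+ 8) ⊠ (y ⊠ y) ⊞ ι (+ 8) ⊠ y) 3∈)))
      go (suc (suc (suc j)) , y , t≡ , y∉) = inj₂ (ι (+ 3) ^ j ⊠ y , trans t≡
        (solve 2 (λ p y → con (+ 3) :* (con (+ 3) :* (con (+ 3) :* p)) :* y := con (+ 27) :* (p :* y)) refl (ι (+ 3) ^ j) y))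

    B-not-square : t ≢ 𝟎 → ∀ {t₀ w} → t ≡ ι (+ 27) ⊠ t₀ → B ≢ w ⊠ w
    B-not-square t≢0 {t₀} {w} t≡ B≡ = go (total v₃ (λ ()) (no 3∤D) w w≢0)
      where
      w≢0 : w ≢ 𝟎
      w≢0 e = B≢0 (trans B≡ (trans (cong (w ⊠_) e) (⊠-zeroʳ w)))
      go : ∃[ k ] Val w k → ⊥
      go (k , vw) = odd≢even 1 k (Val-unique (val-B t₀ t≡) (Val-resp (sym B≡) (Val-* vw vw)))

    nine-square : ∀ {c t₀ y} → t ≡ ι (+ 27) ⊠ t₀ → ι (+ 3) ⊠ (c ⊠ B) ≡ y ⊠ y →
      ∃[ v ] c ⊠ (ι (+ 27) ⊠ (t₀ ⊠ t₀) ⊞ ι (+ 36) ⊠ t₀ ⊞ ι (+ 16)) ≡ v ⊠ v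
    nine-square {c} {t₀} {y} t≡ eq = ι-square-root {+ 9} {c ⊠ (ι (+ 27) ⊠ (t₀ ⊠ t₀) ⊞ ι (+ 36) ⊠ t₀ ⊞ ι (+ 16))} {y} (λ ())
      (trans (solve 2 (λ c t → con (+ 9) :* con (+ 9) :* (c :* (con (+ 27) :* (t :* t) :+ con (+ 36) :* t :+ con (+ 16)))
          := con (+ 3) :* (c :* (con (+ 27) :* t :* (con (+ 27) :* t) :+ con (+ 36) :* (con (+ 27) :* t) :+ con (+ 432)))) refl c t₀)
        (trans (cong (λ z → ι (+ 3) ⊠ (c ⊠ B-of z)) (sym t≡)) eq))

  -- Reduction at 2

  open QuadraticPoly D

  odd-value : ∀ a b → (a +√ b) ∉ᴾ v₂ → ¬ (+ 8 ∣ + 4 ℤ.* (a ℤ.+ D ℤ.* b))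
  odd-value a b x∉ h = x∉ (∣-halve {4} {2} (λ ()) h)

  odd-value₄ : ∀ a b → (a +√ b) ∉ᴾ v₂ → ¬ (+ 4 ∣ + 2 ℤ.* (a ℤ.+ D ℤ.* b))
  odd-value₄ a b x∉ h = x∉ (∣-halve {2} {2} (λ ()) h)

  coords : ∀ n {a b c d} → (a +√ b) ≡ (c +√ d) → n ∣ a ℤ.- c × n ∣ b ℤ.- d
  coords n eq = ∣-of-≡ n (cong re eq) , ∣-of-≡ n (cong im eq)

  coords-mod : ∀ n x y z → x ≡ y ⊞ ι n ⊠ z → n ∣ re x ℤ.- re y × n ∣ im x ℤ.- im y
  coords-mod n .((a +√ b) ⊞ ι n ⊠ (c +√ d)) (a +√ b) (c +√ d) refl =
    divides c (solve 5 (λ k a n c e → a :+ (n :* c :+ k :* (con (+ 0) :* e)) :- a := c :* n) refl D a n c d) ,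
    divides d (solve 4 (λ b n c e → b :+ (n :* e :+ con (+ 0) :* c) :- b := e :* n) refl b n c d)
    where open ℤ-Solve

  -- Meant for the modulus 8, where 4p ≢ 0 says that p is odd. Applied to `evₚ`, which sends √m to
  -- m, it expresses that an element is prime to v₂.
  oddₚ : ∀ {v} → Poly v → Formula v
  oddₚ p = (n∣ con (+ 4) ⊗ p) ⇒̇ ⊥̇

  X₂ : Quad 2
  X₂ = var 0F , var 1F

  X Y : Quad 4
  X = var 0F , var 1F
  Y = var 2F , var 3F

  X₆ Y₆ Z₆ : Quad 6
  X₆ = var 0F , var 1F
  Y₆ = var 2F , var 3F
  Z₆ = var 4F , var 5F

  norm-formula : Formula 2
  norm-formula = oddₚ (evₚ X₂) ⇒̇ (n∣ Nₚ X₂ ⊖ con (+ 7)) ⇒̇ ⊥̇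

  B-formula : Formula 2
  B-formula = oddₚ (evₚ X₂) ⇒̇ (n∣ Nₚ (Bₚ X₂) ⊖ con (+ 1))

  class-formula : ℤ → Formula 4
  class-formula ρ = oddₚ (evₚ X) ⇒̇ (ιₚ ρ *ₚ Bₚ X ≈ₚ Y *ₚ Y) ⇒̇ ⊥̇

  fourth-formula : Formula 2
  fourth-formula = oddₚ (evₚ X₂) ⇒̇ (n∣ proj₁ (ιₚ (ℤ.- + 27) *ₚ (X₂ ^ₚ 4)) ⊖ con (+ 5))

  unit-root-formula : ℤ → Formula 4
  unit-root-formula g = oddₚ (evₚ X) ⇒̇ (Y *ₚ Y ≈ₚ ιₚ g *ₚ (ιₚ (ℤ.- + 27) *ₚ (X ^ₚ 4))) ⇒̇ (n∣ Nₚ Y ⊖ con (+ 5))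

  -- Taken modulo 16: re Δ ≡ 5 (mod 8) gives re (±2Δ) ≡ ±10 (mod 16), which is not the rational part
  -- of a square.
  double-root-formula : ℤ → Formula 2
  double-root-formula g = (n∣ proj₁ (X₂ *ₚ X₂) ⊖ con g) ⇒̇ ⊥̇

  -- For X₆ = a₁, Y₆ = a₁²/2 and Z₆ = a₃ the term R is the part of Δ that `Δ-a₁²=2e` leaves modulo
  -- 4; the formula evaluates it to r + 2√m.
  ramified-formula : ℤ → Formula 6
  ramified-formula r = (n∣ con (+ 2) ⊗ evₚ X₆) ⇒̇ ((n∣ con (+ 2) ⊗ var 0F) ∧̇ (n∣ con (+ 2) ⊗ var 1F) ⇒̇ ⊥̇) ⇒̇
    ((n∣ con (+ 2) ⊗ evₚ Y₆) ⇒̇ ⊥̇) ⇒̇ ((n∣ con (+ 2) ⊗ evₚ Z₆) ⇒̇ ⊥̇) ⇒̇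
    (n∣ proj₁ R ⊖ con r) ∧̇ (n∣ proj₂ R ⊖ con (+ 2))
    where
    R : Quad 6
    R = ιₚ (ℤ.- + 27) *ₚ (Z₆ ^ₚ 4) +ₚ ιₚ (+ 18) *ₚ (Y₆ *ₚ X₆ *ₚ (Z₆ ^ₚ 3))

  -- Congruences modulo powers of 2, decided for each m by evaluation.
  record Checks (r : ℤ) : Set where
    field
      norm-check    : Tautology 8 norm-formula
      B-check       : Tautology 8 B-formula
      fourth-check  : Tautology 8 fourth-formula
      unit-check⁺   : Tautology 8 (unit-root-formula (+ 1))
      unit-check⁻   : Tautology 8 (unit-root-formula ℤ.-1ℤ)
      double-check⁺ : Tautology 16 (double-root-formula (+ 10))
      double-check⁻ : Tautology 16 (double-root-formula (ℤ.- + 10))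
      ramified-check : Tautology 4 (ramified-formula r)

  module AtTwo {r : ℤ} (checks : Checks r) where
    open Checks checks

    norm≢7 : ∀ x → x ∉ᴾ v₂ → ¬ (+ 8 ∣ N x ℤ.- + 7)
    norm≢7 (a +√ b) x∉ = tautological 8 norm-formula norm-check (a ∷ b ∷ []) (odd-value a b x∉)

    NB≡1 : ∀ t → t ∉ᴾ v₂ → + 8 ∣ N (B-of t) ℤ.- + 1
    NB≡1 (a +√ b) t∉ = tautological 8 B-formula B-check (a ∷ b ∷ []) (odd-value a b t∉)

    not-class : ∀ ρ → Tautology 8 (class-formula ρ) → ∀ t y → t ∉ᴾ v₂ →
      ι ρ ⊠ B-of t ≢ y ⊠ y
    not-class ρ chk (a +√ b) (c +√ d) t∉ eq = tautological 8 (class-formula ρ) chk (a ∷ b ∷ c ∷ d ∷ []) (odd-value a b t∉) (coords (+ 8) eq)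

    module _ (G : GoodCurve) where
      open SquareClasses norm≢7 G

      private
        open 𝕆-Solver

        -- Here Δ ≡ 5 (mod 8), which y² = ±Δ or ±2Δ does not allow.
        not-2∣a₁ : ∀ a → a₁ ≢ ι (+ 2) ⊠ a
        not-2∣a₁ a a₁≡ = go (Δ-2∣a₁ a a₁≡)
          where
          go : ∃[ Z ] Δ ≡ ι (ℤ.- + 27) ⊠ a₃ ^ 4 ⊞ ι (+ 8) ⊠ Z → ⊥
          go (Z , Δ≡) = from-root Δ-class
            where
            a₃∉ : a₃ ∉ᴾ v₂
            a₃∉ = a₃∉v₂ {𝟎} {ι (+ 4) ⊠ Z} (trans Δ≡ (solve 2 (λ x z → x :+ con (+ 8) :* z := x :+ con (+ 2) :* con (+ 0) :+ con (+ 2) :* (con (+ 4) :* z)) refl _ Z))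
            reΔ≡5 : + 8 ∣ re Δ ℤ.- + 5
            reΔ≡5 = ∣-minus-trans (+ 8) {re Δ} {re (ι (ℤ.- + 27) ⊠ a₃ ^ 4)} (proj₁ (coords-mod (+ 8) Δ (ι (ℤ.- + 27) ⊠ a₃ ^ 4) Z Δ≡)) (at′ a₃ a₃∉)
              where
              at′ : ∀ x → x ∉ᴾ v₂ → + 8 ∣ re (ι (ℤ.- + 27) ⊠ x ^ 4) ℤ.- + 5
              at′ (a +√ b) x∉ = tautological 8 fourth-formula fourth-check (a ∷ b ∷ []) (odd-value a b x∉)
            unit : ∀ g y → Tautology 8 (unit-root-formula g) → ι g ⊠ Δ ≡ y ⊠ y → + 8 ∣ N y ℤ.- + 5
            unit g y chk eq = at′ a₃ y a₃∉ (coords-mod (+ 8) (y ⊠ y) (ι g ⊠ (ι (ℤ.- + 27) ⊠ a₃ ^ 4)) (ι g ⊠ Z)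
              (trans (sym eq) (trans (cong (ι g ⊠_) Δ≡) (solve 3 (λ g x z → g :* (x :+ con (+ 8) :* z) := g :* x :+ con (+ 8) :* (g :* z)) refl (ι g) _ Z))))
              where
              at′ : ∀ x y → x ∉ᴾ v₂ → + 8 ∣ re (y ⊠ y) ℤ.- re (ι g ⊠ (ι (ℤ.- + 27) ⊠ x ^ 4)) × + 8 ∣ im (y ⊠ y) ℤ.- im (ι g ⊠ (ι (ℤ.- + 27) ⊠ x ^ 4)) →
                   + 8 ∣ N y ℤ.- + 5
              at′ (a +√ b) (c +√ d) x∉ = tautological 8 (unit-root-formula g) chk (a ∷ b ∷ c ∷ d ∷ []) (odd-value a b x∉)
            double : ∀ g y c → Tautology 16 (double-root-formula c) → (∀ d → + 8 ∣ d ℤ.- + 5 → + 16 ∣ g ℤ.* d ℤ.- c) → ι g ⊠ Δ ≢ y ⊠ y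
            double g y c chk lift eq = at′ y (subst (λ z → + 16 ∣ z ℤ.- c) (sym (trans (cong re (sym eq)) (cong re (ι-⊠ g Δ)))) (lift (re Δ) reΔ≡5))
              where
              at′ : ∀ y → ¬ (+ 16 ∣ re (y ⊠ y) ℤ.- c)
              at′ (a +√ b) = tautological 16 (double-root-formula c) chk (a ∷ b ∷ [])
            not-5 : ∀ {f k y} → AtMost 2 f → N y ≡ f ℤ.* (k ℤ.* k) → ¬ (+ 8 ∣ N y ℤ.- + 5)
            not-5 {k = k} {y} (inj₁ (inj₁ refl)) e h = square-class-≢ 8 (+ 1) (+ 5) refl (N y) k e h
            not-5 {k = k} {y} (inj₁ (inj₂ refl)) e h = square-class-≢ 8 ℤ.-1ℤ (+ 5) refl (N y) k e h
            not-5 {k = k} {y} (inj₂ (inj₁ refl)) e h = square-class-≢ 8 (+ 2) (+ 5) refl (N y) k e h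
            not-5 {k = k} {y} (inj₂ (inj₂ refl)) e h = square-class-≢ 8 (ℤ.- + 2) (+ 5) refl (N y) k e h
            norm-contradiction : ∀ {g y} → Small g → ι g ⊠ Δ ≡ y ⊠ y → + 8 ∣ N y ℤ.- + 5 → ⊥
            norm-contradiction {g} {y} small eq h = finish (root-norm {g} {y} small eq)
              where
              finish : ∃[ f ] ∃[ k ] N y ≡ f ℤ.* (k ℤ.* k) × AtMost 2 f → ⊥
              finish (f , k , e , f≡) = not-5 {f} {k} {y} f≡ e h
            from-root : ∃[ g ] ∃[ y ] Small g × ι g ⊠ Δ ≡ y ⊠ y → ⊥
            from-root (g , y , small@(inj₁ (inj₁ refl)) , eq) = norm-contradiction {g} {y} small eq (unit (+ 1) y unit-check⁺ eq)
            from-root (g , y , small@(inj₁ (inj₂ refl)) , eq) = norm-contradiction {g} {y} small eq (unit ℤ.-1ℤ y unit-check⁻ eq)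
            from-root (g , y , inj₂ (inj₁ refl) , eq) = double (+ 2) y (+ 10) double-check⁺ (λ d h → subst (+ 16 ∣_)
              (ℤ-Solve.solve 1 (λ d → ℤ-Solve.con (+ 2) ℤ-Solve.:* (d ℤ-Solve.:- ℤ-Solve.con (+ 5)) ℤ-Solve.:= ℤ-Solve.con (+ 2) ℤ-Solve.:* d ℤ-Solve.:- ℤ-Solve.con (+ 10)) refl d) (∣-double {2} {8} h)) eq
            from-root (g , y , inj₂ (inj₂ refl) , eq) = double (ℤ.- + 2) y (ℤ.- + 10) double-check⁻ (λ d h → ∣-multiple ℤ.-1ℤ (∣-double {2} {8} h)
              (ℤ-Solve.solve 1 (λ d → ℤ-Solve.con (ℤ.- + 2) ℤ-Solve.:* d ℤ-Solve.:- ℤ-Solve.con (ℤ.- + 10) ℤ-Solve.:= ℤ-Solve.con ℤ.-1ℤ ℤ-Solve.:* (ℤ-Solve.con (+ 2) ℤ-Solve.:* (d ℤ-Solve.:- ℤ-Solve.con (+ 5)))) refl d)) eq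

      -- The reduction at v₂ is supersingular because a₁ ∈ v₂, but a₁ has the least possible
      -- valuation there, so that η = a₁²/2 is a unit.
      record Ramified₂ : Set where
        field
          {η}    : 𝕆
          a₁∈    : a₁ ∈ᴾ v₂
          2∤a₁   : ¬ 2 ∣̂ a₁
          a₁²≡2η : a₁ ^ 2 ≡ ι (+ 2) ⊠ η
          η∉     : η ∉ᴾ v₂
          a₃∉    : a₃ ∉ᴾ v₂
          reΔ    : + 4 ∣ re Δ ℤ.- r
          imΔ    : + 4 ∣ im Δ ℤ.- + 2

      reduction-cases : t ∉ᴾ v₂ ⊎ Ramified₂
      reduction-cases = go a₁-cases
        where
        go : (a₁ ∉ᴾ v₂) ⊎ (∃[ a ] a₁ ≡ ι (+ 2) ⊠ a) ⊎ (a₁ ∈ᴾ v₂ × ¬ 2 ∣̂ a₁ × ∃[ e ] a₁ ⊠ a₁ ≡ ι (+ 2) ⊠ e × e ∉ᴾ v₂) → t ∉ᴾ v₂ ⊎ Ramified₂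
        go (inj₁ a₁∉)                  = inj₁ (ordinary a₁∉)
        go (inj₂ (inj₁ (a , a₁≡)))     = ⊥-elim (not-2∣a₁ a a₁≡)
        go (inj₂ (inj₂ (a₁∈ , 2∤a₁ , e , a₁a₁≡ , e∉))) = inj₂ (from-Δ (Δ-a₁²=2e e a₁²≡))
          where
          a₁²≡ : a₁ ^ 2 ≡ ι (+ 2) ⊠ e
          a₁²≡ = trans (^2≡ a₁) a₁a₁≡
          from-Δ : ∃[ Z ] Δ ≡ ι (ℤ.- + 27) ⊠ a₃ ^ 4 ⊞ ι (+ 18) ⊠ (e ⊠ a₁ ⊠ a₃ ^ 3) ⊞ ι (+ 4) ⊠ Z → Ramified₂
          from-Δ (Z , Δ≡) = record { η = e ; a₁∈ = a₁∈ ; 2∤a₁ = 2∤a₁ ; a₁²≡2η = a₁²≡ ; η∉ = e∉ ; a₃∉ = a₃∉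
              ; reΔ = ∣-minus-trans (+ 4) {re Δ} {re (M a₁ e a₃)} (proj₁ mod-4) (proj₁ main) ; imΔ = ∣-minus-trans (+ 4) {im Δ} {im (M a₁ e a₃)} (proj₂ mod-4) (proj₂ main) }
            where
            M : 𝕆 → 𝕆 → 𝕆 → 𝕆
            M a₁ e a₃ = ι (ℤ.- + 27) ⊠ a₃ ^ 4 ⊞ ι (+ 18) ⊠ (e ⊠ a₁ ⊠ a₃ ^ 3)
            a₃∉ : a₃ ∉ᴾ v₂
            a₃∉ = a₃∉v₂ {ι (+ 9) ⊠ (e ⊠ a₁ ⊠ a₃ ^ 3)} {ι (+ 2) ⊠ Z} (trans Δ≡
              (solve 3 (λ x y z → x :+ con (+ 18) :* y :+ con (+ 4) :* z := x :+ con (+ 2) :* (con (+ 9) :* y) :+ con (+ 2) :* (con (+ 2) :* z)) refl _ _ Z))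
            mod-4 : + 4 ∣ re Δ ℤ.- re (M a₁ e a₃) × + 4 ∣ im Δ ℤ.- im (M a₁ e a₃)
            mod-4 = coords-mod (+ 4) Δ (M a₁ e a₃) Z Δ≡
            at′ : ∀ a₁ e a₃ → a₁ ∈ᴾ v₂ → ¬ 2 ∣̂ a₁ → e ∉ᴾ v₂ → a₃ ∉ᴾ v₂ → + 4 ∣ re (M a₁ e a₃) ℤ.- r × + 4 ∣ im (M a₁ e a₃) ℤ.- + 2
            at′ (a +√ b) (c +√ d) (g +√ h) a₁∈ 2∤a₁ e∉ a₃∉ = tautological 4 (ramified-formula r) ramified-check (a ∷ b ∷ c ∷ d ∷ g ∷ h ∷ [])
              (∣-double {2} {2} a₁∈) (λ (k , l) → 2∤a₁ (∣-halve {2} {2} (λ ()) k , ∣-halve {2} {2} (λ ()) l)) (odd-value₄ c d e∉) (odd-value₄ g h a₃∉)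
            main : + 4 ∣ re (M a₁ e a₃) ℤ.- r × + 4 ∣ im (M a₁ e a₃) ℤ.- + 2
            main = at′ a₁ e a₃ a₁∈ 2∤a₁ e∉ a₃∉

  -- N Δ ≡ r² - 4m (mod 8), since im Δ ≡ 2 (mod 4); for odd r and m this is the non-square 5.
  ramified-norm-formula : ℤ → Formula 3
  ramified-norm-formula r = (n∣ con (+ 2) ⊗ (var 0F ⊖ con r)) ⇒̇ (n∣ con (+ 2) ⊗ (var 1F ⊖ con (+ 2))) ⇒̇
    (n∣ Nₚ (var 0F , var 1F) ⊖ var 2F ⊗ var 2F) ⇒̇ ⊥̇

  -- For ρ = 3 or 6 and 3 inert: 3 divides y, hence 9 divides y² and 3 divides B ≡ t² (mod 3), so 3
  -- divides t. The modulus 9 allows the factor 3 of ρ to be cancelled.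
  three-formula : ℤ → Formula 4
  three-formula ρ = (ιₚ ρ *ₚ Bₚ X ≈ₚ Y *ₚ Y) ⇒̇ (n∣ con (+ 3) ⊗ var 0F) ∧̇ (n∣ con (+ 3) ⊗ var 1F)

  shifted-norm-formula : Formula 4
  shifted-norm-formula = (ιₚ (+ 1) *ₚ (ιₚ (+ 27) *ₚ (X *ₚ X) +ₚ ιₚ (+ 36) *ₚ X +ₚ ιₚ (+ 16)) ≈ₚ Y *ₚ Y) ⇒̇ (n∣ Nₚ X ⊖ con (+ 1)) ⇒̇
    (n∣ Nₚ (Y +ₚ ιₚ (+ 2)) ⊖ con (+ 5))

  -- Excluding the classes when t is prime to 2

  module OddAtTwo {r : ℤ} (checks : Checks r) (G : GoodCurve) where
    open AtTwo checks
    open SquareClasses norm≢7 G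

    Class : ℕ → Set
    Class ρ = ∃[ y ] ι (+ ρ) ⊠ B ≡ y ⊠ y

    module _ (t∉ : t ∉ᴾ v₂) where
      t≢0 : t ≢ 𝟎
      t≢0 = ∉⇒≢0 v₂ t∉

      classes : (∃[ k ] N B ≡ k ℤ.* k) × ∃[ ρ ] ∃[ y ] (ρ ≡ 1 ⊎ ρ ≡ 2 ⊎ ρ ≡ 3 ⊎ ρ ≡ 6) × ι (+ ρ) ⊠ B ≡ y ⊠ y
      classes = B-class t≢0 B 0 (sym (⊠-identityˡ B)) (NB≡1 t t∉)

      excluded : ∀ {ρ} → Tautology 8 (class-formula (+ ρ)) → ¬ Class ρ
      excluded {ρ} chk (y , eq) = not-class (+ ρ) chk t y t∉ eq

      Nt≡1 : + 8 ∣ N t ℤ.- + 1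
      Nt≡1 = go (proj₁ classes)
        where
        go : ∃[ k ] N B ≡ k ℤ.* k → + 8 ∣ N t ℤ.- + 1
        go (k , NB≡) = from-square (Nt-square {k} B 0 (sym (⊠-identityˡ B)) NB≡)
          where
          k′ = proj₁ NΔ-square
          k²≡1 : + 8 ∣ k ℤ.* k ℤ.- + 1
          k²≡1 = subst (λ z → + 8 ∣ z ℤ.- + 1) NB≡ (NB≡1 t t∉)
          from-square : ∃[ l ] ∃[ n ] N t ℤ.* (l ℤ.* l) ≡ n ℤ.* n × l ≡ + 1 ℤ.* k ℤ.* k′ → + 8 ∣ N t ℤ.- + 1
          from-square (.(+ 1 ℤ.* k ℤ.* k′) , n , eq , refl) = valid 8
            ((n∣ var 0F ⊗ (l ⊗ l) ⊖ var 3F ⊗ var 3F) ⇒̇ ((n∣ con (+ 4) ⊗ var 0F) ⇒̇ ⊥̇) ⇒̇ (n∣ var 1F ⊗ var 1F ⊖ con (+ 1)) ⇒̇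
              ((n∣ con (+ 4) ⊗ (var 2F ⊗ var 2F)) ⇒̇ ⊥̇) ⇒̇ (n∣ var 0F ⊖ con (+ 1)))
            refl (N t ∷ k ∷ k′ ∷ n ∷ []) (∣-of-≡ (+ 8) eq) (λ h → odd-norm t t∉ (∣-halve {4} {2} (λ ()) h)) k²≡1
            (λ h → odd-norm Δ Δ∉v₂ (subst (+ 2 ∣_) (sym (proj₂ NΔ-square)) (∣-halve {4} {2} (λ ()) h)))
            where
            l : Poly 4
            l = con (+ 1) ⊗ var 1F ⊗ var 2F

    no-ramified : Tautology 8 (ramified-norm-formula r) → ¬ Ramified₂ G
    no-ramified chk R = tautological 8 (ramified-norm-formula r) chk (re Δ ∷ im Δ ∷ proj₁ NΔ-square ∷ [])
        (∣-double {2} {4} (Ramified₂.reΔ R)) (∣-double {2} {4} (Ramified₂.imΔ R)) (∣-of-≡ (+ 8) (trans (sym (N-coords Δ)) (proj₂ NΔ-square)))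
      where
      N-coords : ∀ x → N x ≡ re x ℤ.* re x ℤ.- D ℤ.* (im x ℤ.* im x)
      N-coords (a +√ b) = refl

    unramified : Tautology 8 (ramified-norm-formula r) → t ∉ᴾ v₂
    unramified chk = [ (λ t∉ → t∉) , (λ R → ⊥-elim (no-ramified chk R)) ]′ (reduction-cases G)

  module ThreeClass {r : ℤ} (checks : Checks r) (inert-3 : Inert 3) (G : GoodCurve) where
    open AtTwo checks
    open AtThree inert-3 norm≢7 G

    27∣t : ∀ ρ → Tautology 9 (three-formula ρ) → t ≢ 𝟎 → ∀ {y} → ι ρ ⊠ B ≡ y ⊠ y → ∃[ t₀ ] t ≡ ι (+ 27) ⊠ t₀
    27∣t ρ chk t≢0 {y} eq = [ (λ 3∤t → ⊥-elim (3∤t (3∣t t y eq))) , (λ h → h) ]′ (t-at-3 t≢0)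
      where
      3∣t : ∀ t y → ι ρ ⊠ B-of t ≡ y ⊠ y → 3 ∣̂ t
      3∣t (a +√ b) (c +√ d) eq = halve (tautological 9 (three-formula ρ) chk (a ∷ b ∷ c ∷ d ∷ []) (coords (+ 9) eq))
        where
        halve : + 9 ∣ + 3 ℤ.* a × + 9 ∣ + 3 ℤ.* b → 3 ∣̂ (a +√ b)
        halve (h , h′) = ∣-halve {3} {3} (λ ()) h , ∣-halve {3} {3} (λ ()) h′

    -- With z = 3t₀ + 2, the product (v + 2)(v − 2) is 3z², so v + 2 is a square up to 2 and 3 while its norm is 5 (mod 8).
    three-not-class : Tautology 9 (three-formula (+ 3)) → Tautology 8 shifted-norm-formula → (t∉ : t ∉ᴾ v₂) → ∀ {y} → ι (+ 3) ⊠ B ≢ y ⊠ y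
    three-not-class chk₉ chk₈ t∉ {y} eq = from-t₀ (27∣t (+ 3) chk₉ (∉⇒≢0 v₂ t∉) {y} eq)
      where
      from-t₀ : ∃[ t₀ ] t ≡ ι (+ 27) ⊠ t₀ → ⊥
      from-t₀ (t₀ , t≡) = from-v (nine-square {ι (+ 1)} {t₀} {y} t≡ (trans (cong (ι (+ 3) ⊠_) (⊠-identityˡ B)) eq))
        where
        Nt₀≡1 : + 8 ∣ N t₀ ℤ.- + 1
        Nt₀≡1 = valid 8 ((n∣ con (+ 27) ⊗ con (+ 27) ⊗ var 0F ⊖ con (+ 1)) ⇒̇ (n∣ var 0F ⊖ con (+ 1))) refl (N t₀ ∷ [])
          (subst (λ z → + 8 ∣ z ℤ.- + 1) (trans (cong N t≡) (trans (N-⊠ (ι (+ 27)) t₀) (cong (ℤ._* N t₀) (N-ι (+ 27))))) (OddAtTwo.Nt≡1 checks G t∉))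
        from-v : ∃[ v ] ι (+ 1) ⊠ (ι (+ 27) ⊠ (t₀ ⊠ t₀) ⊞ ι (+ 36) ⊠ t₀ ⊞ ι (+ 16)) ≡ v ⊠ v → ⊥
        from-v (v , eq) = finish (norm-class prime-3 w w≢0 (inj₂ 2∤Nw) even)
          where
          w u z : 𝕆
          w = v ⊞ ι (+ 2)
          u = v ⊟ ι (+ 2)
          z = ι (+ 3) ⊠ t₀ ⊞ ι (+ 2)
          Nw≡5 : + 8 ∣ N w ℤ.- + 5
          Nw≡5 = go t₀ v eq Nt₀≡1
            where
            go : ∀ t₀ v → ι (+ 1) ⊠ (ι (+ 27) ⊠ (t₀ ⊠ t₀) ⊞ ι (+ 36) ⊠ t₀ ⊞ ι (+ 16)) ≡ v ⊠ v → + 8 ∣ N t₀ ℤ.- + 1 → + 8 ∣ N (v ⊞ ι (+ 2)) ℤ.- + 5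
            go (a +√ b) (c +√ d) eq = tautological 8 shifted-norm-formula chk₈ (a ∷ b ∷ c ∷ d ∷ []) (coords (+ 8) eq)
          2∤Nw : ¬ (+ 2 ∣ N w)
          2∤Nw h = valid 8 ((n∣ con (+ 4) ⊗ var 0F) ⇒̇ (n∣ var 0F ⊖ con (+ 5)) ⇒̇ ⊥̇) refl (N w ∷ []) (∣-double {4} {2} h) Nw≡5
          w≢0 : w ≢ 𝟎
          w≢0 e = 2∤Nw (subst (λ x → + 2 ∣ N x) (sym e) (subst (+ 2 ∣_) (sym (N-ι (+ 0))) (subst (+ 2 ∣_) (sym (ℤ.*-zeroʳ (+ 0))) ℤ.∣0)))
          z≢0 : z ≢ 𝟎
          z≢0 e = go t₀ (cong re e)
            where
            go : ∀ t₀ → re (ι (+ 3) ⊠ t₀ ⊞ ι (+ 2)) ≢ + 0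
            go (a +√ b) e = valid 3 ((n∣ con (+ 3) ⊗ var 0F ⊕ var 2F ⊗ (con (+ 0) ⊗ var 1F) ⊕ con (+ 2)) ⇒̇ ⊥̇) refl (a ∷ b ∷ D ∷ [])
              (subst (+ 3 ∣_) (sym e) ℤ.∣0)
          wu≡ : w ⊠ u ≡ ι (+ 3) ⊠ (z ⊠ z)
          wu≡ = trans (solve 1 (λ v → (v :+ con (+ 2)) :* (v :- con (+ 2)) := v :* v :- con (+ 4)) refl v)
            (trans (cong (_⊟ ι (+ 4)) (sym eq)) (solve 1 (λ t → con (+ 1) :* (con (+ 27) :* (t :* t) :+ con (+ 36) :* t :+ con (+ 16)) :- con (+ 4)
              := con (+ 3) :* ((con (+ 3) :* t :+ con (+ 2)) :* (con (+ 3) :* t :+ con (+ 2)))) refl t₀))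
            where open 𝕆-Solver
          even : ∀ v → char v ≢ 2 → char v ≢ 3 → EvenAt v w
          even P p≢2 p≢3 d = by-cases (PrimeIdeal.𝔓? (ideal P) w)
            where
            open Valᴾ P d
            open PrimeIdeal (ideal P) using (resp; +-closed; *-absorb)
            prime∉ : ∀ {s} → Prime s → char P ≢ s → ι (+ s) ∉ᴾ P
            prime∉ ps p≢s h = [ (λ p≡1 → ¬p∣1 (char-prime P) (ℤ.∣ᵤ⇒∣ (ℕ∣.∣-reflexive p≡1))) , p≢s ]′ (prime⇒irreducible ps (ℤ.∣⇒∣ᵤ (∈⇒char∣ P h)))
            4∉ : ι (+ 4) ∉ᴾ P
            4∉ = subst (_∉ᴾ P) (trans (sym (ι-* (+ 2) (+ 2))) (cong ι (sym (ℤ.pos-* 2 2))))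
              (∉-⊠ P (ι (+ 2)) (ι (+ 2)) (prime∉ prime-2 p≢2) (prime∉ prime-2 p≢2))
            by-cases : Dec (w ∈ᴾ P) → ∃[ k ] Val w (k ℕ.+ k)
            by-cases (no w∉)  = 0 , Val-unit w∉
            by-cases (yes w∈) = go (total P p≢2 d w w≢0) (total P p≢2 d z z≢0)
              where
              u∉ : u ∉ᴾ P
              u∉ u∈ = 4∉ (resp (solve 1 (λ v → (v :+ con (+ 2)) :+ con ℤ.-1ℤ :* (v :- con (+ 2)) := con (+ 4)) refl v)
                (+-closed {w} w∈ (*-absorb (ι ℤ.-1ℤ) {u} u∈)))
                where open 𝕆-Solver
              go : ∃[ k ] Val w k → ∃[ l ] Val z l → ∃[ k ] Val w (k ℕ.+ k)
              go (k , vw) (l , vz) = l , subst (Val w) (trans (sym (ℕ.+-identityʳ k))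
                (Val-unique (Val-resp wu≡ (Val-* vw (Val-unit u∉))) (Val-* (Val-unit (prime∉ prime-3 p≢3)) (Val-* vz vz)))) vw
          finish : ∃[ f ] ∃[ k ] N w ≡ f ℤ.* (k ℤ.* k) × AtMost 3 f → ⊥
          finish (f , k , N≡ , inj₁ (inj₁ refl)) = square-class-≢ 8 (+ 1) (+ 5) refl (N w) k N≡ Nw≡5
          finish (f , k , N≡ , inj₁ (inj₂ refl)) = square-class-≢ 8 ℤ.-1ℤ (+ 5) refl (N w) k N≡ Nw≡5
          -- Norms have even valuation at the inert prime 3, so the classes ±3 cannot occur.
          finish (f , k , N≡ , inj₂ (inj₁ refl)) = inert-norm-squarefree-part prime-3 (λ ()) inert-3 {w} {+ 3} {k} w≢0 N≡ (from-yes (squarefree? 3)) ℤ.∣-refl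
          finish (f , k , N≡ , inj₂ (inj₂ refl)) = inert-norm-squarefree-part prime-3 (λ ()) inert-3 {w} {ℤ.- + 3} {k} w≢0 N≡ (from-yes (squarefree? 3))
            (divides ℤ.-1ℤ (sym (ℤ.-1*i≡-i (+ 3))))

  norm-three-formula : Formula 2
  norm-three-formula = (n∣ Nₚ X₂) ⇒̇ (n∣ var 0F) ∧̇ (n∣ var 1F)

  inert-3 : Tautology 3 norm-three-formula → Inert 3
  inert-3 chk (a +√ b) h = tautological 3 norm-three-formula chk (a ∷ b ∷ []) h

  no-curve-odd : ∀ {r} → Checks r → Tautology 8 (ramified-norm-formula r) →
    Tautology 8 (class-formula (+ 1)) → Tautology 8 (class-formula (+ 2)) → Tautology 8 (class-formula (+ 3)) → Tautology 8 (class-formula (+ 6)) →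
    NoCurve
  no-curve-odd checks chk c₁ c₂ c₃ c₆ = no-curve no-good-curve
    where
    no-good-curve : ¬ GoodCurve
    no-good-curve G = go (proj₂ (classes t∉))
      where
      open OddAtTwo checks G
      t∉ = unramified chk
      go : ∃[ ρ ] ∃[ y ] (ρ ≡ 1 ⊎ ρ ≡ 2 ⊎ ρ ≡ 3 ⊎ ρ ≡ 6) × ι (+ ρ) ⊠ Curve.B G ≡ y ⊠ y → ⊥
      go (_ , y , inj₁ refl , eq)               = excluded t∉ c₁ (y , eq)
      go (_ , y , inj₂ (inj₁ refl) , eq)        = excluded t∉ c₂ (y , eq)
      go (_ , y , inj₂ (inj₂ (inj₁ refl)) , eq) = excluded t∉ c₃ (y , eq)
      go (_ , y , inj₂ (inj₂ (inj₂ refl)) , eq) = excluded t∉ c₆ (y , eq)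

  no-curve-three : ∀ {r} → Checks r → Tautology 8 (ramified-norm-formula r) →
    Tautology 8 (class-formula (+ 1)) → Tautology 8 (class-formula (+ 2)) → Tautology 8 (class-formula (+ 6)) →
    Tautology 9 (three-formula (+ 3)) → Tautology 8 shifted-norm-formula → Tautology 3 norm-three-formula → NoCurve
  no-curve-three checks chk c₁ c₂ c₆ chk₉ chk₈ chk₃ = no-curve no-good-curve
    where
    no-good-curve : ¬ GoodCurve
    no-good-curve G = go (proj₂ (classes t∉))
      where
      open OddAtTwo checks G
      t∉ = unramified chk
      go : ∃[ ρ ] ∃[ y ] (ρ ≡ 1 ⊎ ρ ≡ 2 ⊎ ρ ≡ 3 ⊎ ρ ≡ 6) × ι (+ ρ) ⊠ Curve.B G ≡ y ⊠ y → ⊥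
      go (_ , y , inj₁ refl , eq)               = excluded t∉ c₁ (y , eq)
      go (_ , y , inj₂ (inj₁ refl) , eq)        = excluded t∉ c₂ (y , eq)
      go (_ , y , inj₂ (inj₂ (inj₁ refl)) , eq) = ThreeClass.three-not-class checks (inert-3 chk₃) G chk₉ chk₈ t∉ {y} eq
      go (_ , y , inj₂ (inj₂ (inj₂ refl)) , eq) = excluded t∉ c₆ (y , eq)

  -- The field ℚ(√62)

  -- Half of the √m-coordinate of x σ y - y σ x.
  det : 𝕆 → 𝕆 → ℤ
  det (a +√ b) (c +√ d) = c ℤ.* b ℤ.- d ℤ.* a

  -- For m = 62 the premise reads Y² ≡ 2 ≡ m (mod 3), so Y ≡ ±√m because 2 is not a square modulo 3.
  -- As Z ≡ 2, the determinant of the two is prime to 3.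
  det-formula : Formula 4
  det-formula = (ιₚ (+ 2) *ₚ (ιₚ (+ 27) *ₚ (X *ₚ X) +ₚ ιₚ (+ 36) *ₚ X +ₚ ιₚ (+ 16)) ≈ₚ Y *ₚ Y) ⇒̇
      (n∣ proj₁ Y ⊗ proj₂ Z ⊖ proj₂ Y ⊗ proj₁ Z) ⇒̇ ⊥̇
    where
    Z : Quad 4
    Z = ιₚ (+ 3) *ₚ X +ₚ ιₚ (+ 2)

  cube-formula : Formula 4
  cube-formula = ((X ^ₚ 3) *ₚ Y ≈ₚ ιₚ (+ 0)) ⇒̇ oddₚ (evₚ Y) ⇒̇ (n∣ con (+ 4) ⊗ proj₁ X) ∧̇ (n∣ con (+ 4) ⊗ proj₂ X)

  η-formula : Formula 4
  η-formula = (X ^ₚ 2 ≈ₚ ιₚ (+ 2) *ₚ Y) ⇒̇ (n∣ con (+ 4) ⊗ evₚ X) ⇒̇ ((n∣ con (+ 4) ⊗ proj₁ X) ∧̇ (n∣ con (+ 4) ⊗ proj₂ X) ⇒̇ ⊥̇) ⇒̇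
    (n∣ con (+ 2) ⊗ (proj₁ (Y *ₚ Y) ⊖ con (+ 1))) ∧̇ (n∣ con (+ 2) ⊗ (proj₂ (Y *ₚ Y) ⊖ con (+ 0)))

  c₄-formula : Formula 6
  c₄-formula = (X₆ ≈ₚ ιₚ (+ 1)) ⇒̇ (n∣ con (+ 2) ⊗ evₚ Y₆) ⇒̇ ((n∣ con (+ 2) ⊗ proj₁ Y₆) ∧̇ (n∣ con (+ 2) ⊗ proj₂ Y₆) ⇒̇ ⊥̇) ⇒̇
    ((n∣ con (+ 2) ⊗ evₚ Z₆) ⇒̇ ⊥̇) ⇒̇ (X₆ -ₚ ιₚ (+ 6) *ₚ (Y₆ *ₚ Z₆) ≈ₚ con (+ 1) , con (+ 2))

  cube-root-formula : Formula 6
  cube-root-formula = ((X₆ ^ₚ 3) *ₚ Y₆ ≈ₚ Z₆ ^ₚ 3) ⇒̇ (Y₆ ≈ₚ con (+ 1) , con (+ 2)) ⇒̇ (Z₆ ≈ₚ con (+ 1) , con (+ 2)) ⇒̇ (X₆ ≈ₚ ιₚ (+ 1))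

  B′ₚ : ∀ {v} → Quad v → Quad v
  B′ₚ τ = ιₚ (+ 49) +ₚ ιₚ (+ 52) *ₚ τ +ₚ ιₚ (+ 16) *ₚ (τ *ₚ τ)

  B′-formula : Formula 2
  B′-formula = n∣ Nₚ (B′ₚ X₂) ⊖ con (+ 1)

  B′-class-formula : ℤ → Formula 4
  B′-class-formula ρ = (ιₚ ρ *ₚ B′ₚ X ≈ₚ Y *ₚ Y) ⇒̇ ⊥̇

  root-formula : Formula 2
  root-formula = (n∣ con (+ 2) ⊗ (proj₁ (X₂ *ₚ X₂) ⊖ con (+ 2))) ⇒̇ (n∣ con (+ 2) ⊗ (proj₂ (X₂ *ₚ X₂) ⊖ con (+ 4))) ⇒̇ (n∣ Nₚ X₂ ⊖ con (+ 6))

  record Checks₆₂ : Set where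
    field
      D≡62          : D ≡ + 62
      checks        : Checks (+ 1)
      inert-check   : Tautology 3 norm-three-formula
      class-1       : Tautology 8 (class-formula (+ 1))
      class-2       : Tautology 8 (class-formula (+ 2))
      class-3       : Tautology 8 (class-formula (+ 3))
      three-check   : Tautology 9 (three-formula (+ 6))
      det-check     : Tautology 3 det-formula
      cube-check    : Tautology 8 cube-formula
      η-check       : Tautology 8 η-formula
      c₄-check      : Tautology 4 c₄-formula
      cube-root-check : Tautology 4 cube-root-formula
      B′-check      : Tautology 8 B′-formula
      B′-class-2    : Tautology 8 (B′-class-formula (+ 2))
      B′-class-3    : Tautology 8 (B′-class-formula (+ 3))
      root-check    : Tautology 16 root-formula

  module SixtyTwo (c : Checks₆₂) (G : GoodCurve) where
    open Checks₆₂ c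
    open AtTwo checks
    i₃ = inert-3 inert-check
    open AtThree i₃ norm≢7 G

    -- Multiply v + √6 X by its conjugate σv - √6 σX over ℚ(√372): the product is A + 2E√372, and
    -- its norm is 8². Thus A² - 1488 E² = 64 with 1488 = 16 · 93, and after division by 16
    -- `pell-93` forces 3 ∣ E = `det X v`.
    6X²+8≢v² : ∀ X v → ¬ (+ 3 ∣ det X v) → ι (+ 6) ⊠ (X ⊠ X) ⊞ ι (+ 8) ≢ v ⊠ v
    6X²+8≢v² (a +√ b) (c +√ d) 3∤ eq = go (∣-halve {4} {4} (λ ())
        (valid 16 ((n∣ var 0F ⊗ var 0F ⊖ (con (+ 1488) ⊗ (var 1F ⊗ var 1F) ⊕ con (+ 64))) ⇒̇ (n∣ con (+ 4) ⊗ var 0F)) refl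
          (A ∷ E ∷ []) (∣-of-≡ (+ 16) A²)))
      where
      open ℤ-Solve
      A E P Q : ℤ
      A = (c ℤ.* c ℤ.- D ℤ.* (d ℤ.* d)) ℤ.- + 6 ℤ.* (a ℤ.* a ℤ.- D ℤ.* (b ℤ.* b))
      E = c ℤ.* b ℤ.- d ℤ.* a
      P = (c ℤ.* c ℤ.+ D ℤ.* (d ℤ.* d)) ℤ.- + 6 ℤ.* (a ℤ.* a ℤ.+ D ℤ.* (b ℤ.* b))
      Q = (c ℤ.* d ℤ.+ d ℤ.* c) ℤ.- + 6 ℤ.* (a ℤ.* b ℤ.+ b ℤ.* a)
      P≡8 : P ≡ + 8
      P≡8 = trans (cong (ℤ._- + 6 ℤ.* (a ℤ.* a ℤ.+ D ℤ.* (b ℤ.* b))) (sym (cong re eq)))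
        (solve 3 (λ s k u → con (+ 6) :* s :+ k :* (con (+ 0) :* u) :+ con (+ 8) :- con (+ 6) :* s := con (+ 8)) refl (a ℤ.* a ℤ.+ D ℤ.* (b ℤ.* b)) D (a ℤ.* b ℤ.+ b ℤ.* a))
      Q≡0 : Q ≡ + 0
      Q≡0 = trans (cong (ℤ._- + 6 ℤ.* (a ℤ.* b ℤ.+ b ℤ.* a)) (sym (cong im eq)))
        (solve 2 (λ s u → con (+ 6) :* u :+ con (+ 0) :* s :+ con (+ 0) :- con (+ 6) :* u := con (+ 0)) refl (a ℤ.* a ℤ.+ D ℤ.* (b ℤ.* b)) (a ℤ.* b ℤ.+ b ℤ.* a))
      A² : A ℤ.* A ≡ + 1488 ℤ.* (E ℤ.* E) ℤ.+ + 64
      A² = trans (solve 5 (λ k a b c d → let A = (c :* c :- k :* (d :* d)) :- con (+ 6) :* (a :* a :- k :* (b :* b))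
                                             E = c :* b :- d :* a
                                             P = (c :* c :+ k :* (d :* d)) :- con (+ 6) :* (a :* a :+ k :* (b :* b))
                                             Q = (c :* d :+ d :* c) :- con (+ 6) :* (a :* b :+ b :* a) in
          A :* A := con (+ 24) :* k :* (E :* E) :+ (P :* P :- k :* (Q :* Q))) refl D a b c d)
        (trans (cong₂ (λ k x → + 24 ℤ.* k ℤ.* (E ℤ.* E) ℤ.+ x) D≡62 (cong₂ (λ p q → p ℤ.* p ℤ.- D ℤ.* (q ℤ.* q)) P≡8 Q≡0))
          (solve 2 (λ e k → con (+ 24) :* con (+ 62) :* e :+ (con (+ 8) :* con (+ 8) :- k :* (con (+ 0) :* con (+ 0))) := con (+ 1488) :* e :+ con (+ 64)) refl (E ℤ.* E) D))
      go : + 4 ∣ A → ⊥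
      go (divides y A≡) = 3∤ (ℤ.∣ᵤ⇒∣ (ℤ.∣⇒∣ᵤ (pell-93 (<-wellFounded ℤ.∣ E ∣) ℤ.∣ y ∣ (ℤ.+-injective eqℕ))))
        where
        16y² : + 16 ℤ.* (y ℤ.* y) ≡ + 16 ℤ.* (+ 93 ℤ.* (E ℤ.* E) ℤ.+ + 4)
        16y² = trans (solve 1 (λ y → con (+ 16) :* (y :* y) := y :* con (+ 4) :* (y :* con (+ 4))) refl y) (trans (cong (λ z → z ℤ.* z) (sym A≡))
          (trans A² (solve 1 (λ e → con (+ 1488) :* e :+ con (+ 64) := con (+ 16) :* (con (+ 93) :* e :+ con (+ 4))) refl (E ℤ.* E))))
        eqℕ : + (ℤ.∣ y ∣ ℕ.* ℤ.∣ y ∣) ≡ + (93 ℕ.* (ℤ.∣ E ∣ ℕ.* ℤ.∣ E ∣) ℕ.+ 4)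
        eqℕ = trans (∣i∣²≡i² y) (trans (ℤ.*-cancelˡ-≡ (+ 16) (y ℤ.* y) (+ 93 ℤ.* (E ℤ.* E) ℤ.+ + 4) 16y²)
          (cong (ℤ._+ + 4) (sym (trans (ℤ.pos-* 93 _) (cong (+ 93 ℤ.*_) (∣i∣²≡i² E))))))

    -- Once t = 27 t₀, a square 6B yields 6X² + 8 = v² with X = 3t₀ + 2.
    not-six : t ≢ 𝟎 → ∀ {y} → ι (+ 6) ⊠ B ≢ y ⊠ y
    not-six t≢0 {y} eq = from-t₀ (ThreeClass.27∣t checks i₃ G (+ 6) three-check t≢0 {y} eq)
      where
      open 𝕆-Solver
      from-v : ∀ t₀ v → ι (+ 2) ⊠ (ι (+ 27) ⊠ (t₀ ⊠ t₀) ⊞ ι (+ 36) ⊠ t₀ ⊞ ι (+ 16)) ≡ v ⊠ v → ⊥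
      from-v t₀ v eq = 6X²+8≢v² (ι (+ 3) ⊠ t₀ ⊞ ι (+ 2)) v (3∤ t₀ v eq) (trans (solve 1 (λ t →
          con (+ 6) :* ((con (+ 3) :* t :+ con (+ 2)) :* (con (+ 3) :* t :+ con (+ 2))) :+ con (+ 8) := con (+ 2) :* (con (+ 27) :* (t :* t) :+ con (+ 36) :* t :+ con (+ 16))) refl t₀) eq)
        where
        3∤ : ∀ t₀ v → ι (+ 2) ⊠ (ι (+ 27) ⊠ (t₀ ⊠ t₀) ⊞ ι (+ 36) ⊠ t₀ ⊞ ι (+ 16)) ≡ v ⊠ v → ¬ (+ 3 ∣ det (ι (+ 3) ⊠ t₀ ⊞ ι (+ 2)) v)
        3∤ (a +√ b) (c +√ d) eq = tautological 3 det-formula det-check (a ∷ b ∷ c ∷ d ∷ []) (coords (+ 3) eq)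
      from-t₀ : ∃[ t₀ ] t ≡ ι (+ 27) ⊠ t₀ → ⊥
      from-t₀ (t₀ , t≡) = finish (nine-square {ι (+ 2)} {t₀} {y} t≡ (trans (solve 1 (λ b → con (+ 3) :* (con (+ 2) :* b) := con (+ 6) :* b) refl B) eq))
        where
        finish : ∃[ v ] ι (+ 2) ⊠ (ι (+ 27) ⊠ (t₀ ⊠ t₀) ⊞ ι (+ 36) ⊠ t₀ ⊞ ι (+ 16)) ≡ v ⊠ v → ⊥
        finish (v , eq) = from-v t₀ v eq

    not-unramified : ¬ (t ∉ᴾ v₂)
    not-unramified t∉ = go (proj₂ (classes t∉))
      where
      open OddAtTwo checks G using (classes; excluded)
      go : ∃[ ρ ] ∃[ y ] (ρ ≡ 1 ⊎ ρ ≡ 2 ⊎ ρ ≡ 3 ⊎ ρ ≡ 6) × ι (+ ρ) ⊠ B ≡ y ⊠ y → ⊥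
      go (_ , y , inj₁ refl , eq)               = excluded t∉ class-1 (y , eq)
      go (_ , y , inj₂ (inj₁ refl) , eq)        = excluded t∉ class-2 (y , eq)
      go (_ , y , inj₂ (inj₂ (inj₁ refl)) , eq) = excluded t∉ class-3 (y , eq)
      go (_ , y , inj₂ (inj₂ (inj₂ refl)) , eq) = not-six (∉⇒≢0 v₂ t∉) {y} eq

  -- B(8 + 16τ)/16.
  B′-of : 𝕆 → 𝕆
  B′-of τ = ι (+ 49) ⊞ ι (+ 52) ⊠ τ ⊞ ι (+ 16) ⊠ (τ ⊠ τ)

  odd∉v₂ : ∀ z → (ι (+ 1) ⊞ ι (+ 2) ⊠ z) ∉ᴾ v₂
  odd∉v₂ (a +√ b) h = valid 2 ((n∣ (con (+ 1) ⊕ (con (+ 2) ⊗ var 0F ⊕ var 2F ⊗ (con (+ 0) ⊗ var 1F))) ⊕ var 2F ⊗ (con (+ 0) ⊕ (con (+ 2) ⊗ var 1F ⊕ con (+ 0) ⊗ var 0F))) ⇒̇ ⊥̇)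
    refl (a ∷ b ∷ D ∷ []) h

  -- m = 62 with supersingular reduction at 2

  module SixtyTwoRamified (c : Checks₆₂) (G : GoodCurve) (R : AtTwo.Ramified₂ (Checks₆₂.checks c) G) where
    open Checks₆₂ c
    open AtTwo checks
    open Ramified₂ R
    open AtThree (inert-3 inert-check) norm≢7 G
    open 𝕆-Solver

    -- The right-hand side has valuation at least 6 at v₂, so x has valuation at least 2, which is
    -- that of 2.
    even-cube : ∀ {x d w} → d ∉ᴾ v₂ → x ^ 3 ⊠ d ≡ ι (+ 8) ⊠ w → ∃[ x₁ ] x ≡ ι (+ 2) ⊠ x₁
    even-cube {x} {d} {w} d∉ eq = extract {2} {x} (go x d d∉ (coords-mod (+ 8) (x ^ 3 ⊠ d) 𝟎 w (trans eq (solve 1 (λ y → y := con (+ 0) :+ y) refl (ι (+ 8) ⊠ w)))))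
      where
      go : ∀ x d → d ∉ᴾ v₂ → + 8 ∣ re (x ^ 3 ⊠ d) ℤ.- + 0 × + 8 ∣ im (x ^ 3 ⊠ d) ℤ.- + 0 → 2 ∣̂ x
      go (a +√ b) (e +√ f) d∉ h = halve (tautological 8 cube-formula cube-check (a ∷ b ∷ e ∷ f ∷ []) h (odd-value e f d∉))
        where
        halve : + 8 ∣ + 4 ℤ.* a × + 8 ∣ + 4 ℤ.* b → 2 ∣̂ (a +√ b)
        halve (h , h′) = ∣-halve {4} {2} (λ ()) h , ∣-halve {4} {2} (λ ()) h′

    cube-quotient : ∀ {x d y} → d ∉ᴾ v₂ → x ^ 3 ⊠ d ≡ (ι (+ 4) ⊠ y) ^ 3 → ∃[ x₂ ] x ≡ ι (+ 4) ⊠ x₂ × x₂ ^ 3 ⊠ d ≡ y ^ 3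
    cube-quotient {x} {d} {y} d∉ eq = once (even-cube {x} {d} {ι (+ 8) ⊠ y ^ 3} d∉ (trans eq (solve 1 (λ y → (con (+ 4) :* y) :^ 3 := con (+ 8) :* (con (+ 8) :* y :^ 3)) refl y)))
      where
      pull : ∀ z → (ι (+ 2) ⊠ z) ^ 3 ⊠ d ≡ ι (+ 8) ⊠ (z ^ 3 ⊠ d)
      pull z = solve 2 (λ z d → (con (+ 2) :* z) :^ 3 :* d := con (+ 8) :* (z :^ 3 :* d)) refl z d
      once : ∃[ x₁ ] x ≡ ι (+ 2) ⊠ x₁ → ∃[ x₂ ] x ≡ ι (+ 4) ⊠ x₂ × x₂ ^ 3 ⊠ d ≡ y ^ 3
      once (x₁ , x≡) = twice (even-cube {x₁} {d} {y ^ 3} d∉ eq₁)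
        where
        eq₁ : x₁ ^ 3 ⊠ d ≡ ι (+ 8) ⊠ y ^ 3
        eq₁ = ι-cancel (+ 8) (λ ()) (trans (sym (pull x₁)) (trans (cong (λ z → z ^ 3 ⊠ d) (sym x≡)) (trans eq
          (solve 1 (λ y → (con (+ 4) :* y) :^ 3 := con (+ 8) :* (con (+ 8) :* y :^ 3)) refl y))))
        twice : ∃[ x₂ ] x₁ ≡ ι (+ 2) ⊠ x₂ → ∃[ x₂ ] x ≡ ι (+ 4) ⊠ x₂ × x₂ ^ 3 ⊠ d ≡ y ^ 3
        twice (x₂ , x₁≡) = x₂ , trans x≡ (trans (cong (ι (+ 2) ⊠_) x₁≡) (solve 1 (λ x → con (+ 2) :* (con (+ 2) :* x) := con (+ 4) :* x) refl x₂)) ,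
          ι-cancel (+ 8) (λ ()) (trans (sym (pull x₂)) (trans (cong (λ z → z ^ 3 ⊠ d) (sym x₁≡)) eq₁))

    -- a₁ = a + b√62 with a even and b odd, so η = a₁²/2 has odd rational part and even
    -- √62-coordinate.
    η²≡1 : + 4 ∣ re (η ⊠ η) ℤ.- + 1 × + 4 ∣ im (η ⊠ η) ℤ.- + 0
    η²≡1 = go a₁ η a₁∈ 2∤a₁ a₁²≡2η
      where
      go : ∀ a₁ η → a₁ ∈ᴾ v₂ → ¬ 2 ∣̂ a₁ → a₁ ^ 2 ≡ ι (+ 2) ⊠ η → + 4 ∣ re (η ⊠ η) ℤ.- + 1 × + 4 ∣ im (η ⊠ η) ℤ.- + 0
      go (a +√ b) (e +√ f) a₁∈ 2∤ eq = halve (tautological 8 η-formula η-check (a ∷ b ∷ e ∷ f ∷ []) (coords (+ 8) eq) (∣-double {4} {2} a₁∈)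
          (λ (h , h′) → 2∤ (∣-halve {4} {2} (λ ()) h , ∣-halve {4} {2} (λ ()) h′)))
        where
        halve : ∀ {x y} → + 8 ∣ + 2 ℤ.* x × + 8 ∣ + 2 ℤ.* y → + 4 ∣ x × + 4 ∣ y
        halve (h , h′) = ∣-halve {2} {4} (λ ()) h , ∣-halve {2} {4} (λ ()) h′

    -- a₁ a₃ ≡ √62 (mod 2), so η² - 6 a₁ a₃ ≡ 1 + 2√62 (mod 4).
    reduced-c₄ : ∃[ y ] c₄ ≡ ι (+ 4) ⊠ y × + 4 ∣ re y ℤ.- + 1 × + 4 ∣ im y ℤ.- + 2
    reduced-c₄ = go (c₄-a₁²=2e η a₁²≡2η)
      where
      M : 𝕆 → 𝕆 → 𝕆 → 𝕆
      M s a₁ a₃ = s ⊟ ι (+ 6) ⊠ (a₁ ⊠ a₃)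
      M≡ : ∀ s a₁ a₃ → a₁ ∈ᴾ v₂ → ¬ 2 ∣̂ a₁ → a₃ ∉ᴾ v₂ → + 4 ∣ re s ℤ.- + 1 × + 4 ∣ im s ℤ.- + 0 →
        + 4 ∣ re (M s a₁ a₃) ℤ.- + 1 × + 4 ∣ im (M s a₁ a₃) ℤ.- + 2
      M≡ (i +√ j) (a +√ b) (g +√ h) a₁∈ 2∤ a₃∉ s≡1 = tautological 4 c₄-formula c₄-check (i ∷ j ∷ a ∷ b ∷ g ∷ h ∷ []) s≡1 (∣-double {2} {2} a₁∈)
        (λ (k , l) → 2∤ (∣-halve {2} {2} (λ ()) k , ∣-halve {2} {2} (λ ()) l)) (odd-value₄ g h a₃∉)
      go : ∃[ Z ] c₄ ≡ ι (+ 4) ⊠ (η ⊠ η ⊟ ι (+ 6) ⊠ (a₁ ⊠ a₃) ⊞ ι (+ 4) ⊠ Z) → ∃[ y ] c₄ ≡ ι (+ 4) ⊠ y × + 4 ∣ re y ℤ.- + 1 × + 4 ∣ im y ℤ.- + 2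
      go (Z , c₄≡) = y , c₄≡ , ∣-minus-trans (+ 4) {re y} {re (M (η ⊠ η) a₁ a₃)} (proj₁ y≡M) (proj₁ M≡1) , ∣-minus-trans (+ 4) {im y} {im (M (η ⊠ η) a₁ a₃)} (proj₂ y≡M) (proj₂ M≡1)
        where
        y : 𝕆
        y = M (η ⊠ η) a₁ a₃ ⊞ ι (+ 4) ⊠ Z
        M≡1 : + 4 ∣ re (M (η ⊠ η) a₁ a₃) ℤ.- + 1 × + 4 ∣ im (M (η ⊠ η) a₁ a₃) ℤ.- + 2
        M≡1 = M≡ (η ⊠ η) a₁ a₃ a₁∈ 2∤a₁ a₃∉ η²≡1
        y≡M : + 4 ∣ re y ℤ.- re (M (η ⊠ η) a₁ a₃) × + 4 ∣ im y ℤ.- im (M (η ⊠ η) a₁ a₃)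
        y≡M = coords-mod (+ 4) y (M (η ⊠ η) a₁ a₃) Z refl

    -- x = 4x₂ with x₂³ Δ = y³, where Δ ≡ y ≡ 1 + 2√62 (mod 4) and y² ≡ 1. So x₂³ ≡ 1, and x₂ ≡ 1
    -- because the units modulo 4 form a 2-group; finally 4x₂ - 12 ≡ 8 (mod 16).
    t-form : ∃[ τ ] t ≡ ι (+ 8) ⊞ ι (+ 16) ⊠ τ
    t-form = go reduced-c₄
      where
      x₂≡1 : ∀ x₂ d y → x₂ ^ 3 ⊠ d ≡ y ^ 3 → + 4 ∣ re d ℤ.- + 1 × + 4 ∣ im d ℤ.- + 2 → + 4 ∣ re y ℤ.- + 1 × + 4 ∣ im y ℤ.- + 2 → 4 ∣̂ (x₂ ⊟ ι (+ 1))
      x₂≡1 (a +√ b) (i +√ j) (g +√ h) eq d≡ y≡ = tautological 4 cube-root-formula cube-root-check (a ∷ b ∷ i ∷ j ∷ g ∷ h ∷ []) (coords (+ 4) eq) d≡ y≡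
      go : ∃[ y ] c₄ ≡ ι (+ 4) ⊠ y × + 4 ∣ re y ℤ.- + 1 × + 4 ∣ im y ℤ.- + 2 → ∃[ τ ] t ≡ ι (+ 8) ⊞ ι (+ 16) ⊠ τ
      go (y , c₄≡ , y≡) = from-x₂ (cube-quotient {x} {Δ} {y} Δ∉v₂ (trans x³Δ (cong (_^ 3) c₄≡)))
        where
        from-x₂ : ∃[ x₂ ] x ≡ ι (+ 4) ⊠ x₂ × x₂ ^ 3 ⊠ Δ ≡ y ^ 3 → ∃[ τ ] t ≡ ι (+ 8) ⊞ ι (+ 16) ⊠ τ
        from-x₂ (x₂ , x≡ , eq) = from-ξ (extract {4} {x₂ ⊟ ι (+ 1)} (x₂≡1 x₂ Δ y eq (reΔ , imΔ) y≡))
          where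
          from-ξ : ∃[ ξ ] x₂ ⊟ ι (+ 1) ≡ ι (+ 4) ⊠ ξ → ∃[ τ ] t ≡ ι (+ 8) ⊞ ι (+ 16) ⊠ τ
          from-ξ (ξ , x₂≡) = ξ ⊟ ι (+ 1) , trans (cong (_⊟ ι (+ 12)) x≡) (trans (solve 1 (λ x → con (+ 4) :* x :- con (+ 12) := con (+ 4) :* (x :- con (+ 1)) :- con (+ 8)) refl x₂)
            (trans (cong (λ z → ι (+ 4) ⊠ z ⊟ ι (+ 8)) x₂≡) (solve 1 (λ x → con (+ 4) :* (con (+ 4) :* x) :- con (+ 8) := con (+ 8) :+ con (+ 16) :* (x :- con (+ 1))) refl ξ)))

    t≢0 : t ≢ 𝟎
    t≢0 t≡0 = go t-form
      where
      go : ∃[ τ ] t ≡ ι (+ 8) ⊞ ι (+ 16) ⊠ τ → ⊥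
      go (τ , t≡) = valid 16 ((n∣ con (+ 0) ⊖ con (+ 8)) ⇒̇ ⊥̇) refl [] (subst (λ z → + 16 ∣ z ℤ.- + 8) (cong re t≡0) (proj₁ (coords-mod (+ 16) t (ι (+ 8)) τ t≡)))

    B-eq : ∀ τ → t ≡ ι (+ 8) ⊞ ι (+ 16) ⊠ τ → B ≡ ι (+ 16) ⊠ B′-of τ
    B-eq τ t≡ = trans (cong B-of t≡) (solve 1 (λ τ → let t = con (+ 8) :+ con (+ 16) :* τ in
      t :* t :+ con (+ 36) :* t :+ con (+ 432) := con (+ 16) :* (con (+ 49) :+ con (+ 52) :* τ :+ con (+ 16) :* (τ :* τ))) refl τ)

    -- Δ = (1 + 2√D) mod 4 makes N G ≡ 6 (mod 16) if 2Δ = G².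
    t≢8 : t ≢ ι (+ 8)
    -- B(8) = 28², so 8 · 28² Δ = 56² · 2Δ is the square c₆².
    t≢8 t≡8 = from-root (ι-square-root {+ 56} {ι (+ 2) ⊠ Δ} {c₆} (λ ()) (trans (solve 1 (λ d → con (+ 56) :* con (+ 56) :* (con (+ 2) :* d)
        := con (+ 8) :* (con (+ 8) :* con (+ 8) :+ con (+ 36) :* con (+ 8) :+ con (+ 432)) :* d) refl Δ)
        (trans (cong (λ z → z ⊠ B-of z ⊠ Δ) (sym t≡8)) tBΔ)))
      where
      NG≡6 : ∀ g d → ι (+ 2) ⊠ d ≡ g ⊠ g → + 4 ∣ re d ℤ.- + 1 → + 4 ∣ im d ℤ.- + 2 → + 16 ∣ N g ℤ.- + 6
      NG≡6 (a +√ b) d eq red imd = tautological 16 root-formula root-check (a ∷ b ∷ [])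
          (lift (re d) (+ 1) (+ 2) refl (cong re eq′) red) (lift (im d) (+ 2) (+ 4) refl (cong im eq′) imd)
        where
        eq′ : (+ 2 ℤ.* re d) +√ (+ 2 ℤ.* im d) ≡ (a +√ b) ⊠ (a +√ b)
        eq′ = trans (sym (ι-⊠ (+ 2) d)) eq
        lift : ∀ u r s {v} → s ≡ r ℤ.+ r → + 2 ℤ.* u ≡ v → + 4 ∣ u ℤ.- r → + 16 ∣ + 2 ℤ.* (v ℤ.- s)
        lift u r .(r ℤ.+ r) refl refl h = subst (+ 16 ∣_) (ℤ-Solve.solve 2 (λ u r → ℤ-Solve.con (+ 4) ℤ-Solve.:* (u ℤ-Solve.:- r) ℤ-Solve.:= ℤ-Solve.con (+ 2) ℤ-Solve.:* (ℤ-Solve.con (+ 2) ℤ-Solve.:* u ℤ-Solve.:- (r ℤ-Solve.:+ r))) refl u r)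
          (∣-double {4} {4} h)
      from-root : ∃[ g ] ι (+ 2) ⊠ Δ ≡ g ⊠ g → ⊥
      from-root (g , eq) = finish (root-norm {+ 2} {g} (inj₂ (inj₁ refl)) eq)
        where
        Ng≡6 : + 16 ∣ N g ℤ.- + 6
        Ng≡6 = NG≡6 g Δ eq reΔ imΔ
        finish : ∃[ f ] ∃[ k ] N g ≡ f ℤ.* (k ℤ.* k) × AtMost 2 f → ⊥
        finish (f , k , e , inj₁ (inj₁ refl)) = square-class-≢ 16 (+ 1) (+ 6) refl (N g) k e Ng≡6
        finish (f , k , e , inj₁ (inj₂ refl)) = square-class-≢ 16 ℤ.-1ℤ (+ 6) refl (N g) k e Ng≡6
        finish (f , k , e , inj₂ (inj₁ refl)) = square-class-≢ 16 (+ 2) (+ 6) refl (N g) k e Ng≡6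
        finish (f , k , e , inj₂ (inj₂ refl)) = square-class-≢ 16 (ℤ.- + 2) (+ 6) refl (N g) k e Ng≡6

  module _ (c : Checks₆₂) (G : GoodCurve) (R : AtTwo.Ramified₂ (Checks₆₂.checks c) G) where
    open Checks₆₂ c
    open AtTwo checks using (norm≢7)
    open AtThree (inert-3 inert-check) norm≢7 G
    open SixtyTwoRamified c G R
    private
      i₃ = inert-3 inert-check

    -- N u divides 27² = 3⁶. As 3 is inert and does not divide u, N u is ±1, and -1 ≡ 7 (mod 8) is
    -- excluded because u is prime to 2.
    unit-of-27 : ∀ {u w} → u ⊠ w ≡ ι (+ 27) → ¬ 3 ∣̂ u → u ∉ᴾ v₂ → N u ≡ + 1 × w ≡ ι (+ 27) ⊠ σ u
    unit-of-27 {u} {w} uw≡ 3∤u u∉ = Nu≡1 , (begin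
        w                     ≡⟨ ⊠-identityˡ w ⟨
        ι (+ 1) ⊠ w           ≡⟨ cong (λ n → ι n ⊠ w) Nu≡1 ⟨
        ι (N u) ⊠ w           ≡⟨ cong (_⊠ w) (x⊠σx u) ⟨
        u ⊠ σ u ⊠ w           ≡⟨ solve 3 (λ u s w → u :* s :* w := u :* w :* s) refl u (σ u) w ⟩
        u ⊠ w ⊠ σ u           ≡⟨ cong (_⊠ σ u) uw≡ ⟩
        ι (+ 27) ⊠ σ u        ∎)
      where
      open ≡-Reasoning
      open 𝕆-Solver
      Nu≡1 : N u ≡ + 1
      Nu≡1 = [ (λ e → e) , (λ e → ⊥-elim (norm≢7 u u∉ (subst (λ n → + 8 ∣ n ℤ.- + 7) (sym e) (divides ℤ.-1ℤ (sym (ℤ.-1*i≡-i (+ 8))))))) ]′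
        (factor-of-3^ 6 (N u) {N w} (trans (sym (N-⊠ u w)) (trans (cong N uw≡) (trans (N-ι (+ 27)) (sym (ℤ.pos-* 27 27))))) (λ h → 3∤u (i₃ u h)))

    -- The sign of N t bounds the unit η, and 31 ∣ a² − 1 then leaves η = ±1.
    no-unit : ∀ {τ k η} → t ≡ ι (+ 8) ⊞ ι (+ 16) ⊠ τ → N (B′-of τ) ≡ k ℤ.* k →
      N η ≡ + 1 → t ≢ η ⊟ ι (+ 27) ⊠ σ η ⊟ ι (+ 18)
    no-unit {τ} {k} {η} t≡ NB′ Nη t≡η = from-square (Nt-square {k} B′ 4 (B-eq τ t≡) NB′)
      where
      B′ = B′-of τ
      k′ = proj₁ NΔ-square
      square≢0 : ∀ {x n} → x ≢ 𝟎 → N x ≡ n ℤ.* n → n ≢ + 0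
      square≢0 x≢0 e refl = N≢0 x≢0 (trans e (ℤ.*-zeroˡ (+ 0)))
      k≢0 : k ≢ + 0
      k≢0 = square≢0 {B′} (λ e → B≢0 (trans (B-eq τ t≡) (trans (cong (ι (+ 16) ⊠_) e) (⊠-zeroʳ _)))) NB′
      k′≢0 : k′ ≢ + 0
      k′≢0 = square≢0 Δ≢0 (proj₂ NΔ-square)
      product≢0 : ∀ {x y} → x ≢ + 0 → y ≢ + 0 → x ℤ.* y ≢ + 0
      product≢0 {x} x≢0 y≢0 e = [ x≢0 , y≢0 ]′ (ℤ.i*j≡0⇒i≡0∨j≡0 x e)
      from-norm : ∀ η → N η ≡ + 1 → t ≡ η ⊟ ι (+ 27) ⊠ σ η ⊟ ι (+ 18) → ∃[ s ] N t ≡ + s → ⊥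
      from-norm (a +√ b) Nη t≡η (s , Nt≡) = by-value a b Nη t≡η (bounded-unit a b s (subst (λ d → a ℤ.* a ℤ.- d ℤ.* (b ℤ.* b) ≡ + 1) D≡62 Nη)
          (subst (λ d → (+ 26 ℤ.* a ℤ.+ + 18) ℤ.* (+ 26 ℤ.* a ℤ.+ + 18) ℤ.- d ℤ.* (+ 28 ℤ.* b ℤ.* (+ 28 ℤ.* b)) ≡ + s) D≡62
            (trans (solve 3 (λ k a b → (con (+ 26) :* a :+ con (+ 18)) :* (con (+ 26) :* a :+ con (+ 18)) :- k :* (con (+ 28) :* b :* (con (+ 28) :* b))
              := (let x = a :- (con (+ 27) :* a :+ k :* (con (+ 0) :* (:- b))) :- con (+ 18)
                      y = b :- (con (+ 27) :* (:- b) :+ con (+ 0) :* a) :- con (+ 0) in x :* x :- k :* (y :* y))) refl D a b) (trans (cong N (sym t≡η)) Nt≡))))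
        where
        open ℤ-Solve
        re-t : ∀ a b → t ≡ (a +√ b) ⊟ ι (+ 27) ⊠ σ (a +√ b) ⊟ ι (+ 18) → re t ≡ a ℤ.- (+ 27 ℤ.* a ℤ.+ D ℤ.* (+ 0 ℤ.* (ℤ.- b))) ℤ.- + 18
        re-t a b e = cong re e
        by-value : ∀ a b → N (a +√ b) ≡ + 1 → t ≡ (a +√ b) ⊟ ι (+ 27) ⊠ σ (a +√ b) ⊟ ι (+ 18) → a ≡ + 1 ⊎ a ≡ ℤ.-1ℤ → ⊥
        -- η = 1 gives t = -44, which is 4 modulo 16 instead of 8, and η = -1 gives t = 8. These are
        -- j = -32³ and j = 20³, the CM invariants of discriminants -11 and -8.
        by-value .(+ 1) b Nη e (inj₁ refl) = valid 16 ((n∣ var 0F ⊖ con (+ 8)) ⇒̇ (n∣ var 0F ⊖ con (ℤ.- + 44)) ⇒̇ ⊥̇) refl (re t ∷ [])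
          (proj₁ (coords-mod (+ 16) t (ι (+ 8)) τ t≡))
          (∣-of-≡ (+ 16) (trans (re-t (+ 1) b e) (solve 2 (λ k b → con (+ 1) :- (con (+ 27) :* con (+ 1) :+ k :* (con (+ 0) :* (:- b))) :- con (+ 18) := con (ℤ.- + 44)) refl D b)))
        by-value .ℤ.-1ℤ b Nη e (inj₂ refl) = t≢8 (trans e (cong₂ _+√_
            (solve 2 (λ k b → con ℤ.-1ℤ :- (con (+ 27) :* con ℤ.-1ℤ :+ k :* (con (+ 0) :* (:- b))) :- con (+ 18) := con (+ 8)) refl D b)
            (trans (cong (λ b → b ℤ.- (+ 27 ℤ.* (ℤ.- b) ℤ.+ + 0 ℤ.* ℤ.-1ℤ) ℤ.- + 0) b≡0) (solve 0 (con (+ 0) :- (con (+ 27) :* (:- con (+ 0)) :+ con (+ 0) :* con ℤ.-1ℤ) :- con (+ 0) := con (+ 0)) refl))))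
          where
          62b² : + 62 ℤ.* (b ℤ.* b) ≡ + 0
          62b² = trans (solve 1 (λ x → x := con (+ 1) :- (con ℤ.-1ℤ :* con ℤ.-1ℤ :- x)) refl (+ 62 ℤ.* (b ℤ.* b)))
            (cong (λ z → + 1 ℤ.- z) (subst (λ d → ℤ.-1ℤ ℤ.* ℤ.-1ℤ ℤ.- d ℤ.* (b ℤ.* b) ≡ + 1) D≡62 Nη))
          b≡0 : b ≡ + 0
          b≡0 = reduce (ℤ.i*j≡0⇒i≡0∨j≡0 b ([ (λ ()) , (λ e → e) ]′ (ℤ.i*j≡0⇒i≡0∨j≡0 (+ 62) 62b²)))
      from-square : ∃[ l ] ∃[ n ] N t ℤ.* (l ℤ.* l) ≡ n ℤ.* n × l ≡ + 16 ℤ.* k ℤ.* k′ → ⊥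
      from-square (l , n , eq , l≡) = from-norm η Nη t≡η (square-quotient-≥0 (N t) l {n} (λ e → product≢0 (product≢0 {+ 16} (λ ()) k≢0) k′≢0 (trans (sym l≡) e)) eq)

    -- 4 B′ = (8τ + 13)² + 27, so B′ = y² factors 27 as p q′ with p, q′ = 2y ∓ (8τ + 13). If 3
    -- divided both factors, then 3 ∣ t, hence 27 ∣ t and B would have valuation 3 at 3, although B
    -- = (4y)²; so one factor is a unit.
    no-ramified-one : ∀ {τ k y} → t ≡ ι (+ 8) ⊞ ι (+ 16) ⊠ τ → N (B′-of τ) ≡ k ℤ.* k →
      B′-of τ ≢ y ⊠ y
    no-ramified-one {τ} {k} {y} t≡ NB′ B′≡ = go (3 ∣̂? p) (3 ∣̂? q′)
      where
      open 𝕆-Solver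
      p q′ : 𝕆
      p  = ι (+ 2) ⊠ y ⊟ ι (+ 13) ⊟ ι (+ 8) ⊠ τ
      q′ = ι (+ 2) ⊠ y ⊞ ι (+ 13) ⊞ ι (+ 8) ⊠ τ
      pq′ : p ⊠ q′ ≡ ι (+ 27)
      pq′ = trans (solve 2 (λ y τ → (con (+ 2) :* y :- con (+ 13) :- con (+ 8) :* τ) :* (con (+ 2) :* y :+ con (+ 13) :+ con (+ 8) :* τ)
            := con (+ 4) :* (y :* y) :- (con (+ 13) :+ con (+ 8) :* τ) :* (con (+ 13) :+ con (+ 8) :* τ)) refl y τ)
          (trans (cong (λ z → ι (+ 4) ⊠ z ⊟ (ι (+ 13) ⊞ ι (+ 8) ⊠ τ) ⊠ (ι (+ 13) ⊞ ι (+ 8) ⊠ τ)) (sym B′≡))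
            (solve 1 (λ τ → con (+ 4) :* (con (+ 49) :+ con (+ 52) :* τ :+ con (+ 16) :* (τ :* τ)) :- (con (+ 13) :+ con (+ 8) :* τ) :* (con (+ 13) :+ con (+ 8) :* τ) := con (+ 27)) refl τ))
      t≡q′-p : t ≡ q′ ⊟ p ⊟ ι (+ 18)
      t≡q′-p = trans t≡ (solve 2 (λ y τ → con (+ 8) :+ con (+ 16) :* τ
        := (con (+ 2) :* y :+ con (+ 13) :+ con (+ 8) :* τ) :- (con (+ 2) :* y :- con (+ 13) :- con (+ 8) :* τ) :- con (+ 18)) refl y τ)
      p∉ : p ∉ᴾ v₂
      p∉ = subst (_∉ᴾ v₂) (solve 2 (λ y τ → con (+ 1) :+ con (+ 2) :* (y :- con (+ 7) :- con (+ 4) :* τ) := con (+ 2) :* y :- con (+ 13) :- con (+ 8) :* τ) refl y τ) (odd∉v₂ (y ⊟ ι (+ 7) ⊟ ι (+ 4) ⊠ τ))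
      q′∉ : q′ ∉ᴾ v₂
      q′∉ = subst (_∉ᴾ v₂) (solve 2 (λ y τ → con (+ 1) :+ con (+ 2) :* (y :+ con (+ 6) :+ con (+ 4) :* τ) := con (+ 2) :* y :+ con (+ 13) :+ con (+ 8) :* τ) refl y τ) (odd∉v₂ (y ⊞ ι (+ 6) ⊞ ι (+ 4) ⊠ τ))
      3∤t : ¬ 3 ∣̂ t
      3∤t h = [ (λ 3∤ → 3∤ h) , (λ (t₀ , t≡27) → B-not-square t≢0 {t₀} {ι (+ 4) ⊠ y} t≡27
          (trans (B-eq τ t≡) (trans (cong (ι (+ 16) ⊠_) B′≡) (solve 1 (λ y → con (+ 16) :* (y :* y) := con (+ 4) :* y :* (con (+ 4) :* y)) refl y)))) ]′ (t-at-3 t≢0)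
      N-⊖ : ∀ x → N (⊖ x) ≡ N x
      N-⊖ (a +√ b) = ℤ-Solve.solve 3 (λ k a b → (ℤ-Solve.:- a) ℤ-Solve.:* (ℤ-Solve.:- a) ℤ-Solve.:- k ℤ-Solve.:* ((ℤ-Solve.:- b) ℤ-Solve.:* (ℤ-Solve.:- b))
        ℤ-Solve.:= a ℤ-Solve.:* a ℤ-Solve.:- k ℤ-Solve.:* (b ℤ-Solve.:* b)) refl D a b
      σ-⊖ : ∀ x → σ (⊖ x) ≡ ⊖ σ x
      σ-⊖ (a +√ b) = refl
      from-p : ¬ 3 ∣̂ p → N p ≡ + 1 × q′ ≡ ι (+ 27) ⊠ σ p → ⊥
      from-p 3∤p (Np , q′≡) = no-unit {τ} {k} {⊖ p} t≡ NB′ (trans (N-⊖ p) Np) (trans t≡q′-p (trans (cong (λ z → z ⊟ p ⊟ ι (+ 18)) q′≡)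
        (trans (solve 2 (λ p s → con (+ 27) :* s :- p :- con (+ 18) := (:- p) :- con (+ 27) :* (:- s) :- con (+ 18)) refl p (σ p))
          (cong (λ z → ⊖ p ⊟ ι (+ 27) ⊠ z ⊟ ι (+ 18)) (sym (σ-⊖ p))))))
      from-q′ : N q′ ≡ + 1 × p ≡ ι (+ 27) ⊠ σ q′ → ⊥
      from-q′ (Nq′ , p≡) = no-unit {τ} {k} {q′} t≡ NB′ Nq′ (trans t≡q′-p (cong (λ z → q′ ⊟ z ⊟ ι (+ 18)) p≡))
      open PrimeIdeal (ideal (inert prime-3 i₃)) using (resp; +-closed; *-absorb; absorbʳ)
      go : Dec (3 ∣̂ p) → Dec (3 ∣̂ q′) → ⊥
      go (no 3∤p) _           = from-p 3∤p (unit-of-27 {p} {q′} pq′ 3∤p p∉)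
      go (yes _)  (no 3∤q′)   = from-q′ (unit-of-27 {q′} {p} (trans (⊠-comm q′ p) pq′) 3∤q′ q′∉)
      go (yes 3∣p) (yes 3∣q′) = 3∤t (resp (trans (solve 2 (λ p q → q :+ con ℤ.-1ℤ :* p :+ con (+ 3) :* con (ℤ.- + 6) := q :- p :- con (+ 18)) refl p q′) (sym t≡q′-p))
        (+-closed {q′ ⊞ ι ℤ.-1ℤ ⊠ p} (+-closed {q′} 3∣q′ (*-absorb (ι ℤ.-1ℤ) {p} 3∣p)) (absorbʳ {ι (+ 3)} (ι (ℤ.- + 6)) (char∣⇒∈ (inert prime-3 i₃) ℤ.∣-refl))))

    no-ramified-62 : ⊥
    no-ramified-62 = from-τ t-form
      where
      open 𝕆-Solver
      B′-norm : ∀ τ → + 8 ∣ N (B′-of τ) ℤ.- + 1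
      B′-norm (a +√ b) = tautological 8 B′-formula B′-check (a ∷ b ∷ [])
      excluded : ∀ ρ → Tautology 8 (B′-class-formula ρ) → ∀ τ y → ι ρ ⊠ B′-of τ ≢ y ⊠ y
      excluded ρ chk (a +√ b) (g +√ h) eq = tautological 8 (B′-class-formula ρ) chk (a ∷ b ∷ g ∷ h ∷ []) (coords (+ 8) eq)
      from-τ : ∃[ τ ] t ≡ ι (+ 8) ⊞ ι (+ 16) ⊠ τ → ⊥
      from-τ (τ , t≡) = go (B-class t≢0 B′ 4 (B-eq τ t≡) (B′-norm τ))
        where
        B′ = B′-of τ
        go : (∃[ k ] N B′ ≡ k ℤ.* k) × (∃[ ρ ] ∃[ y ] (ρ ≡ 1 ⊎ ρ ≡ 2 ⊎ ρ ≡ 3 ⊎ ρ ≡ 6) × ι (+ ρ) ⊠ B′ ≡ y ⊠ y) → ⊥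
        go ((k , NB′) , _ , y , inj₁ refl , eq)        = no-ramified-one {τ} {k} {y} t≡ NB′ (trans (sym (⊠-identityˡ B′)) eq)
        go (_ , _ , y , inj₂ (inj₁ refl) , eq)         = excluded (+ 2) B′-class-2 τ y eq
        go (_ , _ , y , inj₂ (inj₂ (inj₁ refl)) , eq)  = excluded (+ 3) B′-class-3 τ y eq
        go (_ , _ , y , inj₂ (inj₂ (inj₂ refl)) , eq)  = SixtyTwo.not-six c G t≢0 {ι (+ 4) ⊠ y}
          (trans (cong (ι (+ 6) ⊠_) (B-eq τ t≡)) (trans (solve 1 (λ b → con (+ 6) :* (con (+ 16) :* b) := con (+ 16) :* (con (+ 6) :* b)) refl B′)
            (trans (cong (ι (+ 16) ⊠_) eq) (solve 1 (λ y → con (+ 16) :* (y :* y) := con (+ 4) :* y :* (con (+ 4) :* y)) refl y))))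

  no-curve-62 : Checks₆₂ → NoCurve
  no-curve-62 c = no-curve λ G → [ SixtyTwo.not-unramified c G , no-ramified-62 c G ]′ (AtTwo.reduction-cases (Checks₆₂.checks c) G)

theorem1p3 : (m : ℕ) → m ∈ 62 ∷ 67 ∷ 71 ∷ [] →
    let open EllipticCurves (ℚ√ m) in
    ¬ (Σ[ E ∈ EllipticCurve ] EverywhereGoodReduction E × IsCube (EllipticCurve.discriminant E))
theorem1p3 .62 (here refl) = Arithmetic.no-curve-62 62 (from-yes (squarefree? 62)) (inj₁ (ℤ.∣ᵤ⇒∣ (ℕ∣.divides 15 refl)))
  31 (from-yes (prime? 31)) (ℤ.∣ᵤ⇒∣ (ℕ∣.divides 2 refl)) 2 (inj₂ refl) refl record
    { D≡62 = refl
    ; checks = record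
        { norm-check = tautology refl ; B-check = tautology refl ; fourth-check = tautology refl
        ; unit-check⁺ = tautology refl ; unit-check⁻ = tautology refl
        ; double-check⁺ = tautology refl ; double-check⁻ = tautology refl ; ramified-check = tautology refl
        }
    ; inert-check = tautology refl
    ; class-1 = tautology refl ; class-2 = tautology refl ; class-3 = tautology refl
    ; three-check = tautology refl ; det-check = tautology refl ; cube-check = tautology refl
    ; η-check = tautology refl ; c₄-check = tautology refl ; cube-root-check = tautology refl
    ; B′-check = tautology refl ; B′-class-2 = tautology refl ; B′-class-3 = tautology refl
    ; root-check = tautology refl
    }
-- In the supersingular case Δ ≡ 3 + 2√67 (mod 4), hence r = 3; for m = 62 it is 1.
theorem1p3 .67 (there (here refl)) = Arithmetic.no-curve-odd 67 (from-yes (squarefree? 67)) (inj₂ (ℤ.∣ᵤ⇒∣ (ℕ∣.divides 16 refl)))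
  67 (from-yes (prime? 67)) ℤ.∣-refl 1 (inj₁ refl) refl {+ 3} record
    { norm-check = tautology refl ; B-check = tautology refl ; fourth-check = tautology refl
    ; unit-check⁺ = tautology refl ; unit-check⁻ = tautology refl
    ; double-check⁺ = tautology refl ; double-check⁻ = tautology refl ; ramified-check = tautology refl
    }
  (tautology refl) (tautology refl) (tautology refl) (tautology refl) (tautology refl)
theorem1p3 .71 (there (there (here refl))) = Arithmetic.no-curve-three 71 (from-yes (squarefree? 71)) (inj₂ (ℤ.∣ᵤ⇒∣ (ℕ∣.divides 17 refl)))
  71 (from-yes (prime? 71)) ℤ.∣-refl 1 (inj₁ refl) refl {+ 3} record
    { norm-check = tautology refl ; B-check = tautology refl ; fourth-check = tautology refl
    ; unit-check⁺ = tautology refl ; unit-check⁻ = tautology refl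
    ; double-check⁺ = tautology refl ; double-check⁻ = tautology refl ; ramified-check = tautology refl
    }
  (tautology refl) (tautology refl) (tautology refl) (tautology refl) (tautology refl) (tautology refl) (tautology refl)
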